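{- Let $n\ge 1$ and $t\ge 2$ be integers. There exist infinitely many Salem numbers $\alpha$ of degree $2t$ such that $\alpha^{n}-1$ is a unit, whenever one of the following conditions holds: (i) $n$ is odd and $t\ge (n+3)/2$; (ii) $n\equiv 2 \pmod 4$, $t$ is odd and $t\ge (n+4)/2$; (iii) $n=2^{s}$ for some integer $s\ge 2$, $t$ is odd and $t\ge (n+6)/2$; (iv) $n\equiv 4 \pmod 8$, $n\not\equiv 0 \pmod 3$, $t$ is odd and $t\ge (n+6)/2$.
   Context: A Salem number is a real algebraic integer greater than $1$ whose other conjugates all lie in the closed unit disc, with at least one conjugate lying on the unit circle. Conjugates and degree are taken over $\mathbb{Q}$. A unit is an algebraic integer whose inverse is also an algebraic integer (equivalently, an algebraic integer of norm $\pm 1$ over $\mathbb{Q}$). -}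

module Defs where

open import Data.Integer as ℤ using (ℤ)
open import Data.Nat as ℕ using (ℕ; zero; suc)
import Data.Nat.Properties as ℕ
open import Data.Product using (Σ-syntax; ∃-syntax; _×_; _,_)
open import Data.Rational
open import Data.Rational.Properties
open import Data.Rational.Solver using (module +-*-Solver)
open import Data.Vec using (Vec; []; _∷_; map)
open import Relation.Binary.PropositionalEquality using (_≡_; _≢_; refl; sym; trans; cong; cong₂; subst)
open import Relation.Nullary using (¬_)

-- Reals are Cauchy sequences of rationals; their equality is _≈ℝ_, not _≡_.
IsCauchy : (ℕ → ℚ) → Set
IsCauchy x = ∀ ε → 0ℚ < ε →
  ∃[ N ] (∀ m n → N ℕ.≤ m → N ℕ.≤ n → ∣ x m - x n ∣ < ε)

record ℝ : Set where
  constructor mkℝ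
  field
    seq    : ℕ → ℚ
    cauchy : IsCauchy seq

open ℝ public

infix 4 _≈ℝ_ _<ℝ_ _≤ℝ_

_≈ℝ_ : ℝ → ℝ → Set
x ≈ℝ y = ∀ ε → 0ℚ < ε →
  ∃[ N ] (∀ n → N ℕ.≤ n → ∣ seq x n - seq y n ∣ < ε)

_<ℝ_ : ℝ → ℝ → Set
x <ℝ y = Σ[ ε ∈ ℚ ] 0ℚ < ε ×
  ∃[ N ] (∀ n → N ℕ.≤ n → seq x n + ε < seq y n)

_≤ℝ_ : ℝ → ℝ → Set
x ≤ℝ y = ∀ ε → 0ℚ < ε →
  ∃[ N ] (∀ n → N ℕ.≤ n → seq x n < seq y n + ε)

private abstract
  split-max : ∀ {M N k} → M ℕ.⊔ N ℕ.≤ k → M ℕ.≤ k × N ℕ.≤ k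
  split-max {M} {N} h =
    ℕ.≤-trans (ℕ.m≤m⊔n M N) h , ℕ.≤-trans (ℕ.m≤n⊔m M N) h

  halve : ∀ ε → 0ℚ < ε → 0ℚ < ½ * ε
  halve ε 0<ε = subst (_< ½ * ε) (*-zeroʳ ½) (*-monoʳ-<-pos ½ 0<ε)

  halves : ∀ ε → ½ * ε + ½ * ε ≡ ε
  halves ε = trans (sym (*-distribʳ-+ ε ½ ½)) (*-identityˡ ε)

  const-cauchy : ∀ q → IsCauchy (λ _ → q)
  const-cauchy q ε 0<ε =
    0 , λ _ _ _ _ → subst (_< ε) (sym (cong ∣_∣ (+-inverseʳ q))) 0<ε

  +-cauchy : ∀ x y → IsCauchy x → IsCauchy y → IsCauchy (λ n → x n + y n)
  +-cauchy x y cx cy ε 0<ε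
    with cx (½ * ε) (halve ε 0<ε) | cy (½ * ε) (halve ε 0<ε)
  ... | M , hx | N , hy = M ℕ.⊔ N , λ m n m≥ n≥ →
    let (m≥M , m≥N) = split-max {M} {N} m≥
        (n≥M , n≥N) = split-max {M} {N} n≥
        open ≤-Reasoning
    in begin-strict
      ∣ (x m + y m) - (x n + y n) ∣     ≡⟨ cong ∣_∣ (solve 4
        (λ a b c d → (a :+ b) :- (c :+ d) := (a :- c) :+ (b :- d))
        refl (x m) (y m) (x n) (y n)) ⟩
      ∣ (x m - x n) + (y m - y n) ∣     ≤⟨ ∣p+q∣≤∣p∣+∣q∣ (x m - x n) (y m - y n) ⟩
      ∣ x m - x n ∣ + ∣ y m - y n ∣     <⟨ +-mono-< (hx m n m≥M n≥M) (hy m n m≥N n≥N) ⟩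
      ½ * ε + ½ * ε                     ≡⟨ halves ε ⟩
      ε                                 ∎
    where open +-*-Solver

  neg-cauchy : ∀ x → IsCauchy x → IsCauchy (λ n → - x n)
  neg-cauchy x cx ε 0<ε with cx ε 0<ε
  ... | N , h = N , λ m n m≥ n≥ →
    subst (_< ε)
      (trans (sym (∣-p∣≡∣p∣ (x m - x n))) (cong ∣_∣ (neg-distrib-+ (x m) (- x n))))
      (h m n m≥ n≥)

  bounded : ∀ x → IsCauchy x →
    Σ[ B ∈ ℚ ] 0ℚ < B × ∃[ N ] (∀ n → N ℕ.≤ n → ∣ x n ∣ ≤ B)
  bounded x cx with cx 1ℚ (positive⁻¹ 1ℚ)
  ... | N , h = 1ℚ + ∣ x N ∣ , +-mono-<-≤ (positive⁻¹ 1ℚ) (0≤∣p∣ (x N)) , N , λ n n≥ →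
    let open ≤-Reasoning in begin
      ∣ x n ∣                  ≡⟨ cong ∣_∣ (solve 2 (λ a b → a := (a :- b) :+ b) refl (x n) (x N)) ⟩
      ∣ (x n - x N) + x N ∣    ≤⟨ ∣p+q∣≤∣p∣+∣q∣ (x n - x N) (x N) ⟩
      ∣ x n - x N ∣ + ∣ x N ∣  ≤⟨ +-monoˡ-≤ ∣ x N ∣ (<⇒≤ (h n N n≥ ℕ.≤-refl)) ⟩
      1ℚ + ∣ x N ∣             ∎
    where open +-*-Solver

  scale : ∀ B → 0ℚ < B → ∀ ε → 0ℚ < ε → Σ[ δ ∈ ℚ ] 0ℚ < δ × B * δ ≡ ε
  scale B 0<B ε 0<ε = 1/ B * ε , positive⁻¹ (1/ B * ε) , eq
    where
    instance
      B-pos : Positive B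
      B-pos = positive 0<B
      B-nonZero : NonZero B
      B-nonZero = pos⇒nonZero B
      δ-pos : Positive (1/ B * ε)
      δ-pos = pos*pos⇒pos (1/ B) {{1/pos⇒pos B}} ε {{positive 0<ε}}
    eq : B * (1/ B * ε) ≡ ε
    eq = trans (sym (*-assoc B (1/ B) ε))
               (trans (cong (_* ε) (*-inverseʳ B)) (*-identityˡ ε))

  ∣*∣-bound : ∀ {B δ} p q → 0ℚ < B → ∣ p ∣ ≤ B → ∣ q ∣ < δ → ∣ p * q ∣ < B * δ
  ∣*∣-bound {B} {δ} p q 0<B p≤ q< = begin-strict
      ∣ p * q ∣      ≡⟨ ∣p*q∣≡∣p∣*∣q∣ p q ⟩
      ∣ p ∣ * ∣ q ∣  ≤⟨ *-monoʳ-≤-nonNeg ∣ q ∣ {{nonNegative (0≤∣p∣ q)}} p≤ ⟩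
      B * ∣ q ∣      <⟨ *-monoʳ-<-pos B {{positive 0<B}} q< ⟩
      B * δ          ∎
    where open ≤-Reasoning

  product-difference : ∀ a b c d → a * b - c * d ≡ a * (b - d) + d * (a - c)
  product-difference = solve 4
    (λ a b c d → a :* b :- c :* d := a :* (b :- d) :+ d :* (a :- c)) refl
    where open +-*-Solver

  product-close : ∀ B C δ γ a b c d → 0ℚ < B → 0ℚ < C →
    ∣ a ∣ ≤ B → ∣ d ∣ ≤ C → ∣ b - d ∣ < δ → ∣ a - c ∣ < γ →
    ∣ a * b - c * d ∣ < B * δ + C * γ
  product-close B C δ γ a b c d 0<B 0<C a≤ d≤ bd< ac< = begin-strict
      ∣ a * b - c * d ∣                  ≡⟨ cong ∣_∣ (product-difference a b c d) ⟩
      ∣ a * (b - d) + d * (a - c) ∣      ≤⟨ ∣p+q∣≤∣p∣+∣q∣ (a * (b - d)) (d * (a - c)) ⟩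
      ∣ a * (b - d) ∣ + ∣ d * (a - c) ∣  <⟨ +-mono-< (∣*∣-bound a (b - d) 0<B a≤ bd<)
                                                     (∣*∣-bound d (a - c) 0<C d≤ ac<) ⟩
      B * δ + C * γ                      ∎
    where open ≤-Reasoning

  *-cauchy : ∀ x y → IsCauchy x → IsCauchy y → IsCauchy (λ n → x n * y n)
  *-cauchy x y cx cy ε 0<ε =
    let (B , 0<B , M₁ , bx) = bounded x cx
        (C , 0<C , M₂ , by) = bounded y cy
        (δ , 0<δ , Bδ≡)     = scale B 0<B (½ * ε) (halve ε 0<ε)
        (γ , 0<γ , Cγ≡)     = scale C 0<C (½ * ε) (halve ε 0<ε)
        (N₁ , hy)           = cy δ 0<δ
        (N₂ , hx)           = cx γ 0<γ
    in combine B C δ γ M₁ M₂ N₁ N₂ 0<B 0<C bx by hy hx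
         (trans (cong₂ _+_ Bδ≡ Cγ≡) (halves ε))
    where
    combine : ∀ B C δ γ M₁ M₂ N₁ N₂ → 0ℚ < B → 0ℚ < C →
      (∀ n → M₁ ℕ.≤ n → ∣ x n ∣ ≤ B) →
      (∀ n → M₂ ℕ.≤ n → ∣ y n ∣ ≤ C) →
      (∀ m n → N₁ ℕ.≤ m → N₁ ℕ.≤ n → ∣ y m - y n ∣ < δ) →
      (∀ m n → N₂ ℕ.≤ m → N₂ ℕ.≤ n → ∣ x m - x n ∣ < γ) →
      B * δ + C * γ ≡ ε →
      ∃[ N ] (∀ m n → N ℕ.≤ m → N ℕ.≤ n → ∣ x m * y m - x n * y n ∣ < ε)
    combine B C δ γ M₁ M₂ N₁ N₂ 0<B 0<C bx by hy hx refl =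
      (M₁ ℕ.⊔ M₂) ℕ.⊔ (N₁ ℕ.⊔ N₂) , λ m n m≥ n≥ →
        let (m≥M , m≥N)   = split-max {M₁ ℕ.⊔ M₂} {N₁ ℕ.⊔ N₂} m≥
            (n≥M , n≥N)   = split-max {M₁ ℕ.⊔ M₂} {N₁ ℕ.⊔ N₂} n≥
            (m≥M₁ , _)    = split-max {M₁} {M₂} m≥M
            (_ , n≥M₂)    = split-max {M₁} {M₂} n≥M
            (m≥N₁ , m≥N₂) = split-max {N₁} {N₂} m≥N
            (n≥N₁ , n≥N₂) = split-max {N₁} {N₂} n≥N
        in product-close B C δ γ (x m) (y m) (x n) (y n) 0<B 0<C
             (bx m m≥M₁) (by n n≥M₂) (hy m n m≥N₁ n≥N₁) (hx m n m≥N₂ n≥N₂)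

fromℚ : ℚ → ℝ
fromℚ q = mkℝ (λ _ → q) (const-cauchy q)

0ℝ 1ℝ : ℝ
0ℝ = fromℚ 0ℚ
1ℝ = fromℚ 1ℚ

infix  8 -ℝ_
infixl 7 _*ℝ_
infixl 6 _+ℝ_ _-ℝ_
infixr 8 _^ℝ_

_+ℝ_ _*ℝ_ : ℝ → ℝ → ℝ
x +ℝ y = mkℝ (λ n → seq x n + seq y n) (+-cauchy (seq x) (seq y) (cauchy x) (cauchy y))
x *ℝ y = mkℝ (λ n → seq x n * seq y n) (*-cauchy (seq x) (seq y) (cauchy x) (cauchy y))

-ℝ_ : ℝ → ℝ
-ℝ x = mkℝ (λ n → - seq x n) (neg-cauchy (seq x) (cauchy x))

_-ℝ_ : ℝ → ℝ → ℝ
x -ℝ y = x +ℝ (-ℝ y)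

_^ℝ_ : ℝ → ℕ → ℝ
x ^ℝ zero  = 1ℝ
x ^ℝ suc n = x *ℝ x ^ℝ n

record ℂ : Set where
  constructor _+i_
  field
    re im : ℝ

open ℂ public

infix 4 _≈ℂ_

_≈ℂ_ : ℂ → ℂ → Set
z ≈ℂ w = re z ≈ℝ re w × im z ≈ℝ im w

fromℝ : ℝ → ℂ
fromℝ x = x +i 0ℝ

0ℂ 1ℂ : ℂ
0ℂ = fromℝ 0ℝ
1ℂ = fromℝ 1ℝ

infixl 7 _*ℂ_
infixl 6 _+ℂ_

_+ℂ_ _*ℂ_ : ℂ → ℂ → ℂ
z +ℂ w = (re z +ℝ re w) +i (im z +ℝ im w)
z *ℂ w = (re z *ℝ re w -ℝ im z *ℝ im w) +i (re z *ℝ im w +ℝ im z *ℝ re w)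

∣_∣² : ℂ → ℝ
∣ z ∣² = re z *ℝ re z +ℝ im z *ℝ im z

InClosedUnitDisc OnUnitCircle : ℂ → Set
InClosedUnitDisc z = ∣ z ∣² ≤ℝ 1ℝ
OnUnitCircle     z = ∣ z ∣² ≈ℝ 1ℝ

-- A vector (a₀ , … , a_{d-1}) stands for the monic polynomial
-- a₀ + a₁ X + ⋯ + a_{d-1} X^{d-1} + X^d; the leading 1 is not stored.
evalMonic : ∀ {d} → Vec ℚ d → ℂ → ℂ
evalMonic []      z = 1ℂ
evalMonic (a ∷ p) z = fromℝ (fromℚ a) +ℂ z *ℂ evalMonic p z

IsRoot : ∀ {d} → Vec ℚ d → ℂ → Set
IsRoot p z = evalMonic p z ≈ℂ 0ℂ

IsAlgebraicInteger : ℂ → Set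
IsAlgebraicInteger z = ∃[ d ] Σ[ p ∈ Vec ℤ d ] IsRoot (map (λ a → a / 1) p) z

record IsMinimalPolynomial {d} (p : Vec ℚ d) (z : ℂ) : Set where
  field
    root    : IsRoot p z
    minimal : ∀ {e} (q : Vec ℚ e) → IsRoot q z → d ℕ.≤ e

HasDegree : ℂ → ℕ → Set
HasDegree z d = Σ[ p ∈ Vec ℚ d ] IsMinimalPolynomial p z

-- Every algebraic number is one of its own conjugates.
IsConjugate : ℂ → ℂ → Set
IsConjugate z w = ∃[ d ] Σ[ p ∈ Vec ℚ d ] IsMinimalPolynomial p z × IsRoot p w

IsUnit : ℂ → Set
IsUnit z = IsAlgebraicInteger z ×
  Σ[ w ∈ ℂ ] z *ℂ w ≈ℂ 1ℂ × IsAlgebraicInteger w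

record IsSalem (α : ℝ) : Set where
  field
    algebraicInteger : IsAlgebraicInteger (fromℝ α)
    greaterThanOne   : 1ℝ <ℝ α
    othersInDisc     : ∀ β → IsConjugate (fromℝ α) β → ¬ (β ≈ℂ fromℝ α) →
                       InClosedUnitDisc β
    someOnCircle     : Σ[ β ∈ ℂ ] IsConjugate (fromℝ α) β × OnUnitCircle β

-- Distinctness is up to _≈ℝ_, since distinct sequences may represent the
-- same real number.
InfinitelyMany : (ℝ → Set) → Set
InfinitelyMany P = Σ[ f ∈ (ℕ → ℝ) ]
  (∀ i → P (f i)) × (∀ i j → i ≢ j → ¬ (f i ≈ℝ f j))

{-# OPTIONS --safe #-}
-- With x = z + 1/z consider R = (x − a) C − 1, where C = (x − 2) F is an integer
-- polynomial such that zⁿ − 1 divides a product of a power of z with C(z + 1/z);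
-- F is a product of Chebyshev-like polynomials whose zeros are 2 cos θ for
-- explicit rational multiples θ of π.  For large integers a, the polynomial R has
-- the sign of (x − a) C at points between these zeros, which gives all roots of R
-- but one in (−2, 2); the remaining root ρ lies near a.  Since R(a) = −1, a factor
-- of R over ℤ not vanishing at ρ would be ± 1 at a, whereas a − r ≥ 2 for the other
-- roots r; so R is irreducible, and α + 1/α = ρ defines a Salem number, with the
-- conjugates on the unit circle given by the other roots.  Finally
-- C(ρ) (ρ − a) = 1, so the divisor αⁿ − 1 of C(ρ) is a unit.
--
-- Sign changes are located at rational points of the circle: the powers of N + i,
-- for N large, approximate the roots of unity.  Over the reals, where equality is
-- undecidable, the roots are found by bisection at rational points.
module Submission where

open import Defs

-- Since C(z + 1/z) is unchanged under z ↦ 1/z, it vanishes to even order at z = 1: the factor z - 1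
-- of zⁿ - 1 forces X - 2, and for even n the factor z + 1 likewise forces X + 2. The surplus
-- factors are algebraic integers at α, so they do no harm to the unit. The degree is adjusted by a
-- further factor E of F. Its zeros must avoid those of the forced factor, because a double zero
-- gives no sign change; the arithmetic conditions on n say when an E of the required degree can be
-- chosen. For n = 2k + 1 the degree of R is k + 2 + deg E. For n = 2k + 2 it is k + 3 + deg E, and
-- R = -1 at both 2 and -2, so the t - 1 simple roots between are even in number and t is odd. If
-- moreover 4 divides n, then k is odd and deg E must be odd, which raises the lower bound for t by
-- one. In (iv) the factor X + 1 provides this odd degree; its zero 2 cos(2π/3) belongs to cube
-- roots of unity, whence the condition modulo 3.

-- Commutative rings, a solver with integer coefficients, homomorphisms, domains.

module Kit where

  open import Algebra.Bundles using (CommutativeRing)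
  open import Data.Integer as ℤ using (ℤ; -[1+_])
  import Data.Integer.Properties as ℤ
  open import Data.Maybe.Base using (Maybe; just; nothing)
  open import Data.Nat as ℕ using (ℕ; zero; suc)
  import Data.Nat.Properties as ℕ
  open import Level using (0ℓ)
  open import Relation.Binary.PropositionalEquality as ≡ using (_≡_)
  open import Relation.Nullary using (¬_; yes; no)
  import Algebra.Solver.Ring as RingSolver
  open import Algebra.Solver.Ring.AlmostCommutativeRing

  Ring₀ : Set₁
  Ring₀ = CommutativeRing 0ℓ 0ℓ

  module IntegerSolver (A : Ring₀) where
    open CommutativeRing A
    open import Algebra.Properties.Semiring.Mult.TCOptimised semiring
    open import Algebra.Properties.Ring ring
    open import Algebra.Properties.AbelianGroup +-abelianGroup using (⁻¹-∙-comm)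
    open import Relation.Binary.Reasoning.Setoid setoid

    private
      -- With this `_×_` the multiple `1 × 1#` reduces to `1#`, so the constants `:0` and `:1`
      -- denote `0#` and `1#` definitionally and solved equations match their goals.
      ι : ℤ → Carrier
      ι (ℤ.+ n)  = n × 1#
      ι -[1+ n ] = - (suc n × 1#)

      ι-neg : ∀ i → ι (ℤ.- i) ≈ - ι i
      ι-neg (ℤ.+ zero)  = sym -0#≈0#
      ι-neg (ℤ.+ suc n) = refl
      ι-neg -[1+ n ]    = sym (-‿involutive _)

      cancel : ∀ a x y → x - y ≈ (a + x) - (a + y)
      cancel a x y = begin
        x - y                  ≈⟨ +-congʳ (+-identityˡ x) ⟨
        (0# + x) - y           ≈⟨ +-congʳ (+-congʳ (-‿inverseʳ a)) ⟨
        ((a - a) + x) - y      ≈⟨ +-congʳ (+-assoc a (- a) x) ⟩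
        (a + (- a + x)) - y    ≈⟨ +-congʳ (+-congˡ (+-comm (- a) x)) ⟩
        (a + (x - a)) - y      ≈⟨ +-congʳ (+-assoc a x (- a)) ⟨
        ((a + x) - a) - y      ≈⟨ +-assoc (a + x) (- a) (- y) ⟩
        (a + x) + (- a - y)    ≈⟨ +-congˡ (⁻¹-∙-comm a y) ⟩
        (a + x) - (a + y)      ∎

      ι-⊖ : ∀ m n → ι (m ℤ.⊖ n) ≈ m × 1# - n × 1#
      ι-⊖ zero zero = sym (trans (+-congˡ -0#≈0#) (+-identityˡ 0#))
      ι-⊖ zero (suc n) = sym (+-identityˡ _)
      ι-⊖ (suc m) zero = sym (trans (+-congˡ -0#≈0#) (+-identityʳ _))
      ι-⊖ (suc m) (suc n) = begin
        ι (suc m ℤ.⊖ suc n)                   ≡⟨ ≡.cong ι (ℤ.[1+m]⊖[1+n]≡m⊖n m n) ⟩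
        ι (m ℤ.⊖ n)                           ≈⟨ ι-⊖ m n ⟩
        m × 1# - n × 1#                       ≈⟨ cancel 1# _ _ ⟩
        (1# + m × 1#) - (1# + n × 1#)         ≈⟨ +-cong (1+× m 1#) (-‿cong (1+× n 1#)) ⟨
        suc m × 1# - suc n × 1#               ∎

      ι-+ : ∀ i j → ι (i ℤ.+ j) ≈ ι i + ι j
      ι-+ (ℤ.+ m) (ℤ.+ n)   = ×-homo-+ 1# m n
      ι-+ (ℤ.+ m) -[1+ n ]  = ι-⊖ m (suc n)
      ι-+ -[1+ m ] (ℤ.+ n)  = trans (ι-⊖ n (suc m)) (+-comm _ _)
      ι-+ -[1+ m ] -[1+ n ] = begin
        - (suc (suc (m ℕ.+ n)) × 1#)          ≡⟨ ≡.cong (λ k → - (k × 1#)) (ℕ.+-suc (suc m) n) ⟨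
        - ((suc m ℕ.+ suc n) × 1#)            ≈⟨ -‿cong (×-homo-+ 1# (suc m) (suc n)) ⟩
        - (suc m × 1# + suc n × 1#)           ≈⟨ ⁻¹-∙-comm _ _ ⟨
        - (suc m × 1#) - suc n × 1#           ∎

      ι-*⁺ : ∀ m j → ι (ℤ.+ m ℤ.* j) ≈ m × 1# * ι j
      ι-*⁺ zero j = trans (reflexive (≡.cong ι (ℤ.*-zeroˡ j))) (sym (zeroˡ _))
      ι-*⁺ (suc m) j = begin
        ι (ℤ.+ suc m ℤ.* j)         ≡⟨ ≡.cong ι (ℤ.suc-* (ℤ.+ m) j) ⟩
        ι (j ℤ.+ ℤ.+ m ℤ.* j)       ≈⟨ ι-+ j (ℤ.+ m ℤ.* j) ⟩
        ι j + ι (ℤ.+ m ℤ.* j)       ≈⟨ +-cong (sym (*-identityˡ _)) (ι-*⁺ m j) ⟩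
        1# * ι j + m × 1# * ι j     ≈⟨ distribʳ _ _ _ ⟨
        (1# + m × 1#) * ι j         ≈⟨ *-congʳ (1+× m 1#) ⟨
        suc m × 1# * ι j            ∎

      ι-* : ∀ i j → ι (i ℤ.* j) ≈ ι i * ι j
      ι-* (ℤ.+ m) j  = ι-*⁺ m j
      ι-* -[1+ m ] j = begin
        ι (ℤ.- (ℤ.+ suc m) ℤ.* j)   ≡⟨ ≡.cong ι (ℤ.neg-distribˡ-* (ℤ.+ suc m) j) ⟨
        ι (ℤ.- (ℤ.+ suc m ℤ.* j))   ≈⟨ ι-neg (ℤ.+ suc m ℤ.* j) ⟩
        - ι (ℤ.+ suc m ℤ.* j)       ≈⟨ -‿cong (ι-*⁺ (suc m) j) ⟩
        - (suc m × 1# * ι j)        ≈⟨ -‿distribˡ-* _ _ ⟩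
        - (suc m × 1#) * ι j        ∎

      morphism : CommutativeRing.rawRing ℤ.+-*-commutativeRing
                   -Raw-AlmostCommutative⟶ fromCommutativeRing A
      morphism = record
        { ⟦_⟧ = ι ; +-homo = ι-+ ; *-homo = ι-* ; -‿homo = ι-neg ; 0-homo = refl ; 1-homo = refl }

      coeff≟ : ∀ i j → Maybe (ι i ≈ ι j)
      coeff≟ i j with i ℤ.≟ j
      ... | yes i≡j = just (reflexive (≡.cong ι i≡j))
      ... | no  _   = nothing

    open RingSolver (CommutativeRing.rawRing ℤ.+-*-commutativeRing) (fromCommutativeRing A) morphism coeff≟ public
      using (Polynomial; solve; _:=_; _:+_; _:*_; _:-_; :-_; _:^_; con)

    :0 :1 :2 : ∀ {n} → Polynomial n
    :0 = con ℤ.0ℤ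
    :1 = con ℤ.1ℤ
    :2 = con (ℤ.+ 2)

  record Hom (K A : Ring₀) : Set where
    private
      module K = CommutativeRing K
      module A = CommutativeRing A
    field
      ⟦_⟧    : K.Carrier → A.Carrier
      ⟦⟧-cong : ∀ {x y} → x K.≈ y → ⟦ x ⟧ A.≈ ⟦ y ⟧
      +-homo : ∀ x y → ⟦ x K.+ y ⟧ A.≈ ⟦ x ⟧ A.+ ⟦ y ⟧
      *-homo : ∀ x y → ⟦ x K.* y ⟧ A.≈ ⟦ x ⟧ A.* ⟦ y ⟧
      -‿homo : ∀ x → ⟦ K.- x ⟧ A.≈ A.- ⟦ x ⟧
      0-homo : ⟦ K.0# ⟧ A.≈ A.0#
      1-homo : ⟦ K.1# ⟧ A.≈ A.1#

  idHom : (A : Ring₀) → Hom A A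
  idHom A = record
    { ⟦_⟧ = λ x → x ; ⟦⟧-cong = λ p → p ; +-homo = λ _ _ → refl ; *-homo = λ _ _ → refl
    ; -‿homo = λ _ → refl ; 0-homo = refl ; 1-homo = refl }
    where open CommutativeRing A

  _∘ₕ_ : ∀ {K L A} → Hom L A → Hom K L → Hom K A
  _∘ₕ_ {K} {L} {A} g f = record
    { ⟦_⟧ = λ x → g.⟦ f.⟦ x ⟧ ⟧
    ; ⟦⟧-cong = λ p → g.⟦⟧-cong (f.⟦⟧-cong p)
    ; +-homo = λ x y → A.trans (g.⟦⟧-cong (f.+-homo x y)) (g.+-homo _ _)
    ; *-homo = λ x y → A.trans (g.⟦⟧-cong (f.*-homo x y)) (g.*-homo _ _)
    ; -‿homo = λ x → A.trans (g.⟦⟧-cong (f.-‿homo x)) (g.-‿homo _)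
    ; 0-homo = A.trans (g.⟦⟧-cong f.0-homo) g.0-homo
    ; 1-homo = A.trans (g.⟦⟧-cong f.1-homo) g.1-homo }
    where
    module g = Hom g
    module f = Hom f
    module A = CommutativeRing A

  -- Equality of reals is not decidable, so the domain property is stated with
  -- a negated hypothesis and equality is required to be stable.
  record IsDomain (A : Ring₀) : Set where
    open CommutativeRing A
    field
      stable   : ∀ {x} → ¬ ¬ (x ≈ 0#) → x ≈ 0#
      integral : ∀ x y → x * y ≈ 0# → ¬ (x ≈ 0#) → y ≈ 0#
      1≉0      : ¬ (1# ≈ 0#)

-- Polynomials as coefficient vectors: arithmetic, evaluation, division.

module Poly where

  open Kit
  open import Algebra.Bundles using (CommutativeRing)
  open import Data.Nat as ℕ using (ℕ; zero; suc)
  open import Data.Product using (Σ-syntax; _×_; _,_; proj₁; proj₂)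
  open import Data.Vec using (Vec; []; _∷_; zipWith; _∷ʳ_; replicate)
  import Data.Vec as Vec

  double : ℕ → ℕ
  double zero    = zero
  double (suc t) = suc (suc (double t))

  -- A vector of length d stands for a polynomial of degree < d under evalV and,
  -- as in Defs, for a monic polynomial of degree d under evalM.
  module Coefficients (K : Ring₀) where
    open CommutativeRing K using (_+_; _*_; _-_; -_; 0#; 1#; _≈_) renaming (Carrier to C) public

    extend : ∀ d {e} → Vec C (suc e) → Vec C (suc (d ℕ.+ e))
    extend zero    u = u
    extend (suc d) u = extend d u ∷ʳ 0#

    pad : ∀ d {e} → Vec C e → Vec C (d ℕ.+ e)
    pad zero    u = u
    pad (suc d) u = pad d u ∷ʳ 0#

    mulV : ∀ {d e} → Vec C d → Vec C e → Vec C (d ℕ.+ e)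
    mulV []              u = Vec.map (0# *_) u
    mulV {suc d} (c ∷ p) u = zipWith _+_ (0# ∷ mulV p u) (Vec.map (c *_) (pad (suc d) u))

    -- From (c + X p) q = X p q + c q. Only the first summand is monic of full degree; the second
    -- enters as an ordinary vector, with the leading 1 of `q` written out.
    mulM : ∀ {d e} → Vec C d → Vec C e → Vec C (d ℕ.+ e)
    mulM []              q = q
    mulM {suc d} (c ∷ p) q = zipWith _+_ (0# ∷ mulM p q) (Vec.map (c *_) (extend d (q ∷ʳ 1#)))

    addConst : ∀ {d} → Vec C (suc d) → C → Vec C (suc d)
    addConst (a ∷ p) c = (a + c) ∷ p

    -- s₀ = a, s₁ = b, s_{k+2} = X s_{k+1} − s_k
    chain : ∀ {d} → Vec C d → Vec C (suc d) → ∀ k → Vec C (k ℕ.+ d)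
    chain a b zero          = a
    chain a b (suc zero)    = b
    chain a b (suc (suc k)) =
      zipWith _-_ (0# ∷ chain a b (suc k)) ((chain a b k ∷ʳ 1#) ∷ʳ 0#)

    -- The term c Z^(t+1), which sits in the middle in degree 2t + 2. It arises because `reciprocal`
    -- sends c + X p to (Z² + 1) Z^d p(Z + Z⁻¹) + c Z^(d+1).
    middle : C → ∀ t → Vec C (suc (suc (double t)))
    middle c zero    = 0# ∷ c ∷ []
    middle c (suc t) = 0# ∷ (middle c t ∷ʳ 0#)

    -- p ↦ Z^d p(Z + Z⁻¹)
    reciprocal : ∀ {d} → Vec C d → Vec C (double d)
    reciprocal []              = []
    reciprocal {suc d} (c ∷ p) =
      zipWith _+_ (zipWith _+_ (0# ∷ 0# ∷ reciprocal p) ((reciprocal p ∷ʳ 1#) ∷ʳ 0#)) (middle c d)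

    splitLast : ∀ {d} → C → Vec C d → Vec C d × C
    splitLast c []      = [] , c
    splitLast c (a ∷ u) = c ∷ proj₁ (splitLast a u) , proj₂ (splitLast a u)

    -- One step of long division: c + X r has degree at most d, and subtracting its coefficient of
    -- X^d times the monic `p` leaves degree below d.
    reduceStep : ∀ {d} → Vec C d → C → Vec C d → Vec C d
    reduceStep p c r = zipWith (λ a b → a - proj₂ (splitLast c r) * b) (proj₁ (splitLast c r)) p

  module Evaluation {K A : Ring₀} (h : Hom K A) where
    open Coefficients K using (extend; pad; mulV; mulM; addConst; chain; middle; reciprocal; splitLast; reduceStep)
    open Hom h
    private
      module K = CommutativeRing K
    open CommutativeRing A
    open IntegerSolver A
    open import Algebra.Properties.Semiring.Exp semiring using (_^_) public
    open import Relation.Binary.Reasoning.Setoid setoid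

    evalM : ∀ {d} → Vec K.Carrier d → Carrier → Carrier
    evalM []      x = 1#
    evalM (a ∷ p) x = ⟦ a ⟧ + x * evalM p x

    evalV : ∀ {d} → Vec K.Carrier d → Carrier → Carrier
    evalV []      x = 0#
    evalV (a ∷ p) x = ⟦ a ⟧ + x * evalV p x

    evalM-cong : ∀ {d} (p : Vec K.Carrier d) {x y} → x ≈ y → evalM p x ≈ evalM p y
    evalM-cong []      e = refl
    evalM-cong (a ∷ p) e = +-congˡ (*-cong e (evalM-cong p e))

    evalV-snoc : ∀ {d} (u : Vec K.Carrier d) c x → evalV (u ∷ʳ c) x ≈ evalV u x + ⟦ c ⟧ * x ^ d
    evalV-snoc [] c x = solve 2 (λ c x → c :+ x :* :0 := :0 :+ c :* :1) refl ⟦ c ⟧ x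
    evalV-snoc {suc d} (a ∷ u) c x = begin
      ⟦ a ⟧ + x * evalV (u ∷ʳ c) x             ≈⟨ +-congˡ (*-congˡ (evalV-snoc u c x)) ⟩
      ⟦ a ⟧ + x * (evalV u x + ⟦ c ⟧ * x ^ d)  ≈⟨ solve 5 (λ a x u c y →
          a :+ x :* (u :+ c :* y) := (a :+ x :* u) :+ c :* (x :* y)) refl ⟦ a ⟧ x (evalV u x) ⟦ c ⟧ (x ^ d) ⟩
      (⟦ a ⟧ + x * evalV u x) + ⟦ c ⟧ * (x * x ^ d) ∎

    evalV-snoc0 : ∀ {d} (u : Vec K.Carrier d) x → evalV (u ∷ʳ K.0#) x ≈ evalV u x
    evalV-snoc0 u x = begin
      evalV (u ∷ʳ K.0#) x          ≈⟨ evalV-snoc u K.0# x ⟩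
      evalV u x + ⟦ K.0# ⟧ * _     ≈⟨ +-congˡ (*-congʳ 0-homo) ⟩
      evalV u x + 0# * _           ≈⟨ +-congˡ (zeroˡ _) ⟩
      evalV u x + 0#               ≈⟨ +-identityʳ _ ⟩
      evalV u x                    ∎

    evalM-split : ∀ {d} (p : Vec K.Carrier d) x → evalM p x ≈ evalV p x + x ^ d
    evalM-split [] x = sym (+-identityˡ 1#)
    evalM-split {suc d} (a ∷ p) x = begin
      ⟦ a ⟧ + x * evalM p x               ≈⟨ +-congˡ (*-congˡ (evalM-split p x)) ⟩
      ⟦ a ⟧ + x * (evalV p x + x ^ d)     ≈⟨ solve 4 (λ a x u y → a :+ x :* (u :+ y) := (a :+ x :* u) :+ x :* y)
                                               refl ⟦ a ⟧ x (evalV p x) (x ^ d) ⟩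
      (⟦ a ⟧ + x * evalV p x) + x * x ^ d ∎

    evalV-snoc1 : ∀ {d} (p : Vec K.Carrier d) x → evalV (p ∷ʳ K.1#) x ≈ evalM p x
    evalV-snoc1 p x = begin
      evalV (p ∷ʳ K.1#) x              ≈⟨ evalV-snoc p K.1# x ⟩
      evalV p x + ⟦ K.1# ⟧ * _         ≈⟨ +-congˡ (trans (*-congʳ 1-homo) (*-identityˡ _)) ⟩
      evalV p x + _                    ≈⟨ evalM-split p x ⟨
      evalM p x                        ∎

    evalM-+ : ∀ {d} (p u : Vec K.Carrier d) x → evalM (zipWith K._+_ p u) x ≈ evalM p x + evalV u x
    evalM-+ [] [] x = sym (+-identityʳ 1#)
    evalM-+ (a ∷ p) (b ∷ u) x = begin
      ⟦ a K.+ b ⟧ + x * evalM (zipWith K._+_ p u) x      ≈⟨ +-cong (+-homo a b) (*-congˡ (evalM-+ p u x)) ⟩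
      (⟦ a ⟧ + ⟦ b ⟧) + x * (evalM p x + evalV u x)      ≈⟨ solve 5 (λ a b x p u →
          (a :+ b) :+ x :* (p :+ u) := (a :+ x :* p) :+ (b :+ x :* u)) refl ⟦ a ⟧ ⟦ b ⟧ x (evalM p x) (evalV u x) ⟩
      (⟦ a ⟧ + x * evalM p x) + (⟦ b ⟧ + x * evalV u x)  ∎

    private
      sub-homo : ∀ a b → ⟦ a K.- b ⟧ ≈ ⟦ a ⟧ - ⟦ b ⟧
      sub-homo a b = trans (+-homo a (K.- b)) (+-congˡ (-‿homo b))

    evalM-minus : ∀ {d} (p u : Vec K.Carrier d) x → evalM (zipWith K._-_ p u) x ≈ evalM p x - evalV u x
    evalM-minus [] [] x = solve 0 (:1 := :1 :- :0) refl
    evalM-minus (a ∷ p) (b ∷ u) x = begin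
      ⟦ a K.- b ⟧ + x * evalM (zipWith K._-_ p u) x      ≈⟨ +-cong (sub-homo a b) (*-congˡ (evalM-minus p u x)) ⟩
      (⟦ a ⟧ - ⟦ b ⟧) + x * (evalM p x - evalV u x)      ≈⟨ solve 5 (λ a b x p u →
          (a :- b) :+ x :* (p :- u) := (a :+ x :* p) :- (b :+ x :* u)) refl ⟦ a ⟧ ⟦ b ⟧ x (evalM p x) (evalV u x) ⟩
      (⟦ a ⟧ + x * evalM p x) - (⟦ b ⟧ + x * evalV u x)  ∎

    evalV-+ : ∀ {d} (p u : Vec K.Carrier d) x → evalV (zipWith K._+_ p u) x ≈ evalV p x + evalV u x
    evalV-+ [] [] x = sym (+-identityʳ 0#)
    evalV-+ (a ∷ p) (b ∷ u) x = begin
      ⟦ a K.+ b ⟧ + x * evalV (zipWith K._+_ p u) x      ≈⟨ +-cong (+-homo a b) (*-congˡ (evalV-+ p u x)) ⟩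
      (⟦ a ⟧ + ⟦ b ⟧) + x * (evalV p x + evalV u x)      ≈⟨ solve 5 (λ a b x p u →
          (a :+ b) :+ x :* (p :+ u) := (a :+ x :* p) :+ (b :+ x :* u)) refl ⟦ a ⟧ ⟦ b ⟧ x (evalV p x) (evalV u x) ⟩
      (⟦ a ⟧ + x * evalV p x) + (⟦ b ⟧ + x * evalV u x)  ∎

    evalV-combine : ∀ {d} l (u p : Vec K.Carrier d) x →
      evalV (zipWith (λ a b → a K.- l K.* b) u p) x ≈ evalV u x - ⟦ l ⟧ * evalV p x
    evalV-combine l [] [] x = solve 1 (λ l → :0 := :0 :- l :* :0) refl ⟦ l ⟧
    evalV-combine l (a ∷ u) (b ∷ p) x = begin
      ⟦ a K.- l K.* b ⟧ + x * evalV (zipWith (λ a b → a K.- l K.* b) u p) x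
        ≈⟨ +-cong (trans (sub-homo a _) (+-congˡ (-‿cong (*-homo l b)))) (*-congˡ (evalV-combine l u p x)) ⟩
      (⟦ a ⟧ - ⟦ l ⟧ * ⟦ b ⟧) + x * (evalV u x - ⟦ l ⟧ * evalV p x)
        ≈⟨ solve 6 (λ a b l x u p → (a :- l :* b) :+ x :* (u :- l :* p) := (a :+ x :* u) :- l :* (b :+ x :* p))
             refl ⟦ a ⟧ ⟦ b ⟧ ⟦ l ⟧ x (evalV u x) (evalV p x) ⟩
      (⟦ a ⟧ + x * evalV u x) - ⟦ l ⟧ * (⟦ b ⟧ + x * evalV p x) ∎

    evalV-scale : ∀ {d} c (u : Vec K.Carrier d) x → evalV (Vec.map (c K.*_) u) x ≈ ⟦ c ⟧ * evalV u x
    evalV-scale c [] x = sym (zeroʳ _)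
    evalV-scale c (a ∷ u) x = begin
      ⟦ c K.* a ⟧ + x * evalV (Vec.map (c K.*_) u) x  ≈⟨ +-cong (*-homo c a) (*-congˡ (evalV-scale c u x)) ⟩
      ⟦ c ⟧ * ⟦ a ⟧ + x * (⟦ c ⟧ * evalV u x)         ≈⟨ solve 4 (λ c a x u →
          c :* a :+ x :* (c :* u) := c :* (a :+ x :* u)) refl ⟦ c ⟧ ⟦ a ⟧ x (evalV u x) ⟩
      ⟦ c ⟧ * (⟦ a ⟧ + x * evalV u x)                 ∎

    evalV-extend : ∀ d {e} (u : Vec K.Carrier (suc e)) x → evalV (extend d u) x ≈ evalV u x
    evalV-extend zero    u x = refl
    evalV-extend (suc d) u x = trans (evalV-snoc0 (extend d u) x) (evalV-extend d u x)

    private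
      shift0 : ∀ {d} (p : Vec K.Carrier d) x → evalM (K.0# ∷ p) x ≈ x * evalM p x
      shift0 p x = trans (+-congʳ 0-homo) (+-identityˡ _)

      shiftV0 : ∀ {d} (p : Vec K.Carrier d) x → evalV (K.0# ∷ p) x ≈ x * evalV p x
      shiftV0 p x = trans (+-congʳ 0-homo) (+-identityˡ _)

    evalM-mul : ∀ {d e} (p : Vec K.Carrier d) (q : Vec K.Carrier e) x →
      evalM (mulM p q) x ≈ evalM p x * evalM q x
    evalM-mul [] q x = sym (*-identityˡ _)
    evalM-mul {suc d} (c ∷ p) q x = begin
      evalM (zipWith K._+_ (K.0# ∷ mulM p q) (Vec.map (c K.*_) (extend d (q ∷ʳ K.1#)))) x
        ≈⟨ evalM-+ (K.0# ∷ mulM p q) (Vec.map (c K.*_) (extend d (q ∷ʳ K.1#))) x ⟩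
      evalM (K.0# ∷ mulM p q) x + evalV (Vec.map (c K.*_) (extend d (q ∷ʳ K.1#))) x
        ≈⟨ +-cong (trans (shift0 (mulM p q) x) (*-congˡ (evalM-mul p q x)))
                  (trans (evalV-scale c (extend d (q ∷ʳ K.1#)) x)
                         (*-congˡ (trans (evalV-extend d (q ∷ʳ K.1#) x) (evalV-snoc1 q x)))) ⟩
      x * (evalM p x * evalM q x) + ⟦ c ⟧ * evalM q x
        ≈⟨ solve 4 (λ x p q c → x :* (p :* q) :+ c :* q := (c :+ x :* p) :* q) refl x (evalM p x) (evalM q x) ⟦ c ⟧ ⟩
      (⟦ c ⟧ + x * evalM p x) * evalM q x ∎

    evalV-pad : ∀ d {e} (u : Vec K.Carrier e) x → evalV (pad d u) x ≈ evalV u x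
    evalV-pad zero    u x = refl
    evalV-pad (suc d) u x = trans (evalV-snoc0 (pad d u) x) (evalV-pad d u x)

    evalV-mul : ∀ {d e} (p : Vec K.Carrier d) (q : Vec K.Carrier e) x →
      evalV (mulV p q) x ≈ evalV p x * evalV q x
    evalV-mul [] q x = trans (evalV-scale K.0# q x) (*-congʳ 0-homo)
    evalV-mul {suc d} (c ∷ p) q x = begin
      evalV (zipWith K._+_ (K.0# ∷ mulV p q) (Vec.map (c K.*_) (pad (suc d) q))) x
        ≈⟨ evalV-+ (K.0# ∷ mulV p q) (Vec.map (c K.*_) (pad (suc d) q)) x ⟩
      evalV (K.0# ∷ mulV p q) x + evalV (Vec.map (c K.*_) (pad (suc d) q)) x
        ≈⟨ +-cong (trans (shiftV0 (mulV p q) x) (*-congˡ (evalV-mul p q x)))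
                  (trans (evalV-scale c (pad (suc d) q) x) (*-congˡ (evalV-pad (suc d) q x))) ⟩
      x * (evalV p x * evalV q x) + ⟦ c ⟧ * evalV q x
        ≈⟨ solve 4 (λ x p q c → x :* (p :* q) :+ c :* q := (c :+ x :* p) :* q) refl x (evalV p x) (evalV q x) ⟦ c ⟧ ⟩
      (⟦ c ⟧ + x * evalV p x) * evalV q x ∎

    evalV-addConst : ∀ {d} (p : Vec K.Carrier (suc d)) c x → evalV (addConst p c) x ≈ evalV p x + ⟦ c ⟧
    evalV-addConst (a ∷ p) c x = trans (+-congʳ (+-homo a c))
      (solve 3 (λ a c y → (a :+ c) :+ y := (a :+ y) :+ c) refl ⟦ a ⟧ ⟦ c ⟧ (x * evalV p x))

    evalM-addConst : ∀ {d} (p : Vec K.Carrier (suc d)) c x → evalM (addConst p c) x ≈ evalM p x + ⟦ c ⟧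
    evalM-addConst (a ∷ p) c x = trans (+-congʳ (+-homo a c))
      (solve 3 (λ a c y → (a :+ c) :+ y := (a :+ y) :+ c) refl ⟦ a ⟧ ⟦ c ⟧ (x * evalM p x))

    evalM-chain : ∀ {d} (a : Vec K.Carrier d) b k x →
      evalM (chain a b (suc (suc k))) x ≈ x * evalM (chain a b (suc k)) x - evalM (chain a b k) x
    evalM-chain a b k x = trans (evalM-minus (K.0# ∷ chain a b (suc k)) ((chain a b k ∷ʳ K.1#) ∷ʳ K.0#) x)
      (+-cong (shift0 (chain a b (suc k)) x)
              (-‿cong (trans (evalV-snoc0 (chain a b k ∷ʳ K.1#) x) (evalV-snoc1 (chain a b k) x))))

    evalV-middle : ∀ c t x → evalV (middle c t) x ≈ ⟦ c ⟧ * x ^ suc t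
    evalV-middle c zero x = trans (shiftV0 (c ∷ []) x)
      (solve 2 (λ x c → x :* (c :+ x :* :0) := c :* (x :* :1)) refl x ⟦ c ⟧)
    evalV-middle c (suc t) x = begin
      evalV (K.0# ∷ (middle c t ∷ʳ K.0#)) x  ≈⟨ shiftV0 (middle c t ∷ʳ K.0#) x ⟩
      x * evalV (middle c t ∷ʳ K.0#) x       ≈⟨ *-congˡ (trans (evalV-snoc0 (middle c t) x) (evalV-middle c t x)) ⟩
      x * (⟦ c ⟧ * x ^ suc t)                ≈⟨ solve 3 (λ x c y → x :* (c :* y) := c :* (x :* y)) refl x ⟦ c ⟧ (x ^ suc t) ⟩
      ⟦ c ⟧ * x ^ suc (suc t)                ∎

    evalM-reciprocal : ∀ {d} (p : Vec K.Carrier d) z w → z * w ≈ 1# →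
      evalM (reciprocal p) z ≈ z ^ d * evalM p (z + w)
    evalM-reciprocal [] z w e = sym (*-identityˡ 1#)
    evalM-reciprocal {suc d} (c ∷ p) z w e = begin
      evalM (zipWith K._+_ (zipWith K._+_ (K.0# ∷ K.0# ∷ s) ((s ∷ʳ K.1#) ∷ʳ K.0#)) (middle c d)) z
        ≈⟨ evalM-+ (zipWith K._+_ (K.0# ∷ K.0# ∷ s) ((s ∷ʳ K.1#) ∷ʳ K.0#)) (middle c d) z ⟩
      evalM (zipWith K._+_ (K.0# ∷ K.0# ∷ s) ((s ∷ʳ K.1#) ∷ʳ K.0#)) z + evalV (middle c d) z
        ≈⟨ +-cong (evalM-+ (K.0# ∷ K.0# ∷ s) ((s ∷ʳ K.1#) ∷ʳ K.0#) z) (evalV-middle c d z) ⟩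
      (evalM (K.0# ∷ K.0# ∷ s) z + evalV ((s ∷ʳ K.1#) ∷ʳ K.0#) z) + ⟦ c ⟧ * z ^ suc d
        ≈⟨ +-congʳ (+-cong (trans (shift0 (K.0# ∷ s) z) (*-congˡ (shift0 s z)))
                           (trans (evalV-snoc0 (s ∷ʳ K.1#) z) (evalV-snoc1 s z))) ⟩
      (z * (z * evalM s z) + evalM s z) + ⟦ c ⟧ * (z * z ^ d)
        ≈⟨ +-congʳ (+-cong (*-congˡ (*-congˡ ih)) ih) ⟩
      (z * (z * (y * v)) + y * v) + ⟦ c ⟧ * (z * y)
        ≈⟨ +-congʳ (+-congˡ (trans (sym (*-identityˡ _)) (*-congʳ (sym e)))) ⟩
      (z * (z * (y * v)) + z * w * (y * v)) + ⟦ c ⟧ * (z * y)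
        ≈⟨ solve 5 (λ z w y v c → (z :* (z :* (y :* v)) :+ z :* w :* (y :* v)) :+ c :* (z :* y)
                      := (z :* y) :* (c :+ (z :+ w) :* v)) refl z w y v ⟦ c ⟧ ⟩
      (z * z ^ d) * (⟦ c ⟧ + (z + w) * evalM p (z + w)) ∎
      where
      s = reciprocal p
      y = z ^ d
      v = evalM p (z + w)
      ih = evalM-reciprocal p z w e

    evalV-splitLast : ∀ {d} c (u : Vec K.Carrier d) x →
      ⟦ c ⟧ + x * evalV u x ≈ evalV (proj₁ (splitLast c u)) x + ⟦ proj₂ (splitLast c u) ⟧ * x ^ d
    evalV-splitLast c [] x = solve 2 (λ c x → c :+ x :* :0 := :0 :+ c :* :1) refl ⟦ c ⟧ x
    evalV-splitLast {suc d} c (a ∷ u) x = begin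
      ⟦ c ⟧ + x * (⟦ a ⟧ + x * evalV u x)   ≈⟨ +-congˡ (*-congˡ (evalV-splitLast a u x)) ⟩
      ⟦ c ⟧ + x * (i + l * x ^ d)           ≈⟨ solve 5 (λ c x i l y → c :+ x :* (i :+ l :* y)
                                                 := (c :+ x :* i) :+ l :* (x :* y)) refl ⟦ c ⟧ x i l (x ^ d) ⟩
      (⟦ c ⟧ + x * i) + l * (x * x ^ d)     ∎
      where
      i = evalV (proj₁ (splitLast a u)) x
      l = ⟦ proj₂ (splitLast a u) ⟧

    evalV-reduceStep : ∀ {d} (p : Vec K.Carrier d) c r x →
      ⟦ c ⟧ + x * evalV r x ≈ ⟦ proj₂ (splitLast c r) ⟧ * evalM p x + evalV (reduceStep p c r) x
    evalV-reduceStep {d} p c r x = begin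
      ⟦ c ⟧ + x * evalV r x                             ≈⟨ evalV-splitLast c r x ⟩
      evalV i x + ⟦ l ⟧ * x ^ d                         ≈⟨ solve 4 (λ i l y p → i :+ l :* y := l :* (p :+ y) :+ (i :- l :* p))
                                                             refl (evalV i x) ⟦ l ⟧ (x ^ d) (evalV p x) ⟩
      ⟦ l ⟧ * (evalV p x + x ^ d) + (evalV i x - ⟦ l ⟧ * evalV p x)
        ≈⟨ +-cong (*-congˡ (sym (evalM-split p x))) (sym (evalV-combine l i p x)) ⟩
      ⟦ l ⟧ * evalM p x + evalV (reduceStep p c r) x    ∎
      where
      i = proj₁ (splitLast c r)
      l = proj₂ (splitLast c r)

    -- If u = p q + r, then c + X u = p (X q) + (c + X r), and `reduceStep` handles the last
    -- summand. As `p` is monic, no coefficient is inverted, so this works over ℤ too.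
    divideV : ∀ {d e} (p : Vec K.Carrier d) (u : Vec K.Carrier e) →
      Σ[ q ∈ Vec K.Carrier e ] Σ[ r ∈ Vec K.Carrier d ] (∀ x → evalV u x ≈ evalM p x * evalV q x + evalV r x)
    divideV {d} p [] = [] , replicate d K.0# , λ x → sym (trans (+-cong (zeroʳ _) (zeros d x)) (+-identityˡ 0#))
      where
      zeros : ∀ n x → evalV (replicate n K.0#) x ≈ 0#
      zeros zero    x = refl
      zeros (suc n) x = trans (shiftV0 (replicate n K.0#) x) (trans (*-congˡ (zeros n x)) (zeroʳ x))
    divideV p (c ∷ u) =
      let (q , r , eq) = divideV p u
      in proj₂ (splitLast c r) ∷ q , reduceStep p c r , λ x → begin
        ⟦ c ⟧ + x * evalV u x                                  ≈⟨ +-congˡ (*-congˡ (eq x)) ⟩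
        ⟦ c ⟧ + x * (evalM p x * evalV q x + evalV r x)        ≈⟨ solve 5 (λ c x p q r →
            c :+ x :* (p :* q :+ r) := p :* (x :* q) :+ (c :+ x :* r)) refl ⟦ c ⟧ x (evalM p x) (evalV q x) (evalV r x) ⟩
        evalM p x * (x * evalV q x) + (⟦ c ⟧ + x * evalV r x)  ≈⟨ +-congˡ (evalV-reduceStep p c r x) ⟩
        evalM p x * (x * evalV q x) + (⟦ proj₂ (splitLast c r) ⟧ * evalM p x + evalV (reduceStep p c r) x)
          ≈⟨ solve 5 (λ p x q l r → p :* (x :* q) :+ (l :* p :+ r) := p :* (l :+ x :* q) :+ r)
               refl (evalM p x) x (evalV q x) ⟦ proj₂ (splitLast c r) ⟧ (evalV (reduceStep p c r) x) ⟩
        evalM p x * (⟦ proj₂ (splitLast c r) ⟧ + x * evalV q x) + evalV (reduceStep p c r) x ∎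

    -- The quotient of two monic polynomials is again monic, of the exact degree difference; at
    -- equal degrees it is 1 and the remainder is u - p.
    divideM : ∀ {d} e (p : Vec K.Carrier d) (u : Vec K.Carrier (e ℕ.+ d)) →
      Σ[ q ∈ Vec K.Carrier e ] Σ[ r ∈ Vec K.Carrier d ] (∀ x → evalM u x ≈ evalM p x * evalM q x + evalV r x)
    divideM {d} zero p u = [] , zipWith (λ a b → a K.- K.1# K.* b) u p , λ x → sym (begin
        evalM p x * 1# + evalV (zipWith (λ a b → a K.- K.1# K.* b) u p) x
          ≈⟨ +-cong (*-congʳ (evalM-split p x)) (trans (evalV-combine K.1# u p x) (+-congˡ (-‿cong (*-congʳ 1-homo)))) ⟩
        (evalV p x + x ^ d) * 1# + (evalV u x - 1# * evalV p x)
          ≈⟨ solve 3 (λ p y u → (p :+ y) :* :1 :+ (u :- :1 :* p) := u :+ y) refl (evalV p x) (x ^ d) (evalV u x) ⟩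
        evalV u x + x ^ d ≈⟨ evalM-split u x ⟨
        evalM u x ∎)
    divideM (suc e) p (c ∷ u) =
      let (q , r , eq) = divideM e p u
      in proj₂ (splitLast c r) ∷ q , reduceStep p c r , λ x → begin
        ⟦ c ⟧ + x * evalM u x                                  ≈⟨ +-congˡ (*-congˡ (eq x)) ⟩
        ⟦ c ⟧ + x * (evalM p x * evalM q x + evalV r x)        ≈⟨ solve 5 (λ c x p q r →
            c :+ x :* (p :* q :+ r) := p :* (x :* q) :+ (c :+ x :* r)) refl ⟦ c ⟧ x (evalM p x) (evalM q x) (evalV r x) ⟩
        evalM p x * (x * evalM q x) + (⟦ c ⟧ + x * evalV r x)  ≈⟨ +-congˡ (evalV-reduceStep p c r x) ⟩
        evalM p x * (x * evalM q x) + (⟦ proj₂ (splitLast c r) ⟧ * evalM p x + evalV (reduceStep p c r) x)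
          ≈⟨ solve 5 (λ p x q l r → p :* (x :* q) :+ (l :* p :+ r) := p :* (l :+ x :* q) :+ r)
               refl (evalM p x) x (evalM q x) ⟦ proj₂ (splitLast c r) ⟧ (evalV (reduceStep p c r) x) ⟩
        evalM p x * (⟦ proj₂ (splitLast c r) ⟧ + x * evalM q x) + evalV (reduceStep p c r) x ∎

  module _ {K A B : Ring₀} (g : Hom A B) (h : Hom K A) where
    private
      module K = CommutativeRing K
      module A = CommutativeRing A
      module B = CommutativeRing B
      module g = Hom g
      module h = Hom h
      module E = Evaluation h
      module F = Evaluation (g ∘ₕ h)
      module G = Evaluation g

    evalM-hom : ∀ {d} (p : Vec K.Carrier d) x → F.evalM p g.⟦ x ⟧ B.≈ g.⟦ E.evalM p x ⟧
    evalM-hom []      x = B.sym g.1-homo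
    evalM-hom (a ∷ p) x = B.trans (B.+-congˡ (B.trans (B.*-congˡ (evalM-hom p x)) (B.sym (g.*-homo x _))))
                                  (B.sym (g.+-homo h.⟦ a ⟧ _))

    evalM-map : ∀ {d} (p : Vec K.Carrier d) x → G.evalM (Vec.map h.⟦_⟧ p) x B.≈ F.evalM p x
    evalM-map []      x = B.refl
    evalM-map (a ∷ p) x = B.+-congˡ (B.*-congˡ (evalM-map p x))

  -- Separate from `evalM-map`, since `idHom A ∘ₕ h` agrees with `h` as a map but not in its proof
  -- fields, on which the evaluation module also depends.
  evalM-map-id : ∀ {K A : Ring₀} (h : Hom K A) (let module K = CommutativeRing K) (let module A = CommutativeRing A)
    {d} (p : Vec K.Carrier d) x → Evaluation.evalM (idHom A) (Vec.map (Hom.⟦_⟧ h) p) x A.≈ Evaluation.evalM h p x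
  evalM-map-id {A = A} h []      x = CommutativeRing.refl A
  evalM-map-id {A = A} h (a ∷ p) x = A.+-congˡ (A.*-congˡ (evalM-map-id h p x))
    where module A = CommutativeRing A

  evalM-hom-id : ∀ {K A : Ring₀} (h : Hom K A) (let module K = CommutativeRing K) (let module A = CommutativeRing A)
    {d} (p : Vec K.Carrier d) x → Evaluation.evalM h p (Hom.⟦_⟧ h x) A.≈ Hom.⟦_⟧ h (Evaluation.evalM (idHom K) p x)
  evalM-hom-id {A = A} h []      x = CommutativeRing.sym A (Hom.1-homo h)
  evalM-hom-id {A = A} h (a ∷ p) x = A.trans (A.+-congˡ (A.trans (A.*-congˡ (evalM-hom-id h p x)) (A.sym (*-homo x _))))
                                             (A.sym (+-homo a _))
    where
    module A = CommutativeRing A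
    open Hom h

  evalM-ext : ∀ {K A : Ring₀} (g h : Hom K A) (let module K = CommutativeRing K) (let module A = CommutativeRing A) →
    (∀ a → Hom.⟦_⟧ g a A.≈ Hom.⟦_⟧ h a) → ∀ {d} (p : Vec K.Carrier d) x → Evaluation.evalM g p x A.≈ Evaluation.evalM h p x
  evalM-ext {A = A} g h e []      x = CommutativeRing.refl A
  evalM-ext {A = A} g h e (a ∷ p) x = A.+-cong (e a) (A.*-congˡ (evalM-ext g h e p x))
    where module A = CommutativeRing A

-- Factorisation over a domain with undecidable equality.

module Roots where

  open Kit
  open Poly
  open import Algebra.Bundles using (CommutativeRing)
  open import Data.Empty using (⊥-elim)
  open import Data.List using (List; []; _∷_; length)
  open import Data.List.Relation.Unary.All as All using (All; []; _∷_)
  open import Data.List.Relation.Unary.AllPairs using (AllPairs; []; _∷_)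
  open import Data.Nat as ℕ using (ℕ; suc; z≤n; s≤s)
  import Data.Nat.Properties as ℕ
  open import Data.Product using (Σ-syntax; _×_; _,_; proj₁; proj₂)
  open import Data.Sum using (_⊎_; inj₁; inj₂)
  open import Data.Vec using (Vec; []; _∷_)
  open import Relation.Binary.PropositionalEquality as ≡ using (_≡_)
  open import Relation.Nullary using (¬_)

  module LinearFactors (A : Ring₀) (dom : IsDomain A) where
    open CommutativeRing A
    open IsDomain dom
    open IntegerSolver A
    open Evaluation (idHom A) using (evalM)
    open import Algebra.Properties.Group +-group using (x∙y⁻¹≈ε⇒x≈y)
    open import Relation.Binary.Reasoning.Setoid setoid

    prod : List Carrier → Carrier → Carrier
    prod []       x = 1#
    prod (r ∷ rs) x = (x - r) * prod rs x

    difference≉0 : ∀ {x y} → x ≉ y → ¬ (y - x ≈ 0#)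
    difference≉0 x≉y e = x≉y (sym (x∙y⁻¹≈ε⇒x≈y _ _ e))

    -- Which factor vanishes cannot be computed over the reals. The double negation suffices,
    -- because it is only eliminated into goals that are themselves negative.
    zero-product : ∀ x y → x * y ≈ 0# → ¬ ¬ (x ≈ 0# ⊎ y ≈ 0#)
    zero-product x y e k = k (inj₂ (integral x y e (λ x≈0 → k (inj₁ x≈0))))

    -- Synthetic division by X - r: the coefficients of the quotient are the values at `r` of the
    -- successive tails, as in Horner's scheme.
    quotient : ∀ {d} → Carrier → Vec Carrier (suc d) → Vec Carrier d
    quotient r (a ∷ [])        = []
    quotient r (a ∷ p@(_ ∷ _)) = evalM p r ∷ quotient r p

    evalM-quotient : ∀ {d} r (p : Vec Carrier (suc d)) x →
      evalM p x ≈ (x - r) * evalM (quotient r p) x + evalM p r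
    evalM-quotient r (a ∷ []) x =
      solve 3 (λ a r x → a :+ x :* :1 := (x :- r) :* :1 :+ (a :+ r :* :1)) refl a r x
    evalM-quotient r (a ∷ p@(_ ∷ _)) x = begin
      a + x * evalM p x                                              ≈⟨ +-congˡ (*-congˡ (evalM-quotient r p x)) ⟩
      a + x * ((x - r) * evalM (quotient r p) x + evalM p r)         ≈⟨ solve 5 (λ a x r q v →
          a :+ x :* ((x :- r) :* q :+ v) := (x :- r) :* (v :+ x :* q) :+ (a :+ r :* v))
          refl a x r (evalM (quotient r p) x) (evalM p r) ⟩
      (x - r) * (evalM p r + x * evalM (quotient r p) x) + (a + r * evalM p r) ∎

    factor-root : ∀ {d} r (p : Vec Carrier (suc d)) → evalM p r ≈ 0# →
      ∀ x → evalM p x ≈ (x - r) * evalM (quotient r p) x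
    factor-root r p e x = trans (evalM-quotient r p x) (trans (+-congˡ e) (+-identityʳ _))

    -- A root s ≠ r remains a root of the quotient by X - r, because s - r cancels in a domain; d
    -- distinct roots therefore exhaust the degree.
    factor-roots : ∀ {d} (rs : List Carrier) (p : Vec Carrier d) → d ≡ length rs → AllPairs _≉_ rs →
      All (λ r → evalM p r ≈ 0#) rs → ∀ x → evalM p x ≈ prod rs x
    factor-roots [] [] _ _ _ x = refl
    factor-roots {suc d} (r ∷ rs) p e (r≉ ∷ dist) (pr ∷ prs) x =
      trans (factor-root r p pr x) (*-congˡ (factor-roots rs (quotient r p) (ℕ.suc-injective e) dist
        (All.zipWith (λ { (r≉s , ps) → integral _ _ (trans (sym (factor-root r p pr _)) ps) (difference≉0 r≉s) })
          (r≉ , prs)) x))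

    prod-zero : ∀ rs x → prod rs x ≈ 0# → ∀ {P : Carrier → Set} → All P rs → ¬ ¬ (Σ[ r ∈ Carrier ] P r × x ≈ r)
    prod-zero [] x e _ k = 1≉0 e
    prod-zero (r ∷ rs) x e (pr ∷ prs) k = zero-product _ _ e λ where
      (inj₁ x-r≈0) → k (r , pr , x∙y⁻¹≈ε⇒x≈y _ _ x-r≈0)
      (inj₂ rest)  → prod-zero rs x rest prs k

    ProductZero : ∀ {d e} → Vec Carrier d → Vec Carrier e → Carrier → Set
    ProductZero p q r = evalM p r * evalM q r ≈ 0#

    remove-root : ∀ {d e} r rs (p : Vec Carrier (suc d)) (q : Vec Carrier e) → All (r ≉_) rs →
      evalM p r ≈ 0# → All (ProductZero p q) rs → All (ProductZero (quotient r p) q) rs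
    remove-root r rs p q r≉ pr z = All.zipWith
      (λ { (r≉s , zs) → integral _ _ (trans (trans (sym (*-assoc _ _ _)) (*-congʳ (sym (factor-root r p pr _)))) zs)
                          (difference≉0 r≉s) }) (r≉ , z)

    -- The two lists are existential: how the roots are shared between `p` and `q` is not known,
    -- only that each root inherits `P`.
    record Splitting {d e} (P : Carrier → Set) (p : Vec Carrier d) (q : Vec Carrier e) : Set where
      constructor splitting
      field
        {ps qs}   : List Carrier
        length-ps : length ps ≡ d
        length-qs : length qs ≡ e
        all-ps    : All P ps
        all-qs    : All P qs
        eval-p    : ∀ x → evalM p x ≈ prod ps x
        eval-q    : ∀ x → evalM q x ≈ prod qs x

    swap-splitting : ∀ {d e P} {p : Vec Carrier d} {q : Vec Carrier e} → Splitting P p q → Splitting P q p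
    swap-splitting (splitting a b c d e f) = splitting b a d c f e

    add-root : ∀ {d e P r} {p : Vec Carrier (suc d)} {q : Vec Carrier e} → P r → evalM p r ≈ 0# →
      Splitting P (quotient r p) q → Splitting P p q
    add-root {r = r} {p} pr e (splitting a b c d f g) =
      splitting (≡.cong suc a) b (pr ∷ c) d (λ x → trans (factor-root r p e x) (*-congˡ (f x))) g

    -- Each known root of the product is divided out of whichever factor vanishes there; the
    -- remaining roots, being distinct from it, stay roots of the smaller product.
    split : ∀ {d e P} rs (p : Vec Carrier d) (q : Vec Carrier e) → d ℕ.+ e ≡ length rs →
      AllPairs _≉_ rs → All P rs → All (ProductZero p q) rs → ¬ ¬ Splitting P p q
    split [] [] [] _ _ _ _ k = k (splitting ≡.refl ≡.refl [] [] (λ _ → refl) (λ _ → refl))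
    split {d} {e} {P} (r ∷ rs) p q len (r≉ ∷ dist) (pr ∷ prs) (z ∷ zs) k =
      zero-product _ _ z λ where
        (inj₁ e₁) → left p q len zs e₁ k
        (inj₂ e₂) → left q p (≡.trans (ℕ.+-comm e d) len) (All.map (trans (*-comm _ _)) zs) e₂
                      (λ s → k (swap-splitting s))
      where
      left : ∀ {d e} (p : Vec Carrier d) (q : Vec Carrier e) → d ℕ.+ e ≡ suc (length rs) →
        All (ProductZero p q) rs → evalM p r ≈ 0# → ¬ ¬ Splitting P p q
      left []        q _   zs e k = 1≉0 e
      left p@(_ ∷ _) q len zs e k = split rs (quotient r p) q (ℕ.suc-injective len) dist prs
        (remove-root r rs p q r≉ e zs) (λ s → k (add-root {p = p} pr e s))

    -- The pair (A, B) with p ≡ A + BZ modulo Z² - rZ + 1, by the rule Z (A + BZ) ≡ -B + (A + rB) Z.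
    remainder : ∀ {d} → Carrier → Vec Carrier d → Carrier × Carrier
    remainder r []      = 1# , 0#
    remainder r (c ∷ p) = c - proj₂ (remainder r p) , proj₁ (remainder r p) + r * proj₂ (remainder r p)

    remainder-eval : ∀ {d} r z (p : Vec Carrier d) → z * z ≈ r * z - 1# →
      evalM p z ≈ proj₁ (remainder r p) + z * proj₂ (remainder r p)
    remainder-eval r z [] e = solve 1 (λ z → :1 := :1 :+ z :* :0) refl z
    remainder-eval r z (c ∷ p) e = begin
      c + z * evalM p z             ≈⟨ +-congˡ (*-congˡ (remainder-eval r z p e)) ⟩
      c + z * (a + z * b)           ≈⟨ solve 4 (λ c z a b → c :+ z :* (a :+ z :* b) := c :+ z :* a :+ (z :* z) :* b) refl c z a b ⟩
      c + z * a + (z * z) * b       ≈⟨ +-congˡ (*-congʳ e) ⟩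
      c + z * a + (r * z - 1#) * b  ≈⟨ solve 5 (λ c z a b r → c :+ z :* a :+ (r :* z :- :1) :* b
                                         := (c :- b) :+ z :* (a :+ r :* b)) refl c z a b r ⟩
      (c - b) + z * (a + r * b)     ∎
      where
      a = proj₁ (remainder r p)
      b = proj₂ (remainder r p)

    -- If p = (Z² - rZ + 1) q + A + BZ, then the quotient of c + Z p is B + Z q; hence the
    -- coefficients are the B-parts of the remainders of the tails.
    quotient₂ : ∀ {d} → Carrier → Vec Carrier (suc (suc d)) → Vec Carrier d
    quotient₂ r (a ∷ b ∷ [])        = []
    quotient₂ r (a ∷ p@(_ ∷ _ ∷ _)) = proj₂ (remainder r p) ∷ quotient₂ r p

    -- p = (Z² − rZ + 1) (quotient₂ r p) + remainder r p, reduced modulo Z² − sZ + 1.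
    remainder-quotient₂ : ∀ {d} r s (p : Vec Carrier (suc (suc d))) →
      let (a , b) = remainder s (quotient₂ r p) in
      proj₁ (remainder s p) ≈ (s - r) * - b + proj₁ (remainder r p) ×
      proj₂ (remainder s p) ≈ (s - r) * (a + s * b) + proj₂ (remainder r p)
    remainder-quotient₂ r s (a ∷ b ∷ []) =
      solve 3 (λ a r s → a :- (:1 :+ s :* :0) := (s :- r) :* :- :0 :+ (a :- (:1 :+ r :* :0))) refl a r s ,
      solve 3 (λ b r s → (b :- :0) :+ s :* (:1 :+ s :* :0) := (s :- r) :* (:1 :+ s :* :0) :+ ((b :- :0) :+ r :* (:1 :+ r :* :0)))
        refl b r s
    remainder-quotient₂ r s (c ∷ p@(_ ∷ _ ∷ _)) =
      (begin
        c - proj₂ (remainder s p)                ≈⟨ +-congˡ (-‿cong ih₂) ⟩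
        c - ((s - r) * (a + s * b) + b₀)         ≈⟨ solve 6 (λ c s r a b b₀ → c :- ((s :- r) :* (a :+ s :* b) :+ b₀)
                                                      := (s :- r) :* :- (a :+ s :* b) :+ (c :- b₀)) refl c s r a b b₀ ⟩
        (s - r) * - (a + s * b) + (c - b₀)       ∎) ,
      (begin
        proj₁ (remainder s p) + s * proj₂ (remainder s p)
          ≈⟨ +-cong ih₁ (*-congˡ ih₂) ⟩
        ((s - r) * - b + a₀) + s * ((s - r) * (a + s * b) + b₀)
          ≈⟨ solve 6 (λ s r a b a₀ b₀ → ((s :- r) :* :- b :+ a₀) :+ s :* ((s :- r) :* (a :+ s :* b) :+ b₀)
               := (s :- r) :* ((b₀ :- b) :+ s :* (a :+ s :* b)) :+ (a₀ :+ r :* b₀)) refl s r a b a₀ b₀ ⟩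
        (s - r) * ((b₀ - b) + s * (a + s * b)) + (a₀ + r * b₀) ∎)
      where
      a = proj₁ (remainder s (quotient₂ r p))
      b = proj₂ (remainder s (quotient₂ r p))
      a₀ = proj₁ (remainder r p)
      b₀ = proj₂ (remainder r p)
      ih₁ = proj₁ (remainder-quotient₂ r s p)
      ih₂ = proj₂ (remainder-quotient₂ r s p)

    RemainderZero : ∀ {d} → Vec Carrier d → Carrier → Set
    RemainderZero p r = proj₁ (remainder r p) ≈ 0# × proj₂ (remainder r p) ≈ 0#

    -- Modulo Z² - sZ + 1 the divisor Z² - rZ + 1 equals (s - r) Z, where Z is invertible and s - r
    -- is nonzero. So dividing by one quadratic leaves the remainders for the others zero, and each
    -- costs two degrees. In degrees 0 and 1 a monic polynomial has a nonzero remainder.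
    quadratic-factors-degree : ∀ {d} rs (p : Vec Carrier d) → AllPairs _≉_ rs →
      All (RemainderZero p) rs → double (length rs) ℕ.≤ d
    quadratic-factors-degree [] p _ _ = z≤n
    quadratic-factors-degree (r ∷ rs) [] _ ((e , _) ∷ _) = ⊥-elim (1≉0 e)
    quadratic-factors-degree (r ∷ rs) (a ∷ []) _ ((_ , e) ∷ _) =
      ⊥-elim (1≉0 (trans (solve 1 (λ r → :1 := :1 :+ r :* :0) refl r) e))
    quadratic-factors-degree (r ∷ rs) p@(_ ∷ _ ∷ _) (r≉ ∷ dist) ((e₁ , e₂) ∷ es) =
      s≤s (s≤s (quadratic-factors-degree rs (quotient₂ r p) dist (All.zipWith step (r≉ , es))))
      where
      step : ∀ {s} → r ≉ s × RemainderZero p s → RemainderZero (quotient₂ r p) s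
      step {s} (r≉s , f₁ , f₂) = a≈0 , b≈0
        where
        a = proj₁ (remainder s (quotient₂ r p))
        b = proj₂ (remainder s (quotient₂ r p))
        id₁ = proj₁ (remainder-quotient₂ r s p)
        id₂ = proj₂ (remainder-quotient₂ r s p)
        b≈0 : b ≈ 0#
        b≈0 = begin
          b       ≈⟨ solve 1 (λ b → b := :- (:- b)) refl b ⟩
          - - b   ≈⟨ -‿cong (integral _ _ (begin
                       (s - r) * - b                             ≈⟨ +-identityʳ _ ⟨
                       (s - r) * - b + 0#                        ≈⟨ +-congˡ e₁ ⟨
                       (s - r) * - b + proj₁ (remainder r p)     ≈⟨ id₁ ⟨
                       proj₁ (remainder s p)                     ≈⟨ f₁ ⟩
                       0#                                        ∎) (difference≉0 r≉s)) ⟩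
          - 0#    ≈⟨ solve 0 (:- :0 := :0) refl ⟩
          0#      ∎
        a≈0 : a ≈ 0#
        a≈0 = begin
          a               ≈⟨ solve 3 (λ a s b → a := (a :+ s :* b) :- s :* b) refl a s b ⟩
          (a + s * b) - s * b
            ≈⟨ +-cong (integral _ _ (begin
                 (s - r) * (a + s * b)                           ≈⟨ +-identityʳ _ ⟨
                 (s - r) * (a + s * b) + 0#                      ≈⟨ +-congˡ e₂ ⟨
                 (s - r) * (a + s * b) + proj₂ (remainder r p)   ≈⟨ id₂ ⟨
                 proj₂ (remainder s p)                           ≈⟨ f₂ ⟩
                 0#                                              ∎) (difference≉0 r≉s))
               (-‿cong (*-congˡ b≈0)) ⟩
          0# - s * 0#     ≈⟨ solve 1 (λ s → :0 :- s :* :0 := :0) refl s ⟩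
          0#              ∎

-- Cauchy reals: ring structure, tightness, termwise estimates.

module Reals where

  open Kit
  open import Algebra.Bundles using (CommutativeRing)
  open import Data.Empty using (⊥-elim)
  open import Data.Nat as ℕ using (ℕ)
  import Data.Nat.Properties as ℕ
  open import Data.Product using (Σ-syntax; ∃-syntax; _×_; _,_; proj₁; proj₂)
  open import Data.Rational
  open import Data.Rational.Properties
  open import Data.Sum using (inj₁; inj₂)
  open import Relation.Binary.PropositionalEquality using (_≡_; refl; sym; trans; cong; cong₂; subst; subst₂)
  open import Relation.Nullary using (¬_; yes; no)

  ℚ-ring : Ring₀
  ℚ-ring = +-*-commutativeRing

  module ℚS = IntegerSolver ℚ-ring

  0<-+ : ∀ {a b} → 0ℚ < a → 0ℚ < b → 0ℚ < a + b
  0<-+ p q = +-mono-< p q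

  0≤-+ : ∀ {a b} → 0ℚ ≤ a → 0ℚ ≤ b → 0ℚ ≤ a + b
  0≤-+ p q = +-mono-≤ p q

  0<-≤-+ : ∀ {a b} → 0ℚ < a → 0ℚ ≤ b → 0ℚ < a + b
  0<-≤-+ p q = +-mono-<-≤ p q

  0<-* : ∀ {a b} → 0ℚ < a → 0ℚ < b → 0ℚ < a * b
  0<-* {a} {b} p q = positive⁻¹ (a * b) {{pos*pos⇒pos a {{positive p}} b {{positive q}}}}

  0≤-* : ∀ {a b} → 0ℚ ≤ a → 0ℚ ≤ b → 0ℚ ≤ a * b
  0≤-* {a} {b} p q = nonNegative⁻¹ (a * b) {{nonNeg*nonNeg⇒nonNeg a {{nonNegative p}} b {{nonNegative q}}}}

  0≤-square : ∀ a → 0ℚ ≤ a * a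
  0≤-square a with ≤-total 0ℚ a
  ... | inj₁ 0≤a = 0≤-* 0≤a 0≤a
  ... | inj₂ a≤0 = subst (0ℚ ≤_) (solve 1 (λ a → (:- a) :* (:- a) := a :* a) refl a)
                     (0≤-* (neg-antimono-≤ a≤0) (neg-antimono-≤ a≤0))
    where open ℚS

  <⇒0<- : ∀ {a b} → a < b → 0ℚ < b - a
  <⇒0<- {a} {b} p = subst (_< b - a) (+-inverseʳ a) (+-monoˡ-< (- a) p)

  ≤⇒0≤- : ∀ {a b} → a ≤ b → 0ℚ ≤ b - a
  ≤⇒0≤- {a} {b} p = subst (_≤ b - a) (+-inverseʳ a) (+-monoˡ-≤ (- a) p)

  private
    cancel-sub : ∀ a b → (b - a) + a ≡ b
    cancel-sub = solve 2 (λ a b → (b :- a) :+ a := b) refl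
      where open ℚS

  0<-⇒< : ∀ {a b} → 0ℚ < b - a → a < b
  0<-⇒< {a} {b} p = subst₂ _<_ (+-identityˡ a) (cancel-sub a b) (+-monoˡ-< a p)

  0≤-⇒≤ : ∀ {a b} → 0ℚ ≤ b - a → a ≤ b
  0≤-⇒≤ {a} {b} p = subst₂ _≤_ (+-identityˡ a) (cancel-sub a b) (+-monoˡ-≤ a p)

  *-mono-≤-nonNeg : ∀ {a b c d} → 0ℚ ≤ a → 0ℚ ≤ d → a ≤ b → c ≤ d → a * c ≤ b * d
  *-mono-≤-nonNeg {a} {b} {c} {d} 0≤a 0≤d a≤b c≤d =
    ≤-trans (*-monoˡ-≤-nonNeg a {{nonNegative 0≤a}} c≤d) (*-monoʳ-≤-nonNeg d {{nonNegative 0≤d}} a≤b)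

  0<½* : ∀ {ε} → 0ℚ < ε → 0ℚ < ½ * ε
  0<½* = 0<-* (positive⁻¹ ½)

  ½+½ : ∀ ε → ½ * ε + ½ * ε ≡ ε
  ½+½ ε = trans (sym (*-distribʳ-+ ε ½ ½)) (*-identityˡ ε)

  0<1 : 0ℚ < 1ℚ
  0<1 = positive⁻¹ 1ℚ

  ∣∣-triangle : ∀ p q → ∣ p ∣ ≤ ∣ p - q ∣ + ∣ q ∣
  ∣∣-triangle p q = subst (λ r → ∣ r ∣ ≤ ∣ p - q ∣ + ∣ q ∣) (cancel-sub q p) (∣p+q∣≤∣p∣+∣q∣ (p - q) q)

  ∣-∣-comm : ∀ p q → ∣ p - q ∣ ≡ ∣ q - p ∣
  ∣-∣-comm p q = trans (cong ∣_∣ (solve 2 (λ p q → p :- q := :- (q :- p)) refl p q)) (∣-p∣≡∣p∣ (q - p))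
    where open ℚS

  p≤∣p∣ : ∀ p → p ≤ ∣ p ∣
  p≤∣p∣ p with ≤-total 0ℚ p
  ... | inj₁ 0≤p = ≤-reflexive (sym (0≤p⇒∣p∣≡p 0≤p))
  ... | inj₂ p≤0 = ≤-trans p≤0 (0≤∣p∣ p)

  -p≤∣p∣ : ∀ p → - p ≤ ∣ p ∣
  -p≤∣p∣ p = subst (- p ≤_) (∣-p∣≡∣p∣ p) (p≤∣p∣ (- p))

  ∣∣≤ : ∀ {p b} → p ≤ b → - p ≤ b → ∣ p ∣ ≤ b
  ∣∣≤ {p} h k with ∣p∣≡p∨∣p∣≡-p p
  ... | inj₁ e = ≤-trans (≤-reflexive e) h
  ... | inj₂ e = ≤-trans (≤-reflexive e) k

  Null : (ℕ → ℚ) → Set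
  Null s = ∀ ε → 0ℚ < ε → ∃[ N ] (∀ n → N ℕ.≤ n → ∣ s n ∣ < ε)

  Null-cong : ∀ {s t} → (∀ n → s n ≡ t n) → Null s → Null t
  Null-cong e h ε 0<ε with h ε 0<ε
  ... | N , f = N , λ n N≤n → subst (λ p → ∣ p ∣ < ε) (e n) (f n N≤n)

  Null-≡0 : ∀ {s} → (∀ n → s n ≡ 0ℚ) → Null s
  Null-≡0 e ε 0<ε = 0 , λ n _ → subst (λ p → ∣ p ∣ < ε) (sym (e n)) 0<ε

  Null-+ : ∀ {s t} → Null s → Null t → Null (λ n → s n + t n)
  Null-+ {s} {t} hs ht ε 0<ε with hs (½ * ε) (0<½* 0<ε) | ht (½ * ε) (0<½* 0<ε)
  ... | M , f | N , g = M ℕ.⊔ N , λ n le → ≤-<-trans (∣p+q∣≤∣p∣+∣q∣ (s n) (t n))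
    (subst (∣ s n ∣ + ∣ t n ∣ <_) (½+½ ε)
      (+-mono-< (f n (ℕ.≤-trans (ℕ.m≤m⊔n M N) le)) (g n (ℕ.≤-trans (ℕ.m≤n⊔m M N) le))))

  Null-neg : ∀ {s} → Null s → Null (λ n → - s n)
  Null-neg {s} h ε 0<ε with h ε 0<ε
  ... | N , f = N , λ n le → subst (_< ε) (sym (∣-p∣≡∣p∣ (s n))) (f n le)

  Null-dominated : ∀ {s t} → (∀ n → ∣ s n ∣ ≤ ∣ t n ∣) → Null t → Null s
  Null-dominated h ht ε 0<ε with ht ε 0<ε
  ... | N , f = N , λ n le → ≤-<-trans (h n) (f n le)

  eventually-bounded : ∀ x → Σ[ B ∈ ℚ ] 0ℚ < B × ∃[ N ] (∀ n → N ℕ.≤ n → ∣ seq x n ∣ ≤ B)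
  eventually-bounded x with cauchy x 1ℚ 0<1
  ... | N , h = 1ℚ + ∣ seq x N ∣ , 0<-≤-+ 0<1 (0≤∣p∣ (seq x N)) , N , λ n le →
    ≤-trans (∣∣-triangle (seq x n) (seq x N)) (+-monoˡ-≤ ∣ seq x N ∣ (<⇒≤ (h n N le ℕ.≤-refl)))

  recip : ∀ {B} → 0ℚ < B → Σ[ C ∈ ℚ ] 0ℚ < C × B * C ≡ 1ℚ
  recip {B} 0<B = 1/ B , positive⁻¹ (1/ B) , *-inverseʳ B
    where
    instance
      B-pos : Positive B
      B-pos = positive 0<B
      B-nonZero : NonZero B
      B-nonZero = pos⇒nonZero B
      1/B-pos : Positive (1/ B)
      1/B-pos = 1/pos⇒pos B

  Null-* : ∀ {s} → Null s → ∀ y → Null (λ n → s n * seq y n)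
  Null-* {s} h y ε 0<ε = go (eventually-bounded y)
    where
    go : Σ[ B ∈ ℚ ] 0ℚ < B × ∃[ N ] (∀ n → N ℕ.≤ n → ∣ seq y n ∣ ≤ B) → ∃[ N ] (∀ n → N ℕ.≤ n → ∣ s n * seq y n ∣ < ε)
    go (B , 0<B , M , by) = M ℕ.⊔ N , λ n le →
      subst₂ _<_ (sym (∣p*q∣≡∣p∣*∣q∣ (s n) (seq y n))) Bδ≡ε
        (≤-<-trans (*-monoˡ-≤-nonNeg ∣ s n ∣ {{nonNegative (0≤∣p∣ (s n))}} (by n (ℕ.≤-trans (ℕ.m≤m⊔n M N) le)))
                   (*-monoˡ-<-pos B {{positive 0<B}} (f n (ℕ.≤-trans (ℕ.m≤n⊔m M N) le))))
      where
      C = proj₁ (recip 0<B)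
      0<C = proj₁ (proj₂ (recip 0<B))
      N = proj₁ (h (C * ε) (0<-* 0<C 0<ε))
      f = proj₂ (h (C * ε) (0<-* 0<C 0<ε))
      Bδ≡ε : (C * ε) * B ≡ ε
      Bδ≡ε = trans (*-comm (C * ε) B) (trans (sym (*-assoc B C ε))
        (trans (cong (_* ε) (proj₂ (proj₂ (recip 0<B)))) (*-identityˡ ε)))

  -- _≈ℝ_ unfolds to a function type; the wrapper lets unification see its arguments.
  infix 4 _≋_
  record _≋_ (x y : ℝ) : Set where
    constructor ⟨_⟩
    field unwrap : x ≈ℝ y

  open _≋_ public

  pointwise : ∀ {x y} → (∀ n → seq x n ≡ seq y n) → x ≋ y
  pointwise {x} {y} e = ⟨ Null-≡0 (λ n → trans (cong (_- seq y n) (e n)) (+-inverseʳ (seq y n))) ⟩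

  ℝ-ring : Ring₀
  ℝ-ring = record
    { Carrier = ℝ ; _≈_ = _≋_ ; _+_ = _+ℝ_ ; _*_ = _*ℝ_ ; -_ = -ℝ_ ; 0# = 0ℝ ; 1# = 1ℝ
    ; isCommutativeRing = record
      { isRing = record
        { +-isAbelianGroup = record
          { isGroup = record
            { isMonoid = record
              { isSemigroup = record
                { isMagma = record
                  { isEquivalence = record
                    { refl = λ {x} → pointwise (λ _ → refl)
                    ; sym = λ {x} {y} h → ⟨ Null-cong (λ n → solve 2 (λ a b → :- (a :- b) := b :- a) refl (seq x n) (seq y n)) (Null-neg (unwrap h)) ⟩
                    ; trans = λ {x} {y} {z} h k → ⟨ Null-cong (λ n → solve 3 (λ a b c → (a :- b) :+ (b :- c) := a :- c) refl
                        (seq x n) (seq y n) (seq z n)) (Null-+ (unwrap h) (unwrap k)) ⟩ }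
                  ; ∙-cong = λ {x} {y} {u} {v} h k → ⟨ Null-cong (λ n → solve 4 (λ a b c d → (a :- b) :+ (c :- d) := (a :+ c) :- (b :+ d)) refl
                        (seq x n) (seq y n) (seq u n) (seq v n)) (Null-+ (unwrap h) (unwrap k)) ⟩ }
                ; assoc = λ x y z → pointwise (λ n → +-assoc (seq x n) (seq y n) (seq z n)) }
              ; identity = (λ x → pointwise (λ n → +-identityˡ (seq x n)))
                         , (λ x → pointwise (λ n → +-identityʳ (seq x n))) }
            ; inverse = (λ x → pointwise (λ n → +-inverseˡ (seq x n)))
                      , (λ x → pointwise (λ n → +-inverseʳ (seq x n)))
            ; ⁻¹-cong = λ {x} {y} h → ⟨ Null-cong (λ n → neg-distrib-+ (seq x n) (- seq y n)) (Null-neg (unwrap h)) ⟩ }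
          ; comm = λ x y → pointwise (λ n → +-comm (seq x n) (seq y n)) }
        ; *-cong = λ {x} {y} {u} {v} h k → ⟨ Null-cong (λ n → solve 4 (λ a b c d → (a :- b) :* c :+ (c :- d) :* b := a :* c :- b :* d) refl
                     (seq x n) (seq y n) (seq u n) (seq v n)) (Null-+ (Null-* (unwrap h) u) (Null-* (unwrap k) y)) ⟩
        ; *-assoc = λ x y z → pointwise (λ n → *-assoc (seq x n) (seq y n) (seq z n))
        ; *-identity = (λ x → pointwise (λ n → *-identityˡ (seq x n)))
                     , (λ x → pointwise (λ n → *-identityʳ (seq x n)))
        ; distrib = (λ x y z → pointwise (λ n → *-distribˡ-+ (seq x n) (seq y n) (seq z n)))
                  , (λ x y z → pointwise (λ n → *-distribʳ-+ (seq x n) (seq y n) (seq z n))) }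
      ; *-comm = λ x y → pointwise (λ n → *-comm (seq x n) (seq y n)) } }
    where open ℚS

  module ℝR = CommutativeRing ℝ-ring

  p-0≡p : ∀ p → p - 0ℚ ≡ p
  p-0≡p p = +-identityʳ p

  ≈0⇒Null : ∀ {x} → x ≋ 0ℝ → Null (seq x)
  ≈0⇒Null {x} e = Null-cong (λ n → p-0≡p (seq x n)) (unwrap e)

  Null⇒≈0 : ∀ {x} → Null (seq x) → x ≋ 0ℝ
  Null⇒≈0 {x} h = ⟨ Null-cong (λ n → sym (p-0≡p (seq x n))) h ⟩

  -- The positive form of being nonzero: it carries a lower bound, so it is preserved by products.
  Apart₀ : ℝ → Set
  Apart₀ x = Σ[ δ ∈ ℚ ] 0ℚ < δ × ∃[ N ] (∀ n → N ℕ.≤ n → δ ≤ ∣ seq x n ∣)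

  Apart₀⇒≉0 : ∀ {x} → Apart₀ x → ¬ (x ≋ 0ℝ)
  Apart₀⇒≉0 {x} (δ , 0<δ , M , f) e with ≈0⇒Null e δ 0<δ
  ... | N , g = <-irrefl refl (≤-<-trans (f (M ℕ.⊔ N) (ℕ.m≤m⊔n M N)) (g (M ℕ.⊔ N) (ℕ.m≤n⊔m M N)))

  quarters : ∀ ε → ½ * ε - ½ * (½ * ε) ≡ ½ * (½ * ε)
  quarters ε = trans (cong (_- q) (sym (½+½ (½ * ε)))) (solve 1 (λ q → (q :+ q) :- q := q) refl q)
    where
    open ℚS
    q = ½ * (½ * ε)

  -- Choose N beyond which the terms vary by less than ε/4 and compare the rational ∣x_N∣ with ε/2.
  -- Either the tail stays below ε, or it stays above ε/4, which is the excluded apartness.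
  tight : ∀ x → ¬ Apart₀ x → x ≋ 0ℝ
  tight x na = Null⇒≈0 λ ε 0<ε → go ε 0<ε (cauchy x (½ * (½ * ε)) (0<½* (0<½* 0<ε)))
    where
    go : ∀ ε → 0ℚ < ε → ∃[ N ] (∀ m n → N ℕ.≤ m → N ℕ.≤ n → ∣ seq x m - seq x n ∣ < ½ * (½ * ε)) →
         ∃[ N ] (∀ n → N ℕ.≤ n → ∣ seq x n ∣ < ε)
    go ε 0<ε (N , h) with ∣ seq x N ∣ <? ½ * ε
    ... | yes p = N , λ n le → ≤-<-trans (∣∣-triangle (seq x n) (seq x N))
          (subst (∣ seq x n - seq x N ∣ + ∣ seq x N ∣ <_) (½+½ ε)
            (+-mono-< (<-trans (h n N le ℕ.≤-refl)
               (0<-⇒< {½ * (½ * ε)} {½ * ε} (subst (0ℚ <_) (sym (quarters ε)) (0<½* (0<½* 0<ε))))) p))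
    ... | no ¬p = ⊥-elim (na (½ * (½ * ε) , 0<½* (0<½* 0<ε) , N , λ n le → 0≤-⇒≤ (subst (0ℚ ≤_)
        (trans (solve 5 (λ a b d h q → (d :+ a :- b) :+ (b :- h) :+ (q :- d) := a :- (h :- q)) refl
                 (∣ seq x n ∣) (∣ seq x N ∣) (∣ seq x N - seq x n ∣) (½ * ε) (½ * (½ * ε)))
               (cong (λ r → ∣ seq x n ∣ - r) (quarters ε)))
        (0≤-+ (0≤-+ (≤⇒0≤- (∣∣-triangle (seq x N) (seq x n))) (≤⇒0≤- (≮⇒≥ ¬p)))
              (≤⇒0≤- (<⇒≤ (h N n ℕ.≤-refl le)))))))
      where open ℚS

  -- Both properties go through `tight`, whose hypothesis is a negation: it may be refuted after
  -- assuming that all factors are apart from zero.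
  ℝ-domain : IsDomain ℝ-ring
  ℝ-domain = record
    { stable = λ {x} k → tight x (λ a → k (Apart₀⇒≉0 {x} a))
    ; integral = λ x y e x≉0 → tight y (λ y#0 → x≉0 (tight x (λ x#0 → Apart₀⇒≉0 {x *ℝ y} (product x y x#0 y#0) e)))
    ; 1≉0 = Apart₀⇒≉0 {1ℝ} (1ℚ , 0<1 , 0 , λ _ _ → ≤-refl) }
    where
    product : ∀ x y → Apart₀ x → Apart₀ y → Apart₀ (x *ℝ y)
    product x y (δ , 0<δ , M , f) (γ , 0<γ , N , g) = δ * γ , 0<-* 0<δ 0<γ , M ℕ.⊔ N , λ n le →
      ≤-trans (*-mono-≤-nonNeg (<⇒≤ 0<δ) (0≤∣p∣ (seq y n)) (f n (ℕ.≤-trans (ℕ.m≤m⊔n M N) le)) (g n (ℕ.≤-trans (ℕ.m≤n⊔m M N) le)))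
              (≤-reflexive (sym (∣p*q∣≡∣p∣*∣q∣ (seq x n) (seq y n))))

  pointwise-gap⇒≉ : ∀ {x y} δ → 0ℚ < δ → (∀ n → seq x n + δ ≤ seq y n) → ¬ (x ≋ y)
  pointwise-gap⇒≉ {x} {y} δ 0<δ gap e with unwrap e δ 0<δ
  ... | N , f = <-irrefl refl (<-≤-trans (f N ℕ.≤-refl) (≤-trans (0≤-⇒≤ (subst (0ℚ ≤_)
      (solve 3 (λ a b d → b :- (a :+ d) := :- (a :- b) :- d) refl (seq x N) (seq y N) δ) (≤⇒0≤- (gap N))))
      (-p≤∣p∣ (seq x N - seq y N))))
    where open ℚS

  sum-of-nonNeg : ∀ {x y} → (∀ n → 0ℚ ≤ seq x n) → (∀ n → 0ℚ ≤ seq y n) → x +ℝ y ≋ 0ℝ → x ≋ 0ℝ × y ≋ 0ℝ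
  sum-of-nonNeg {x} {y} 0≤x 0≤y e =
    Null⇒≈0 {x} (Null-dominated (λ n → dominated (0≤x n) (0≤y n)) (≈0⇒Null {x +ℝ y} e)) ,
    Null⇒≈0 {y} (Null-dominated (λ n → subst (λ p → ∣ seq y n ∣ ≤ ∣ p ∣) (+-comm (seq y n) (seq x n)) (dominated (0≤y n) (0≤x n)))
      (≈0⇒Null {x +ℝ y} e))
    where
    dominated : ∀ {a b} → 0ℚ ≤ a → 0ℚ ≤ b → ∣ a ∣ ≤ ∣ a + b ∣
    dominated {a} {b} p q = subst₂ _≤_ (sym (0≤p⇒∣p∣≡p p)) (sym (0≤p⇒∣p∣≡p (0≤-+ p q)))
      (subst (_≤ a + b) (+-identityʳ a) (+-monoʳ-≤ a q))

  square≈0 : ∀ x → x *ℝ x ≋ 0ℝ → x ≋ 0ℝ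
  square≈0 x e = stable {x} (λ k → k (integral x x e k))
    where open IsDomain ℝ-domain

  -- The dichotomy of `tight`, applied to x - y: one late term below ε/2 bounds the tail by ε,
  -- otherwise the tail exceeds ε/8, a witness of y < x.
  ≮⇒≥ℝ : ∀ x y → ¬ (y <ℝ x) → x ≤ℝ y
  ≮⇒≥ℝ x y k ε 0<ε = go (cauchy (x -ℝ y) (½ * (½ * ε)) (0<½* (0<½* 0<ε)))
    where
    open ℚS
    d : ℕ → ℚ
    d n = seq x n - seq y n
    q p : ℚ
    q = ½ * (½ * ε)
    p = ½ * q
    0<q : 0ℚ < q
    0<q = 0<½* (0<½* 0<ε)
    split-ε : ∀ c → c + ((q + q) + (q + q)) ≡ c + ε
    split-ε c = cong (c +_) (trans (cong₂ _+_ (½+½ (½ * ε)) (½+½ (½ * ε))) (½+½ ε))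
    go : ∃[ N ] (∀ m n → N ℕ.≤ m → N ℕ.≤ n → ∣ d m - d n ∣ < q) → ∃[ N ] (∀ n → N ℕ.≤ n → seq x n < seq y n + ε)
    go (N , h) with d N <? q + q
    ... | yes D< = N , λ n le → subst (seq x n <_) (split-ε (seq y n)) (0<-⇒< (subst (0ℚ <_)
          (solve 5 (λ a b D f q → ((q :+ q) :- D) :+ (q :- f) :+ q :+ (f :- ((a :- b) :- D))
               := (b :+ ((q :+ q) :+ (q :+ q))) :- a) refl (seq x n) (seq y n) (d N) (∣ d n - d N ∣) q)
          (0<-≤-+ (0<-+ (0<-+ (<⇒0<- D<) (<⇒0<- (h n N le ℕ.≤-refl))) 0<q) (≤⇒0≤- (p≤∣p∣ (d n - d N))))))
    ... | no D≮ = ⊥-elim (k (p , 0<½* 0<q , N , λ n le → 0<-⇒< (subst (0ℚ <_)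
          (regroup (seq x n) (seq y n) (d N) (∣ d N - d n ∣) (½+½ q))
          (0<-≤-+ (0<-≤-+ (0<-+ (<⇒0<- (h N n ℕ.≤-refl le)) (0<½* 0<q)) (≤⇒0≤- (p≤∣p∣ (d N - d n)))) (≤⇒0≤- (≮⇒≥ D≮))))))
      where
      regroup : ∀ a b D f {p q} → p + p ≡ q → (q - f) + p + (f - (D - (a - b))) + (D - (q + q)) ≡ a - (b + p)
      regroup a b D f {p} refl = solve 5 (λ a b D f p → ((p :+ p) :- f) :+ p :+ (f :- (D :- (a :- b))) :+ (D :- ((p :+ p) :+ (p :+ p)))
               := a :- (b :+ p)) refl a b D f p

-- Complex numbers and the embeddings ℤ → ℚ → ℝ → ℂ.

module Complex where

  open Kit
  open Reals
  open import Algebra.Bundles using (CommutativeRing)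
  open import Data.Empty using (⊥-elim)
  open import Data.Integer as ℤ using (ℤ)
  import Data.Integer.Properties as ℤ
  open import Data.Product using (_×_; _,_; proj₁; proj₂)
  open import Data.Rational as ℚ using (ℚ; 0ℚ; _/_)
  import Data.Rational.Properties as ℚ
  import Data.Rational.Unnormalised as ℚᵘ
  import Data.Rational.Unnormalised.Properties as ℚᵘ
  open import Relation.Binary.PropositionalEquality as ≡ using (_≡_)
  open import Relation.Nullary using (yes; no)

  -- The identities behind complex multiplication are proved over an abstract ring, so that Cauchy
  -- sequences never enter the terms of the solver.
  module Pairs (A : Ring₀) where
    open CommutativeRing A
    open IntegerSolver A
    open import Relation.Binary.Reasoning.Setoid setoid

    *-assoc₁ : ∀ a b c d e f → (a * c - b * d) * e - (a * d + b * c) * f ≈ a * (c * e - d * f) - b * (c * f + d * e)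
    *-assoc₁ = solve 6 (λ a b c d e f → (a :* c :- b :* d) :* e :- (a :* d :+ b :* c) :* f
                                    := a :* (c :* e :- d :* f) :- b :* (c :* f :+ d :* e)) refl
    *-assoc₂ : ∀ a b c d e f → (a * c - b * d) * f + (a * d + b * c) * e ≈ a * (c * f + d * e) + b * (c * e - d * f)
    *-assoc₂ = solve 6 (λ a b c d e f → (a :* c :- b :* d) :* f :+ (a :* d :+ b :* c) :* e
                                    := a :* (c :* f :+ d :* e) :+ b :* (c :* e :- d :* f)) refl
    *-identity₁ : ∀ a b → 1# * a - 0# * b ≈ a
    *-identity₁ = solve 2 (λ a b → :1 :* a :- :0 :* b := a) refl
    *-identity₂ : ∀ a b → 1# * b + 0# * a ≈ b
    *-identity₂ = solve 2 (λ a b → :1 :* b :+ :0 :* a := b) refl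
    distrib₁ : ∀ a b c d e f → a * (c + e) - b * (d + f) ≈ (a * c - b * d) + (a * e - b * f)
    distrib₁ = solve 6 (λ a b c d e f → a :* (c :+ e) :- b :* (d :+ f) := (a :* c :- b :* d) :+ (a :* e :- b :* f)) refl
    distrib₂ : ∀ a b c d e f → a * (d + f) + b * (c + e) ≈ (a * d + b * c) + (a * f + b * e)
    distrib₂ = solve 6 (λ a b c d e f → a :* (d :+ f) :+ b :* (c :+ e) := (a :* d :+ b :* c) :+ (a :* f :+ b :* e)) refl
    *-comm₁ : ∀ a b c d → a * c - b * d ≈ c * a - d * b
    *-comm₁ = solve 4 (λ a b c d → a :* c :- b :* d := c :* a :- d :* b) refl
    *-comm₂ : ∀ a b c d → a * d + b * c ≈ c * b + d * a
    *-comm₂ = solve 4 (λ a b c d → a :* d :+ b :* c := c :* b :+ d :* a) refl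

    embed-+ : 0# ≈ 0# + 0#
    embed-+ = solve 0 (:0 := :0 :+ :0) refl
    embed-neg : 0# ≈ - 0#
    embed-neg = solve 0 (:0 := :- :0) refl
    embed-*₁ : ∀ x y → x * y ≈ x * y - 0# * 0#
    embed-*₁ = solve 2 (λ x y → x :* y := x :* y :- :0 :* :0) refl
    embed-*₂ : ∀ x y → 0# ≈ x * 0# + 0# * y
    embed-*₂ = solve 2 (λ x y → :0 := x :* :0 :+ :0 :* y) refl

    -- The multiplicativity ∣z∣²∣w∣² = ∣zw∣²; it reduces integrality of ℂ to that of ℝ.
    norm-zero : ∀ a b c d → a * c - b * d ≈ 0# → a * d + b * c ≈ 0# → (a * a + b * b) * (c * c + d * d) ≈ 0#
    norm-zero a b c d e₁ e₂ = begin
      (a * a + b * b) * (c * c + d * d)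
        ≈⟨ solve 4 (λ a b c d → (a :* a :+ b :* b) :* (c :* c :+ d :* d)
             := (a :* c :- b :* d) :* (a :* c :- b :* d) :+ (a :* d :+ b :* c) :* (a :* d :+ b :* c)) refl a b c d ⟩
      (a * c - b * d) * (a * c - b * d) + (a * d + b * c) * (a * d + b * c)
        ≈⟨ +-cong (*-cong e₁ e₁) (*-cong e₂ e₂) ⟩
      0# * 0# + 0# * 0#  ≈⟨ solve 0 (:0 :* :0 :+ :0 :* :0 := :0) refl ⟩
      0#                 ∎

  module ℝP = Pairs ℝ-ring

  infix 4 _≋ℂ_
  record _≋ℂ_ (z w : ℂ) : Set where
    constructor _,ℂ_
    field
      re≋ : re z ≋ re w
      im≋ : im z ≋ im w

  open _≋ℂ_ public

  ≋ℂ⇒≈ℂ : ∀ {z w} → z ≋ℂ w → z ≈ℂ w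
  ≋ℂ⇒≈ℂ (p ,ℂ q) = unwrap p , unwrap q

  ≈ℂ⇒≋ℂ : ∀ {z w} → z ≈ℂ w → z ≋ℂ w
  ≈ℂ⇒≋ℂ (p , q) = ⟨ p ⟩ ,ℂ ⟨ q ⟩

  -ℂ_ : ℂ → ℂ
  -ℂ z = (-ℝ re z) +i (-ℝ im z)

  module _ where
    open CommutativeRing ℝ-ring
    open ℝP

    ℂ-ring : Ring₀
    ℂ-ring = record
      { Carrier = ℂ ; _≈_ = _≋ℂ_ ; _+_ = _+ℂ_ ; _*_ = _*ℂ_ ; -_ = -ℂ_ ; 0# = 0ℂ ; 1# = 1ℂ
      ; isCommutativeRing = record
        { isRing = record
          { +-isAbelianGroup = record
            { isGroup = record
              { isMonoid = record
                { isSemigroup = record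
                  { isMagma = record
                    { isEquivalence = record
                      { refl = refl ,ℂ refl
                      ; sym = λ (p ,ℂ q) → sym p ,ℂ sym q
                      ; trans = λ (p ,ℂ q) (p' ,ℂ q') → trans p p' ,ℂ trans q q' }
                    ; ∙-cong = λ {z} {z'} {w} {w'} (p ,ℂ q) (p' ,ℂ q') →
                        +-cong {re z} {re z'} {re w} {re w'} p p' ,ℂ +-cong {im z} {im z'} {im w} {im w'} q q' }
                  ; assoc = λ z w v → +-assoc (re z) (re w) (re v) ,ℂ +-assoc (im z) (im w) (im v) }
                ; identity = (λ z → +-identityˡ (re z) ,ℂ +-identityˡ (im z))
                           , (λ z → +-identityʳ (re z) ,ℂ +-identityʳ (im z)) }
              ; inverse = (λ z → -‿inverseˡ (re z) ,ℂ -‿inverseˡ (im z))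
                        , (λ z → -‿inverseʳ (re z) ,ℂ -‿inverseʳ (im z))
              ; ⁻¹-cong = λ {z} {w} (p ,ℂ q) → -‿cong {re z} {re w} p ,ℂ -‿cong {im z} {im w} q }
            ; comm = λ z w → +-comm (re z) (re w) ,ℂ +-comm (im z) (im w) }
          ; *-cong = λ {z} {z'} {w} {w'} (p ,ℂ q) (p' ,ℂ q') →
              +-cong {re z * re w} {re z' * re w'} { - (im z * im w)} { - (im z' * im w')}
                (*-cong {re z} {re z'} {re w} {re w'} p p')
                (-‿cong {im z * im w} {im z' * im w'} (*-cong {im z} {im z'} {im w} {im w'} q q')) ,ℂ
              +-cong {re z * im w} {re z' * im w'} {im z * re w} {im z' * re w'}
                (*-cong {re z} {re z'} {im w} {im w'} p q') (*-cong {im z} {im z'} {re w} {re w'} q p')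
          ; *-assoc = λ z w v → *-assoc₁ (re z) (im z) (re w) (im w) (re v) (im v) ,ℂ *-assoc₂ (re z) (im z) (re w) (im w) (re v) (im v)
          ; *-identity = (λ z → *-identity₁ (re z) (im z) ,ℂ *-identity₂ (re z) (im z))
                       , (λ z → trans (*-comm₁ (re z) (im z) 1# 0#) (*-identity₁ (re z) (im z)) ,ℂ
                                trans (*-comm₂ (re z) (im z) 1# 0#) (*-identity₂ (re z) (im z)))
          ; distrib = (λ z w v → distrib₁ (re z) (im z) (re w) (im w) (re v) (im v) ,ℂ distrib₂ (re z) (im z) (re w) (im w) (re v) (im v))
                    , (λ z w v → dist₁ z w v ,ℂ dist₂ z w v) }
        ; *-comm = λ z w → *-comm₁ (re z) (im z) (re w) (im w) ,ℂ *-comm₂ (re z) (im z) (re w) (im w) } }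
      where
      dist₁ : ∀ z w v → re ((w +ℂ v) *ℂ z) ≈ re (w *ℂ z +ℂ v *ℂ z)
      dist₁ z w v = trans (*-comm₁ (re w + re v) (im w + im v) (re z) (im z))
        (trans (distrib₁ (re z) (im z) (re w) (im w) (re v) (im v))
          (+-cong {re (z *ℂ w)} {re (w *ℂ z)} {re (z *ℂ v)} {re (v *ℂ z)}
            (*-comm₁ (re z) (im z) (re w) (im w)) (*-comm₁ (re z) (im z) (re v) (im v))))
      dist₂ : ∀ z w v → im ((w +ℂ v) *ℂ z) ≈ im (w *ℂ z +ℂ v *ℂ z)
      dist₂ z w v = trans (*-comm₂ (re w + re v) (im w + im v) (re z) (im z))
        (trans (distrib₂ (re z) (im z) (re w) (im w) (re v) (im v))
          (+-cong {im (z *ℂ w)} {im (w *ℂ z)} {im (z *ℂ v)} {im (v *ℂ z)}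
            (*-comm₂ (re z) (im z) (re w) (im w)) (*-comm₂ (re z) (im z) (re v) (im v))))

    sum-of-squares : ∀ x y → x * x + y * y ≈ 0# → x ≈ 0# × y ≈ 0#
    sum-of-squares x y e = square≈0 x (proj₁ both) , square≈0 y (proj₂ both)
      where both = sum-of-nonNeg {x * x} {y * y} (λ n → 0≤-square (seq x n)) (λ n → 0≤-square (seq y n)) e

    ℂ-domain : IsDomain ℂ-ring
    ℂ-domain = record
      { stable = λ {z} k → stable (λ n → k (λ e → n (re≋ e))) ,ℂ stable (λ n → k (λ e → n (im≋ e)))
      ; integral = λ z w (e₁ ,ℂ e₂) z≉0 →
          let w≈0 = sum-of-squares (re w) (im w) (integral (∣ z ∣²) (∣ w ∣²) (norm-zero (re z) (im z) (re w) (im w) e₁ e₂)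
                      (λ e → z≉0 (let z≈0 = sum-of-squares (re z) (im z) e in proj₁ z≈0 ,ℂ proj₂ z≈0)))
          in proj₁ w≈0 ,ℂ proj₂ w≈0
      ; 1≉0 = λ e → 1≉0 (re≋ e) }
      where open IsDomain ℝ-domain

    ℝ→ℂ : Hom ℝ-ring ℂ-ring
    ℝ→ℂ = record
      { ⟦_⟧ = fromℝ
      ; ⟦⟧-cong = λ e → e ,ℂ refl
      ; +-homo = λ x y → refl ,ℂ embed-+
      ; *-homo = λ x y → embed-*₁ x y ,ℂ embed-*₂ x y
      ; -‿homo = λ x → refl ,ℂ embed-neg
      ; 0-homo = refl ,ℂ refl
      ; 1-homo = refl ,ℂ refl }

    ℚ→ℝ : Hom ℚ-ring ℝ-ring
    ℚ→ℝ = record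
      { ⟦_⟧ = fromℚ
      ; ⟦⟧-cong = λ { ≡.refl → refl }
      ; +-homo = λ p q → pointwise (λ _ → ≡.refl)
      ; *-homo = λ p q → pointwise (λ _ → ≡.refl)
      ; -‿homo = λ p → pointwise (λ _ → ≡.refl)
      ; 0-homo = refl
      ; 1-homo = refl }

  ℤ-ring : Ring₀
  ℤ-ring = ℤ.+-*-commutativeRing

  fromℤ : ℤ → ℚ
  fromℤ i = i / 1

  private
    toℚᵘ-fromℤ : ∀ i → ℚ.toℚᵘ (fromℤ i) ℚᵘ.≃ ℚᵘ.mkℚᵘ i 0
    toℚᵘ-fromℤ i = ℚ.toℚᵘ-fromℚᵘ (ℚᵘ.mkℚᵘ i 0)

    fromℤ-+ : ∀ i j → fromℤ (i ℤ.+ j) ≡ fromℤ i ℚ.+ fromℤ j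
    fromℤ-+ i j = ℚ.toℚᵘ-injective (ℚᵘ.≃-trans (toℚᵘ-fromℤ (i ℤ.+ j)) (ℚᵘ.≃-trans
      (ℚᵘ.*≡* (≡.cong (ℤ._* ℤ.1ℤ) (≡.sym (≡.cong₂ ℤ._+_ (ℤ.*-identityʳ i) (ℤ.*-identityʳ j)))))
      (ℚᵘ.≃-sym (ℚᵘ.≃-trans (ℚ.toℚᵘ-homo-+ (fromℤ i) (fromℤ j)) (ℚᵘ.+-cong (toℚᵘ-fromℤ i) (toℚᵘ-fromℤ j))))))

    fromℤ-* : ∀ i j → fromℤ (i ℤ.* j) ≡ fromℤ i ℚ.* fromℤ j
    fromℤ-* i j = ℚ.toℚᵘ-injective (ℚᵘ.≃-trans (toℚᵘ-fromℤ (i ℤ.* j)) (ℚᵘ.≃-trans (ℚᵘ.*≡* ≡.refl)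
      (ℚᵘ.≃-sym (ℚᵘ.≃-trans (ℚ.toℚᵘ-homo-* (fromℤ i) (fromℤ j)) (ℚᵘ.*-cong (toℚᵘ-fromℤ i) (toℚᵘ-fromℤ j))))))

    fromℤ-neg : ∀ i → fromℤ (ℤ.- i) ≡ ℚ.- fromℤ i
    fromℤ-neg i = ℚ.toℚᵘ-injective (ℚᵘ.≃-trans (toℚᵘ-fromℤ (ℤ.- i))
      (ℚᵘ.≃-sym (ℚᵘ.≃-trans (ℚ.toℚᵘ-homo‿- (fromℤ i)) (ℚᵘ.-‿cong (toℚᵘ-fromℤ i)))))

  fromℤ-injective : ∀ {i j} → fromℤ i ≡ fromℤ j → i ≡ j
  fromℤ-injective {i} {j} e with ℚᵘ.≃-trans (ℚᵘ.≃-sym (toℚᵘ-fromℤ i)) (ℚᵘ.≃-trans (ℚᵘ.≃-reflexive (≡.cong ℚ.toℚᵘ e)) (toℚᵘ-fromℤ j))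
  ... | ℚᵘ.*≡* f = ≡.trans (≡.sym (ℤ.*-identityʳ i)) (≡.trans f (ℤ.*-identityʳ j))

  fromℤ-mono-≤ : ∀ {i j} → i ℤ.≤ j → fromℤ i ℚ.≤ fromℤ j
  fromℤ-mono-≤ {i} {j} i≤j = ℚ.toℚᵘ-cancel-≤ (ℚᵘ.≤-respˡ-≃ (ℚᵘ.≃-sym (toℚᵘ-fromℤ i)) (ℚᵘ.≤-respʳ-≃ (ℚᵘ.≃-sym (toℚᵘ-fromℤ j))
    (ℚᵘ.*≤* (ℤ.*-monoʳ-≤-nonNeg ℤ.1ℤ i≤j))))

  fromℤ-mono-< : ∀ {i j} → i ℤ.< j → fromℤ i ℚ.< fromℤ j
  fromℤ-mono-< {i} {j} i<j = ℚ.toℚᵘ-cancel-< (ℚᵘ.<-respˡ-≃ (ℚᵘ.≃-sym (toℚᵘ-fromℤ i)) (ℚᵘ.<-respʳ-≃ (ℚᵘ.≃-sym (toℚᵘ-fromℤ j))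
    (ℚᵘ.*<* (ℤ.*-monoʳ-<-pos ℤ.1ℤ i<j))))

  ℤ→ℚ : Hom ℤ-ring ℚ-ring
  ℤ→ℚ = record
    { ⟦_⟧ = fromℤ ; ⟦⟧-cong = ≡.cong fromℤ ; +-homo = fromℤ-+ ; *-homo = fromℤ-* ; -‿homo = fromℤ-neg
    ; 0-homo = ≡.refl ; 1-homo = ≡.refl }

  ℚ→ℂ : Hom ℚ-ring ℂ-ring
  ℚ→ℂ = ℝ→ℂ ∘ₕ ℚ→ℝ

  fromℚ-injective : ∀ {p q} → fromℚ p ≋ fromℚ q → p ≡ q
  fromℚ-injective {p} {q} e with p ℚ.≟ q
  ... | yes p≡q = p≡q
  ... | no p≢q = ⊥-elim (Apart₀⇒≉0 {fromℚ p -ℝ fromℚ q} (ℚ.∣ p ℚ.- q ∣ , 0<∣∣ , 0 , λ _ _ → ℚ.≤-refl)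
                   (ℝR.trans (ℝR.+-congʳ e) (ℝR.-‿inverseʳ (fromℚ q))))
    where
    open import Algebra.Properties.Group (CommutativeRing.+-group ℚ-ring) using (x∙y⁻¹≈ε⇒x≈y)
    0<∣∣ : 0ℚ ℚ.< ℚ.∣ p ℚ.- q ∣
    0<∣∣ = ℚ.≰⇒> λ le → p≢q (x∙y⁻¹≈ε⇒x≈y p q (ℚ.∣p∣≡0⇒p≡0 (p ℚ.- q) (ℚ.≤-antisym le (ℚ.0≤∣p∣ (p ℚ.- q)))))

  ℚ→ℂ-injective : ∀ {p q} → Hom.⟦_⟧ ℚ→ℂ p ≋ℂ Hom.⟦_⟧ ℚ→ℂ q → p ≡ q
  ℚ→ℂ-injective e = fromℚ-injective (re≋ e)

-- Gauss's lemma, in terms of values at an integer.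

module Gauss where

  open Kit
  open Poly
  open Reals
  open Complex
  open import Data.Integer as ℤ using (ℤ; 0ℤ; 1ℤ) renaming (+_ to pos)
  import Data.Integer.Properties as ℤ
  open import Data.Integer.Divisibility.Signed
  open import Data.List as List using (List; []; _∷_)
  open import Data.List.Relation.Unary.All using (All; []; _∷_)
  open import Data.Nat as ℕ using (ℕ; zero; suc)
  import Data.Nat.Properties as ℕ
  import Data.Nat.Divisibility as ℕ∣
  open import Data.Nat.ListAction using (product)
  open import Data.Nat.Primality using (Prime; euclidsLemma; prime⇒nonZero)
  open import Data.Nat.Primality.Factorisation using (factorise; PrimeFactorisation)
  open import Data.Rational as ℚ using (ℚ; ↥_; ↧_; ↧ₙ_)
  import Data.Rational.Properties as ℚ
  import Data.Rational.Unnormalised as ℚᵘ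
  import Data.Rational.Unnormalised.Properties as ℚᵘ
  open import Data.Sum using (_⊎_; inj₁; inj₂)
  open import Data.Vec using (Vec; []; _∷_)
  open import Relation.Binary.PropositionalEquality
  open import Relation.Nullary using (yes; no; contradiction)

  module ℤS = IntegerSolver ℤ-ring

  infixl 6 _⊕_
  infixl 7 _⊗_

  -- Lists replace vectors here because degrees play no part in divisibility; trailing zeros are
  -- allowed and polynomials are compared through `coeff`.
  _⊕_ : List ℤ → List ℤ → List ℤ
  []       ⊕ G        = G
  (f ∷ F)  ⊕ []       = f ∷ F
  (f ∷ F)  ⊕ (g ∷ G)  = f ℤ.+ g ∷ F ⊕ G

  scale : ℤ → List ℤ → List ℤ
  scale c = List.map (c ℤ.*_)

  _⊗_ : List ℤ → List ℤ → List ℤ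
  []      ⊗ G = []
  (f ∷ F) ⊗ G = scale f G ⊕ (0ℤ ∷ F ⊗ G)

  coeff : List ℤ → ℕ → ℤ
  coeff []      _       = 0ℤ
  coeff (f ∷ F) zero    = f
  coeff (f ∷ F) (suc i) = coeff F i

  evalL : List ℤ → ℤ → ℤ
  evalL []      x = 0ℤ
  evalL (f ∷ F) x = f ℤ.+ x ℤ.* evalL F x

  coeff-⊕ : ∀ F G i → coeff (F ⊕ G) i ≡ coeff F i ℤ.+ coeff G i
  coeff-⊕ []      G       i       = sym (ℤ.+-identityˡ _)
  coeff-⊕ (f ∷ F) []      i       = sym (ℤ.+-identityʳ _)
  coeff-⊕ (f ∷ F) (g ∷ G) zero    = refl
  coeff-⊕ (f ∷ F) (g ∷ G) (suc i) = coeff-⊕ F G i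

  coeff-scale : ∀ c F i → coeff (scale c F) i ≡ c ℤ.* coeff F i
  coeff-scale c []      i       = sym (ℤ.*-zeroʳ c)
  coeff-scale c (f ∷ F) zero    = refl
  coeff-scale c (f ∷ F) (suc i) = coeff-scale c F i

  evalL-⊕ : ∀ F G x → evalL (F ⊕ G) x ≡ evalL F x ℤ.+ evalL G x
  evalL-⊕ []      G       x = sym (ℤ.+-identityˡ _)
  evalL-⊕ (f ∷ F) []      x = sym (ℤ.+-identityʳ _)
  evalL-⊕ (f ∷ F) (g ∷ G) x = trans (cong (λ v → f ℤ.+ g ℤ.+ x ℤ.* v) (evalL-⊕ F G x))
    (solve 5 (λ f g x a b → f :+ g :+ x :* (a :+ b) := (f :+ x :* a) :+ (g :+ x :* b)) refl f g x (evalL F x) (evalL G x))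
    where open ℤS

  evalL-scale : ∀ c F x → evalL (scale c F) x ≡ c ℤ.* evalL F x
  evalL-scale c []      x = sym (ℤ.*-zeroʳ c)
  evalL-scale c (f ∷ F) x = trans (cong (λ v → c ℤ.* f ℤ.+ x ℤ.* v) (evalL-scale c F x))
    (solve 4 (λ c f x a → c :* f :+ x :* (c :* a) := c :* (f :+ x :* a)) refl c f x (evalL F x))
    where open ℤS

  evalL-⊗ : ∀ F G x → evalL (F ⊗ G) x ≡ evalL F x ℤ.* evalL G x
  evalL-⊗ []      G x = refl
  evalL-⊗ (f ∷ F) G x = trans (evalL-⊕ (scale f G) (0ℤ ∷ F ⊗ G) x)
    (trans (cong₂ (λ u v → u ℤ.+ (0ℤ ℤ.+ x ℤ.* v)) (evalL-scale f G x) (evalL-⊗ F G x))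
      (solve 4 (λ f g x a → f :* g :+ (:0 :+ x :* (a :* g)) := (f :+ x :* a) :* g) refl f (evalL G x) x (evalL F x)))
    where open ℤS

  -- The product is defined by recursion on its left factor; this is the recursion on the right one,
  -- which Gauss's lemma needs when the lowest coefficient on the left is a unit modulo p.
  coeff-⊗-∷ʳ : ∀ F g G i → coeff (F ⊗ (g ∷ G)) i ≡ coeff (scale g F ⊕ (0ℤ ∷ F ⊗ G)) i
  coeff-⊗-∷ʳ [] g G zero = refl
  coeff-⊗-∷ʳ [] g G (suc i) = refl
  coeff-⊗-∷ʳ (f ∷ F) g G zero = cong (ℤ._+ 0ℤ) (ℤ.*-comm f g)
  coeff-⊗-∷ʳ (f ∷ F) g G (suc i) = begin
    coeff (scale f G ⊕ F ⊗ (g ∷ G)) i                          ≡⟨ coeff-⊕ (scale f G) _ i ⟩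
    a ℤ.+ coeff (F ⊗ (g ∷ G)) i                                ≡⟨ cong (λ v → a ℤ.+ v) (coeff-⊗-∷ʳ F g G i) ⟩
    a ℤ.+ coeff (scale g F ⊕ (0ℤ ∷ F ⊗ G)) i                   ≡⟨ cong (λ v → a ℤ.+ v) (coeff-⊕ (scale g F) _ i) ⟩
    a ℤ.+ (b ℤ.+ c)                                            ≡⟨ solve 3 (λ a b c → a :+ (b :+ c) := b :+ (a :+ c)) refl a b c ⟩
    b ℤ.+ (a ℤ.+ c)                                            ≡⟨ cong (λ v → b ℤ.+ v) (coeff-⊕ (scale f G) _ i) ⟨
    b ℤ.+ coeff ((f ∷ F) ⊗ G) i                                ≡⟨ coeff-⊕ (scale g F) _ i ⟨
    coeff (scale g F ⊕ (f ∷ F) ⊗ G) i                          ∎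
    where
    open ≡-Reasoning
    open ℤS
    a = coeff (scale f G) i
    b = coeff (scale g F) i
    c = coeff (0ℤ ∷ F ⊗ G) i

  Divides : ℤ → List ℤ → Set
  Divides p F = ∀ i → p ∣ coeff F i

  euclid : ∀ {p} → Prime p → ∀ m n → pos p ∣ m ℤ.* n → pos p ∣ m ⊎ pos p ∣ n
  euclid {p} pr m n d with euclidsLemma ℤ.∣ m ∣ ℤ.∣ n ∣ pr (subst (p ℕ∣.∣_) (ℤ.abs-* m n) (∣⇒∣ᵤ d))
  ... | inj₁ e = inj₁ (∣ᵤ⇒∣ e)
  ... | inj₂ e = inj₂ (∣ᵤ⇒∣ e)

  prime-divides-product : ∀ {p} → Prime p → ∀ F G → Divides (pos p) (F ⊗ G) → Divides (pos p) F ⊎ Divides (pos p) G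
  prime-divides-product {p} pr [] G h = inj₁ (λ _ → divides 0ℤ refl)
  prime-divides-product {p} pr (f ∷ F) G h with pos p ∣? f
  ... | yes p∣f with prime-divides-product pr F G
        (λ i → ∣m+n∣m⇒∣n (subst (pos p ∣_) (coeff-⊕ (scale f G) _ (suc i)) (h (suc i)))
                          (subst (pos p ∣_) (sym (coeff-scale f G (suc i))) (∣m⇒∣m*n _ p∣f)))
  ...   | inj₁ k = inj₁ λ { zero → p∣f ; (suc i) → k i }
  ...   | inj₂ k = inj₂ k
  prime-divides-product {p} pr (f ∷ F) G h | no p∤f = inj₂ (go G h)
    where
    go : ∀ G → Divides (pos p) ((f ∷ F) ⊗ G) → Divides (pos p) G
    go [] h i = divides 0ℤ refl
    go (g ∷ G) h = λ { zero → p∣g ; (suc i) → go G shifted i }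
      where
      p∣g : pos p ∣ g
      p∣g with euclid pr f g (subst (pos p ∣_) (ℤ.+-identityʳ (f ℤ.* g)) (h zero))
      ... | inj₁ p∣f = contradiction p∣f p∤f
      ... | inj₂ p∣g = p∣g
      shifted : Divides (pos p) ((f ∷ F) ⊗ G)
      shifted i = ∣m+n∣m⇒∣n
        (subst (pos p ∣_) (trans (coeff-⊗-∷ʳ (f ∷ F) g G (suc i)) (coeff-⊕ (scale g (f ∷ F)) (0ℤ ∷ (f ∷ F) ⊗ G) (suc i))) (h (suc i)))
        (subst (pos p ∣_) (sym (coeff-scale g (f ∷ F) (suc i))) (∣m⇒∣m*n _ p∣g))

  quotientL : ∀ p F → Divides p F → List ℤ
  quotientL p []      h = []
  quotientL p (f ∷ F) h = quotient (h zero) ∷ quotientL p F (λ i → h (suc i))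

  scale-quotientL : ∀ p F h → scale p (quotientL p F h) ≡ F
  scale-quotientL p []      h = refl
  scale-quotientL p (f ∷ F) h =
    cong₂ _∷_ (trans (ℤ.*-comm p _) (sym (_∣_.equality (h zero)))) (scale-quotientL p F (λ i → h (suc i)))

  multiple⇒zero : ∀ c v → c ℤ.+ pos (suc ℤ.∣ c ∣) ℤ.* v ≡ 0ℤ → c ≡ 0ℤ
  multiple⇒zero c v e with ℤ.∣ c ∣ in eq
  ... | zero  = ℤ.∣i∣≡0⇒i≡0 eq
  ... | suc k = contradiction (ℕ∣.∣⇒≤ (subst (suc (suc k) ℕ∣.∣_) eq (∣⇒∣ᵤ {pos (suc (suc k))} {c}
            (divides (ℤ.- v) (trans (solve 2 (λ c w → c := (c :+ w) :- w) refl c (pos (suc (suc k)) ℤ.* v))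
              (trans (cong (ℤ._- (pos (suc (suc k)) ℤ.* v)) e)
                (solve 2 (λ n v → :0 :- n :* v := (:- v) :* n) refl (pos (suc (suc k))) v))))))) (ℕ.<⇒≱ (ℕ.n<1+n (suc k)))
    where open ℤS

  -- Passes from values to coefficients: at m = ∣c∣ + 1 a vanishing value makes the constant term c
  -- a multiple of m, hence zero, and then X can be cancelled. Identities are given as values, while
  -- divisibility concerns coefficients.
  zero-polynomial : ∀ F → (∀ m → evalL F (pos (suc m)) ≡ 0ℤ) → ∀ i → coeff F i ≡ 0ℤ
  zero-polynomial [] h i = refl
  zero-polynomial (f ∷ F) h = λ { zero → f≡0 ; (suc i) → zero-polynomial F tail i }
    where
    f≡0 : f ≡ 0ℤ
    f≡0 = multiple⇒zero f (evalL F (pos (suc ℤ.∣ f ∣))) (h ℤ.∣ f ∣)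
    tail : ∀ m → evalL F (pos (suc m)) ≡ 0ℤ
    tail m with ℤ.i*j≡0⇒i≡0∨j≡0 (pos (suc m)) (trans (sym (ℤ.+-identityˡ _)) (trans (cong (λ c → c ℤ.+ pos (suc m) ℤ.* evalL F (pos (suc m))) (sym f≡0)) (h m)))
    ... | inj₂ e = e

  -- When F G = n R, the factor n is split as k l, with k taken out of F and l out of G; nothing is
  -- claimed about the contents that remain.
  record Primitive (F G R : List ℤ) (n : ℤ) : Set where
    field
      F′ G′ : List ℤ
      k l   : ℤ
      F≡    : scale k F′ ≡ F
      G≡    : scale l G′ ≡ G
      kl≡n  : k ℤ.* l ≡ n

  private
    scale-scale : ∀ c d F → scale c (scale d F) ≡ scale (c ℤ.* d) F
    scale-scale c d []      = refl
    scale-scale c d (f ∷ F) = cong₂ _∷_ (sym (ℤ.*-assoc c d f)) (scale-scale c d F)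

    scale-1 : ∀ F → scale 1ℤ F ≡ F
    scale-1 []      = refl
    scale-1 (f ∷ F) = cong₂ _∷_ (ℤ.*-identityˡ f) (scale-1 F)

  -- The primes of n are removed one at a time; each divides F G = n R coefficientwise, hence
  -- divides one of the factors.
  factor-content : ∀ ps → All Prime ps → ∀ F G R → (∀ m → evalL F m ℤ.* evalL G m ≡ pos (product ps) ℤ.* evalL R m) →
    Primitive F G R (pos (product ps))
  factor-content [] [] F G R h = record
    { F′ = F ; G′ = G ; k = 1ℤ ; l = 1ℤ ; F≡ = scale-1 F ; G≡ = scale-1 G ; kl≡n = refl }
  factor-content (p ∷ ps) (pr ∷ prs) F G R h = case (prime-divides-product pr F G p∣FG)
    where
    open ℤS
    instance
      p≢0 : ℤ.NonZero (pos p)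
      p≢0 = prime⇒nonZero pr
    n = pos (product ps)
    pn≡ : pos (product (p ∷ ps)) ≡ pos p ℤ.* n
    pn≡ = ℤ.pos-* p (product ps)
    p∣FG : Divides (pos p) (F ⊗ G)
    p∣FG i = divides (n ℤ.* coeff R i) (trans
      (trans (trans (solve 2 (λ a b → a := (a :+ b) :- b) refl (coeff (F ⊗ G) i) (coeff (scale c R) i))
                    (cong (ℤ._- coeff (scale c R) i) (trans (sym (coeff-⊕ (F ⊗ G) (scale c R) i)) vanish)))
             (trans (cong (λ v → 0ℤ ℤ.- v) (trans (coeff-scale c R i) (cong (λ v → ℤ.- v ℤ.* coeff R i) pn≡)))
                    (solve 3 (λ p n r → :0 :- :- (p :* n) :* r := (n :* r) :* p) refl (pos p) n (coeff R i)))) refl)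
      where
      c = ℤ.- pos (product (p ∷ ps))
      vanish : coeff (F ⊗ G ⊕ scale c R) i ≡ 0ℤ
      vanish = zero-polynomial (F ⊗ G ⊕ scale c R) (λ m → let x = pos (suc m) in
        trans (evalL-⊕ (F ⊗ G) (scale c R) x)
          (trans (cong₂ ℤ._+_ (trans (evalL-⊗ F G x) (h x)) (evalL-scale c R x))
            (solve 2 (λ n r → n :* r :+ (:- n) :* r := :0) refl (pos (product (p ∷ ps))) (evalL R x)))) i
    case : Divides (pos p) F ⊎ Divides (pos p) G → Primitive F G R (pos (product (p ∷ ps)))
    case (inj₁ d) = record
      { F′ = P.F′ ; G′ = P.G′ ; k = pos p ℤ.* P.k ; l = P.l
      ; F≡ = trans (sym (scale-scale (pos p) P.k P.F′)) (trans (cong (scale (pos p)) P.F≡) (scale-quotientL (pos p) F d))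
      ; G≡ = P.G≡
      ; kl≡n = trans (ℤ.*-assoc (pos p) P.k P.l) (trans (cong (pos p ℤ.*_) P.kl≡n) (sym pn≡)) }
      where
      F₁ = quotientL (pos p) F d
      module P = Primitive (factor-content ps prs F₁ G R (λ m → ℤ.*-cancelˡ-≡ (pos p) _ _
        (trans (sym (ℤ.*-assoc (pos p) (evalL F₁ m) (evalL G m)))
          (trans (cong (ℤ._* evalL G m) (trans (sym (evalL-scale (pos p) F₁ m)) (cong (λ L → evalL L m) (scale-quotientL (pos p) F d))))
            (trans (h m) (trans (cong (ℤ._* evalL R m) pn≡) (ℤ.*-assoc (pos p) n (evalL R m))))))))
    case (inj₂ d) = record
      { F′ = P.F′ ; G′ = P.G′ ; k = P.k ; l = pos p ℤ.* P.l
      ; F≡ = P.F≡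
      ; G≡ = trans (sym (scale-scale (pos p) P.l P.G′)) (trans (cong (scale (pos p)) P.G≡) (scale-quotientL (pos p) G d))
      ; kl≡n = trans (solve 3 (λ p k l → k :* (p :* l) := p :* (k :* l)) refl (pos p) P.k P.l) (trans (cong (pos p ℤ.*_) P.kl≡n) (sym pn≡)) }
      where
      G₁ = quotientL (pos p) G d
      module P = Primitive (factor-content ps prs F G₁ R (λ m → ℤ.*-cancelˡ-≡ (pos p) _ _
        (trans (solve 3 (λ p f g → p :* (f :* g) := f :* (p :* g)) refl (pos p) (evalL F m) (evalL G₁ m))
          (trans (cong (evalL F m ℤ.*_) (trans (sym (evalL-scale (pos p) G₁ m)) (cong (λ L → evalL L m) (scale-quotientL (pos p) G d))))
            (trans (h m) (trans (cong (ℤ._* evalL R m) pn≡) (ℤ.*-assoc (pos p) n (evalL R m))))))))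

  module ℤE = Evaluation (idHom ℤ-ring)
  module ℤℚE = Evaluation ℤ→ℚ
  module ℚE = Evaluation (idHom ℚ-ring)

  denominator-* : ∀ q → fromℤ (↧ q) ℚ.* q ≡ fromℤ (↥ q)
  denominator-* q = ℚ.toℚᵘ-injective (ℚᵘ.≃-trans (ℚ.toℚᵘ-homo-* (fromℤ (↧ q)) q)
    (ℚᵘ.≃-trans (ℚᵘ.*-cong (ℚ.toℚᵘ-fromℚᵘ (ℚᵘ.mkℚᵘ (↧ q) 0)) (ℚᵘ.≃-refl {ℚ.toℚᵘ q}))
      (ℚᵘ.≃-trans (cancel q) (ℚᵘ.≃-sym (ℚ.toℚᵘ-fromℚᵘ (ℚᵘ.mkℚᵘ (↥ q) 0))))))
    where
    cancel : ∀ q → ℚᵘ.mkℚᵘ (↧ q) 0 ℚᵘ.* ℚ.toℚᵘ q ℚᵘ.≃ ℚᵘ.mkℚᵘ (↥ q) 0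
    cancel (ℚ.mkℚ n d _) = ℚᵘ.*≡* (trans (ℤ.*-identityʳ (pos (suc d) ℤ.* n))
      (trans (ℤ.*-comm (pos (suc d)) n) (cong (λ e → n ℤ.* pos (suc e)) (sym (ℕ.+-identityʳ d)))))

  -- As `p` is monic, the leading coefficient of the cleared polynomial is the denominator itself;
  -- this is how nonvanishing of the multipliers in `gauss` is seen.
  record Cleared {d} (p : Vec ℚ d) : Set where
    field
      denominator : ℕ
      numerator   : List ℤ
      nonZero     : ℕ.NonZero denominator
      leading     : coeff numerator d ≡ pos denominator
      evaluation  : ∀ m → fromℤ (pos denominator) ℚ.* ℚE.evalM p (fromℤ m) ≡ fromℤ (evalL numerator m)

  clear-denominators : ∀ {d} (p : Vec ℚ d) → Cleared p
  clear-denominators [] = record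
    { denominator = 1 ; numerator = 1ℤ ∷ [] ; nonZero = _ ; leading = refl
    ; evaluation = λ m → cong fromℤ (sym (trans (cong (λ v → 1ℤ ℤ.+ v) (ℤ.*-zeroʳ m)) (ℤ.+-identityʳ 1ℤ))) }
  clear-denominators {suc d} (a ∷ p) = record
    { denominator = ↧ₙ a ℕ.* denominator
    ; numerator = ↥ a ℤ.* pos denominator ∷ scale (↧ a) numerator
    ; nonZero = ℕ.m*n≢0 (↧ₙ a) denominator {{_}} {{nonZero}}
    ; leading = trans (coeff-scale (↧ a) numerator d) (trans (cong (↧ a ℤ.*_) leading) (sym (ℤ.pos-* (↧ₙ a) denominator)))
    ; evaluation = λ m → let v = ℚE.evalM p (fromℤ m) in begin
        fromℤ (pos (↧ₙ a ℕ.* denominator)) ℚ.* (a ℚ.+ fromℤ m ℚ.* v)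
          ≡⟨ cong (ℚ._* (a ℚ.+ fromℤ m ℚ.* v)) (trans (cong fromℤ (ℤ.pos-* (↧ₙ a) denominator)) (*-homo (↧ a) (pos denominator))) ⟩
        fromℤ (↧ a) ℚ.* fromℤ (pos denominator) ℚ.* (a ℚ.+ fromℤ m ℚ.* v)
          ≡⟨ solve 5 (λ e c a m v → e :* c :* (a :+ m :* v) := (e :* a) :* c :+ m :* (e :* (c :* v))) refl
               (fromℤ (↧ a)) (fromℤ (pos denominator)) a (fromℤ m) v ⟩
        (fromℤ (↧ a) ℚ.* a) ℚ.* fromℤ (pos denominator) ℚ.+ fromℤ m ℚ.* (fromℤ (↧ a) ℚ.* (fromℤ (pos denominator) ℚ.* v))
          ≡⟨ cong₂ (λ x y → x ℚ.* fromℤ (pos denominator) ℚ.+ fromℤ m ℚ.* (fromℤ (↧ a) ℚ.* y)) (denominator-* a) (evaluation m) ⟩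
        fromℤ (↥ a) ℚ.* fromℤ (pos denominator) ℚ.+ fromℤ m ℚ.* (fromℤ (↧ a) ℚ.* fromℤ (evalL numerator m))
          ≡⟨ cong₂ (λ x y → x ℚ.+ fromℤ m ℚ.* y) (*-homo (↥ a) (pos denominator))
               (trans (cong fromℤ (evalL-scale (↧ a) numerator m)) (*-homo (↧ a) (evalL numerator m))) ⟨
        fromℤ (↥ a ℤ.* pos denominator) ℚ.+ fromℤ m ℚ.* fromℤ (evalL (scale (↧ a) numerator) m)
          ≡⟨ trans (+-homo (↥ a ℤ.* pos denominator) (m ℤ.* evalL (scale (↧ a) numerator) m)) (cong (fromℤ (↥ a ℤ.* pos denominator) ℚ.+_) (*-homo m (evalL (scale (↧ a) numerator) m))) ⟨
        fromℤ (↥ a ℤ.* pos denominator ℤ.+ m ℤ.* evalL (scale (↧ a) numerator) m) ∎ }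
    where
    open Cleared (clear-denominators p)
    open Hom ℤ→ℚ
    open ℚS
    open ≡-Reasoning

  full : ∀ {d} → Vec ℤ d → List ℤ
  full []      = 1ℤ ∷ []
  full (c ∷ p) = c ∷ full p

  evalL-full : ∀ {d} (p : Vec ℤ d) x → evalL (full p) x ≡ ℤE.evalM p x
  evalL-full []      x = trans (cong (λ v → 1ℤ ℤ.+ v) (ℤ.*-zeroʳ x)) (ℤ.+-identityʳ 1ℤ)
  evalL-full (c ∷ p) x = cong (λ v → c ℤ.+ x ℤ.* v) (evalL-full p x)

  record IntegralMultiples {d e} (p : Vec ℚ d) (q : Vec ℚ e) (a b : ℤ) : Set where
    field
      s s′ u u′ : ℤ
      s≢0  : s ≢ 0ℤ
      s′≢0 : s′ ≢ 0ℤ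
      sp≡u : fromℤ s ℚ.* ℚE.evalM p (fromℤ a) ≡ fromℤ u
      sq≡u : fromℤ s′ ℚ.* ℚE.evalM q (fromℤ a) ≡ fromℤ u′
      uu′≡ : u ℤ.* u′ ≡ b

  -- After clearing denominators the product is a multiple of the integral polynomial, and
  -- `factor-content` distributes the multiple. What remains are integer multiples s p and s′ q
  -- whose product is r, so their values at `a` are integers with product r(a).
  gauss : ∀ {d e t} (p : Vec ℚ d) (q : Vec ℚ e) (r : Vec ℤ t) →
    (∀ m → ℚE.evalM p (fromℤ m) ℚ.* ℚE.evalM q (fromℤ m) ≡ fromℤ (ℤE.evalM r m)) →
    ∀ a → IntegralMultiples p q a (ℤE.evalM r a)
  gauss {d} {e} p q r h a = record
    { s = coeff F′ d ; s′ = coeff G′ e ; u = evalL F′ a ; u′ = evalL G′ a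
    ; s≢0 = λ z → c≢0 (trans (sym (top k F≡ P.leading)) (trans (cong (k ℤ.*_) z) (ℤ.*-zeroʳ k)))
    ; s′≢0 = λ z → c′≢0 (trans (sym (top l G≡ Q.leading)) (trans (cong (l ℤ.*_) z) (ℤ.*-zeroʳ l)))
    ; sp≡u = value k k≢0 F≡ P.leading (P.evaluation a)
    ; sq≡u = value l l≢0 G≡ Q.leading (Q.evaluation a)
    ; uu′≡ = ℤ.*-cancelˡ-≡ n _ _ {{ℤ.≢-nonZero n≢0}} (begin
        n ℤ.* (evalL F′ a ℤ.* evalL G′ a)                    ≡⟨ cong (ℤ._* (evalL F′ a ℤ.* evalL G′ a)) kl≡n ⟨
        k ℤ.* l ℤ.* (evalL F′ a ℤ.* evalL G′ a)              ≡⟨ solve 4 (λ k l f g → k :* l :* (f :* g) := (k :* f) :* (l :* g)) refl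
                                                                  k l (evalL F′ a) (evalL G′ a) ⟩
        (k ℤ.* evalL F′ a) ℤ.* (l ℤ.* evalL G′ a)            ≡⟨ cong₂ ℤ._*_ (scaled k F≡) (scaled l G≡) ⟩
        evalL P.numerator a ℤ.* evalL Q.numerator a          ≡⟨ product-eq a ⟩
        n ℤ.* evalL (full r) a                               ≡⟨ cong (n ℤ.*_) (evalL-full r a) ⟩
        n ℤ.* ℤE.evalM r a                                   ∎) }
    where
    open ℤS
    open ≡-Reasoning
    open Hom ℤ→ℚ using (*-homo)
    module P = Cleared (clear-denominators p)
    module Q = Cleared (clear-denominators q)
    instance
      product≢0 : ℕ.NonZero (P.denominator ℕ.* Q.denominator)
      product≢0 = ℕ.m*n≢0 P.denominator Q.denominator {{P.nonZero}} {{Q.nonZero}}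
    module PF = PrimeFactorisation (factorise (P.denominator ℕ.* Q.denominator))
    n = pos (product PF.factors)
    n≡ : n ≡ pos P.denominator ℤ.* pos Q.denominator
    n≡ = trans (cong pos (sym PF.isFactorisation)) (ℤ.pos-* P.denominator Q.denominator)
    c≢0 : pos P.denominator ≢ 0ℤ
    c≢0 e = ℕ.≢-nonZero⁻¹ P.denominator {{P.nonZero}} (ℤ.+-injective e)
    c′≢0 : pos Q.denominator ≢ 0ℤ
    c′≢0 e = ℕ.≢-nonZero⁻¹ Q.denominator {{Q.nonZero}} (ℤ.+-injective e)
    n≢0 : n ≢ 0ℤ
    n≢0 e with ℤ.i*j≡0⇒i≡0∨j≡0 (pos P.denominator) (trans (sym n≡) e)
    ... | inj₁ z = c≢0 z
    ... | inj₂ z = c′≢0 z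
    product-eq : ∀ m → evalL P.numerator m ℤ.* evalL Q.numerator m ≡ n ℤ.* evalL (full r) m
    product-eq m = fromℤ-injective (begin
      fromℤ (evalL P.numerator m ℤ.* evalL Q.numerator m)
        ≡⟨ *-homo (evalL P.numerator m) (evalL Q.numerator m) ⟩
      fromℤ (evalL P.numerator m) ℚ.* fromℤ (evalL Q.numerator m)
        ≡⟨ cong₂ ℚ._*_ (P.evaluation m) (Q.evaluation m) ⟨
      (fromℤ (pos P.denominator) ℚ.* x) ℚ.* (fromℤ (pos Q.denominator) ℚ.* y)
        ≡⟨ ℚS.solve 4 (λ a x b y → (a ℚS.:* x) ℚS.:* (b ℚS.:* y) ℚS.:= (a ℚS.:* b) ℚS.:* (x ℚS.:* y)) refl
             (fromℤ (pos P.denominator)) x (fromℤ (pos Q.denominator)) y ⟩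
      (fromℤ (pos P.denominator) ℚ.* fromℤ (pos Q.denominator)) ℚ.* (x ℚ.* y)
        ≡⟨ cong₂ ℚ._*_ (trans (sym (*-homo (pos P.denominator) (pos Q.denominator))) (cong fromℤ (sym n≡)))
                       (trans (h m) (cong fromℤ (sym (evalL-full r m)))) ⟩
      fromℤ n ℚ.* fromℤ (evalL (full r) m)
        ≡⟨ *-homo n (evalL (full r) m) ⟨
      fromℤ (n ℤ.* evalL (full r) m) ∎)
      where
      x = ℚE.evalM p (fromℤ m)
      y = ℚE.evalM q (fromℤ m)
    open Primitive (factor-content PF.factors PF.factorsPrime P.numerator Q.numerator (full r) product-eq)
    k≢0 : k ≢ 0ℤ
    k≢0 e = n≢0 (trans (sym kl≡n) (cong (ℤ._* l) e))
    l≢0 : l ≢ 0ℤ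
    l≢0 e = n≢0 (trans (sym kl≡n) (trans (cong (k ℤ.*_) e) (ℤ.*-zeroʳ k)))
    top : ∀ k {F′ F d c} → scale k F′ ≡ F → coeff F d ≡ c → k ℤ.* coeff F′ d ≡ c
    top k {F′} {d = d} e f = trans (sym (coeff-scale k F′ d)) (trans (cong (λ L → coeff L d) e) f)
    scaled : ∀ k {F′ F} → scale k F′ ≡ F → k ℤ.* evalL F′ a ≡ evalL F a
    scaled k {F′} e = trans (sym (evalL-scale k F′ a)) (cong (λ L → evalL L a) e)
    value : ∀ k {F′ F d c x} → k ≢ 0ℤ → scale k F′ ≡ F → coeff F d ≡ c → fromℤ c ℚ.* x ≡ fromℤ (evalL F a) →
      fromℤ (coeff F′ d) ℚ.* x ≡ fromℤ (evalL F′ a)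
    value k {F′} {F} {d} {c} {x} k≢0 e f g = ℚ-cancel (fromℤ k) (λ z → k≢0 (fromℤ-injective z)) (begin
      fromℤ k ℚ.* (fromℤ (coeff F′ d) ℚ.* x)  ≡⟨ ℚ.*-assoc (fromℤ k) (fromℤ (coeff F′ d)) x ⟨
      fromℤ k ℚ.* fromℤ (coeff F′ d) ℚ.* x    ≡⟨ cong (ℚ._* x) (trans (sym (*-homo k (coeff F′ d))) (cong fromℤ (top k e f))) ⟩
      fromℤ c ℚ.* x                            ≡⟨ g ⟩
      fromℤ (evalL F a)                        ≡⟨ trans (cong fromℤ (sym (scaled k e))) (*-homo k (evalL F′ a)) ⟩
      fromℤ k ℚ.* fromℤ (evalL F′ a)           ∎)
      where
      ℚ-cancel : ∀ k {x y} → k ≢ ℚ.0ℚ → k ℚ.* x ≡ k ℚ.* y → x ≡ y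
      ℚ-cancel k {x} {y} k≢0 e = trans (sym (undo x)) (trans (cong (λ v → ℚ.1/ k ℚ.* v) e) (undo y))
        where
        instance
          k-nonZero : ℚ.NonZero k
          k-nonZero = ℚ.≢-nonZero k≢0
        undo : ∀ x → ℚ.1/ k ℚ.* (k ℚ.* x) ≡ x
        undo x = trans (sym (ℚ.*-assoc (ℚ.1/ k) k x)) (trans (cong (ℚ._* x) (ℚ.*-inverseˡ k)) (ℚ.*-identityˡ x))

-- Irreducibility of R and the degree of α.

module Irreducible where

  open Kit
  open Poly
  open Roots
  open Reals
  open Complex
  open Gauss
  open import Algebra.Bundles using (CommutativeRing)
  open import Data.Empty using (⊥; ⊥-elim)
  open import Data.Integer as ℤ using (ℤ; 0ℤ; -1ℤ) renaming (+_ to pos)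
  import Data.Integer.Properties as ℤ
  open import Data.List using (List; []; _∷_; length)
  open import Data.List.Relation.Unary.All as All using (All; []; _∷_)
  import Data.List.Relation.Unary.All.Properties as All
  open import Data.List.Relation.Unary.AllPairs as AllPairs using (AllPairs; []; _∷_)
  import Data.List.Relation.Unary.AllPairs.Properties as AllPairs
  open import Data.Nat as ℕ using (ℕ; zero; suc; z≤n; s≤s)
  import Data.Nat.Properties as ℕ
  open import Data.Nat.Induction using (<-wellFounded)
  open import Induction.WellFounded using (Acc; acc)
  open import Data.Product using (Σ-syntax; ∃-syntax; _×_; _,_; proj₁; proj₂)
  open import Data.Rational as ℚ using (ℚ; 0ℚ; 1ℚ)
  import Data.Rational.Properties as ℚ
  open import Data.Sum using (_⊎_; inj₁; inj₂)
  open import Data.Vec as Vec using (Vec; []; _∷_)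
  open import Relation.Binary.PropositionalEquality as ≡ using (_≡_; _≢_)
  open import Relation.Nullary using (yes; no)

  record IsMono {K A : Ring₀} (h : Hom K A) : Set where
    private
      module K = CommutativeRing K
      module A = CommutativeRing A
    field
      injective : ∀ {x y} → Hom.⟦_⟧ h x A.≈ Hom.⟦_⟧ h y → x K.≈ y

  private
    -- The integer u divides -1, so 1 = ∣u∣ = ∣s∣∣q∣, which is at least 2 when q ≥ 2.
    unit-bound : ∀ {s u u′ q} → s ≢ 0ℤ → fromℤ s ℚ.* q ≡ fromℤ u → u ℤ.* u′ ≡ -1ℤ ⊎ u′ ℤ.* u ≡ -1ℤ → fromℤ (pos 2) ℚ.≤ q → ⊥
    unit-bound {s} {u} {u′} {q} s≢0 e uu′ 2≤q = ℚ.<-irrefl ≡.refl (ℚ.<-≤-trans (fromℤ-mono-< {pos 1} {pos 2} (ℤ.+<+ (s≤s (s≤s z≤n)))) 2≤1)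
      where
      ∣u∣≡1 : u ℤ.* u′ ≡ -1ℤ ⊎ u′ ℤ.* u ≡ -1ℤ → ℤ.∣ u ∣ ≡ 1
      ∣u∣≡1 (inj₁ f) = ℕ.m*n≡1⇒m≡1 ℤ.∣ u ∣ ℤ.∣ u′ ∣ (≡.trans (≡.sym (ℤ.abs-* u u′)) (≡.cong ℤ.∣_∣ f))
      ∣u∣≡1 (inj₂ f) = ℕ.m*n≡1⇒n≡1 ℤ.∣ u′ ∣ ℤ.∣ u ∣ (≡.trans (≡.sym (ℤ.abs-* u′ u)) (≡.cong ℤ.∣_∣ f))
      ∣fromℤ∣ : ∀ i → ℚ.∣ fromℤ i ∣ ≡ fromℤ (pos ℤ.∣ i ∣)
      ∣fromℤ∣ (ℤ.+ n) = ℚ.0≤p⇒∣p∣≡p (fromℤ-mono-≤ {pos 0} {pos n} (ℤ.+≤+ z≤n))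
      ∣fromℤ∣ ℤ.-[1+ n ] = ≡.trans (≡.cong ℚ.∣_∣ (Hom.-‿homo ℤ→ℚ (pos (suc n)))) (≡.trans (ℚ.∣-p∣≡∣p∣ (fromℤ (pos (suc n)))) (∣fromℤ∣ (pos (suc n))))
      1≤∣s∣ : fromℤ (pos 1) ℚ.≤ ℚ.∣ fromℤ s ∣
      1≤∣s∣ = ≡.subst (fromℤ (pos 1) ℚ.≤_) (≡.sym (∣fromℤ∣ s)) (fromℤ-mono-≤ (ℤ.+≤+ (ℕ.n≢0⇒n>0 (λ z → s≢0 (ℤ.∣i∣≡0⇒i≡0 z)))))
      2≤1 : fromℤ (pos 2) ℚ.≤ fromℤ (pos 1)
      2≤1 = ≡.subst₂ ℚ._≤_ (ℚ.*-identityˡ (fromℤ (pos 2)))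
        (≡.trans (≡.sym (ℚ.∣p*q∣≡∣p∣*∣q∣ (fromℤ s) q)) (≡.trans (≡.cong ℚ.∣_∣ e) (≡.trans (∣fromℤ∣ u) (≡.cong (λ n → fromℤ (pos n)) (∣u∣≡1 uu′)))))
        (*-mono-≤-nonNeg {fromℤ (pos 1)} {ℚ.∣ fromℤ s ∣} {fromℤ (pos 2)} {ℚ.∣ q ∣}
          (fromℤ-mono-≤ {pos 0} {pos 1} (ℤ.+≤+ z≤n)) (ℚ.0≤∣p∣ q) 1≤∣s∣ (ℚ.≤-trans 2≤q (p≤∣p∣ q)))

  module Normalisation {A : Ring₀} (dom : IsDomain A) (h : Hom ℚ-ring A) (mono : IsMono h) where
    open CommutativeRing A
    open IntegerSolver A
    open Hom h
    open Evaluation h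

    -- Coefficients are rational, so it is decidable whether a remainder vanishes and which of its
    -- coefficients leads; a nonzero one becomes a scalar times a monic polynomial of smaller
    -- degree.
    normalise : ∀ {d} (u : Vec ℚ d) → (∀ z → evalV u z ≈ 0#) ⊎
      (Σ[ e ∈ ℕ ] e ℕ.< d × Σ[ v ∈ Vec ℚ e ] Σ[ c ∈ ℚ ] c ≢ 0ℚ × (∀ z → evalV u z ≈ ⟦ c ⟧ * evalM v z))
    normalise [] = inj₁ (λ z → refl)
    normalise (a ∷ u) with normalise u
    ... | inj₂ (e , e<d , v , c , c≢0 , eq) =
      inj₂ (suc e , s≤s e<d , proj₁ (divide c≢0 a) ∷ v , c , c≢0 , λ z →
        trans (+-cong (trans (⟦⟧-cong (≡.sym (proj₂ (divide c≢0 a)))) (*-homo c _)) (*-congˡ (eq z)))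
              (solve 4 (λ z c b v → c :* b :+ z :* (c :* v) := c :* (b :+ z :* v)) refl z ⟦ c ⟧ _ (evalM v z)))
      where
      divide : ∀ {c} → c ≢ 0ℚ → ∀ a → Σ[ b ∈ ℚ ] c ℚ.* b ≡ a
      divide {c} c≢0 a = ℚ.1/ c ℚ.* a , ≡.trans (≡.sym (ℚ.*-assoc c (ℚ.1/ c) a)) (≡.trans (≡.cong (ℚ._* a) (ℚ.*-inverseʳ c)) (ℚ.*-identityˡ a))
        where
        instance
          c-nonZero : ℚ.NonZero c
          c-nonZero = ℚ.≢-nonZero c≢0
    ... | inj₁ eq with a ℚ.≟ 0ℚ
    ...   | yes ≡.refl = inj₁ (λ z → trans (+-cong 0-homo (trans (*-congˡ (eq z)) (zeroʳ z))) (+-identityˡ 0#))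
    ...   | no a≢0 = inj₂ (0 , s≤s z≤n , [] , a , a≢0 , λ z →
        trans (+-congˡ (trans (*-congˡ (eq z)) (zeroʳ z))) (trans (+-identityʳ _) (sym (*-identityʳ _))))

    normalised-root : ∀ {d} {u : Vec ℚ d} {e} {v : Vec ℚ e} {c} → c ≢ 0ℚ →
      (∀ z → evalV u z ≈ ⟦ c ⟧ * evalM v z) → ∀ {z} → evalV u z ≈ 0# → evalM v z ≈ 0#
    normalised-root {c = c} c≢0 eq {z} e =
      IsDomain.integral dom _ _ (trans (sym (eq z)) e) (λ f → c≢0 (IsMono.injective mono (trans f (sym 0-homo))))

  -- An abstract ring has no order, so the smallness of the other roots and the estimate ∏ (a - r) ≥
  -- 2 that it implies are supplied as data.
  record TraceRoots {A : Ring₀} (h : Hom ℚ-ring A) (dom : IsDomain A) {t} (R : Vec ℤ t) : Set₁ where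
    open CommutativeRing A
    open LinearFactors A dom using (prod)
    open Evaluation (h ∘ₕ ℤ→ℚ) using (evalM)
    field
      centre   : ℤ
      R[a]     : ℤE.evalM R centre ≡ -1ℤ
      ρ        : Carrier
      others   : List Carrier
      count    : t ≡ suc (length others)
      distinct : AllPairs _≉_ (ρ ∷ others)
      roots    : All (λ r → evalM R r ≈ 0#) (ρ ∷ others)
      Small    : Carrier → Set
      small    : All Small others
      large    : ∀ {rs} → All Small rs → 1 ℕ.≤ length rs → ∀ q → Hom.⟦_⟧ h q ≈ prod rs (Hom.⟦_⟧ h (fromℤ centre)) → fromℤ (pos 2) ℚ.≤ q

  module Irreducibility {A : Ring₀} (dom : IsDomain A) (h : Hom ℚ-ring A) (mono : IsMono h)
    {t} {R : Vec ℤ t} (tr : TraceRoots h dom R) where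
    open TraceRoots tr
    open CommutativeRing A
    open IntegerSolver A using (solve; _:=_; _:+_; _:*_; _:-_; :-_; :0; :1)
    open Normalisation dom h mono
    module AF = LinearFactors A dom
    module AD = IsDomain dom
    module QE = Evaluation h
    module ZE = Evaluation (h ∘ₕ ℤ→ℚ)
    open Hom h

    -- At the centre the factor without the root ρ has modulus at least 2, although
    -- the two values are integers with product −1.
    no-factorisation : ∀ {d e} (p : Vec ℚ d) (q : Vec ℚ e) → d ℕ.+ e ≡ t → 1 ℕ.≤ d → 1 ℕ.≤ e →
      (∀ z → ZE.evalM R z ≈ QE.evalM p z * QE.evalM q z) → ⊥
    no-factorisation {d} {e} p q d+e≡t 1≤d 1≤e eq =
      AF.zero-product _ _ (trans (sym (eq ρ)) (All.head roots)) λ where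
        (inj₁ z) → factor p q (≡.trans d+e≡t count) 1≤e eq z M.q-small
        (inj₂ z) → factor q p (≡.trans (ℕ.+-comm e d) (≡.trans d+e≡t count)) 1≤d
                     (λ z → trans (eq z) (*-comm _ _)) z M.p-small
      where
      integers : ∀ m → ℚE.evalM p (fromℤ m) ℚ.* ℚE.evalM q (fromℤ m) ≡ fromℤ (ℤE.evalM R m)
      integers m = IsMono.injective mono (trans (*-homo _ _)
        (trans (*-cong (sym (evalM-hom-id h p (fromℤ m))) (sym (evalM-hom-id h q (fromℤ m))))
          (trans (sym (eq (⟦ fromℤ m ⟧))) (evalM-hom-id (h ∘ₕ ℤ→ℚ) R m))))
      module M where
        open IntegralMultiples (gauss p q R integers centre) public
        uu′≡-1 = ≡.trans uu′≡ R[a]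
        q-small : fromℤ (pos 2) ℚ.≤ ℚE.evalM q (fromℤ centre) → ⊥
        q-small = unit-bound {s′} {u′} {u} s′≢0 sq≡u (inj₂ uu′≡-1)
        p-small : fromℤ (pos 2) ℚ.≤ ℚE.evalM p (fromℤ centre) → ⊥
        p-small = unit-bound {s} {u} {u′} s≢0 sp≡u (inj₁ uu′≡-1)
      -- The factor vanishing at ρ is divided by X - ρ. The remaining roots are exactly `others`, so
      -- whatever share of them `q` receives consists of small roots.
      factor : ∀ {d e} (p : Vec ℚ d) (q : Vec ℚ e) → d ℕ.+ e ≡ suc (length others) → 1 ℕ.≤ e →
        (∀ z → ZE.evalM R z ≈ QE.evalM p z * QE.evalM q z) → QE.evalM p ρ ≈ 0# → (fromℤ (pos 2) ℚ.≤ ℚE.evalM q (fromℤ centre) → ⊥) → ⊥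
      factor {zero} [] q _ _ _ z _ = AD.1≉0 z
      factor {suc d} {e} p q len 1≤e eq z k = AF.split others (AF.quotient ρ P) Q (ℕ.suc-injective len)
          (AllPairs.tail distinct) small
          (AF.remove-root ρ others P Q (AllPairs.head distinct) (trans (evalM-map-id h p _) z)
            (All.map (λ {x} rz → trans (*-cong (evalM-map-id h p x) (evalM-map-id h q x)) (trans (sym (eq x)) rz)) (All.tail roots)))
          λ s → let open AF.Splitting s in k (large all-qs (≡.subst (1 ℕ.≤_) (≡.sym length-qs) 1≤e) (ℚE.evalM q (fromℤ centre))
            (trans (sym (evalM-hom-id h q (fromℤ centre))) (trans (sym (evalM-map-id h q _)) (eval-q _))))
        where
        P = Vec.map ⟦_⟧ p
        Q = Vec.map ⟦_⟧ q

    Rℚ : Vec ℚ t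
    Rℚ = Vec.map fromℤ R

    evalM-Rℚ : ∀ x → QE.evalM Rℚ x ≈ ZE.evalM R x
    evalM-Rℚ = evalM-map h ℤ→ℚ R

    -- Descent on the degree: divide R by `p`. A zero remainder would factor R; a nonzero one, made
    -- monic, vanishes at the same root in smaller degree.
    root-degree : ∀ {d} (p : Vec ℚ d) → d ℕ.< t → ∀ {r} → ZE.evalM R r ≈ 0# → QE.evalM p r ≈ 0# → ⊥
    root-degree {d} p d<t {r} Rr pr = go p (<-wellFounded d) d<t pr
      where
      go : ∀ {d} (p : Vec ℚ d) → Acc ℕ._<_ d → d ℕ.< t → QE.evalM p r ≈ 0# → ⊥
      go {zero} [] _ _ pr = AD.1≉0 pr
      go {suc d} p (acc rec) d<t pr with ℕ.m≤n⇒∃[o]m+o≡n d<t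
      ... | k , 2+d+k≡t = step (QE.divideM (suc k) p (≡.subst (Vec ℚ) t≡ Rℚ))
        where
        t≡ : t ≡ suc k ℕ.+ suc d
        t≡ = ≡.trans (≡.sym 2+d+k≡t) (≡.trans (≡.cong suc (ℕ.+-comm (suc d) k)) ≡.refl)
        step : Σ[ q ∈ Vec ℚ (suc k) ] Σ[ u ∈ Vec ℚ (suc d) ] (∀ x → QE.evalM (≡.subst (Vec ℚ) t≡ Rℚ) x ≈ QE.evalM p x * QE.evalM q x + QE.evalV u x) → ⊥
        step (q , u , eq) = finish (normalise u)
          where
          R≈ : ∀ x → ZE.evalM R x ≈ QE.evalM p x * QE.evalM q x + QE.evalV u x
          R≈ x = trans (sym (evalM-Rℚ x)) (trans (reflexive (subst-eval t≡ Rℚ)) (eq x))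
            where
            subst-eval : ∀ {m n} (e : m ≡ n) (p : Vec ℚ m) → QE.evalM p x ≡ QE.evalM (≡.subst (Vec ℚ) e p) x
            subst-eval ≡.refl p = ≡.refl
          finish : _ ⊎ _ → ⊥
          finish (inj₁ u≈0) = no-factorisation p q (≡.trans (ℕ.+-comm (suc d) (suc k)) (≡.sym t≡)) (s≤s z≤n) (s≤s z≤n)
            (λ x → trans (R≈ x) (trans (+-congˡ (u≈0 x)) (+-identityʳ _)))
          finish (inj₂ (e , e<d , v , c , c≢0 , v≈)) = go v (rec e<d) (ℕ.<-trans e<d d<t)
            (normalised-root {u = u} {v = v} c≢0 v≈ (trans (trans (sym (trans (+-congʳ (trans (*-congʳ pr) (zeroˡ _))) (+-identityˡ _))) (sym (R≈ r))) Rr))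

    -- Galois conjugation without automorphisms: modulo R the polynomial `u` is either zero or of
    -- degree below t, and the latter cannot vanish at a root.
    vanishes-at-all-roots : ∀ {n} (u : Vec ℚ n) {r s} → ZE.evalM R r ≈ 0# → ZE.evalM R s ≈ 0# → QE.evalV u r ≈ 0# → QE.evalV u s ≈ 0#
    vanishes-at-all-roots u {r} {s} Rr Rs ur = go (normalise v)
      where
      v = proj₁ (proj₂ (QE.divideV Rℚ u))
      eq : ∀ {x} → ZE.evalM R x ≈ 0# → QE.evalV u x ≈ QE.evalV v x
      eq {x} Rx = trans (proj₂ (proj₂ (QE.divideV Rℚ u)) x)
        (trans (+-congʳ (trans (*-congʳ (trans (evalM-Rℚ x) Rx)) (zeroˡ _))) (+-identityˡ _))
      go : _ ⊎ _ → QE.evalV u s ≈ 0#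
      go (inj₁ v≈0) = trans (eq Rs) (v≈0 s)
      go (inj₂ (e , e<t , w , c , c≢0 , w≈)) = ⊥-elim (root-degree w e<t Rr (normalised-root {u = v} {v = w} c≢0 w≈ (trans (sym (eq Rr)) ur)))

    open Coefficients ℚ-ring using (mulV; pad; addConst)

    -- The computation of `remainder` with r an indeterminate: A and B become polynomials, so that
    -- conjugation can be applied to them.
    remainderPoly : ∀ {d} → Vec ℚ d → Vec ℚ (suc d) × Vec ℚ (suc d)
    remainderPoly []      = 1ℚ ∷ [] , 0ℚ ∷ []
    remainderPoly (c ∷ q) =
      addConst (Vec.map (ℚ.- 1ℚ ℚ.*_) (proj₂ (remainderPoly q) Vec.∷ʳ 0ℚ)) c ,
      Vec.zipWith ℚ._+_ (proj₁ (remainderPoly q) Vec.∷ʳ 0ℚ) (0ℚ ∷ proj₂ (remainderPoly q))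

    remainderPoly-eval : ∀ {d} (q : Vec ℚ d) x →
      QE.evalV (proj₁ (remainderPoly q)) x ≈ proj₁ (AF.remainder x (Vec.map ⟦_⟧ q)) ×
      QE.evalV (proj₂ (remainderPoly q)) x ≈ proj₂ (AF.remainder x (Vec.map ⟦_⟧ q))
    remainderPoly-eval [] x = trans (+-congʳ 1-homo) (trans (+-congˡ (zeroʳ x)) (+-identityʳ 1#)) ,
                              trans (+-congʳ 0-homo) (trans (+-congˡ (zeroʳ x)) (+-identityʳ 0#))
    remainderPoly-eval (c ∷ q) x =
      trans (QE.evalV-addConst (Vec.map (ℚ.- 1ℚ ℚ.*_) (b Vec.∷ʳ 0ℚ)) c x)
        (trans (+-congʳ (trans (QE.evalV-scale (ℚ.- 1ℚ) (b Vec.∷ʳ 0ℚ) x)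
            (*-cong (trans (-‿homo 1ℚ) (-‿cong 1-homo)) (trans (QE.evalV-snoc0 b x) (proj₂ ih)))))
          (solve 2 (λ c b → (:- :1) :* b :+ c := c :- b) refl ⟦ c ⟧ _)) ,
      trans (QE.evalV-+ (a Vec.∷ʳ 0ℚ) (0ℚ ∷ b) x)
        (+-cong (trans (QE.evalV-snoc0 a x) (proj₁ ih)) (trans (+-congʳ 0-homo) (trans (+-identityˡ _) (*-congˡ (proj₂ ih)))))
      where
      a = proj₁ (remainderPoly q)
      b = proj₂ (remainderPoly q)
      ih = remainderPoly-eval q x

    -- The norm a² + X a b + b² of a + bZ for the quadratic Z² - XZ + 1.
    normPoly : ∀ {n} → Vec ℚ n → Vec ℚ n → Vec ℚ (suc (n ℕ.+ n))
    normPoly a b = Vec.zipWith ℚ._+_ (0ℚ ∷ mulV a b) (Vec.zipWith ℚ._+_ (pad 1 (mulV a a)) (pad 1 (mulV b b)))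

    normPoly-eval : ∀ {n} (a b : Vec ℚ n) x → let u = QE.evalV a x; v = QE.evalV b x in
      QE.evalV (normPoly a b) x ≈ u * u + x * (u * v) + v * v
    normPoly-eval a b x = trans (QE.evalV-+ (0ℚ ∷ mulV a b) (Vec.zipWith ℚ._+_ (pad 1 (mulV a a)) (pad 1 (mulV b b))) x)
      (trans (+-cong (trans (+-congʳ 0-homo) (trans (+-identityˡ _) (*-congˡ (QE.evalV-mul a b x))))
               (trans (QE.evalV-+ (pad 1 (mulV a a)) (pad 1 (mulV b b)) x)
                 (+-cong (trans (QE.evalV-pad 1 (mulV a a) x) (QE.evalV-mul a a x)) (trans (QE.evalV-pad 1 (mulV b b) x) (QE.evalV-mul b b x)))))
        (solve 3 (λ u v x → x :* (u :* v) :+ (u :* u :+ v :* v) := u :* u :+ x :* (u :* v) :+ v :* v) refl _ _ x))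

    -- Modulo Z² − xZ + 1 the polynomial q becomes A(x) + B(x) Z.  The norm
    -- A² + xAB + B² vanishes at ρ, hence at the root r₁ where it is a definite
    -- form; so A and B vanish at all roots r, and every Z² − rZ + 1 divides q.
    minimal-degree : ∀ z → z * z ≈ ρ * z - 1# →
      ∀ r₁ → ZE.evalM R r₁ ≈ 0# → (∀ u v → u * u + r₁ * (u * v) + v * v ≈ 0# → u ≈ 0# × v ≈ 0#) →
      ∀ {e} (q : Vec ℚ e) → QE.evalM q z ≈ 0# → double t ℕ.≤ e
    minimal-degree z z²≈ r₁ Rr₁ definite q qz = ≡.subst (λ k → double k ℕ.≤ _) (≡.sym count)
      (AF.quadratic-factors-degree (ρ ∷ others) (Vec.map ⟦_⟧ q) distinct (All.map both roots))
      where
      open import Relation.Binary.Reasoning.Setoid setoid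
      a = proj₁ (remainderPoly q)
      b = proj₂ (remainderPoly q)
      u = QE.evalV a ρ
      v = QE.evalV b ρ
      u+zv≈0 : u + z * v ≈ 0#
      u+zv≈0 = begin
        u + z * v     ≈⟨ +-cong (proj₁ (remainderPoly-eval q ρ)) (*-congˡ (proj₂ (remainderPoly-eval q ρ))) ⟩
        _             ≈⟨ AF.remainder-eval ρ z (Vec.map ⟦_⟧ q) z²≈ ⟨
        _             ≈⟨ evalM-map-id h q z ⟩
        QE.evalM q z  ≈⟨ qz ⟩
        0#            ∎
      norm≈0 : QE.evalV (normPoly a b) ρ ≈ 0#
      norm≈0 = begin
        QE.evalV (normPoly a b) ρ          ≈⟨ normPoly-eval a b ρ ⟩
        -- Since ρ - z is the inverse of z, the norm is the product of u + zv and u + z⁻¹v.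
        u * u + ρ * (u * v) + v * v        ≈⟨ solve 4 (λ u v r z → u :* u :+ r :* (u :* v) :+ v :* v
                                                := (u :+ z :* v) :* (u :+ (r :- z) :* v) :+ (z :* z :- (r :* z :- :1)) :* (v :* v)) refl u v ρ z ⟩
        (u + z * v) * (u + (ρ - z) * v) + (z * z - (ρ * z - 1#)) * (v * v)
          ≈⟨ +-cong (*-congʳ u+zv≈0) (*-congʳ (+-congʳ z²≈)) ⟩
        0# * (u + (ρ - z) * v) + ((ρ * z - 1#) - (ρ * z - 1#)) * (v * v)
          ≈⟨ solve 3 (λ k m v → :0 :* k :+ (m :- m) :* v := :0) refl (u + (ρ - z) * v) (ρ * z - 1#) (v * v) ⟩
        0# ∎
      at-r₁ : QE.evalV a r₁ ≈ 0# × QE.evalV b r₁ ≈ 0#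
      at-r₁ = definite _ _ (trans (sym (normPoly-eval a b r₁)) (vanishes-at-all-roots (normPoly a b) (All.head roots) Rr₁ norm≈0))
      both : ∀ {r} → ZE.evalM R r ≈ 0# → AF.RemainderZero (Vec.map ⟦_⟧ q) r
      both {r} Rr = trans (sym (proj₁ (remainderPoly-eval q r))) (vanishes-at-all-roots a Rr₁ Rr (proj₁ at-r₁)) ,
                    trans (sym (proj₂ (remainderPoly-eval q r))) (vanishes-at-all-roots b Rr₁ Rr (proj₂ at-r₁))

-- Integrality of the elements of a finitely generated ring.

module Integral where

  open Kit
  open Poly
  open Complex using (ℤ-ring)
  open import Algebra.Bundles using (CommutativeRing)
  open import Data.Integer as ℤ using (ℤ; 0ℤ; 1ℤ; -1ℤ)
  open import Data.List as List using (List; []; _∷_; _++_)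
  import Data.List.Properties as List
  open import Data.List.Membership.Propositional using (_∈_)
  open import Data.List.Relation.Unary.Any using (here; there)
  open import Data.List.Relation.Unary.All as All using (All; []; _∷_)
  import Data.List.Relation.Unary.All.Properties as All
  open import Data.Nat as ℕ using (ℕ; zero; suc)
  open import Data.Product using (Σ-syntax; ∃-syntax; _×_; _,_; proj₁; proj₂)
  open import Data.Vec as Vec using (Vec; []; _∷_)
  open import Relation.Binary.PropositionalEquality as ≡ using (_≡_)

  module Integrality {A : Ring₀} (h : Hom ℤ-ring A) where
    open CommutativeRing A
    open IntegerSolver A
    open Hom h
    open Evaluation h
    open Coefficients ℤ-ring using (mulV)
    open import Algebra.Properties.Semiring.Exp semiring using (^-homo-*)
    open import Relation.Binary.Reasoning.Setoid setoid

    IsIntegral : Carrier → Set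
    IsIntegral w = ∃[ d ] Σ[ p ∈ Vec ℤ d ] evalM p w ≈ 0#

    record DegreeBelow (k : ℕ) (w x : Carrier) : Set where
      constructor below
      field
        coefficients : Vec ℤ k
        value        : evalV coefficients w ≈ x

    below-cong : ∀ {k w x y} → x ≈ y → DegreeBelow k w x → DegreeBelow k w y
    below-cong e (below u f) = below u (trans f e)

    below-+ : ∀ {k w x y} → DegreeBelow k w x → DegreeBelow k w y → DegreeBelow k w (x + y)
    below-+ {w = w} (below u e) (below v f) = below (Vec.zipWith ℤ._+_ u v) (trans (evalV-+ u v w) (+-cong e f))

    below-* : ∀ {k l w x y} → DegreeBelow k w x → DegreeBelow l w y → DegreeBelow (k ℕ.+ l) w (x * y)
    below-* {w = w} (below u e) (below v f) = below (mulV u v) (trans (evalV-mul u v w) (*-cong e f))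

    below-const : ∀ {w} c → DegreeBelow 1 w ⟦ c ⟧
    below-const {w} c = below (c ∷ []) (trans (+-congˡ (zeroʳ w)) (+-identityʳ _))

    below-neg : ∀ {k w x} → DegreeBelow k w x → DegreeBelow k w (- x)
    below-neg {k} {w} {x} (below u e) = below (Vec.map (-1ℤ ℤ.*_) u) (trans (evalV-scale -1ℤ u w)
      (trans (*-cong (trans (-‿homo 1ℤ) (-‿cong 1-homo)) e) (solve 1 (λ x → (:- :1) :* x := :- x) refl x)))

    below-shift : ∀ l {k w x} → DegreeBelow k w x → DegreeBelow (l ℕ.+ k) w (w ^ l * x)
    below-shift zero    d = below-cong (sym (*-identityˡ _)) d
    below-shift (suc l) {w = w} d with below-shift l d
    ... | below u e = below (0ℤ ∷ u) (trans (+-congʳ 0-homo) (trans (+-identityˡ _)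
                        (trans (*-congˡ e) (sym (*-assoc w _ _)))))

    -- Combinations with coefficients polynomial in `w` of degree below `k`; the nested sums expose
    -- the coefficient of the first vector, the one to be eliminated.
    Span : ℕ → Carrier → List Carrier → Carrier → Set
    Span k w []       y = y ≈ 0#
    Span k w (v ∷ vs) y = Σ[ p ∈ Carrier ] DegreeBelow k w p × Span k w vs (y - p * v)

    span-cong : ∀ {k w} vs {x y} → x ≈ y → Span k w vs x → Span k w vs y
    span-cong []       e f           = trans (sym e) f
    span-cong (v ∷ vs) e (p , d , s) = p , d , span-cong vs (+-congʳ e) s

    span-+ : ∀ {k w} vs {x y} → Span k w vs x → Span k w vs y → Span k w vs (x + y)
    span-+ []       e f = trans (+-cong e f) (+-identityˡ 0#)
    span-+ (v ∷ vs) {x} {y} (p , d , s) (q , d′ , s′) = p + q , below-+ d d′ ,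
      span-cong vs (solve 5 (λ x p v y q → (x :- p :* v) :+ (y :- q :* v) := (x :+ y) :- (p :+ q) :* v) refl x p v y q)
        (span-+ vs s s′)

    span-scale : ∀ {k l w} vs {c x} → DegreeBelow l w c → Span k w vs x → Span (l ℕ.+ k) w vs (c * x)
    span-scale [] c e = trans (*-congˡ e) (zeroʳ _)
    span-scale (v ∷ vs) {c} {x} d (p , d′ , s) = c * p , below-* d d′ ,
      span-cong vs (solve 4 (λ c x p v → c :* (x :- p :* v) := c :* x :- (c :* p) :* v) refl c x p v) (span-scale vs d s)

    span-shift : ∀ {k w} l vs {x} → Span k w vs x → Span (l ℕ.+ k) w vs (w ^ l * x)
    span-shift l [] e = trans (*-congˡ e) (zeroʳ _)
    span-shift {w = w} l (v ∷ vs) {x} (p , d , s) = w ^ l * p , below-shift l d ,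
      span-cong vs (solve 4 (λ c x p v → c :* (x :- p :* v) := c :* x :- (c :* p) :* v) refl (w ^ l) x p v) (span-shift l vs s)

    span-0 : ∀ {k w} vs → Span k w vs 0#
    span-0 []       = refl
    span-0 {k} (v ∷ vs) = 0# , zeros k , span-cong vs (solve 1 (λ v → :0 := :0 :- :0 :* v) refl v) (span-0 vs)
      where
      zeros : ∀ k {w} → DegreeBelow k w 0#
      zeros zero    = below [] refl
      zeros (suc k) {w} with zeros k
      ... | below u e = below (0ℤ ∷ u) (trans (+-cong 0-homo (trans (*-congˡ e) (zeroʳ w))) (+-identityˡ 0#))

    span-∈ : ∀ {k w v p} vs → v ∈ vs → DegreeBelow k w p → Span k w vs (p * v)
    span-∈ {p = p} (v ∷ vs) (here ≡.refl) d = p , d , span-cong vs (sym (-‿inverseʳ _)) (span-0 vs)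
    span-∈ {k} {w} {v} {p} (u ∷ vs) (there m) d with span-0 {k} {w} (u ∷ vs)
    ... | q , d′ , s = q , d′ , span-cong vs (solve 2 (λ a b → (:0 :- a) :+ b := b :- a) refl (q * u) (p * v)) (span-+ vs s (span-∈ vs m d))

    -- Gaussian elimination of v from the relations w^k u ∈ Span k; the degree
    -- bound doubles, and the last relation is a monic equation for w.
    eliminate : ∀ {w} k vs → All (λ v → Span k w (vs ++ 1# ∷ []) (w ^ k * v)) (vs ++ 1# ∷ []) → IsIntegral w
    eliminate {w} k [] ((p , below u e , f) ∷ []) = k , Vec.map (-1ℤ ℤ.*_) u , (begin
      evalM (Vec.map (-1ℤ ℤ.*_) u) w           ≈⟨ evalM-split (Vec.map (-1ℤ ℤ.*_) u) w ⟩
      evalV (Vec.map (-1ℤ ℤ.*_) u) w + w ^ k   ≈⟨ +-congʳ (DegreeBelow.value (below-neg (below u e))) ⟩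
      - p + w ^ k                              ≈⟨ solve 2 (λ p y → :- p :+ y := y :* :1 :- p :* :1) refl p (w ^ k) ⟩
      w ^ k * 1# - p * 1#                      ≈⟨ f ⟩
      0#                                       ∎)
    eliminate {w} k (v ∷ vs) ((p , d , s) ∷ rows) = eliminate (k ℕ.+ k) vs (All.tabulate new-row)
      where
      rest = vs ++ 1# ∷ []
      W = w ^ k
      new-row : ∀ {u} → u ∈ rest → Span (k ℕ.+ k) w rest (w ^ (k ℕ.+ k) * u)
      new-row {u} m with All.lookup rows m
      -- Write W u = q v + σ′ and W v = p v + σ, with σ and σ′ free of v. Then W² u = W σ′ + q σ + p
      -- (q v), and q v = W u - σ′ removes the last occurrence of v; the new coefficient W p still
      -- has degree below 2k.
      ... | q , d′ , s′ = span-cong rest (begin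
          ((W * p) * u + - p * (W * u - q * v)) + (q * (W * v - p * v) + W * (W * u - q * v))
            ≈⟨ solve 5 (λ W p q u v → ((W :* p) :* u :+ (:- p) :* (W :* u :- q :* v)) :+ (q :* (W :* v :- p :* v) :+ W :* (W :* u :- q :* v))
                 := (W :* W) :* u) refl W p q u v ⟩
          (W * W) * u        ≈⟨ *-congʳ (^-homo-* w k k) ⟨
          w ^ (k ℕ.+ k) * u  ∎)
        (span-+ rest (span-+ rest (span-∈ rest m (below-shift k d)) (span-scale rest (below-neg d) s′))
                     (span-+ rest (span-scale rest d′ s) (span-shift k rest s′)))

    -- The ring ℤ[r] + αℤ[r], closed under products by α² = rα - 1. It is generated as a group by rⁱ
    -- and αrⁱ for i < t, so multiplication by any element gives the relations that `eliminate`
    -- requires.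
    module Order {t} (R : Vec ℤ t) (r α : Carrier) (Rr : evalM R r ≈ 0#) (α² : α * α ≈ r * α - 1#) where

      IsPoly : Carrier → Set
      IsPoly x = ∃[ n ] DegreeBelow n r x

      poly-+ : ∀ {x y} → IsPoly x → IsPoly y → IsPoly (x + y)
      poly-+ (m , below u e) (n , below v f) =
        let (k , w , g) = go u v in k , below w (trans g (+-cong e f))
        where
        go : ∀ {m n} (u : Vec ℤ m) (v : Vec ℤ n) → ∃[ k ] Σ[ w ∈ Vec ℤ k ] evalV w r ≈ evalV u r + evalV v r
        go []      v       = _ , v , sym (+-identityˡ _)
        go (a ∷ u) []      = _ , a ∷ u , sym (+-identityʳ _)
        go (a ∷ u) (b ∷ v) with go u v
        ... | k , w , g = suc k , a ℤ.+ b ∷ w , trans (+-cong (+-homo a b) (*-congˡ g))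
          (solve 5 (λ a b r x y → (a :+ b) :+ r :* (x :+ y) := (a :+ r :* x) :+ (b :+ r :* y)) refl ⟦ a ⟧ ⟦ b ⟧ r (evalV u r) (evalV v r))

      poly-* : ∀ {x y} → IsPoly x → IsPoly y → IsPoly (x * y)
      poly-* (m , u) (n , v) = m ℕ.+ n , below-* u v

      poly-neg : ∀ {x} → IsPoly x → IsPoly (- x)
      poly-neg (m , u) = m , below-neg u

      poly-const : ∀ c → IsPoly ⟦ c ⟧
      poly-const c = 1 , below-const c

      poly-0 : IsPoly 0#
      poly-0 = 0 , below [] refl

      poly-1 : IsPoly 1#
      poly-1 = 1 , below-cong 1-homo (below-const 1ℤ)

      poly-r : IsPoly r
      poly-r = 2 , below (0ℤ ∷ 1ℤ ∷ []) (trans (+-cong 0-homo (*-congˡ (+-congʳ 1-homo)))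
        (solve 1 (λ r → :0 :+ r :* (:1 :+ r :* :0) := r) refl r))

      Member : Carrier → Set
      Member y = Σ[ a ∈ Carrier ] Σ[ b ∈ Carrier ] IsPoly a × IsPoly b × y ≈ a + α * b

      member-cong : ∀ {x y} → x ≈ y → Member x → Member y
      member-cong e (a , b , pa , pb , f) = a , b , pa , pb , trans (sym e) f

      member-+ : ∀ {x y} → Member x → Member y → Member (x + y)
      member-+ (a , b , pa , pb , e) (c , d , pc , pd , f) = a + c , b + d , poly-+ pa pc , poly-+ pb pd ,
        trans (+-cong e f) (solve 5 (λ a b c d z → (a :+ z :* b) :+ (c :+ z :* d) := (a :+ c) :+ z :* (b :+ d)) refl a b c d α)

      member-neg : ∀ {x} → Member x → Member (- x)
      member-neg (a , b , pa , pb , e) = - a , - b , poly-neg pa , poly-neg pb ,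
        trans (-‿cong e) (solve 3 (λ a b z → :- (a :+ z :* b) := :- a :+ z :* :- b) refl a b α)

      member-* : ∀ {x y} → Member x → Member y → Member (x * y)
      member-* (a , b , pa , pb , e) (c , d , pc , pd , f) =
        a * c - b * d , a * d + b * c + r * (b * d) ,
        poly-+ (poly-* pa pc) (poly-neg (poly-* pb pd)) ,
        poly-+ (poly-+ (poly-* pa pd) (poly-* pb pc)) (poly-* poly-r (poly-* pb pd)) , (begin
          _                                                        ≈⟨ *-cong e f ⟩
          (a + α * b) * (c + α * d)                                ≈⟨ solve 5 (λ a b c d z → (a :+ z :* b) :* (c :+ z :* d)
                                                                        := a :* c :+ z :* (a :* d :+ b :* c) :+ (z :* z) :* (b :* d)) refl a b c d α ⟩
          a * c + α * (a * d + b * c) + (α * α) * (b * d)          ≈⟨ +-congˡ (*-congʳ α²) ⟩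
          a * c + α * (a * d + b * c) + (r * α - 1#) * (b * d)     ≈⟨ solve 6 (λ a b c d z r → a :* c :+ z :* (a :* d :+ b :* c) :+ (r :* z :- :1) :* (b :* d)
                                                                        := (a :* c :- b :* d) :+ z :* (a :* d :+ b :* c :+ r :* (b :* d))) refl a b c d α r ⟩
          (a * c - b * d) + α * (a * d + b * c + r * (b * d))      ∎)

      member-poly : ∀ {x} → IsPoly x → Member x
      member-poly {x} p = x , 0# , p , poly-0 , solve 2 (λ x z → x := x :+ z :* :0) refl x α

      member-1 : Member 1#
      member-1 = member-poly poly-1

      member-α : Member α
      member-α = 0# , 1# , poly-0 , poly-1 , solve 1 (λ z → z := :0 :+ z :* :1) refl α

      member-^ : ∀ {x} n → Member x → Member (x ^ n)
      member-^ zero    m = member-1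
      member-^ (suc n) m = member-* m (member-^ n m)

      powers : Carrier → ℕ → List Carrier
      powers c zero    = []
      powers c (suc n) = c ∷ powers (c * r) n

      span-powers : ∀ {w n} (u : Vec ℤ n) c rest y → Span 1 w rest (y - c * evalV u r) → Span 1 w (powers c n ++ rest) y
      span-powers [] c rest y s = span-cong rest (solve 2 (λ y c → y :- c :* :0 := y) refl y c) s
      span-powers (a ∷ u) c rest y s = ⟦ a ⟧ , below-const a , span-powers u (c * r) rest (y - ⟦ a ⟧ * c)
        (span-cong rest (solve 5 (λ y c a r v → y :- c :* (a :+ r :* v) := (y :- a :* c) :- (c :* r) :* v) refl y c ⟦ a ⟧ r (evalV u r)) s)

      members-powers : ∀ {c} n → Member c → All Member (powers c n)
      members-powers zero    m = []
      members-powers (suc n) m = m ∷ members-powers n (member-* m (member-poly poly-r))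

      reduce : ∀ {x} → IsPoly x → Σ[ u ∈ Vec ℤ t ] evalV u r ≈ x
      reduce (n , below u e) = let (q , v , f) = divideV R u in v , (begin
        evalV v r                          ≈⟨ solve 2 (λ q v → v := :0 :* q :+ v) refl (evalV q r) (evalV v r) ⟩
        0# * evalV q r + evalV v r         ≈⟨ +-congʳ (*-congʳ Rr) ⟨
        evalM R r * evalV q r + evalV v r  ≈⟨ f r ⟨
        evalV u r                          ≈⟨ e ⟩
        _                                  ∎)

      -- Below, `1#` is adjoined at the end, since `eliminate` keeps that vector for last to read
      -- off a monic equation.
      basis : List Carrier
      basis = powers 1# t ++ powers α t

      span-basis : ∀ {w} (u v : Vec ℤ t) → Span 1 w (basis ++ 1# ∷ []) (evalV u r + α * evalV v r)
      span-basis {w} u v = ≡.subst (λ vs → Span 1 w vs y) (≡.sym (List.++-assoc (powers 1# t) (powers α t) (1# ∷ [])))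
        (span-powers u 1# (powers α t ++ 1# ∷ []) y (span-powers v α (1# ∷ []) (y - 1# * evalV u r)
          (span-cong {1} {w} (1# ∷ []) (solve 3 (λ x z y → :0 := (x :+ z :* y :- :1 :* x) :- z :* y) refl (evalV u r) α (evalV v r))
            (span-0 {1} {w} (1# ∷ [])))))
        where y = evalV u r + α * evalV v r

      member-span : ∀ {w y} → Member y → Span 1 w (basis ++ 1# ∷ []) y
      member-span {w} {y} (a , b , pa , pb , e) = span-cong {1} {w} (basis ++ 1# ∷ []) (trans (+-cong (proj₂ (reduce pa)) (*-congˡ (proj₂ (reduce pb)))) (sym e))
        (span-basis {w} (proj₁ (reduce pa)) (proj₁ (reduce pb)))

      basis-members : All Member (basis ++ 1# ∷ [])
      basis-members = All.++⁺ (All.++⁺ (members-powers t member-1) (members-powers t member-α)) (member-1 ∷ [])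

      integral : ∀ {w} → Member w → IsIntegral w
      integral {w} m = eliminate 1 basis (All.map (λ mv → member-span (member-* (member-^ 1 m) mv)) basis-members)

-- Lucas sequences and Chebyshev-like polynomials.

module Lucas where

  open Kit
  open Poly
  open Complex using (ℤ-ring)
  open import Algebra.Bundles using (CommutativeRing)
  open import Data.Integer as ℤ using (ℤ; 0ℤ; 1ℤ) renaming (+_ to pos)
  open import Data.Nat as ℕ using (ℕ; zero; suc)
  import Data.Nat.Properties as ℕ
  open import Data.Product using (_×_; _,_; proj₁; proj₂)
  open import Data.Vec using (Vec; []; _∷_)
  open import Relation.Binary.PropositionalEquality as ≡ using (_≡_)

  open Coefficients ℤ-ring using (chain)

  -- For X = Z + Z⁻¹:  𝕌 k = (Z^{k+1} − Z^{−k−1})/(Z − Z⁻¹),  𝕍 k = Z^{k+1} + Z^{−k−1},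
  -- 𝕆 k = (Z^{2k+1} − 1)/(Z^k (Z − 1)).
  𝕌 𝕆 : ∀ k → Vec ℤ (k ℕ.+ 0)
  𝕌 = chain [] (0ℤ ∷ [])
  𝕆 = chain [] (1ℤ ∷ [])

  𝕍 : ∀ k → Vec ℤ (k ℕ.+ 1)
  𝕍 = chain (0ℤ ∷ []) (ℤ.- pos 2 ∷ 0ℤ ∷ [])

  -- If β and β′ are the roots of T² - sT + π, then y m = (β^m - β′^m)/(β - β′) and v m = β^m +
  -- β′^m. Two instances occur: β, β′ = N ± i, where y and v become sines and cosines, and β, β′ =
  -- z, 1, where y m = (z^m - 1)/(z - 1).
  module Sequence (A : Ring₀) (s π : CommutativeRing.Carrier A) where
    open CommutativeRing A hiding (zero)
    open IntegerSolver A
    open import Algebra.Properties.Semiring.Exp semiring using (_^_)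
    open import Relation.Binary.Reasoning.Setoid setoid

    y : ℕ → Carrier
    y zero          = 0#
    y (suc zero)    = 1#
    y (suc (suc m)) = s * y (suc m) - π * y m

    v : ℕ → Carrier
    v m = (y (suc m) + y (suc m)) - s * y m

    Recurrent : (σ ϖ : Carrier) → (ℕ → Carrier) → Set
    Recurrent σ ϖ f = ∀ m → f (suc (suc m)) ≈ σ * f (suc m) - ϖ * f m

    -- The means of proving the identities that follow without the roots β and β′: both sides solve
    -- one recurrence, and only the first two values are compared.
    recurrence-unique : ∀ {σ ϖ f g} → Recurrent σ ϖ f → Recurrent σ ϖ g → f 0 ≈ g 0 → f 1 ≈ g 1 → ∀ m → f m ≈ g m
    recurrence-unique {σ} {ϖ} {f} {g} rf rg e₀ e₁ m = proj₁ (go m)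
      where
      go : ∀ m → f m ≈ g m × f (suc m) ≈ g (suc m)
      go zero    = e₀ , e₁
      go (suc m) = proj₂ (go m) ,
        trans (rf m) (trans (+-cong (*-congˡ (proj₂ (go m))) (-‿cong (*-congˡ (proj₁ (go m))))) (sym (rg m)))

    y-recurrent : Recurrent s π y
    y-recurrent m = refl

    combination-recurrent : ∀ {σ ϖ f g} a b → Recurrent σ ϖ f → Recurrent σ ϖ g → Recurrent σ ϖ (λ m → a * f m - b * g m)
    combination-recurrent {σ} {ϖ} {f} {g} a b rf rg m = trans (+-cong (*-congˡ (rf m)) (-‿cong (*-congˡ (rg m))))
      (solve 8 (λ a b σ ϖ f₁ f₀ g₁ g₀ → a :* (σ :* f₁ :- ϖ :* f₀) :- b :* (σ :* g₁ :- ϖ :* g₀)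
         := σ :* (a :* f₁ :- b :* g₁) :- ϖ :* (a :* f₀ :- b :* g₀)) refl a b σ ϖ (f (suc m)) (f m) (g (suc m)) (g m))

    shift-recurrent : ∀ {σ ϖ f} k → Recurrent σ ϖ f → Recurrent σ ϖ (λ m → f (m ℕ.+ k))
    shift-recurrent k rf m = rf (m ℕ.+ k)

    v-recurrent : Recurrent s π v
    v-recurrent m = solve 4 (λ s π y₁ y₀ →
        ((s :* (s :* y₁ :- π :* y₀) :- π :* y₁) :+ (s :* (s :* y₁ :- π :* y₀) :- π :* y₁)) :- s :* (s :* y₁ :- π :* y₀)
        := s :* (((s :* y₁ :- π :* y₀) :+ (s :* y₁ :- π :* y₀)) :- s :* y₁) :- π :* ((y₁ :+ y₁) :- s :* y₀))
      refl s π (y (suc m)) (y m)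

    y-addition : ∀ k m → y (m ℕ.+ suc k) ≈ y (suc k) * y (suc m) - π * y k * y m
    y-addition k = recurrence-unique {s} {π} (shift-recurrent {f = y} (suc k) y-recurrent)
      (combination-recurrent {g = y} (y (suc k)) (π * y k) (λ m → y-recurrent (suc m)) y-recurrent)
      (solve 2 (λ a b → a := a :* :1 :- b :* :0) refl (y (suc k)) (π * y k))
      (solve 4 (λ s a π b → s :* a :- π :* b := a :* (s :* :1 :- π :* :0) :- π :* b :* :1) refl s (y (suc k)) π (y k))

    cassini : ∀ q → y (suc q) * y (suc q) - y q * y (suc (suc q)) ≈ π ^ q
    cassini zero = solve 2 (λ s π → :1 :* :1 :- :0 :* (s :* :1 :- π :* :0) := :1) refl s π
    cassini (suc q) = begin
      y₂ * y₂ - y₁ * (s * y₂ - π * y₁)           ≈⟨ solve 4 (λ s π y₁ y₀ →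
          (s :* y₁ :- π :* y₀) :* (s :* y₁ :- π :* y₀) :- y₁ :* (s :* (s :* y₁ :- π :* y₀) :- π :* y₁)
          := π :* (y₁ :* y₁ :- y₀ :* (s :* y₁ :- π :* y₀))) refl s π y₁ (y q) ⟩
      π * (y₁ * y₁ - y q * y₂)                   ≈⟨ *-congˡ (cassini q) ⟩
      π * π ^ q                                  ∎
      where
      y₁ = y (suc q)
      y₂ = y (suc (suc q))

    y-double : ∀ q → y (q ℕ.+ q) ≈ v q * y q
    y-double zero = solve 1 (λ v → :0 := v :* :0) refl (v zero)
    y-double (suc k) = trans (y-addition k (suc k))
      (solve 4 (λ s π a b → a :* (s :* a :- π :* b) :- π :* b :* a := ((s :* a :- π :* b) :+ (s :* a :- π :* b) :- s :* a) :* a)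
        refl s π (y (suc k)) (y k))

    y-double-suc : ∀ q → y (suc (q ℕ.+ q)) ≈ v q * y (suc q) - π ^ q
    y-double-suc zero = solve 1 (λ s → :1 := (:1 :+ :1 :- s :* :0) :* :1 :- :1) refl s
    y-double-suc (suc k) = begin
      y (suc (suc k) ℕ.+ suc k)                                 ≈⟨ y-addition k (suc (suc k)) ⟩
      y₁ * (s * y₂ - π * y₁) - π * y₀ * y₂                      ≈⟨ solve 4 (λ s π y₁ y₀ →
          y₁ :* (s :* (s :* y₁ :- π :* y₀) :- π :* y₁) :- π :* y₀ :* (s :* y₁ :- π :* y₀)
          := ((s :* y₁ :- π :* y₀) :+ (s :* y₁ :- π :* y₀) :- s :* y₁) :* (s :* y₁ :- π :* y₀)
             :- ((s :* y₁ :- π :* y₀) :* (s :* y₁ :- π :* y₀) :- y₁ :* (s :* (s :* y₁ :- π :* y₀) :- π :* y₁))) refl s π y₁ y₀ ⟩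
      v (suc k) * y₂ - (y₂ * y₂ - y₁ * (s * y₂ - π * y₁))       ≈⟨ +-congˡ (-‿cong (cassini (suc k))) ⟩
      v (suc k) * y₂ - π ^ suc k                                ∎
      where
      y₀ = y k
      y₁ = y (suc k)
      y₂ = y (suc (suc k))

    -- The powers β^q and β′^q are the roots of T² - v_q T + π^q.
    y-step : ∀ q m → y (m ℕ.+ (q ℕ.+ q)) ≈ v q * y (m ℕ.+ q) - π ^ q * y m
    y-step q = recurrence-unique {s} {π} (shift-recurrent {f = y} (q ℕ.+ q) y-recurrent)
      (combination-recurrent {f = λ m → y (m ℕ.+ q)} {g = y} (v q) (π ^ q) (shift-recurrent {f = y} q y-recurrent) y-recurrent)
      (trans (y-double q) (solve 2 (λ a b → a := a :- b :* :0) refl (v q * y q) (π ^ q)))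
      (trans (y-double-suc q) (solve 2 (λ a b → a :- b := a :- b :* :1) refl (v q * y (suc q)) (π ^ q)))

    v-step : ∀ q m → v (m ℕ.+ (q ℕ.+ q)) ≈ v q * v (m ℕ.+ q) - π ^ q * v m
    v-step q m = trans (+-cong (+-cong (y-step q (suc m)) (y-step q (suc m))) (-‿cong (*-congˡ (y-step q m))))
      (solve 7 (λ v a b p c d s → ((v :* a :- p :* b) :+ (v :* a :- p :* b)) :- s :* (v :* c :- p :* d)
         := v :* ((a :+ a) :- s :* c) :- p :* ((b :+ b) :- s :* d))
       refl (v q) (y (suc m ℕ.+ q)) (y (suc m)) (π ^ q) (y (m ℕ.+ q)) (y m) s)

    -- The formula cos(mθ) - cos((m+2)θ) = 2 sin θ sin((m+1)θ), homogenised. It makes the sample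
    -- points decrease as long as the sines are positive.
    v-difference : ∀ m → π * v m - v (suc (suc m)) ≈ (π + π + π + π - s * s) * y (suc m)
    v-difference = recurrence-unique {s} {π}
      (combination-minus π (λ m → v-recurrent m) (λ m → v-recurrent (suc (suc m))))
      (scaled (π + π + π + π - s * s) (λ m → y-recurrent (suc m)))
      (solve 2 (λ s π → π :* (:1 :+ :1 :- s :* :0) :- ((s :* (s :* :1 :- π :* :0) :- π :* :1) :+ (s :* (s :* :1 :- π :* :0) :- π :* :1) :- s :* (s :* :1 :- π :* :0))
          := (π :+ π :+ π :+ π :- s :* s) :* :1) refl s π)
      (solve 2 (λ s π → let y₂ = s :* :1 :- π :* :0 ; y₃ = s :* y₂ :- π :* :1 ; y₄ = s :* y₃ :- π :* y₂ in
          π :* (y₂ :+ y₂ :- s :* :1) :- (y₄ :+ y₄ :- s :* y₃) := (π :+ π :+ π :+ π :- s :* s) :* y₂) refl s π)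
      where
      combination-minus : ∀ a {f g} → Recurrent s π f → Recurrent s π g → Recurrent s π (λ m → a * f m - g m)
      combination-minus a {f} {g} rf rg m = trans (+-cong (*-congˡ (rf m)) (-‿cong (rg m)))
        (solve 7 (λ a σ ϖ f₁ f₀ g₁ g₀ → a :* (σ :* f₁ :- ϖ :* f₀) :- (σ :* g₁ :- ϖ :* g₀)
           := σ :* (a :* f₁ :- g₁) :- ϖ :* (a :* f₀ :- g₀)) refl a s π (f (suc m)) (f m) (g (suc m)) (g m))
      scaled : ∀ a {f} → Recurrent s π f → Recurrent s π (λ m → a * f m)
      scaled a {f} rf m = trans (*-congˡ (rf m))
        (solve 5 (λ a σ ϖ f₁ f₀ → a :* (σ :* f₁ :- ϖ :* f₀) := σ :* (a :* f₁) :- ϖ :* (a :* f₀)) refl a s π (f (suc m)) (f m))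

    -- Here x = Z + Z⁻¹ for Z = (β/β′)^j, multiplied out by ϖ = π^j to avoid quotients. Over ℚ the
    -- formulas below give the signs of the polynomials, while for β, β′ = z, 1 and j = 1 they give
    -- divisibility by zⁿ - 1.
    module Chebyshev (h : Hom ℤ-ring A) (j : ℕ) (x : Carrier) (xπ : x * π ^ j ≈ v (j ℕ.+ j)) where
      open Evaluation h using (evalM; evalM-chain)
      open Hom h
      ϖ = π ^ j

      v₂ : v (j ℕ.+ j) ≈ v j * v j - (ϖ + ϖ)
      v₂ = trans (v-step j 0) (+-congˡ (-‿cong (solve 2 (λ p s → p :* (:1 :+ :1 :- s :* :0) := p :+ p) refl ϖ s)))

      xϖ : x * ϖ ≈ v j * v j - (ϖ + ϖ)
      xϖ = trans xπ v₂

      private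
        double-step : ∀ {f} → (∀ m → f (m ℕ.+ (j ℕ.+ j)) ≈ v j * f (m ℕ.+ j) - ϖ * f m) →
          ∀ m → f (m ℕ.+ (j ℕ.+ j) ℕ.+ (j ℕ.+ j)) ≈ (x * ϖ) * f (m ℕ.+ (j ℕ.+ j)) - (ϖ * ϖ) * f m
        double-step {f} step m = begin
          f (m ℕ.+ (j ℕ.+ j) ℕ.+ (j ℕ.+ j))                   ≈⟨ step (m ℕ.+ (j ℕ.+ j)) ⟩
          v j * f (m ℕ.+ (j ℕ.+ j) ℕ.+ j) - ϖ * F₂            ≡⟨ ≡.cong (λ k → v j * f k - ϖ * F₂) (≡.trans (ℕ.+-assoc m (j ℕ.+ j) j) (≡.trans (≡.cong (m ℕ.+_) (ℕ.+-assoc j j j)) (≡.sym (ℕ.+-assoc m j (j ℕ.+ j))))) ⟩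
          v j * f (m ℕ.+ j ℕ.+ (j ℕ.+ j)) - ϖ * F₂            ≈⟨ +-congʳ (*-congˡ (trans (step (m ℕ.+ j)) (+-congʳ (*-congˡ (reflexive (≡.cong f (ℕ.+-assoc m j j))))))) ⟩
          v j * (v j * F₂ - ϖ * F₁) - ϖ * F₂                  ≈⟨ solve 4 (λ v p f₂ f₁ → v :* (v :* f₂ :- p :* f₁) :- p :* f₂
                                                                   := (v :* v :- p) :* f₂ :- p :* (v :* f₁)) refl (v j) ϖ F₂ F₁ ⟩
          (v j * v j - ϖ) * F₂ - ϖ * (v j * F₁)               ≈⟨ +-congˡ (-‿cong (*-congˡ (trans (solve 2 (λ a b → a := (a :- b) :+ b) refl (v j * F₁) (ϖ * f m)) (+-congʳ (sym (step m)))))) ⟩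
          (v j * v j - ϖ) * F₂ - ϖ * (F₂ + ϖ * f m)           ≈⟨ solve 4 (λ v p f₂ f₀ → (v :* v :- p) :* f₂ :- p :* (f₂ :+ p :* f₀)
                                                                   := (v :* v :- (p :+ p)) :* f₂ :- (p :* p) :* f₀) refl (v j) ϖ F₂ (f m) ⟩
          (v j * v j - (ϖ + ϖ)) * F₂ - (ϖ * ϖ) * f m          ≈⟨ +-congʳ (*-congʳ xϖ) ⟨
          (x * ϖ) * F₂ - (ϖ * ϖ) * f m                        ∎
          where
          F₁ = f (m ℕ.+ j)
          F₂ = f (m ℕ.+ (j ℕ.+ j))

        chain-formula : ∀ {d} (a : Vec ℤ d) b u (f : ℕ → Carrier) →
          (∀ k → f (suc (suc k)) ≈ (x * ϖ) * f (suc k) - (ϖ * ϖ) * f k) →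
          evalM a x * u ≈ f 0 → evalM b x * ϖ * u ≈ f 1 → ∀ k → evalM (chain a b k) x * ϖ ^ k * u ≈ f k
        chain-formula a b u f rf e₀ e₁ = recurrence-unique {x * ϖ} {ϖ * ϖ}
          (λ k → trans (*-congʳ (*-congʳ (evalM-chain a b k x)))
            (solve 6 (λ x b a p q u → (x :* b :- a) :* (p :* (p :* q)) :* u := (x :* p) :* (b :* (p :* q) :* u) :- (p :* p) :* (a :* q :* u))
              refl x (evalM (chain a b (suc k)) x) (evalM (chain a b k) x) ϖ (ϖ ^ k) u))
          rf
          (trans (solve 2 (λ a u → a :* :1 :* u := a :* u) refl (evalM a x) u) e₀)
          (trans (solve 3 (λ b p u → b :* (p :* :1) :* u := b :* p :* u) refl (evalM b x) ϖ u) e₁)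

        linear : ∀ (f : ℕ → Carrier) b → (∀ m → f (m ℕ.+ (j ℕ.+ j) ℕ.+ (j ℕ.+ j)) ≈ (x * ϖ) * f (m ℕ.+ (j ℕ.+ j)) - (ϖ * ϖ) * f m) →
          ∀ k → f (b ℕ.+ suc (suc k) ℕ.* (j ℕ.+ j)) ≈ (x * ϖ) * f (b ℕ.+ suc k ℕ.* (j ℕ.+ j)) - (ϖ * ϖ) * f (b ℕ.+ k ℕ.* (j ℕ.+ j))
        linear f b step k = begin
          f (b ℕ.+ (J ℕ.+ (J ℕ.+ kJ)))   ≡⟨ ≡.cong f (rearrange₂ b J kJ) ⟩
          f (b ℕ.+ kJ ℕ.+ J ℕ.+ J)       ≈⟨ step (b ℕ.+ kJ) ⟩
          (x * ϖ) * f (b ℕ.+ kJ ℕ.+ J) - (ϖ * ϖ) * f (b ℕ.+ kJ)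
            ≡⟨ ≡.cong (λ i → (x * ϖ) * f i - (ϖ * ϖ) * f (b ℕ.+ kJ)) (rearrange₁ b J kJ) ⟩
          (x * ϖ) * f (b ℕ.+ (J ℕ.+ kJ)) - (ϖ * ϖ) * f (b ℕ.+ kJ) ∎
          where
          J = j ℕ.+ j
          kJ = k ℕ.* (j ℕ.+ j)
          rearrange₁ : ∀ b J i → b ℕ.+ i ℕ.+ J ≡ b ℕ.+ (J ℕ.+ i)
          rearrange₁ b J i = ≡.trans (ℕ.+-assoc b i J) (≡.cong (b ℕ.+_) (ℕ.+-comm i J))
          rearrange₂ : ∀ b J i → b ℕ.+ (J ℕ.+ (J ℕ.+ i)) ≡ b ℕ.+ i ℕ.+ J ℕ.+ J
          rearrange₂ b J i = ≡.trans (≡.sym (rearrange₁ b J (J ℕ.+ i))) (≡.cong (ℕ._+ J) (≡.sym (rearrange₁ b J i)))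

        jj : j ℕ.+ 1 ℕ.* (j ℕ.+ j) ≡ j ℕ.+ (j ℕ.+ j)
        jj = ≡.cong (j ℕ.+_) (ℕ.+-identityʳ (j ℕ.+ j))

      𝕆-formula : ∀ k → evalM (𝕆 k) x * ϖ ^ k * y j ≈ y (j ℕ.+ k ℕ.* (j ℕ.+ j))
      𝕆-formula = chain-formula [] (1ℤ ∷ []) (y j) (λ k → y (j ℕ.+ k ℕ.* (j ℕ.+ j))) (linear y j (double-step (y-step j)))
        (trans (*-identityˡ _) (reflexive (≡.cong y (≡.sym (ℕ.+-identityʳ j)))))
        (begin
          (⟦ 1ℤ ⟧ + x * 1#) * ϖ * y j                     ≈⟨ *-congʳ (*-congʳ (+-congʳ 1-homo)) ⟩
          (1# + x * 1#) * ϖ * y j                         ≈⟨ solve 3 (λ x p y → (:1 :+ x :* :1) :* p :* y := (x :* p :+ p) :* y) refl x ϖ (y j) ⟩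
          (x * ϖ + ϖ) * y j                               ≈⟨ *-congʳ (+-congʳ xϖ) ⟩
          (v j * v j - (ϖ + ϖ) + ϖ) * y j                 ≈⟨ solve 3 (λ v p y → (v :* v :- (p :+ p) :+ p) :* y := v :* (v :* y) :- p :* y) refl (v j) ϖ (y j) ⟩
          v j * (v j * y j) - ϖ * y j                     ≈⟨ +-congʳ (*-congˡ (y-double j)) ⟨
          v j * y (j ℕ.+ j) - ϖ * y j                     ≈⟨ y-step j j ⟨
          y (j ℕ.+ (j ℕ.+ j))                             ≡⟨ ≡.cong y jj ⟨
          y (j ℕ.+ 1 ℕ.* (j ℕ.+ j))                       ∎)

      𝕌-formula : ∀ k → evalM (𝕌 k) x * ϖ ^ k * y (j ℕ.+ j) ≈ y ((j ℕ.+ j) ℕ.+ k ℕ.* (j ℕ.+ j))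
      𝕌-formula = chain-formula [] (0ℤ ∷ []) (y (j ℕ.+ j)) (λ k → y ((j ℕ.+ j) ℕ.+ k ℕ.* (j ℕ.+ j))) (linear y (j ℕ.+ j) (double-step (y-step j)))
        (trans (*-identityˡ _) (reflexive (≡.cong y (≡.sym (ℕ.+-identityʳ (j ℕ.+ j))))))
        (begin
          (⟦ 0ℤ ⟧ + x * 1#) * ϖ * y (j ℕ.+ j)             ≈⟨ *-congʳ (*-congʳ (+-congʳ 0-homo)) ⟩
          (0# + x * 1#) * ϖ * y (j ℕ.+ j)                 ≈⟨ solve 4 (λ x p y₂ z → (:0 :+ x :* :1) :* p :* y₂ := (x :* p) :* y₂ :- z :* :0) refl x ϖ (y (j ℕ.+ j)) (ϖ * ϖ) ⟩
          (x * ϖ) * y (j ℕ.+ j) - (ϖ * ϖ) * 0#            ≈⟨ double-step (y-step j) 0 ⟨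
          y ((j ℕ.+ j) ℕ.+ (j ℕ.+ j))                     ≡⟨ ≡.cong (λ i → y ((j ℕ.+ j) ℕ.+ i)) (ℕ.+-identityʳ (j ℕ.+ j)) ⟨
          y ((j ℕ.+ j) ℕ.+ 1 ℕ.* (j ℕ.+ j))               ∎)

      𝕍-formula : ∀ k → evalM (𝕍 k) x * ϖ ^ k * ϖ ≈ v ((j ℕ.+ j) ℕ.+ k ℕ.* (j ℕ.+ j))
      𝕍-formula = chain-formula (0ℤ ∷ []) (ℤ.- pos 2 ∷ 0ℤ ∷ []) ϖ (λ k → v ((j ℕ.+ j) ℕ.+ k ℕ.* (j ℕ.+ j))) (linear v (j ℕ.+ j) (double-step (v-step j)))
        (begin
          (⟦ 0ℤ ⟧ + x * 1#) * ϖ                           ≈⟨ *-congʳ (+-congʳ 0-homo) ⟩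
          (0# + x * 1#) * ϖ                               ≈⟨ solve 2 (λ x p → (:0 :+ x :* :1) :* p := x :* p) refl x ϖ ⟩
          x * ϖ                                           ≈⟨ xπ ⟩
          v (j ℕ.+ j)                                     ≡⟨ ≡.cong v (ℕ.+-identityʳ (j ℕ.+ j)) ⟨
          v ((j ℕ.+ j) ℕ.+ 0)                             ∎)
        (begin
          (⟦ ℤ.- pos 2 ⟧ + x * (⟦ 0ℤ ⟧ + x * 1#)) * ϖ * ϖ ≈⟨ *-congʳ (*-congʳ (+-cong (trans (-‿homo (pos 2)) (-‿cong (trans (+-homo 1ℤ 1ℤ) (+-cong 1-homo 1-homo)))) (*-congˡ (+-congʳ 0-homo)))) ⟩
          (- (1# + 1#) + x * (0# + x * 1#)) * ϖ * ϖ       ≈⟨ solve 3 (λ x p s → (:- (:1 :+ :1) :+ x :* (:0 :+ x :* :1)) :* p :* p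
                                                                := (x :* p) :* (x :* p) :- (p :* p) :* (:1 :+ :1 :- s :* :0)) refl x ϖ s ⟩
          (x * ϖ) * (x * ϖ) - (ϖ * ϖ) * v 0               ≈⟨ +-congʳ (*-congˡ xπ) ⟩
          (x * ϖ) * v (j ℕ.+ j) - (ϖ * ϖ) * v 0           ≈⟨ double-step (v-step j) 0 ⟨
          v ((j ℕ.+ j) ℕ.+ (j ℕ.+ j))                     ≡⟨ ≡.cong (λ i → v ((j ℕ.+ j) ℕ.+ i)) (ℕ.+-identityʳ (j ℕ.+ j)) ⟨
          v ((j ℕ.+ j) ℕ.+ 1 ℕ.* (j ℕ.+ j))               ∎)

-- Signs of sines from the powers of N + i.

module Signs where

  open Kit
  open Reals
  open Complex
  open Lucas
  open import Data.Integer as ℤ using (ℤ) renaming (+_ to pos)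
  import Data.Integer.Properties as ℤ
  open import Data.Nat as ℕ using (ℕ; zero; suc; z≤n; s≤s; _/_; _%_)
  import Data.Nat.Properties as ℕ
  open import Data.Nat.DivMod using (m≡m%n+[m/n]*n; m%n<n)
  import Data.Nat.Solver
  open import Data.Product using (_×_; _,_)
  open import Data.Rational as ℚ using (ℚ; 0ℚ; 1ℚ; _+_; _*_; _-_; -_; _≤_; _<_)
  import Data.Rational.Properties as ℚ
  open import Data.Sum using (_⊎_; inj₁; inj₂)
  open import Relation.Binary.PropositionalEquality
  open import Relation.Nullary using (yes; no)

  -- Opaque, so that numerals are never normalised.
  opaque
    ν : ℕ → ℚ
    ν n = fromℤ (pos n)

    ν≡fromℤ : ∀ n → ν n ≡ fromℤ (pos n)
    ν≡fromℤ n = refl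

    ν-0 : ν 0 ≡ 0ℚ
    ν-0 = refl

    ν-1 : ν 1 ≡ 1ℚ
    ν-1 = refl

    ν-+ : ∀ m n → ν (m ℕ.+ n) ≡ ν m + ν n
    ν-+ m n = Hom.+-homo ℤ→ℚ (pos m) (pos n)

    ν-* : ∀ m n → ν (m ℕ.* n) ≡ ν m * ν n
    ν-* m n = trans (cong fromℤ (ℤ.pos-* m n)) (Hom.*-homo ℤ→ℚ (pos m) (pos n))

    ν-mono-≤ : ∀ {m n} → m ℕ.≤ n → ν m ≤ ν n
    ν-mono-≤ m≤n = fromℤ-mono-≤ (ℤ.+≤+ m≤n)

    ν-mono-< : ∀ {m n} → m ℕ.< n → ν m < ν n
    ν-mono-< m<n = fromℤ-mono-< (ℤ.+<+ m<n)

  ν-suc : ∀ n → ν (suc n) ≡ 1ℚ + ν n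
  ν-suc n = trans (ν-+ 1 n) (cong (_+ ν n) ν-1)

  0<ν : ∀ {n} → 1 ℕ.≤ n → 0ℚ < ν n
  0<ν {n} 1≤n = subst (_< ν n) ν-0 (ν-mono-< 1≤n)

  0≤ν : ∀ n → 0ℚ ≤ ν n
  0≤ν n = subst (_≤ ν n) ν-0 (ν-mono-≤ z≤n)

  sgn : ℕ → ℚ
  sgn zero    = 1ℚ
  sgn (suc ℓ) = - sgn ℓ

  private
    small-angle-identity : ∀ N b x y {two} → two ≡ 1ℚ + 1ℚ →
      N * (b * x - N * y) + ((N - b) * x + (b * x - N * y) + (N - (two + b)) * y) ≡ (two + b) * (N * x - y) - N * (N * y + x)
    small-angle-identity N b x y refl = solve 4 (λ N b x y →
        N :* (b :* x :- N :* y) :+ ((N :- b) :* x :+ (b :* x :- N :* y) :+ (N :- ((:1 :+ :1) :+ b)) :* y)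
        := ((:1 :+ :1) :+ b) :* (N :* x :- y) :- N :* (N :* y :+ x)) refl N b x y
      where open ℚS

  module Rotation (n : ℕ) where
    N D : ℚ
    N = ν n
    D = N * N + 1ℚ

    open Sequence ℚ-ring (N + N) D public
    open ℚS

    0<D : 0ℚ < D
    0<D = subst (0ℚ <_) (ℚ.+-comm 1ℚ (N * N)) (0<-≤-+ 0<1 (0≤-square N))

    -- x k = y (suc k) − N y k is the real part of (N + i)^k, y k the imaginary
    -- part; the angle of (N + i)^k is at most about 2k/N.
    x : ℕ → ℚ
    x k = y (suc k) - N * y k

    y-suc : ∀ k → y (suc k) ≡ N * y k + x k
    y-suc k = solve 2 (λ a b → a := b :+ (a :- b)) refl (y (suc k)) (N * y k)

    x-suc : ∀ k → x (suc k) ≡ N * x k - y k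
    x-suc k = solve 3 (λ N a b → (N :+ N) :* a :- (N :* N :+ :1) :* b :- N :* a := N :* (a :- N :* b) :- b) refl N (y (suc k)) (y k)

    -- For θ = arctan(1/N) the estimate is tan(kθ) ≤ 2k/N. The factor 2 leaves room for the
    -- induction while 2k ≤ N, and it keeps (N + i)^k in the first quadrant, so that the half-turn
    -- is long.
    small-angle : 1 ℕ.≤ n → ∀ k → k ℕ.+ k ℕ.≤ n → 0ℚ < x k × 0ℚ ≤ y k × N * y k ≤ ν (k ℕ.+ k) * x k
    small-angle 1≤n zero _ =
      subst (0ℚ <_) (solve 1 (λ N → :1 := :1 :- N :* :0) refl N) 0<1 , ℚ.≤-refl ,
      ℚ.≤-reflexive (trans (solve 2 (λ N x → N :* :0 := :0 :* x) refl N (x 0)) (cong (_* x 0) (sym ν-0)))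
    small-angle 1≤n (suc k) 2k+2≤n = step (small-angle 1≤n k (ℕ.≤-trans (ℕ.n≤1+n _) (ℕ.≤-trans (ℕ.n≤1+n _) b+2≤n′)))
      where
      b+2≤n′ : suc (suc (k ℕ.+ k)) ℕ.≤ n
      b+2≤n′ = subst (ℕ._≤ n) (cong suc (ℕ.+-suc k k)) 2k+2≤n
      b = ν (k ℕ.+ k)
      two = ν 2
      b+2 : ν (suc k ℕ.+ suc k) ≡ two + b
      b+2 = trans (cong ν (cong suc (ℕ.+-suc k k))) (ν-+ 2 (k ℕ.+ k))
      b+2≤N : 0ℚ ≤ N - (two + b)
      b+2≤N = ≤⇒0≤- (subst (_≤ N) (ν-+ 2 (k ℕ.+ k)) (ν-mono-≤ b+2≤n′))
      0≤N-b : 0ℚ < N - b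
      0≤N-b = subst (0ℚ <_) (solve 3 (λ N t b → t :+ (N :- (t :+ b)) := N :- b) refl N two b) (0<-≤-+ (0<ν {2} (s≤s z≤n)) b+2≤N)
      1≤N : 0ℚ ≤ N - 1ℚ
      1≤N = ≤⇒0≤- (subst (_≤ N) ν-1 (ν-mono-≤ 1≤n))
      step : 0ℚ < x k × 0ℚ ≤ y k × N * y k ≤ b * x k →
             0ℚ < x (suc k) × 0ℚ ≤ y (suc k) × N * y (suc k) ≤ ν (suc k ℕ.+ suc k) * x (suc k)
      step (0<x , 0≤y , le) = first , second , third
        where
        bx-Ny : 0ℚ ≤ b * x k - N * y k
        bx-Ny = ≤⇒0≤- le
        first′ : 0ℚ < N * x k - y k
        first′ = subst (0ℚ <_) (solve 4 (λ N b x y → (N :- b) :* x :+ ((b :* x :- N :* y) :+ (N :- :1) :* y) := N :* x :- y) refl N b (x k) (y k))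
          (0<-≤-+ (0<-* 0≤N-b 0<x) (0≤-+ bx-Ny (0≤-* 1≤N 0≤y)))
        first : 0ℚ < x (suc k)
        first = subst (0ℚ <_) (sym (x-suc k)) first′
        second : 0ℚ ≤ y (suc k)
        second = subst (0ℚ ≤_) (sym (y-suc k)) (0≤-+ (0≤-* (0≤ν n) 0≤y) (ℚ.<⇒≤ 0<x))
        third′ : 0ℚ ≤ (two + b) * (N * x k - y k) - N * (N * y k + x k)
        third′ = subst (0ℚ ≤_) (small-angle-identity N b (x k) (y k) (trans (ν-suc 1) (cong (λ t → 1ℚ + t) ν-1)))
          (0≤-+ (0≤-* (0≤ν n) bx-Ny) (0≤-+ (0≤-+ (0≤-* (ℚ.<⇒≤ 0≤N-b) (ℚ.<⇒≤ 0<x)) bx-Ny) (0≤-* b+2≤N 0≤y)))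
        third″ : N * (N * y k + x k) ≤ (two + b) * (N * x k - y k)
        third″ = 0≤-⇒≤ third′
        third : N * y (suc k) ≤ ν (suc k ℕ.+ suc k) * x (suc k)
        third = subst₂ (λ p q → N * p ≤ q) (sym (y-suc k)) (sym (cong₂ _*_ b+2 (x-suc k))) third″

    y-positive : 1 ℕ.≤ n → ∀ k → k ℕ.+ k ℕ.≤ n → 0ℚ < y (suc k)
    y-positive 1≤n k le = let (0<x , 0≤y , _) = small-angle 1≤n k le in
      subst (0ℚ <_) (sym (trans (y-suc k) (ℚ.+-comm (N * y k) (x k)))) (0<-≤-+ 0<x (0≤-* (0≤ν n) 0≤y))

    private
      X : ℚ
      X = (N + N) * (N + N)

      0≤-cancel : ∀ {a b} → 0ℚ < a → 0ℚ ≤ a * b → 0ℚ ≤ b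
      0≤-cancel {a} {b} 0<a h = ℚ.*-cancelˡ-≤-pos a {{ℚ.positive 0<a}} (subst (_≤ a * b) (sym (ℚ.*-zeroʳ a)) h)

      0<N+N : 1 ℕ.≤ n → 0ℚ < N + N
      0<N+N 1≤n = 0<-+ (0<ν 1≤n) (0<ν 1≤n)

    -- y (m+2)/y (m+1) decreases by at least 1/2N in each step.
    ratio-decreases : 1 ℕ.≤ n → ∀ m → (∀ k → k ℕ.≤ m → 0ℚ < y (suc k)) → (N + N) * y (suc (suc m)) ≤ (X - ν m) * y (suc m)
    ratio-decreases 1≤n zero _ = ℚ.≤-reflexive (trans (solve 2 (λ s D → s :* (s :* :1 :- D :* :0) := (s :* s :- :0) :* :1) refl (N + N) D)
      (cong (λ t → (X - t) * 1ℚ) (sym ν-0)))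
    ratio-decreases 1≤n (suc m) pos-y = 0≤-⇒≤ (0≤-cancel (0<N+N 1≤n) (subst (0ℚ ≤_)
        (trans (solve 4 (λ N μ y₂ y₁ → (:1 :+ μ) :* (((N :+ N) :* (N :+ N) :- μ) :* y₁ :- (N :+ N) :* y₂) :+ ((N :* N :+ N :* N :- μ) :* (N :* N :+ N :* N :- μ) :+ μ) :* y₁
            := (N :+ N) :* (((N :+ N) :* (N :+ N) :- (:1 :+ μ)) :* y₂ :- (N :+ N) :* ((N :+ N) :* y₂ :- (N :* N :+ :1) :* y₁)))
            refl N (ν m) (y (suc (suc m))) (y (suc m)))
          (cong (λ t → (N + N) * ((X - t) * y (suc (suc m)) - (N + N) * y (suc (suc (suc m))))) (sym (ν-suc m))))
        (0≤-+ (0≤-* (0≤-+ (ℚ.<⇒≤ 0<1) (0≤ν m)) (≤⇒0≤- (ratio-decreases 1≤n m (λ k k≤m → pos-y k (ℕ.m≤n⇒m≤1+n k≤m)))))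
              (0≤-* (0≤-+ (0≤-square (N * N + N * N - ν m)) (0≤ν m)) (ℚ.<⇒≤ (pos-y m (ℕ.n≤1+n m)))))))

    -- The index K = K′ + 1 is the first at which (N + i)^K has left the upper half-plane; Kθ
    -- exceeds π by less than one step, or equals it.
    record HalfTurn : Set where
      field
        K′     : ℕ
        before : ∀ k → k ℕ.< K′ → 0ℚ < y (suc k)
        after  : y (suc K′) ≤ 0ℚ

    search : ∀ b → (∀ k → k ℕ.< b → 0ℚ < y (suc k)) ⊎ HalfTurn
    search zero = inj₁ (λ k ())
    search (suc b) = go (search b)
      where
      go : _ ⊎ HalfTurn → _
      go (inj₂ t) = inj₂ t
      go (inj₁ h) with y (suc b) ℚ.≤? 0ℚ
      ... | yes le = inj₂ (record { K′ = b ; before = h ; after = le })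
      ... | no  ≰0 = inj₁ λ k k<1+b → case k (ℕ.m≤n⇒m<n∨m≡n (ℕ.≤-pred k<1+b))
        where
        case : ∀ k → k ℕ.< b ⊎ k ≡ b → 0ℚ < y (suc k)
        case k (inj₁ k<b)  = h k k<b
        case k (inj₂ refl) = ℚ.≰⇒> ≰0

    -- After (2N)² steps the bound of `ratio-decreases` has reached zero, so a nonpositive value has
    -- occurred by then.
    half-turn : 1 ℕ.≤ n → HalfTurn
    half-turn 1≤n = go (search (suc x²))
      where
      x² = (n ℕ.+ n) ℕ.* (n ℕ.+ n)
      go : _ ⊎ HalfTurn → HalfTurn
      go (inj₂ t) = t
      go (inj₁ h) = record { K′ = suc x² ; before = h ; after = 0≤-⇒≤ (0≤-cancel (0<N+N 1≤n) (subst (0ℚ ≤_)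
          (trans (cong (λ t → (X - t) * y (suc x²) - (N + N) * y (suc (suc x²))) (trans (ν-* (n ℕ.+ n) (n ℕ.+ n)) (cong₂ _*_ (ν-+ n n) (ν-+ n n))))
            (solve 3 (λ s a b → (s :* s :- s :* s) :* a :- s :* b := s :* (:0 :- b)) refl (N + N) (y (suc x²)) (y (suc (suc x²)))))
          (≤⇒0≤- (ratio-decreases 1≤n x² (λ k k≤ → h k (s≤s k≤)))))) }

    module _ (t : HalfTurn) (1≤K′ : 1 ℕ.≤ HalfTurn.K′ t) where
      open HalfTurn t

      K : ℕ
      K = suc K′

      -- −(N + i)^K lies in the cone spanned by 1 and N + i.
      sign-after-turns : ∀ ℓ r → suc r ℕ.+ ℓ ℕ.≤ K′ → 0ℚ < sgn ℓ * y (suc r ℕ.+ ℓ ℕ.* K)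
      sign-after-turns zero r le = subst (0ℚ <_) (sym (trans (ℚ.*-identityˡ _) (cong y (ℕ.+-identityʳ (suc r)))))
        (before r (subst (ℕ._≤ K′) (ℕ.+-identityʳ (suc r)) le))
      -- By the addition formula -y(m + K) = D y(K′) y(m) + (-y(K)) y(m + 1), both coefficients
      -- being nonnegative. The second term uses r + 1, so every turn costs one index; this is the ℓ
      -- in the hypothesis.
      sign-after-turns (suc ℓ) r le = subst (0ℚ <_) eq
          (0<-≤-+ (0<-* (0<-* 0<D 0<y) (sign-after-turns ℓ r (ℕ.≤-trans (ℕ.+-monoʳ-≤ (suc r) (ℕ.n≤1+n ℓ)) le)))
                  (0≤-* (≤⇒0≤- after) (ℚ.<⇒≤ (sign-after-turns ℓ (suc r) (subst (ℕ._≤ K′) (ℕ.+-suc (suc r) ℓ) le)))))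
        where
        0<y : 0ℚ < y K′
        0<y = go K′ 1≤K′ before
          where
          go : ∀ b → 1 ℕ.≤ b → (∀ k → k ℕ.< b → 0ℚ < y (suc k)) → 0ℚ < y b
          go (suc b) _ h = h b (ℕ.n<1+n b)
        m = suc r ℕ.+ ℓ ℕ.* K
        index : suc r ℕ.+ suc ℓ ℕ.* K ≡ m ℕ.+ K
        index = trans (cong (suc r ℕ.+_) (ℕ.+-comm K (ℓ ℕ.* K))) (sym (ℕ.+-assoc (suc r) (ℓ ℕ.* K) K))
        eq : D * y K′ * (sgn ℓ * y m) + (0ℚ - y K) * (sgn ℓ * y (suc m)) ≡ sgn (suc ℓ) * y (suc r ℕ.+ suc ℓ ℕ.* K)
        eq = trans (solve 6 (λ D a g u b w → D :* a :* (g :* u) :+ (:0 :- b) :* (g :* w) := (:- g) :* (b :* w :- D :* a :* u)) refl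
                     D (y K′) (sgn ℓ) (y m) (y K) (y (suc m)))
                   (cong (sgn (suc ℓ) *_) (trans (sym (y-addition K′ m)) (cong y (sym index))))

  -- An approximate primitive 2L-th root of unity: the powers m κ of N + i have
  -- the signs of sin(π m/L), for all m ≤ B not divisible by L.
  record SignTable (L B : ℕ) : Set where
    field
      n κ : ℕ
    open Rotation n public
    field
      0<κ   : 1 ℕ.≤ κ
      sign  : ∀ ℓ r → 1 ℕ.≤ r → r ℕ.< L → r ℕ.+ ℓ ℕ.* L ℕ.≤ B → 0ℚ < sgn ℓ * y ((r ℕ.+ ℓ ℕ.* L) ℕ.* κ)
      first : ∀ m → suc m ℕ.+ κ ℕ.≤ L ℕ.* κ → 0ℚ < y (suc m)

  sign-table : ∀ L B → 1 ℕ.≤ L → SignTable L B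
  sign-table L@(suc L′) B _ = record { n = n ; κ = κ ; 0<κ = ℕ.≤-trans (s≤s z≤n) κ-large ; sign = sign ; first = first }
    where
    -- As 2W = n, `small-angle` shows that the half-turn K = K′ + 1 is longer than W = Lc, so κ = K
    -- / L is at least c. By c > LB + B one κ outweighs the rounding error ρℓ ≤ LB, where K = ρ +
    -- κL, and also the at most B indices lost to turns.
    c W n : ℕ
    c = suc (L ℕ.* B ℕ.+ B)
    W = L ℕ.* c
    n = W ℕ.+ W
    1≤n : 1 ℕ.≤ n
    1≤n = s≤s z≤n
    open Rotation n hiding (x)
    t = half-turn 1≤n
    open HalfTurn t
    W<K′ : W ℕ.< K′
    W<K′ = ℕ.≰⇒> λ K′≤W → ℚ.<-irrefl refl (ℚ.<-≤-trans (y-positive 1≤n K′ (ℕ.+-mono-≤ K′≤W K′≤W)) after)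
    κ ρ : ℕ
    κ = suc K′ / L
    ρ = suc K′ % L
    K≡ : suc K′ ≡ ρ ℕ.+ κ ℕ.* L
    K≡ = m≡m%n+[m/n]*n (suc K′) L
    ρ<L : ρ ℕ.< L
    ρ<L = m%n<n (suc K′) L
    κ-large : c ℕ.≤ κ
    κ-large = ℕ.≮⇒≥ λ κ<c → ℕ.<-irrefl refl (begin-strict
      ρ ℕ.+ κ ℕ.* L  <⟨ ℕ.+-monoˡ-< (κ ℕ.* L) ρ<L ⟩
      suc κ ℕ.* L    ≤⟨ ℕ.*-monoˡ-≤ L κ<c ⟩
      c ℕ.* L        ≡⟨ ℕ.*-comm c L ⟩
      W              ≤⟨ ℕ.<⇒≤ (ℕ.<-trans W<K′ (ℕ.n<1+n K′)) ⟩
      suc K′         ≡⟨ K≡ ⟩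
      ρ ℕ.+ κ ℕ.* L  ∎)
      where open ℕ.≤-Reasoning
    1≤K′ : 1 ℕ.≤ K′
    1≤K′ = ℕ.≤-trans (s≤s z≤n) W<K′
    first : ∀ m → suc m ℕ.+ κ ℕ.≤ L ℕ.* κ → 0ℚ < y (suc m)
    first m le = before m (ℕ.≤-pred (begin
      suc (suc m)            ≡⟨ ℕ.+-comm 1 (suc m) ⟩
      suc m ℕ.+ 1            ≤⟨ ℕ.+-monoʳ-≤ (suc m) (ℕ.≤-trans (s≤s z≤n) κ-large) ⟩
      suc m ℕ.+ κ            ≤⟨ le ⟩
      L ℕ.* κ                ≡⟨ ℕ.*-comm L κ ⟩
      κ ℕ.* L                ≤⟨ ℕ.m≤n+m (κ ℕ.* L) ρ ⟩
      ρ ℕ.+ κ ℕ.* L          ≡⟨ K≡ ⟨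
      suc K′                 ∎))
      where open ℕ.≤-Reasoning
    sign : ∀ ℓ r → 1 ℕ.≤ r → r ℕ.< L → r ℕ.+ ℓ ℕ.* L ℕ.≤ B → 0ℚ < sgn ℓ * y ((r ℕ.+ ℓ ℕ.* L) ℕ.* κ)
    sign ℓ r 1≤r r<L le = subst (λ i → 0ℚ < sgn ℓ * y i) index
        (sign-after-turns t 1≤K′ ℓ r″ (subst (λ i → i ℕ.+ ℓ ℕ.≤ K′) r′≡ (ℕ.≤-pred bound)))
      where
      open ℕ.≤-Reasoning
      ℓ≤B : ℓ ℕ.≤ B
      ℓ≤B = begin
        ℓ                 ≤⟨ ℕ.m≤m*n ℓ L ⟩
        ℓ ℕ.* L           ≤⟨ ℕ.m≤n+m (ℓ ℕ.* L) r ⟩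
        r ℕ.+ ℓ ℕ.* L     ≤⟨ le ⟩
        B                 ∎
      ρℓ<κ : ρ ℕ.* ℓ ℕ.< κ
      ρℓ<κ = begin-strict
        ρ ℕ.* ℓ           ≤⟨ ℕ.*-mono-≤ (ℕ.<⇒≤ ρ<L) ℓ≤B ⟩
        L ℕ.* B           ≤⟨ ℕ.m≤m+n (L ℕ.* B) B ⟩
        L ℕ.* B ℕ.+ B     <⟨ κ-large ⟩
        κ                 ∎
      κ≤rκ : κ ℕ.≤ r ℕ.* κ
      κ≤rκ = ℕ.m≤n*m κ r {{ℕ.>-nonZero 1≤r}}
      -- The index (r + ℓL) κ consists of ℓ half-turns K and the rest rκ - ρℓ, which is positive
      -- because ρℓ < κ.
      r′ = r ℕ.* κ ℕ.∸ ρ ℕ.* ℓ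
      r′+ : r′ ℕ.+ ρ ℕ.* ℓ ≡ r ℕ.* κ
      r′+ = ℕ.m∸n+n≡m (ℕ.<⇒≤ (ℕ.<-≤-trans ρℓ<κ κ≤rκ))
      1≤r′ : 1 ℕ.≤ r′
      1≤r′ = ℕ.m<n⇒0<n∸m (ℕ.<-≤-trans ρℓ<κ κ≤rκ)
      r″ = ℕ.pred r′
      r′≡ : r′ ≡ suc r″
      r′≡ = sym (ℕ.suc-pred r′ {{ℕ.>-nonZero 1≤r′}})
      bound : r′ ℕ.+ ℓ ℕ.< suc K′
      bound = begin-strict
        r′ ℕ.+ ℓ                ≤⟨ ℕ.+-monoˡ-≤ ℓ (ℕ.m∸n≤m (r ℕ.* κ) (ρ ℕ.* ℓ)) ⟩
        r ℕ.* κ ℕ.+ ℓ           <⟨ ℕ.+-monoʳ-< (r ℕ.* κ) (ℕ.≤-<-trans ℓ≤B (ℕ.<-≤-trans (s≤s (ℕ.m≤n+m B (L ℕ.* B))) κ-large)) ⟩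
        r ℕ.* κ ℕ.+ κ           ≡⟨ ℕ.+-comm (r ℕ.* κ) κ ⟩
        suc r ℕ.* κ             ≤⟨ ℕ.*-monoˡ-≤ κ r<L ⟩
        L ℕ.* κ                 ≡⟨ ℕ.*-comm L κ ⟩
        κ ℕ.* L                 ≤⟨ ℕ.m≤n+m (κ ℕ.* L) ρ ⟩
        ρ ℕ.+ κ ℕ.* L           ≡⟨ K≡ ⟨
        suc K′                  ∎
      index : suc r″ ℕ.+ ℓ ℕ.* suc K′ ≡ (r ℕ.+ ℓ ℕ.* L) ℕ.* κ
      index = trans (cong₂ (λ a b → a ℕ.+ ℓ ℕ.* b) (sym r′≡) K≡)
        (trans (NS.solve 5 (λ r′ ρ ℓ κ L → r′ NS.:+ ℓ NS.:* (ρ NS.:+ κ NS.:* L) NS.:= (r′ NS.:+ ρ NS.:* ℓ) NS.:+ ℓ NS.:* L NS.:* κ) refl r′ ρ ℓ κ L)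
          (trans (cong (ℕ._+ ℓ ℕ.* L ℕ.* κ) r′+) (sym (ℕ.*-distribʳ-+ κ r (ℓ ℕ.* L)))))
        where module NS = Data.Nat.Solver.+-*-Solver

-- Lipschitz functions on rational intervals and bisection.

module Analysis where

  open Kit
  open Poly
  open Reals
  open Complex
  open Gauss using (module ℤℚE; denominator-*)
  open Signs using (ν; ν≡fromℤ; ν-1; ν-suc; ν-mono-<; 0≤ν)
  open import Data.Empty using (⊥-elim)
  open import Data.Integer as ℤ using (ℤ) renaming (+_ to pos)
  import Data.Integer.Properties as ℤ
  open import Data.Nat as ℕ using (ℕ; zero; suc; z≤n; s≤s)
  import Data.Nat.Properties as ℕ
  open import Data.Product using (Σ-syntax; ∃-syntax; _×_; _,_; proj₁; proj₂)
  open import Data.Rational as ℚ using (ℚ; 0ℚ; 1ℚ; ½; _+_; _*_; _-_; -_; _≤_; _<_; ∣_∣; ↥_; ↧_)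
  import Data.Rational.Properties as ℚ
  open import Data.Sum using (_⊎_; inj₁; inj₂)
  open import Data.Vec using (Vec; []; _∷_)
  open import Relation.Binary.PropositionalEquality
  open import Relation.Nullary using (Dec; yes; no)

  archimedean : ∀ q → ∃[ n ] q ≤ ν n
  archimedean q with q ℚ.≤? 0ℚ
  ... | yes q≤0 = 0 , ℚ.≤-trans q≤0 (0≤ν 0)
  ... | no  q≰0 = ℤ.∣ ↥ q ∣ , subst (q ≤_) (sym (ν≡fromℤ ℤ.∣ ↥ q ∣)) (ℚ.≤-trans q≤num (fromℤ-mono-≤ (i≤∣i∣ (↥ q))))
    where
    i≤∣i∣ : ∀ i → i ℤ.≤ pos ℤ.∣ i ∣
    i≤∣i∣ (ℤ.+ n)      = ℤ.≤-refl
    i≤∣i∣ ℤ.-[1+ n ] = ℤ.-≤+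
    1≤den : ∀ q → pos 1 ℤ.≤ ↧ q
    1≤den (ℚ.mkℚ _ _ _) = ℤ.+≤+ (s≤s z≤n)
    q≤num : q ≤ fromℤ (↥ q)
    q≤num = subst₂ _≤_ (ℚ.*-identityˡ q) (denominator-* q)
      (ℚ.*-monoʳ-≤-nonNeg q {{ℚ.nonNegative (ℚ.<⇒≤ (ℚ.≰⇒> q≰0))}} (fromℤ-mono-≤ (1≤den q)))

  -- Totalised by 0 at nonpositive arguments, so that it can be composed like any function on ℚ.
  inv : ℚ → ℚ
  inv q = go (0ℚ ℚ.<? q)
    where
    go : Dec (0ℚ < q) → ℚ
    go (yes 0<q) = proj₁ (recip 0<q)
    go (no _)    = 0ℚ

  inv-inverse : ∀ {q} → 0ℚ < q → q * inv q ≡ 1ℚ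
  inv-inverse {q} 0<q with 0ℚ ℚ.<? q
  ... | yes h = proj₂ (proj₂ (recip h))
  ... | no ¬h = ⊥-elim (¬h 0<q)

  inv-positive : ∀ {q} → 0ℚ < q → 0ℚ < inv q
  inv-positive {q} 0<q with 0ℚ ℚ.<? q
  ... | yes h = proj₁ (proj₂ (recip h))
  ... | no ¬h = ⊥-elim (¬h 0<q)

  inv≤1 : ∀ {q} → 1ℚ ≤ q → inv q ≤ 1ℚ
  inv≤1 {q} 1≤q = subst₂ _≤_ (ℚ.*-identityˡ (inv q)) (inv-inverse 0<q)
    (ℚ.*-monoʳ-≤-nonNeg (inv q) {{ℚ.nonNegative (ℚ.<⇒≤ (inv-positive 0<q))}} 1≤q)
    where 0<q = ℚ.<-≤-trans 0<1 1≤q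

  inv-difference : ∀ {a b} → 1ℚ ≤ a → 1ℚ ≤ b → ∣ inv a - inv b ∣ ≤ ∣ a - b ∣
  inv-difference {a} {b} 1≤a 1≤b = subst₂ _≤_ eq (ℚ.*-identityʳ ∣ a - b ∣)
    (ℚ.*-monoˡ-≤-nonNeg ∣ a - b ∣ {{ℚ.nonNegative (ℚ.0≤∣p∣ (a - b))}}
      (subst (ia * ib ≤_) (ℚ.*-identityˡ 1ℚ) (*-mono-≤-nonNeg (ℚ.<⇒≤ 0<ia) (ℚ.<⇒≤ 0<1) (inv≤1 1≤a) (inv≤1 1≤b))))
    where
    open ℚS
    ia = inv a
    ib = inv b
    0<a = ℚ.<-≤-trans 0<1 1≤a
    0<b = ℚ.<-≤-trans 0<1 1≤b
    0<ia = inv-positive 0<a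
    0<ib = inv-positive 0<b
    split : (b - a) * (ia * ib) ≡ ia - ib
    split = trans (solve 4 (λ a b x y → (b :- a) :* (x :* y) := (b :* y) :* x :- (a :* x) :* y) refl a b ia ib)
      (trans (cong₂ (λ u v → u * ia - v * ib) (inv-inverse 0<b) (inv-inverse 0<a)) (cong₂ _-_ (ℚ.*-identityˡ ia) (ℚ.*-identityˡ ib)))
    eq : ∣ a - b ∣ * (ia * ib) ≡ ∣ ia - ib ∣
    eq = trans (cong₂ _*_ (∣-∣-comm a b) (sym (ℚ.0≤p⇒∣p∣≡p (ℚ.<⇒≤ (0<-* 0<ia 0<ib)))))
      (trans (sym (ℚ.∣p*q∣≡∣p∣*∣q∣ (b - a) (ia * ib))) (cong ∣_∣ split))

  -- Weak inequalities, so that a zero at an end point counts as a sign change.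
  OppositeSigns : ℚ → ℚ → Set
  OppositeSigns a b = (a ≤ 0ℚ × 0ℚ ≤ b) ⊎ (0ℚ ≤ a × b ≤ 0ℚ)

  module Interval (p q : ℚ) where

    In : ℚ → Set
    In x = p ≤ x × x ≤ q

    -- The bound is carried along because the slope of a product depends on it.
    record Lipschitz (f : ℚ → ℚ) : Set where
      field
        bound slope : ℚ
        0≤bound     : 0ℚ ≤ bound
        0≤slope     : 0ℚ ≤ slope
        bounded     : ∀ {x} → In x → ∣ f x ∣ ≤ bound
        lipschitz   : ∀ {x y} → In x → In y → ∣ f x - f y ∣ ≤ slope * ∣ x - y ∣

    open Lipschitz

    lip-const : ∀ c → Lipschitz (λ _ → c)
    lip-const c = record
      { bound = ∣ c ∣ ; slope = 0ℚ ; 0≤bound = ℚ.0≤∣p∣ c ; 0≤slope = ℚ.≤-refl ; bounded = λ _ → ℚ.≤-refl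
      ; lipschitz = λ {x} {y} _ _ → ℚ.≤-reflexive (trans (cong ∣_∣ (ℚ.+-inverseʳ c)) (sym (ℚ.*-zeroˡ ∣ x - y ∣))) }

    lip-id : Lipschitz (λ x → x)
    lip-id = record
      { bound = ∣ p ∣ + ∣ q ∣ ; slope = 1ℚ ; 0≤bound = 0≤-+ (ℚ.0≤∣p∣ p) (ℚ.0≤∣p∣ q) ; 0≤slope = ℚ.<⇒≤ 0<1
      ; bounded = λ {x} (p≤x , x≤q) → ∣∣≤
          (ℚ.≤-trans x≤q (ℚ.≤-trans (p≤∣p∣ q) (subst (_≤ ∣ p ∣ + ∣ q ∣) (ℚ.+-identityˡ ∣ q ∣) (ℚ.+-monoˡ-≤ ∣ q ∣ (ℚ.0≤∣p∣ p)))))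
          (ℚ.≤-trans (ℚ.neg-antimono-≤ p≤x) (ℚ.≤-trans (-p≤∣p∣ p) (subst (_≤ ∣ p ∣ + ∣ q ∣) (ℚ.+-identityʳ ∣ p ∣) (ℚ.+-monoʳ-≤ ∣ p ∣ (ℚ.0≤∣p∣ q)))))
      ; lipschitz = λ {x} {y} _ _ → ℚ.≤-reflexive (sym (ℚ.*-identityˡ ∣ x - y ∣)) }

    lip-+ : ∀ {f g} → Lipschitz f → Lipschitz g → Lipschitz (λ x → f x + g x)
    lip-+ {f} {g} F G = record
      { bound = bound F + bound G ; slope = slope F + slope G
      ; 0≤bound = 0≤-+ (0≤bound F) (0≤bound G) ; 0≤slope = 0≤-+ (0≤slope F) (0≤slope G)
      ; bounded = λ {x} i → ℚ.≤-trans (ℚ.∣p+q∣≤∣p∣+∣q∣ (f x) (g x)) (ℚ.+-mono-≤ (bounded F i) (bounded G i))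
      ; lipschitz = λ {x} {y} i j → subst₂ _≤_
          (cong ∣_∣ (solve 4 (λ a b c d → (a :- b) :+ (c :- d) := (a :+ c) :- (b :+ d)) refl (f x) (f y) (g x) (g y)))
          (sym (ℚ.*-distribʳ-+ ∣ x - y ∣ (slope F) (slope G)))
          (ℚ.≤-trans (ℚ.∣p+q∣≤∣p∣+∣q∣ (f x - f y) (g x - g y)) (ℚ.+-mono-≤ (lipschitz F i j) (lipschitz G i j))) }
      where open ℚS

    lip-neg : ∀ {f} → Lipschitz f → Lipschitz (λ x → - f x)
    lip-neg {f} F = record
      { bound = bound F ; slope = slope F ; 0≤bound = 0≤bound F ; 0≤slope = 0≤slope F
      ; bounded = λ {x} i → subst (_≤ bound F) (sym (ℚ.∣-p∣≡∣p∣ (f x))) (bounded F i)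
      ; lipschitz = λ {x} {y} i j → subst (_≤ slope F * ∣ x - y ∣)
          (trans (sym (ℚ.∣-p∣≡∣p∣ (f x - f y))) (cong ∣_∣ (ℚ.neg-distrib-+ (f x) (- f y)))) (lipschitz F i j) }

    lip-* : ∀ {f g} → Lipschitz f → Lipschitz g → Lipschitz (λ x → f x * g x)
    lip-* {f} {g} F G = record
      { bound = bound F * bound G ; slope = slope F * bound G + bound F * slope G
      ; 0≤bound = 0≤-* (0≤bound F) (0≤bound G)
      ; 0≤slope = 0≤-+ (0≤-* (0≤slope F) (0≤bound G)) (0≤-* (0≤bound F) (0≤slope G))
      ; bounded = λ {x} i → subst (_≤ bound F * bound G) (sym (ℚ.∣p*q∣≡∣p∣*∣q∣ (f x) (g x)))
          (*-mono-≤-nonNeg (ℚ.0≤∣p∣ (f x)) (0≤bound G) (bounded F i) (bounded G i))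
      ; lipschitz = λ {x} {y} i j → subst₂ _≤_
          (cong ∣_∣ (solve 4 (λ a b c d → (a :- b) :* c :+ b :* (c :- d) := a :* c :- b :* d) refl (f x) (f y) (g x) (g y)))
          (solve 5 (λ a b c d e → (a :* e) :* b :+ c :* (d :* e) := (a :* b :+ c :* d) :* e) refl (slope F) (bound G) (bound F) (slope G) (∣ x - y ∣))
          (ℚ.≤-trans (ℚ.∣p+q∣≤∣p∣+∣q∣ ((f x - f y) * g x) (f y * (g x - g y))) (ℚ.+-mono-≤
            (subst (_≤ (slope F * ∣ x - y ∣) * bound G) (sym (ℚ.∣p*q∣≡∣p∣*∣q∣ (f x - f y) (g x)))
              (*-mono-≤-nonNeg (ℚ.0≤∣p∣ (f x - f y)) (0≤bound G) (lipschitz F i j) (bounded G i)))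
            (subst (_≤ bound F * (slope G * ∣ x - y ∣)) (sym (ℚ.∣p*q∣≡∣p∣*∣q∣ (f y) (g x - g y)))
              (*-mono-≤-nonNeg (ℚ.0≤∣p∣ (f y)) (0≤-* (0≤slope G) (ℚ.0≤∣p∣ (x - y))) (bounded F j) (lipschitz G i j))))) }
      where open ℚS

    lip-inv : ∀ {f} → Lipschitz f → (∀ {x} → In x → 1ℚ ≤ f x) → Lipschitz (λ x → inv (f x))
    lip-inv {f} F 1≤f = record
      { bound = 1ℚ ; slope = slope F ; 0≤bound = ℚ.<⇒≤ 0<1 ; 0≤slope = 0≤slope F
      ; bounded = λ {x} i → subst (_≤ 1ℚ) (sym (ℚ.0≤p⇒∣p∣≡p (ℚ.<⇒≤ (inv-positive (ℚ.<-≤-trans 0<1 (1≤f i)))))) (inv≤1 (1≤f i))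
      ; lipschitz = λ {x} {y} i j → ℚ.≤-trans (inv-difference (1≤f i) (1≤f j)) (lipschitz F i j) }

    lip-evalM : ∀ {d} (R : Vec ℤ d) {g} → Lipschitz g → Lipschitz (λ x → ℤℚE.evalM R (g x))
    lip-evalM []      G = lip-const 1ℚ
    lip-evalM (a ∷ R) G = lip-+ (lip-const (fromℤ a)) (lip-* G (lip-evalM R G))

    -- Bisection yields a sequence in the parameter, along which several functions are taken to the
    -- limit. Reals obtained from one path, such as α and 1/α or the coordinates of a point of the
    -- circle, satisfy their relations term by term.
    record Path : Set where
      field
        τ      : ℕ → ℚ
        inside : ∀ n → In (τ n)
        cauchy-τ : IsCauchy τ

    module _ (path : Path) where
      open Path path

      limit : ∀ {g} → Lipschitz g → ℝ
      limit {g} G = mkℝ (λ n → g (τ n)) λ ε 0<ε →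
        let (C , 0<C , eq) = recip {slope G + 1ℚ} (subst (0ℚ <_) (ℚ.+-comm 1ℚ (slope G)) (0<-≤-+ 0<1 (0≤slope G)))
            (N , h) = cauchy-τ (C * ε) (0<-* 0<C 0<ε)
        in N , λ m n N≤m N≤n → ℚ.≤-<-trans (lipschitz G (inside m) (inside n)) (scaled C ε eq 0<C (0≤slope G) (ℚ.0≤∣p∣ (τ m - τ n)) (h m n N≤m N≤n))
        where
        scaled : ∀ C ε {s d} → (s + 1ℚ) * C ≡ 1ℚ → 0ℚ < C → 0ℚ ≤ s → 0ℚ ≤ d → d < C * ε → s * d < ε
        scaled C ε {s} {d} eq 0<C 0≤s 0≤d d< = ℚ.≤-<-trans
          (subst (_≤ (s + 1ℚ) * d) refl (ℚ.*-monoʳ-≤-nonNeg d {{ℚ.nonNegative 0≤d}} (subst (_≤ s + 1ℚ) (ℚ.+-identityʳ s) (ℚ.+-monoʳ-≤ s (ℚ.<⇒≤ 0<1)))))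
          (subst ((s + 1ℚ) * d <_) (trans (sym (ℚ.*-assoc (s + 1ℚ) C ε)) (trans (cong (_* ε) eq) (ℚ.*-identityˡ ε)))
            (ℚ.*-monoʳ-<-pos (s + 1ℚ) {{ℚ.positive (ℚ.<-≤-trans 0<1 (subst (_≤ s + 1ℚ) (ℚ.+-identityˡ 1ℚ) (ℚ.+-monoˡ-≤ 1ℚ 0≤s)))}} d<))

    module Bisection (p≤q : p ≤ q) {f : ℚ → ℚ} (F : Lipschitz f) (fp≤0 : f p ≤ 0ℚ) (0≤fq : 0ℚ ≤ f q) where

      record Bracket : Set where
        field
          lo hi : ℚ
          p≤lo  : p ≤ lo
          lo≤hi : lo ≤ hi
          hi≤q  : hi ≤ q
          flo≤0 : f lo ≤ 0ℚ
          0≤fhi : 0ℚ ≤ f hi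

      open Bracket

      mid : ℚ → ℚ → ℚ
      mid a b = ½ * (a + b)

      mid+mid : ∀ a b → mid a b + mid a b ≡ a + b
      mid+mid a b = ½+½ (a + b)

      module _ {a b m : ℚ} (2m : m + m ≡ a + b) where
        open ℚS
        private
          halfway : m - a ≡ b - m
          halfway = trans (solve 2 (λ m a → m :- a := (m :+ m) :- a :- m) refl m a)
            (trans (cong (λ s → s - a - m) 2m) (solve 3 (λ m a b → (a :+ b) :- a :- m := b :- m) refl m a b))

          double-nonNeg : ∀ {c} → 0ℚ ≤ c + c → 0ℚ ≤ c
          double-nonNeg {c} h = ℚ.≮⇒≥ λ c<0 → ℚ.<-irrefl refl (ℚ.≤-<-trans h (ℚ.+-mono-< {c} {0ℚ} {c} {0ℚ} c<0 c<0))

        left-half : (m - a) + (m - a) ≡ b - a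
        left-half = trans (cong ((m - a) +_) halfway) (solve 3 (λ m a b → (m :- a) :+ (b :- m) := b :- a) refl m a b)

        right-half : (b - m) + (b - m) ≡ b - a
        right-half = trans (cong (_+ (b - m)) (sym halfway)) (solve 3 (λ m a b → (m :- a) :+ (b :- m) := b :- a) refl m a b)

        a≤m : a ≤ b → a ≤ m
        a≤m a≤b = 0≤-⇒≤ (double-nonNeg (subst (0ℚ ≤_) (sym left-half) (≤⇒0≤- a≤b)))

        m≤b : a ≤ b → m ≤ b
        m≤b a≤b = 0≤-⇒≤ (double-nonNeg (subst (0ℚ ≤_) (sym right-half) (≤⇒0≤- a≤b)))

      record Halves (B B′ : Bracket) : Set where
        field
          lo≤lo′ : lo B ≤ lo B′
          hi′≤hi : hi B′ ≤ hi B
          width  : (hi B′ - lo B′) + (hi B′ - lo B′) ≡ hi B - lo B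

      halve : (B : Bracket) → Σ[ B′ ∈ Bracket ] Halves B B′
      halve B = go (f m ℚ.≤? 0ℚ)
        where
        m = mid (lo B) (hi B)
        2m = mid+mid (lo B) (hi B)
        go : Dec (f m ≤ 0ℚ) → Σ[ B′ ∈ Bracket ] Halves B B′
        go (yes fm≤0) = record { lo = m ; hi = hi B ; p≤lo = ℚ.≤-trans (p≤lo B) (a≤m {lo B} {hi B} {m} 2m (lo≤hi B)) ; lo≤hi = m≤b {lo B} {hi B} {m} 2m (lo≤hi B)
                               ; hi≤q = hi≤q B ; flo≤0 = fm≤0 ; 0≤fhi = 0≤fhi B } ,
                        record { lo≤lo′ = a≤m {lo B} {hi B} {m} 2m (lo≤hi B) ; hi′≤hi = ℚ.≤-refl ; width = right-half {lo B} {hi B} {m} 2m }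
        go (no fm≰0)  = record { lo = lo B ; hi = m ; p≤lo = p≤lo B ; lo≤hi = a≤m {lo B} {hi B} {m} 2m (lo≤hi B)
                               ; hi≤q = ℚ.≤-trans (m≤b {lo B} {hi B} {m} 2m (lo≤hi B)) (hi≤q B) ; flo≤0 = flo≤0 B ; 0≤fhi = ℚ.<⇒≤ (ℚ.≰⇒> fm≰0) } ,
                        record { lo≤lo′ = ℚ.≤-refl ; hi′≤hi = m≤b {lo B} {hi B} {m} 2m (lo≤hi B) ; width = left-half {lo B} {hi B} {m} 2m }

      bracket : ℕ → Bracket
      bracket zero    = record { lo = p ; hi = q ; p≤lo = ℚ.≤-refl ; lo≤hi = p≤q ; hi≤q = ℚ.≤-refl ; flo≤0 = fp≤0 ; 0≤fhi = 0≤fq }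
      bracket (suc n) = proj₁ (halve (bracket n))

      halves : ∀ n → Halves (bracket n) (bracket (suc n))
      halves n = proj₂ (halve (bracket n))

      width : ℕ → ℚ
      width n = hi (bracket n) - lo (bracket n)

      0≤width : ∀ n → 0ℚ ≤ width n
      0≤width n = ≤⇒0≤- (lo≤hi (bracket n))

      -- Weaker than halving but free of powers: n + 2 ≤ 2(n + 1).
      width-bound : ∀ n → ν (suc n) * width n ≤ width 0
      width-bound zero = ℚ.≤-reflexive (trans (cong (_* width 0) ν-1) (ℚ.*-identityˡ (width 0)))
      width-bound (suc n) = ℚ.≤-trans (0≤-⇒≤ (subst (0ℚ ≤_) eq (0≤-* (0≤ν n) (0≤width (suc n))))) (width-bound n)
        where
        open ℚS
        w = width (suc n)
        eq : ν n * w ≡ ν (suc n) * width n - ν (suc (suc n)) * w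
        eq = trans (solve 2 (λ ν w → ν :* w := (:1 :+ ν) :* (w :+ w) :- (:1 :+ (:1 :+ ν)) :* w) refl (ν n) w)
          (trans (cong₂ (λ a b → a * b - (1ℚ + a) * w) (sym (ν-suc n)) (Halves.width (halves n)))
                 (cong (λ c → ν (suc n) * width n - c * w) (sym (ν-suc (suc n)))))

      lo-mono : ∀ {m n} → m ℕ.≤ n → lo (bracket m) ≤ lo (bracket n)
      lo-mono m≤n = go (ℕ.≤⇒≤′ m≤n)
        where
        go : ∀ {m n} → m ℕ.≤′ n → lo (bracket m) ≤ lo (bracket n)
        go ℕ.≤′-refl           = ℚ.≤-refl
        go (ℕ.≤′-step {n} m≤n) = ℚ.≤-trans (go m≤n) (Halves.lo≤lo′ (halves n))

      hi-anti : ∀ {m n} → m ℕ.≤ n → hi (bracket n) ≤ hi (bracket m)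
      hi-anti m≤n = go (ℕ.≤⇒≤′ m≤n)
        where
        go : ∀ {m n} → m ℕ.≤′ n → hi (bracket n) ≤ hi (bracket m)
        go ℕ.≤′-refl           = ℚ.≤-refl
        go (ℕ.≤′-step {n} m≤n) = ℚ.≤-trans (Halves.hi′≤hi (halves n)) (go m≤n)

      width-anti : ∀ {m n} → m ℕ.≤ n → width n ≤ width m
      width-anti m≤n = ℚ.+-mono-≤ (hi-anti m≤n) (ℚ.neg-antimono-≤ (lo-mono m≤n))

      width-small : ∀ ε → 0ℚ < ε → ∃[ N ] (∀ n → N ℕ.≤ n → width n < ε)
      width-small ε 0<ε = N , λ n N≤n → ℚ.≤-<-trans (width-anti N≤n) (small-N)
        where
        C = proj₁ (recip 0<ε)
        N = proj₁ (archimedean (C * width 0))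
        small-N : width N < ε
        small-N = ℚ.≰⇒> λ ε≤w → ℚ.<-irrefl refl (ℚ.≤-<-trans
          (ℚ.≤-trans (ℚ.*-monoˡ-≤-nonNeg (ν (suc N)) {{ℚ.nonNegative (0≤ν (suc N))}} ε≤w) (ℚ.≤-trans (width-bound N) w0≤))
          (ℚ.*-monoˡ-<-pos ε {{ℚ.positive 0<ε}} (ν-mono-< (ℕ.n<1+n N))))
          where
          w0≤ : width 0 ≤ ν N * ε
          w0≤ = subst (_≤ ν N * ε) (trans (ℚ.*-comm (C * width 0) ε) (trans (sym (ℚ.*-assoc ε C (width 0)))
                  (trans (cong (_* width 0) (proj₂ (proj₂ (recip 0<ε)))) (ℚ.*-identityˡ (width 0)))))
            (ℚ.*-monoʳ-≤-nonNeg ε {{ℚ.nonNegative (ℚ.<⇒≤ 0<ε)}} (proj₂ (archimedean (C * width 0))))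

      path : Path
      path = record
        { τ = λ n → lo (bracket n)
        ; inside = λ n → p≤lo (bracket n) , ℚ.≤-trans (lo≤hi (bracket n)) (hi≤q (bracket n))
        ; cauchy-τ = λ ε 0<ε → let (N , h) = width-small ε 0<ε in N , λ m n N≤m N≤n →
            ℚ.≤-<-trans (∣∣≤ (close N≤m N≤n) (subst (_≤ width N) (solve 2 (λ a b → b :- a := :- (a :- b)) refl (lo (bracket m)) (lo (bracket n))) (close N≤n N≤m))) (h N ℕ.≤-refl) }
        where
        open ℚS
        close : ∀ {N m n} → N ℕ.≤ m → N ℕ.≤ n → lo (bracket m) - lo (bracket n) ≤ width N
        close {N} {m} N≤m N≤n = ℚ.+-mono-≤ (ℚ.≤-trans (lo≤hi (bracket m)) (hi-anti N≤m)) (ℚ.neg-antimono-≤ (lo-mono N≤n))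

      -- From f(lo) ≤ 0 ≤ f(hi) follows ∣f(lo)∣ ≤ f(hi) - f(lo), which is at most slope times width.
      value-null : Null (λ n → f (lo (bracket n)))
      value-null = Null-dominated bound-n (Null-slope)
        where
        open ℚS
        s = slope F
        bound-n : ∀ n → ∣ f (lo (bracket n)) ∣ ≤ ∣ width n * s ∣
        bound-n n = ∣∣≤
          (ℚ.≤-trans (flo≤0 B) (ℚ.0≤∣p∣ _))
          (ℚ.≤-trans (0≤-⇒≤ (subst (0ℚ ≤_) (solve 2 (λ a b → b := (b :- a) :- (:- a)) refl (f (lo B)) (f (hi B))) (0≤fhi B)))
            (ℚ.≤-trans (p≤∣p∣ (f (hi B) - f (lo B)))
              (ℚ.≤-trans (lipschitz F (ℚ.≤-trans (p≤lo B) (lo≤hi B) , hi≤q B) (p≤lo B , ℚ.≤-trans (lo≤hi B) (hi≤q B)))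
                (ℚ.≤-reflexive (trans (cong (s *_) (ℚ.0≤p⇒∣p∣≡p (0≤width n))) (trans (ℚ.*-comm s (width n)) (sym (ℚ.0≤p⇒∣p∣≡p (0≤-* (0≤width n) (0≤slope F))))))))))
          where B = bracket n
        Null-slope : Null (λ n → width n * s)
        Null-slope = Null-* (λ ε 0<ε → let (N , h) = width-small ε 0<ε in
          N , λ n N≤n → subst (_< ε) (sym (ℚ.0≤p⇒∣p∣≡p (0≤width n))) (h n N≤n)) (fromℚ s)

    intermediate-value : p ≤ q → ∀ {f} → Lipschitz f → OppositeSigns (f p) (f q) → Σ[ P ∈ Path ] Null (λ n → f (Path.τ P n))
    intermediate-value p≤q F (inj₁ (a , b)) = B.path , B.value-null
      where module B = Bisection p≤q F a b
    intermediate-value p≤q {f} F (inj₂ (a , b)) = B.path , Null-cong (λ n → solve 1 (λ a → :- (:- a) := a) refl (f _)) (Null-neg B.value-null)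
      where
      open ℚS
      module B = Bisection p≤q (lip-neg F) (ℚ.neg-antimono-≤ a) (ℚ.neg-antimono-≤ b)

  ℤ→ℝ : Hom ℤ-ring ℝ-ring
  ℤ→ℝ = ℚ→ℝ ∘ₕ ℤ→ℚ

  module ℤℝE = Evaluation ℤ→ℝ

  seq-evalM : ∀ {d} (p : Vec ℤ d) x n → seq (ℤℝE.evalM p x) n ≡ ℤℚE.evalM p (seq x n)
  seq-evalM []      x n = refl
  seq-evalM (a ∷ p) x n = cong (λ v → fromℤ a + seq x n * v) (seq-evalM p x n)

  null-root : ∀ {d} (R : Vec ℤ d) r → Null (λ n → ℤℚE.evalM R (seq r n)) → ℤℝE.evalM R r ≋ 0ℝ
  null-root R r h = Null⇒≈0 (Null-cong (λ n → sym (seq-evalM R r n)) h)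

-- Sample points in (-2, 2) and the signs of the polynomials there.

module Sampling where

  open Poly
  open Reals
  open Complex
  open Gauss using (module ℤℚE)
  open Lucas
  open Signs
  open Analysis
  open import Data.Empty using (⊥; ⊥-elim)
  open import Algebra.Bundles using (CommutativeRing)
  open import Data.Integer using (ℤ)
  open import Data.Nat as ℕ using (ℕ; zero; suc; z≤n; s≤s; _/_; _%_; NonZero)
  import Data.Nat.Properties as ℕ
  open import Data.Nat.Divisibility using (_∣_; divides)
  open import Data.Nat.DivMod using (m≡m%n+[m/n]*n; m%n<n; m<n⇒m/n≡0)
  import Data.Nat.Solver
  open import Data.Product using (_×_; _,_)
  open import Data.Rational as ℚ using (ℚ; 0ℚ; 1ℚ; _+_; _*_; _-_; -_; _≤_; _<_)
  import Data.Rational.Properties as ℚ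
  open import Data.Sum using (_⊎_; inj₁; inj₂)
  open import Data.Vec using (Vec)
  open import Relation.Binary.PropositionalEquality
  open import Relation.Nullary using (Dec; yes; no)
  open import Algebra.Properties.Semiring.Exp (CommutativeRing.semiring ℚ-ring) using (_^_)

  module NS = Data.Nat.Solver.+-*-Solver

  open Coefficients ℤ-ring using (mulM)

  division-unique : ∀ {m q} r n .{{_ : NonZero n}} → r ℕ.< n → m ≡ r ℕ.+ q ℕ.* n → m / n ≡ q
  division-unique {m} {q} r n r<n refl = ℕ.≤-antisym (ℕ.≮⇒≥ λ q< → above q<) (ℕ.≮⇒≥ λ <q → below <q)
    where
    m≡ = m≡m%n+[m/n]*n m n
    open ℕ.≤-Reasoning
    above : q ℕ.< m / n → ⊥
    above q< = ℕ.<-irrefl refl (begin-strict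
      r ℕ.+ q ℕ.* n            <⟨ ℕ.+-monoˡ-< (q ℕ.* n) r<n ⟩
      suc q ℕ.* n              ≤⟨ ℕ.*-monoˡ-≤ n q< ⟩
      m / n ℕ.* n              ≤⟨ ℕ.m≤n+m (m / n ℕ.* n) (m % n) ⟩
      m % n ℕ.+ m / n ℕ.* n    ≡⟨ m≡ ⟨
      r ℕ.+ q ℕ.* n            ∎)
    below : m / n ℕ.< q → ⊥
    below <q = ℕ.<-irrefl refl (begin-strict
      r ℕ.+ q ℕ.* n            ≡⟨ m≡ ⟩
      m % n ℕ.+ m / n ℕ.* n    <⟨ ℕ.+-monoˡ-< (m / n ℕ.* n) (m%n<n m n) ⟩
      suc (m / n) ℕ.* n        ≤⟨ ℕ.*-monoˡ-≤ n <q ⟩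
      q ℕ.* n                  ≤⟨ ℕ.m≤n+m (q ℕ.* n) r ⟩
      r ℕ.+ q ℕ.* n            ∎)

  -- A level counts multiples, so it rises by at most one from a cell to the next, and only across a
  -- multiple.
  division-step : ∀ m n .{{_ : NonZero n}} → suc m / n ≡ m / n ⊎ (suc m / n ≡ suc (m / n) × n ∣ suc m)
  division-step m n with suc (m % n) ℕ.<? n
  ... | yes r<n = inj₁ (division-unique (suc (m % n)) n r<n (cong suc (m≡m%n+[m/n]*n m n)))
  ... | no  r≮n = inj₂ (division-unique 0 n (ℕ.≤-<-trans z≤n (m%n<n m n)) eq , divides (suc (m / n)) eq)
    where
    eq : suc m ≡ suc (m / n) ℕ.* n
    eq = trans (cong suc (m≡m%n+[m/n]*n m n)) (cong (ℕ._+ m / n ℕ.* n) (ℕ.≤-antisym (m%n<n m n) (ℕ.≮⇒≥ r≮n)))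

  sgn-+ : ∀ a b → sgn (a ℕ.+ b) ≡ sgn a * sgn b
  sgn-+ zero    b = sym (ℚ.*-identityˡ (sgn b))
  sgn-+ (suc a) b = trans (cong -_ (sgn-+ a b)) (ℚ.neg-distribˡ-* (sgn a) (sgn b))

  sgn-square : ∀ a → sgn a * sgn a ≡ 1ℚ
  sgn-square zero    = ℚ.*-identityˡ 1ℚ
  sgn-square (suc a) = trans (solve 1 (λ s → (:- s) :* (:- s) := s :* s) refl (sgn a)) (sgn-square a)
    where open ℚS

  sgn-double : ∀ a → sgn (a ℕ.+ a) ≡ 1ℚ
  sgn-double a = trans (sgn-+ a a) (sgn-square a)

  -- ⌊c/P⌋ + ⌊c/2P⌋ and ⌊(c + P)/2P⌋ have the same parity.
  sgn-half : ∀ c P .{{_ : NonZero P}} .{{_ : NonZero (P ℕ.+ P)}} →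
    sgn (c / P ℕ.+ c / (P ℕ.+ P)) ≡ sgn ((c ℕ.+ P) / (P ℕ.+ P))
  sgn-half c P = go (r ℕ.<? P)
    where
    r = c % (P ℕ.+ P)
    d = c / (P ℕ.+ P)
    c≡ : c ≡ r ℕ.+ d ℕ.* (P ℕ.+ P)
    c≡ = m≡m%n+[m/n]*n c (P ℕ.+ P)
    go : Dec (r ℕ.< P) → sgn (c / P ℕ.+ d) ≡ sgn ((c ℕ.+ P) / (P ℕ.+ P))
    go (yes r<P) = trans (cong sgn (cong (ℕ._+ d) c/P≡)) (trans (sgn-+ (d ℕ.+ d) d)
        (trans (cong (_* sgn d) (sgn-double d)) (trans (ℚ.*-identityˡ (sgn d)) (cong sgn (sym c+P≡)))))
      where
      c/P≡ : c / P ≡ d ℕ.+ d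
      c/P≡ = division-unique r P r<P (trans c≡ (NS.solve 3 (λ r d P → r NS.:+ d NS.:* (P NS.:+ P) NS.:= r NS.:+ (d NS.:+ d) NS.:* P) refl r d P))
      c+P≡ : (c ℕ.+ P) / (P ℕ.+ P) ≡ d
      c+P≡ = division-unique (r ℕ.+ P) (P ℕ.+ P) (ℕ.+-monoˡ-< P r<P)
        (trans (cong (ℕ._+ P) c≡) (NS.solve 3 (λ r D P → r NS.:+ D NS.:+ P NS.:= r NS.:+ P NS.:+ D) refl r (d ℕ.* (P ℕ.+ P)) P))
    go (no r≮P) = trans (cong sgn (cong (ℕ._+ d) c/P≡)) (trans (cong -_ (sgn-+ (d ℕ.+ d) d))
        (trans (cong (λ s → - (s * sgn d)) (sgn-double d)) (trans (cong -_ (ℚ.*-identityˡ (sgn d))) (cong sgn (sym c+P≡)))))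
      where
      r′ = r ℕ.∸ P
      r′+P : r′ ℕ.+ P ≡ r
      r′+P = ℕ.m∸n+n≡m (ℕ.≮⇒≥ r≮P)
      r′<P : r′ ℕ.< P
      r′<P = ℕ.+-cancelʳ-< P r′ P (subst (ℕ._< P ℕ.+ P) (sym r′+P) (m%n<n c (P ℕ.+ P)))
      c/P≡ : c / P ≡ suc (d ℕ.+ d)
      c/P≡ = division-unique r′ P r′<P (trans c≡ (trans (cong (ℕ._+ d ℕ.* (P ℕ.+ P)) (sym r′+P))
        (NS.solve 3 (λ r d P → r NS.:+ P NS.:+ d NS.:* (P NS.:+ P) NS.:= r NS.:+ (P NS.:+ (d NS.:+ d) NS.:* P)) refl r′ d P)))
      c+P≡ : (c ℕ.+ P) / (P ℕ.+ P) ≡ suc d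
      c+P≡ = division-unique r′ (P ℕ.+ P) (ℕ.<-trans r′<P (ℕ.m<m+n P (ℕ.>-nonZero⁻¹ P)))
        (trans (cong (ℕ._+ P) (trans c≡ (cong (ℕ._+ d ℕ.* (P ℕ.+ P)) (sym r′+P))))
          (NS.solve 3 (λ r D P → r NS.:+ P NS.:+ D NS.:+ P NS.:= r NS.:+ ((P NS.:+ P) NS.:+ D)) refl r′ (d ℕ.* (P ℕ.+ P)) P))

  -- Multiplying g by h² preserves its sign and turns it into (g h) h.
  positive-factor : ∀ {a b g h w} → g * h ≡ w → 0ℚ < sgn a * w → 0ℚ < sgn b * h → 0ℚ < sgn (a ℕ.+ b) * g
  positive-factor {a} {b} {g} {h} refl hw hh = ℚ.≰⇒> λ le → ℚ.<-irrefl refl (ℚ.<-≤-trans (0<-* hw hh)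
    (subst₂ _≤_ eq (ℚ.*-zeroˡ (h * h)) (ℚ.*-monoʳ-≤-nonNeg (h * h) {{ℚ.nonNegative (0≤-square h)}} le)))
    where
    open ℚS
    eq : sgn (a ℕ.+ b) * g * (h * h) ≡ (sgn a * (g * h)) * (sgn b * h)
    eq = trans (cong (λ s → s * g * (h * h)) (sgn-+ a b))
      (solve 4 (λ a b g h → a :* b :* g :* (h :* h) := (a :* (g :* h)) :* (b :* h)) refl (sgn a) (sgn b) g h)

  -- The zeros of the polynomials have angles that are multiples of π/M, and cell c lies between
  -- πc/M and π(c+1)/M. `S q` approximates 2 cos(πq/3M), so q = 3c + 1 and 3c + 2 are the thirds of
  -- cell c. Half angles enter the sines, hence L = 6M; B bounds all indices p (3c + e) with p ≤ 2M.
  module Samples (M : ℕ) (1≤M : 1 ℕ.≤ M) where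
    L B : ℕ
    L = 3 ℕ.* (M ℕ.+ M)
    B = (M ℕ.+ M) ℕ.* (3 ℕ.* M)

    open SignTable (sign-table L B (ℕ.≤-trans 1≤M (ℕ.≤-trans (ℕ.m≤m+n M M) (ℕ.m≤m+n (M ℕ.+ M) _)))) public
    open ℚS

    private
      ι : ℚ
      ι = inv D

      ι^D^ : ∀ j → ι ^ j * D ^ j ≡ 1ℚ
      ι^D^ zero    = ℚ.*-identityˡ 1ℚ
      ι^D^ (suc j) = trans (solve 4 (λ i p D q → (i :* p) :* (D :* q) := (D :* i) :* (p :* q)) refl ι (ι ^ j) D (D ^ j))
        (trans (cong₂ _*_ (inv-inverse 0<D) (ι^D^ j)) (ℚ.*-identityˡ 1ℚ))

      0<ι^ : ∀ j → 0ℚ < ι ^ j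
      0<ι^ zero    = 0<1
      0<ι^ (suc j) = 0<-* (inv-positive 0<D) (0<ι^ j)

      0<D^ : ∀ j → 0ℚ < D ^ j
      0<D^ zero    = 0<1
      0<D^ (suc j) = 0<-* 0<D (0<D^ j)

    -- Twice the cosine of 2jθ, where θ is the angle of N + i and D^j the modulus of its 2j-th
    -- power.
    X : ℕ → ℚ
    X j = v (j ℕ.+ j) * ι ^ j

    X-v : ∀ j → X j * D ^ j ≡ v (j ℕ.+ j)
    X-v j = trans (ℚ.*-assoc (v (j ℕ.+ j)) (ι ^ j) (D ^ j)) (trans (cong (v (j ℕ.+ j) *_) (ι^D^ j)) (ℚ.*-identityʳ (v (j ℕ.+ j))))

    X-0 : X 0 ≡ 1ℚ + 1ℚ
    X-0 = solve 1 (λ s → ((:1 :+ :1) :- s :* :0) :* :1 := :1 :+ :1) refl (N + N)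

    X-decreasing : ∀ j → 0ℚ < y (suc (j ℕ.+ j)) → X (suc j) < X j
    X-decreasing j 0<y = 0<-⇒< (subst (0ℚ <_) eq (0<-* (0<-* (0<-+ (0<-+ 0<1 0<1) (0<-+ 0<1 0<1)) 0<y) (0<ι^ (suc j))))
      where
      jj = j ℕ.+ j
      a = v jj
      b = v (suc (suc jj))
      four : (1ℚ + 1ℚ) + (1ℚ + 1ℚ) ≡ D + D + D + D - (N + N) * (N + N)
      four = solve 1 (λ N → (:1 :+ :1) :+ (:1 :+ :1) := (N :* N :+ :1) :+ (N :* N :+ :1) :+ (N :* N :+ :1) :+ (N :* N :+ :1) :- (N :+ N) :* (N :+ N)) refl N
      eq : ((1ℚ + 1ℚ) + (1ℚ + 1ℚ)) * y (suc jj) * ι ^ suc j ≡ X j - X (suc j)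
      eq = trans (cong (_* ι ^ suc j) (trans (cong (_* y (suc jj)) four) (sym (v-difference jj))))
        (trans (solve 5 (λ D a b i p → (D :* a :- b) :* (i :* p) := a :* p :* (D :* i) :- b :* (i :* p)) refl D a b ι (ι ^ j))
          (cong₂ _-_ (trans (cong (a * ι ^ j *_) (inv-inverse 0<D)) (ℚ.*-identityʳ (a * ι ^ j)))
                     (cong (λ i → v i * ι ^ suc j) (cong suc (sym (ℕ.+-suc j j))))))

    -- The duplication formula gives X j + 2 = (v j)²/D^j.
    -2≤X : ∀ j → - (1ℚ + 1ℚ) ≤ X j
    -2≤X j = 0≤-⇒≤ (subst (0ℚ ≤_) eq (0≤-* (0≤-square (v j)) (ℚ.<⇒≤ (0<ι^ j))))
      where
      open Chebyshev ℤ→ℚ j (X j) (X-v j) using (v₂)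
      eq : v j * v j * ι ^ j ≡ X j - - (1ℚ + 1ℚ)
      eq = trans (solve 3 (λ v p i → v :* v :* i := (v :* v :- (p :+ p)) :* i :+ (i :* p) :* (:1 :+ :1)) refl (v j) (D ^ j) (ι ^ j))
        (trans (cong₂ (λ a b → a * ι ^ j + b * (1ℚ + 1ℚ)) (sym v₂) (ι^D^ j))
          (solve 1 (λ x → x :+ :1 :* (:1 :+ :1) := x :- :- (:1 :+ :1)) refl (X j)))

    lastIndex : ℕ
    lastIndex = (3 ℕ.* M ℕ.∸ 1) ℕ.* κ

    private
      3M≡ : suc (3 ℕ.* M ℕ.∸ 1) ≡ 3 ℕ.* M
      3M≡ = ℕ.m+[n∸m]≡n {1} (ℕ.≤-trans 1≤M (ℕ.m≤m+n M _))

      in-range : ∀ j → j ℕ.≤ lastIndex → 0ℚ < y (suc (j ℕ.+ j))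
      in-range j j≤ = first (j ℕ.+ j) (begin
        suc (j ℕ.+ j) ℕ.+ κ                              ≤⟨ ℕ.+-monoˡ-≤ κ (s≤s (ℕ.+-mono-≤ j≤ j≤)) ⟩
        suc (lastIndex ℕ.+ lastIndex) ℕ.+ κ              ≤⟨ ℕ.+-monoˡ-≤ κ (ℕ.+-monoˡ-≤ (lastIndex ℕ.+ lastIndex) 0<κ) ⟩
        κ ℕ.+ (lastIndex ℕ.+ lastIndex) ℕ.+ κ            ≡⟨ NS.solve 2 (λ k m → k NS.:+ (m NS.:* k NS.:+ m NS.:* k) NS.:+ k NS.:= ((NS.con 1 NS.:+ m) NS.:+ (NS.con 1 NS.:+ m)) NS.:* k) refl κ (3 ℕ.* M ℕ.∸ 1) ⟩
        (suc (3 ℕ.* M ℕ.∸ 1) ℕ.+ suc (3 ℕ.* M ℕ.∸ 1)) ℕ.* κ  ≡⟨ cong (λ k → (k ℕ.+ k) ℕ.* κ) 3M≡ ⟩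
        (3 ℕ.* M ℕ.+ 3 ℕ.* M) ℕ.* κ                      ≡⟨ cong (ℕ._* κ) (NS.solve 1 (λ M → NS.con 3 NS.:* M NS.:+ NS.con 3 NS.:* M NS.:= NS.con 3 NS.:* (M NS.:+ M)) refl M) ⟩
        L ℕ.* κ                                          ∎)
        where open ℕ.≤-Reasoning

    X-antitone : ∀ {i j} → i ℕ.≤ j → j ℕ.≤ suc lastIndex → X j ≤ X i
    X-antitone i≤j j≤ = go (ℕ.≤⇒≤′ i≤j) j≤
      where
      go : ∀ {i j} → i ℕ.≤′ j → j ℕ.≤ suc lastIndex → X j ≤ X i
      go ℕ.≤′-refl _ = ℚ.≤-refl
      go (ℕ.≤′-step {j} i≤j) (s≤s j≤) = ℚ.≤-trans (ℚ.<⇒≤ (X-decreasing j (in-range j j≤))) (go i≤j (ℕ.m≤n⇒m≤1+n j≤))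

    X-strict : ∀ {i j} → i ℕ.< j → j ℕ.≤ suc lastIndex → X j < X i
    X-strict {i} i<j j≤ = ℚ.≤-<-trans (X-antitone i<j j≤) (X-decreasing i (in-range i (ℕ.≤-pred (ℕ.≤-trans i<j j≤))))

    S : ℕ → ℚ
    S q = X (q ℕ.* κ)

    S-strict : ∀ {q r} → q ℕ.< r → r ℕ.< 3 ℕ.* M → S r < S q
    S-strict {q} {r} q<r r<3M = X-strict (ℕ.*-monoˡ-< κ {{ℕ.>-nonZero 0<κ}} q<r) (ℕ.m≤n⇒m≤1+n (ℕ.*-monoˡ-≤ κ (ℕ.≤-pred (subst (r ℕ.<_) (sym 3M≡) r<3M))))

    S<2 : ∀ {q} → 1 ℕ.≤ q → q ℕ.< 3 ℕ.* M → S q < 1ℚ + 1ℚ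
    S<2 {q} 1≤q q< = subst (S q <_) X-0 (S-strict 1≤q q<)

    -2<S : ∀ {q} → q ℕ.< 3 ℕ.* M → - (1ℚ + 1ℚ) < S q
    -2<S {q} q<3M = ℚ.≤-<-trans (-2≤X (suc (q ℕ.* κ)))
      (X-strict (ℕ.n<1+n (q ℕ.* κ)) (s≤s (ℕ.*-monoˡ-≤ κ (ℕ.≤-pred (subst (q ℕ.<_) (sym 3M≡) q<3M)))))

    sample-bound : ∀ {c e} → c ℕ.< M → e ℕ.≤ 2 → 3 ℕ.* c ℕ.+ e ℕ.< 3 ℕ.* M
    sample-bound {c} {e} c<M e≤2 = begin-strict
      3 ℕ.* c ℕ.+ e     <⟨ ℕ.+-monoʳ-< (3 ℕ.* c) (s≤s e≤2) ⟩
      3 ℕ.* c ℕ.+ 3     ≡⟨ NS.solve 1 (λ c → NS.con 3 NS.:* c NS.:+ NS.con 3 NS.:= NS.con 3 NS.:* (NS.con 1 NS.:+ c)) refl c ⟩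
      3 ℕ.* suc c       ≤⟨ ℕ.*-monoʳ-≤ 3 c<M ⟩
      3 ℕ.* M           ∎
      where open ℕ.≤-Reasoning

    -- sin(pψ) at ψ = π(3c + e)/6M, where the zeros are multiples of P = 2M/p.
    sine-sign : ∀ p P .{{_ : NonZero P}} → p ℕ.* P ≡ M ℕ.+ M → ∀ c e → c ℕ.< M → 1 ℕ.≤ e → e ℕ.≤ 2 →
      0ℚ < sgn (c / P) * y (p ℕ.* ((3 ℕ.* c ℕ.+ e) ℕ.* κ))
    sine-sign p P pP≡ c e c<M 1≤e e≤2 = subst (λ i → 0ℚ < sgn (c / P) * y i)
        (trans (cong (ℕ._* κ) (sym index)) (ℕ.*-assoc p (3 ℕ.* c ℕ.+ e) κ))
        (sign (c / P) r (ℕ.*-mono-≤ 1≤p (ℕ.≤-trans 1≤e (ℕ.m≤n+m e (3 ℕ.* c′)))) r<L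
          (subst (ℕ._≤ B) index (ℕ.*-mono-≤ p≤2M (ℕ.<⇒≤ (sample-bound c<M e≤2)))))
      where
      open ℕ.≤-Reasoning
      c′ = c % P
      r = p ℕ.* (3 ℕ.* c′ ℕ.+ e)
      1≤p : 1 ℕ.≤ p
      1≤p = ℕ.n≢0⇒n>0 λ p≡0 → ℕ.<-irrefl refl (begin-strict
        0           <⟨ ℕ.≤-trans 1≤M (ℕ.m≤m+n M M) ⟩
        M ℕ.+ M     ≡⟨ pP≡ ⟨
        p ℕ.* P     ≡⟨ cong (ℕ._* P) p≡0 ⟩
        0           ∎)
      p≤2M : p ℕ.≤ M ℕ.+ M
      p≤2M = subst (p ℕ.≤_) pP≡ (ℕ.m≤m*n p P)
      index : p ℕ.* (3 ℕ.* c ℕ.+ e) ≡ r ℕ.+ c / P ℕ.* L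
      index = trans (cong (λ c → p ℕ.* (3 ℕ.* c ℕ.+ e)) (m≡m%n+[m/n]*n c P))
        (trans (NS.solve 5 (λ p c d P e → p NS.:* (NS.con 3 NS.:* (c NS.:+ d NS.:* P) NS.:+ e) NS.:= p NS.:* (NS.con 3 NS.:* c NS.:+ e) NS.:+ d NS.:* (NS.con 3 NS.:* (p NS.:* P))) refl p c′ (c / P) P e)
          (cong (λ M → r ℕ.+ c / P ℕ.* (3 ℕ.* M)) pP≡))
      r<L : r ℕ.< L
      r<L = begin-strict
        r                     <⟨ ℕ.*-monoʳ-< p {{ℕ.>-nonZero 1≤p}} (ℕ.+-monoʳ-< (3 ℕ.* c′) (s≤s e≤2)) ⟩
        p ℕ.* (3 ℕ.* c′ ℕ.+ 3)  ≡⟨ NS.solve 2 (λ p c → p NS.:* (NS.con 3 NS.:* c NS.:+ NS.con 3) NS.:= NS.con 3 NS.:* (p NS.:* (NS.con 1 NS.:+ c))) refl p c′ ⟩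
        3 ℕ.* (p ℕ.* suc c′)    ≤⟨ ℕ.*-monoʳ-≤ 3 (ℕ.*-monoʳ-≤ p (m%n<n c P)) ⟩
        3 ℕ.* (p ℕ.* P)         ≡⟨ cong (3 ℕ.*_) pP≡ ⟩
        L                     ∎

    -- `T c` is the number of zeros at angles up to πc/M, and `Jump c` holds when πc/M may itself be
    -- one. Since the zeros are simple and lie between cells, the sign in cell c is that of
    -- (-1)^T(c).
    record Levelled {d} (p : Vec ℤ d) : Set₁ where
      field
        T     : ℕ → ℕ
        T0    : T 0 ≡ 0
        Jump  : ℕ → Set
        step  : ∀ c → suc c ℕ.< M → T (suc c) ≡ T c ⊎ (T (suc c) ≡ suc (T c) × Jump (suc c))
        sample-sign : ∀ c e → c ℕ.< M → 1 ℕ.≤ e → e ℕ.≤ 2 → 0ℚ < sgn (T c) * ℤℚE.evalM p (S (3 ℕ.* c ℕ.+ e))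

    module _ {d e} {p : Vec ℤ d} {q : Vec ℤ e} (lp : Levelled p) (lq : Levelled q) where
      private
        module P = Levelled lp
        module Q = Levelled lq

      -- Without common zeros the levels add and still rise by at most one at a time, so every zero
      -- of the product remains a sign change.
      product-level : (∀ c → 1 ℕ.≤ c → c ℕ.< M → P.Jump c → Q.Jump c → ⊥) → Levelled (mulM p q)
      product-level disjoint = record
        { T = λ c → P.T c ℕ.+ Q.T c
        ; T0 = cong₂ ℕ._+_ P.T0 Q.T0
        ; Jump = λ c → P.Jump c ⊎ Q.Jump c
        ; step = λ c c< → combine c c< (P.step c c<) (Q.step c c<)
        ; sample-sign = λ c e c< 1≤e e≤2 → let x = S (3 ℕ.* c ℕ.+ e) in subst (0ℚ <_)
            (trans (solve 4 (λ s a t b → (s :* a) :* (t :* b) := (s :* t) :* (a :* b)) refl (sgn (P.T c)) (ℤℚE.evalM p x) (sgn (Q.T c)) (ℤℚE.evalM q x))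
              (cong₂ _*_ (sym (sgn-+ (P.T c) (Q.T c))) (sym (ℤℚE.evalM-mul p q x))))
            (0<-* (P.sample-sign c e c< 1≤e e≤2) (Q.sample-sign c e c< 1≤e e≤2)) }
        where
        combine : ∀ c → suc c ℕ.< M → _ ⊎ _ → _ ⊎ _ → _
        combine c c< (inj₁ a) (inj₁ b) = inj₁ (cong₂ ℕ._+_ a b)
        combine c c< (inj₁ a) (inj₂ (b , j)) = inj₂ (trans (cong₂ ℕ._+_ a b) (ℕ.+-suc (P.T c) (Q.T c)) , inj₂ j)
        combine c c< (inj₂ (a , j)) (inj₁ b) = inj₂ (cong₂ ℕ._+_ a b , inj₁ j)
        combine c c< (inj₂ (a , j)) (inj₂ (b , k)) = ⊥-elim (disjoint (suc c) (s≤s z≤n) c< j k)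

    private
      index-𝕆 : ∀ j k → j ℕ.+ k ℕ.* (j ℕ.+ j) ≡ suc (k ℕ.+ k) ℕ.* j
      index-𝕆 = NS.solve 2 (λ j k → j NS.:+ k NS.:* (j NS.:+ j) NS.:= (NS.con 1 NS.:+ (k NS.:+ k)) NS.:* j) refl

      index-𝕌 : ∀ j k → (j ℕ.+ j) ℕ.+ k ℕ.* (j ℕ.+ j) ≡ (suc k ℕ.+ suc k) ℕ.* j
      index-𝕌 = NS.solve 2 (λ j k → (j NS.:+ j) NS.:+ k NS.:* (j NS.:+ j) NS.:= ((NS.con 1 NS.:+ k) NS.:+ (NS.con 1 NS.:+ k)) NS.:* j) refl

      index-2 : ∀ j → j ℕ.+ j ≡ 2 ℕ.* j
      index-2 = NS.solve 1 (λ j → j NS.:+ j NS.:= NS.con 2 NS.:* j) refl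

      sign-0 : ∀ {c n} .{{_ : NonZero n}} {a} → c ℕ.< n → 0ℚ < sgn (c / n) * a → 0ℚ < sgn 0 * a
      sign-0 {c} {n} {a} c<n h = subst (λ ℓ → 0ℚ < sgn ℓ * a) (m<n⇒m/n≡0 c<n) h

      divide-sign : ∀ {a b g w h s} → 0ℚ < w → g * w * h ≡ s → 0ℚ < sgn a * s → 0ℚ < sgn b * h → 0ℚ < sgn (a ℕ.+ b) * g
      divide-sign {a} {b} {g} {w} {h} 0<w eq hs hh = positive-factor {a} {b} {g} {w * h} (trans (sym (ℚ.*-assoc g w h)) eq) hs
        (subst (0ℚ <_) (solve 3 (λ w b h → w :* (b :* h) := b :* (w :* h)) refl w (sgn b) h) (0<-* 0<w hh))

      0<pow : ∀ j k → 0ℚ < (D ^ j) ^ k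
      0<pow j zero    = 0<1
      0<pow j (suc k) = 0<-* (0<D^ j) (0<pow j k)

      drop-0 : ∀ {a g} → 0ℚ < sgn (a ℕ.+ 0) * g → 0ℚ < sgn a * g
      drop-0 {a} {g} = subst (λ ℓ → 0ℚ < sgn ℓ * g) (ℕ.+-identityʳ a)

    level-step : ∀ o Q .{{_ : NonZero Q}} c → (suc c ℕ.+ o) / Q ≡ (c ℕ.+ o) / Q ⊎ ((suc c ℕ.+ o) / Q ≡ suc ((c ℕ.+ o) / Q) × Q ∣ suc c ℕ.+ o)
    level-step o Q c = division-step (c ℕ.+ o) Q

    -- The value is y((2k+1)j)/y(j) up to a positive factor, and the denominator is positive on all
    -- samples; the zeros sit at the multiples of P.
    𝕆-level : ∀ k P .{{_ : NonZero P}} → suc (k ℕ.+ k) ℕ.* P ≡ M ℕ.+ M → Levelled (𝕆 k)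
    𝕆-level k P kP≡ = record
      { T = λ c → c / P ; T0 = m<n⇒m/n≡0 (ℕ.>-nonZero⁻¹ P) ; Jump = λ c → P ∣ c
      ; step = λ c _ → division-step c P
      ; sample-sign = λ c e c< 1≤e e≤2 → let j = (3 ℕ.* c ℕ.+ e) ℕ.* κ in
          drop-0 {c / P} (divide-sign {c / P} {0} (0<pow j k) (trans (Chebyshev.𝕆-formula ℤ→ℚ j (X j) (X-v j) k) (cong y (index-𝕆 j k)))
            (sine-sign (suc (k ℕ.+ k)) P kP≡ c e c< 1≤e e≤2)
            (subst (λ i → 0ℚ < sgn 0 * y i) (ℕ.*-identityˡ j)
              (sign-0 {{2M}} (ℕ.<-≤-trans c< (ℕ.m≤m+n M M)) (sine-sign 1 (M ℕ.+ M) {{2M}} (ℕ.*-identityˡ (M ℕ.+ M)) c e c< 1≤e e≤2)))) }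
      where
      2M : NonZero (M ℕ.+ M)
      2M = ℕ.>-nonZero (ℕ.≤-trans 1≤M (ℕ.m≤m+n M M))

    𝕌-level : ∀ k P .{{_ : NonZero P}} → (suc k ℕ.+ suc k) ℕ.* P ≡ M ℕ.+ M → Levelled (𝕌 k)
    𝕌-level k P kP≡ = record
      { T = λ c → c / P ; T0 = m<n⇒m/n≡0 (ℕ.>-nonZero⁻¹ P) ; Jump = λ c → P ∣ c
      ; step = λ c _ → division-step c P
      ; sample-sign = λ c e c< 1≤e e≤2 → let j = (3 ℕ.* c ℕ.+ e) ℕ.* κ in
          drop-0 {c / P} (divide-sign {c / P} {0} (0<pow j k) (trans (Chebyshev.𝕌-formula ℤ→ℚ j (X j) (X-v j) k) (cong y (index-𝕌 j k)))
            (sine-sign (suc k ℕ.+ suc k) P kP≡ c e c< 1≤e e≤2)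
            (subst (λ i → 0ℚ < sgn 0 * y i) (sym (index-2 j))
              (sign-0 {{M′}} c< (sine-sign 2 M {{M′}} (sym (index-2 M)) c e c< 1≤e e≤2)))) }
      where
      M′ : NonZero M
      M′ = ℕ.>-nonZero 1≤M

    -- Here the zeros are the odd multiples of P. The sign of the cosine v i comes from y(2i) = v i
    -- · y i, whose two sines have levels ⌊c/P⌋ and ⌊c/2P⌋; `sgn-half` combines these.
    𝕍-level : ∀ k P .{{_ : NonZero P}} .{{_ : NonZero (P ℕ.+ P)}} →
      (suc k ℕ.+ suc k) ℕ.* (P ℕ.+ P) ≡ M ℕ.+ M → Levelled (𝕍 k)
    𝕍-level k P kP≡ = record
      { T = λ c → (c ℕ.+ P) / (P ℕ.+ P) ; T0 = m<n⇒m/n≡0 (ℕ.m<m+n P (ℕ.>-nonZero⁻¹ P)) ; Jump = λ c → (P ℕ.+ P) ∣ c ℕ.+ P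
      ; step = λ c _ → level-step P (P ℕ.+ P) c
      ; sample-sign = λ c e c< 1≤e e≤2 → let j = (3 ℕ.* c ℕ.+ e) ℕ.* κ ; i = (suc k ℕ.+ suc k) ℕ.* j in
          subst (λ s → 0ℚ < s * _) (sgn-half c P)
            (divide-sign {c / P} {c / (P ℕ.+ P)} (0<-* (0<pow j k) (0<D^ j))
              (trans (cong (_* y i) (trans (sym (ℚ.*-assoc (ℤℚE.evalM (𝕍 k) (X j)) ((D ^ j) ^ k) (D ^ j)))
                  (trans (Chebyshev.𝕍-formula ℤ→ℚ j (X j) (X-v j) k) (cong v (index-𝕌 j k))))) (sym (y-double i)))
              (subst (λ m → 0ℚ < sgn (c / P) * y m) (NS.solve 2 (λ k j → (k NS.:+ k) NS.:* j NS.:= k NS.:* j NS.:+ k NS.:* j) refl (suc k ℕ.+ suc k) j)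
                (sine-sign (suc k ℕ.+ suc k ℕ.+ (suc k ℕ.+ suc k)) P
                  (trans (NS.solve 2 (λ k P → (k NS.:+ k) NS.:* P NS.:= k NS.:* (P NS.:+ P)) refl (suc k ℕ.+ suc k) P) kP≡) c e c< 1≤e e≤2))
              (sine-sign (suc k ℕ.+ suc k) (P ℕ.+ P) kP≡ c e c< 1≤e e≤2)) }

-- The roots of R between -2 and 2.

module Interior where

  open Poly
  open Reals
  open Complex
  open Gauss using (module ℤℚE)
  open Lucas
  open Signs
  open Analysis
  open Sampling
  open import Algebra.Bundles using (CommutativeRing)
  open import Data.Integer using (ℤ)
  open import Data.List using (List; []; _∷_; length)
  open import Data.List.Relation.Unary.All as All using (All; []; _∷_)
  open import Data.List.Relation.Unary.AllPairs using (AllPairs; []; _∷_)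
  open import Data.Nat as ℕ using (ℕ; zero; suc; z≤n; s≤s)
  import Data.Nat.Properties as ℕ
  open import Data.Nat.DivMod using (0/n≡0)
  open import Data.Product using (_×_; _,_; proj₁; proj₂)
  open import Data.Rational as ℚ using (ℚ; 0ℚ; 1ℚ; _+_; _*_; _-_; -_; _≤_; _<_)
  import Data.Rational.Properties as ℚ
  open import Data.Sum using (_⊎_; inj₁; inj₂)
  open import Data.Vec using (Vec; []; _∷_)
  open import Relation.Binary.PropositionalEquality
  open import Relation.Nullary using (¬_)
  open import Algebra.Properties.Semiring.Exp (CommutativeRing.semiring ℚ-ring) using (_^_)

  two : ℚ
  two = 1ℚ + 1ℚ

  sgn-cases : ∀ a → sgn a ≡ 1ℚ ⊎ sgn a ≡ - 1ℚ
  sgn-cases zero = inj₁ refl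
  sgn-cases (suc a) with sgn-cases a
  ... | inj₁ e = inj₂ (cong -_ e)
  ... | inj₂ e = inj₁ (trans (cong -_ e) refl)

  opposite-signs : ∀ a {x y} → 0ℚ < sgn (suc a) * x → 0ℚ < sgn a * y → OppositeSigns x y
  opposite-signs a {x} {y} hx hy = case (sgn-cases a)
    where
    open ℚS
    case : sgn a ≡ 1ℚ ⊎ sgn a ≡ - 1ℚ → _
    case (inj₁ e) = inj₁ (ℚ.<⇒≤ (0<-⇒< (subst (0ℚ <_) (trans (cong (λ s → (- s) * x) e) (solve 1 (λ x → (:- :1) :* x := :0 :- x) refl x)) hx)) ,
                          ℚ.<⇒≤ (subst (0ℚ <_) (trans (cong (_* y) e) (ℚ.*-identityˡ y)) hy))
    case (inj₂ e) = inj₂ (ℚ.<⇒≤ (subst (0ℚ <_) (trans (cong (λ s → (- s) * x) e) (solve 1 (λ x → (:- :- :1) :* x := x) refl x)) hx) ,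
                          ℚ.<⇒≤ (0<-⇒< (subst (0ℚ <_) (trans (cong (_* y) e) (solve 1 (λ y → (:- :1) :* y := :0 :- y) refl y)) hy)))

  inv-antitone : ∀ {a b} → 0ℚ < a → a ≤ b → inv b ≤ inv a
  inv-antitone {a} {b} 0<a a≤b = 0≤-⇒≤ (subst (0ℚ ≤_) eq (0≤-* (≤⇒0≤- a≤b) (ℚ.<⇒≤ (0<-* (inv-positive 0<a) (inv-positive 0<b)))))
    where
    open ℚS
    0<b = ℚ.<-≤-trans 0<a a≤b
    eq : (b - a) * (inv a * inv b) ≡ inv a - inv b
    eq = trans (solve 4 (λ a b x y → (b :- a) :* (x :* y) := (b :* y) :* x :- (a :* x) :* y) refl a b (inv a) (inv b))
      (trans (cong₂ (λ u v → u * inv a - v * inv b) (inv-inverse 0<b) (inv-inverse 0<a)) (cong₂ _-_ (ℚ.*-identityˡ (inv a)) (ℚ.*-identityˡ (inv b))))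

  inv-unique : ∀ {a b} → 0ℚ < a → a * b ≡ 1ℚ → inv a ≡ b
  inv-unique {a} {b} 0<a e = trans (sym (ℚ.*-identityʳ (inv a))) (trans (cong (inv a *_) (sym e))
    (trans (solve 3 (λ i a b → i :* (a :* b) := (a :* i) :* b) refl (inv a) a b) (trans (cong (_* b) (inv-inverse 0<a)) (ℚ.*-identityˡ b))))
    where open ℚS

  -- The interval is swept downwards from 2; `lo` is the point reached, and roots found later lie
  -- strictly below it.
  record Located {t} (R : Vec ℤ t) (lo : ℚ) (k : ℕ) : Set where
    field
      list     : List ℝ
      count    : length list ≡ k
      distinct : AllPairs (λ x y → ¬ (x ≋ y)) list
      roots    : All (λ r → ℤℝE.evalM R r ≋ 0ℝ) list
      bounds   : All (λ r → ∀ n → lo ≤ seq r n × seq r n ≤ two) list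

  module _ {t} {R : Vec ℤ t} where
    open Located

    weaken : ∀ {lo lo′ k} → lo′ ≤ lo → Located R lo k → Located R lo′ k
    weaken le ℓ = record
      { list = list ℓ ; count = count ℓ ; distinct = distinct ℓ ; roots = roots ℓ
      ; bounds = All.map (λ b n → ℚ.≤-trans le (proj₁ (b n)) , proj₂ (b n)) (bounds ℓ) }

    add-root-below : ∀ {lo k lo′ mid} → Located R lo k → lo′ ≤ mid → mid < lo → mid ≤ two →
      OppositeSigns (ℤℚE.evalM R lo′) (ℤℚE.evalM R mid) → Located R lo′ (suc k)
    add-root-below {lo} {k} {lo′} {mid} ℓ lo′≤mid mid<lo mid≤2 opp = record
      { list = r ∷ list ℓ ; count = cong suc (count ℓ)
      ; distinct = All.map (λ {s} b → pointwise-gap⇒≉ {r} {s} (lo - mid) (<⇒0<- mid<lo) (λ n → gap (proj₂ (I.Path.inside P n)) (proj₁ (b n)))) (bounds ℓ) ∷ distinct ℓ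
      ; roots = null-root R r (proj₂ result) ∷ roots ℓ
      ; bounds = (λ n → proj₁ (I.Path.inside P n) , ℚ.≤-trans (proj₂ (I.Path.inside P n)) mid≤2)
               ∷ All.map (λ b n → ℚ.≤-trans lo′≤mid (ℚ.≤-trans (ℚ.<⇒≤ mid<lo) (proj₁ (b n))) , proj₂ (b n)) (bounds ℓ) }
      where
      module I = Interval lo′ mid
      result = I.intermediate-value lo′≤mid (I.lip-evalM R I.lip-id) opp
      P = proj₁ result
      r = I.limit P I.lip-id
      gap : ∀ {a b} → a ≤ mid → lo ≤ b → a + (lo - mid) ≤ b
      gap {a} {b} a≤mid lo≤b = 0≤-⇒≤ (subst (0ℚ ≤_)
        (solve 4 (λ a b l m → (m :- a) :+ (b :- l) := b :- (a :+ (l :- m))) refl a b lo mid)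
        (0≤-+ (≤⇒0≤- a≤mid) (≤⇒0≤- lo≤b)))
        where open ℚS

  -- One root is recorded together with a point u + iv of the circle above it, because that point
  -- will be a conjugate of α; extracting v from the root alone would need a square root.
  record CircleRoot {t} (R : Vec ℤ t) (lo : ℚ) : Set where
    field
      u v    : ℝ
      circle : ∀ n → seq u n * seq u n + seq v n * seq v n ≡ 1ℚ
      root   : ℤℝE.evalM R (u +ℝ u) ≋ 0ℝ
      within : ∀ n → lo ≤ seq (u +ℝ u) n × seq (u +ℝ u) n ≤ two

  -- x₁ = 2(1 − s₁²)/(1 + s₁²), in the rational parametrisation of the circle.
  circle-root : ∀ {t} (R : Vec ℤ t) {s₁ x₁} → 0ℚ ≤ s₁ → (1ℚ + s₁ * s₁) * (x₁ + two) ≡ two + two →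
    ℤℚE.evalM R two ≤ 0ℚ → 0ℚ ≤ ℤℚE.evalM R x₁ → CircleRoot R x₁
  circle-root R {s₁} {x₁} 0≤s₁ eq R2≤0 0≤Rx₁ = record
    { u = I.limit P U ; v = I.limit P V
    ; circle = λ n → on-circle (I.Path.τ P n)
    ; root = null-root R (I.limit P U +ℝ I.limit P U) (proj₂ result)
    ; within = λ n → within (I.Path.τ P n) (I.Path.inside P n) }
    where
    open ℚS
    module I = Interval 0ℚ s₁
    q e u v : ℚ → ℚ
    q s = 1ℚ + s * s
    e s = inv (q s)
    u s = (e s + e s) - 1ℚ
    v s = (s + s) * e s
    0<q : ∀ s → 0ℚ < q s
    0<q s = 0<-≤-+ 0<1 (0≤-square s)
    1≤q : ∀ s → 1ℚ ≤ q s
    1≤q s = subst (_≤ q s) (ℚ.+-identityʳ 1ℚ) (ℚ.+-monoʳ-≤ 1ℚ (0≤-square s))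
    qe : ∀ s → q s * e s ≡ 1ℚ
    qe s = inv-inverse (0<q s)
    E : I.Lipschitz e
    E = I.lip-inv (I.lip-+ (I.lip-const 1ℚ) (I.lip-* I.lip-id I.lip-id)) (λ {s} _ → 1≤q s)
    U : I.Lipschitz u
    U = I.lip-+ (I.lip-+ E E) (I.lip-const (- 1ℚ))
    V : I.Lipschitz v
    V = I.lip-* (I.lip-+ I.lip-id I.lip-id) E
    u-0 : u 0ℚ + u 0ℚ ≡ two
    u-0 = trans (cong (λ e → (e + e - 1ℚ) + (e + e - 1ℚ)) (inv-unique {q 0ℚ} {1ℚ} (0<q 0ℚ) (solve 0 ((:1 :+ :0 :* :0) :* :1 := :1) refl)))
      (solve 0 ((:1 :+ :1 :- :1) :+ (:1 :+ :1 :- :1) := :1 :+ :1) refl)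
    u-s₁ : u s₁ + u s₁ ≡ x₁
    u-s₁ = trans (solve 2 (λ e x → (e :+ e :- :1) :+ (e :+ e :- :1) := ((:1 :+ :1) :+ (:1 :+ :1)) :* e :- (:1 :+ :1)) refl (e s₁) x₁)
      (trans (cong (λ c → c * e s₁ - two) (sym eq))
        (trans (solve 3 (λ q x e → (q :* (x :+ (:1 :+ :1))) :* e :- (:1 :+ :1) := (q :* e) :* (x :+ (:1 :+ :1)) :- (:1 :+ :1)) refl (q s₁) x₁ (e s₁))
          (trans (cong (λ c → c * (x₁ + two) - two) (qe s₁)) (solve 1 (λ x → :1 :* (x :+ (:1 :+ :1)) :- (:1 :+ :1) := x) refl x₁))))
    result = I.intermediate-value 0≤s₁ (I.lip-evalM R (I.lip-+ U U))
      (inj₁ (subst (λ x → ℤℚE.evalM R x ≤ 0ℚ) (sym u-0) R2≤0 , subst (λ x → 0ℚ ≤ ℤℚE.evalM R x) (sym u-s₁) 0≤Rx₁))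
    P = proj₁ result
    on-circle : ∀ s → u s * u s + v s * v s ≡ 1ℚ
    on-circle s = trans (solve 2 (λ s e → (e :+ e :- :1) :* (e :+ e :- :1) :+ ((s :+ s) :* e) :* ((s :+ s) :* e)
          := ((:1 :+ :1) :+ (:1 :+ :1)) :* (e :* ((:1 :+ s :* s) :* e :- :1)) :+ :1) refl s (e s))
      (trans (cong (λ c → (two + two) * (e s * (c - 1ℚ)) + 1ℚ) (qe s)) (solve 1 (λ e → ((:1 :+ :1) :+ (:1 :+ :1)) :* (e :* (:1 :- :1)) :+ :1 := :1) refl (e s)))
    double-mono : ∀ {a b} → a ≤ b → (a + a - 1ℚ) + (a + a - 1ℚ) ≤ (b + b - 1ℚ) + (b + b - 1ℚ)
    double-mono a≤b = ℚ.+-mono-≤ (ℚ.+-monoˡ-≤ (- 1ℚ) (ℚ.+-mono-≤ a≤b a≤b)) (ℚ.+-monoˡ-≤ (- 1ℚ) (ℚ.+-mono-≤ a≤b a≤b))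
    within : ∀ s → I.In s → x₁ ≤ u s + u s × u s + u s ≤ two
    within s (0≤s , s≤s₁) =
      subst (_≤ u s + u s) u-s₁ (double-mono (inv-antitone (0<q s) (ℚ.+-monoʳ-≤ 1ℚ (*-mono-≤-nonNeg 0≤s 0≤s₁ s≤s₁ s≤s₁)))) ,
      subst (u s + u s ≤_) u-0 (double-mono (inv-antitone (0<q 0ℚ) (ℚ.+-monoʳ-≤ 1ℚ (*-mono-≤-nonNeg ℚ.≤-refl 0≤s 0≤s 0≤s))))

  module InteriorRoots (M : ℕ) (1≤M : 1 ℕ.≤ M) {d} {p : Vec ℤ d} (lev : Samples.Levelled M 1≤M p) {t} (R : Vec ℤ t)
    (R-sign : ∀ c e → c ℕ.< M → 1 ℕ.≤ e → e ℕ.≤ 2 → 0ℚ < sgn (Samples.Levelled.T lev c) * ℤℚE.evalM R (Samples.S M 1≤M (3 ℕ.* c ℕ.+ e)))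
    (R2<0 : ℤℚE.evalM R two < 0ℚ) where
    open Samples M 1≤M
    open Levelled lev

    private
      κ≡ : 1 ℕ.* κ ≡ κ
      κ≡ = ℕ.*-identityˡ κ

      open ℚS

      0<y : 0ℚ < y κ
      0<y = subst (0ℚ <_) (trans (ℚ.*-identityˡ (y (1 ℕ.* (1 ℕ.* κ)))) (cong y (trans (ℕ.*-identityˡ (1 ℕ.* κ)) κ≡)))
        (sign′ 1 (M ℕ.+ M) (ℕ.*-identityˡ (M ℕ.+ M)) 0<2M)
        where
        0<2M : 0 ℕ.< M ℕ.+ M
        0<2M = ℕ.≤-trans 1≤M (ℕ.m≤m+n M M)
        sign′ : ∀ p P → p ℕ.* P ≡ M ℕ.+ M → 0 ℕ.< P → 0ℚ < sgn 0 * y (p ℕ.* (1 ℕ.* κ))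
        sign′ p P@(suc _) e _ = subst (λ ℓ → 0ℚ < sgn ℓ * y (p ℕ.* (1 ℕ.* κ))) (0/n≡0 P) (sine-sign p P e 0 1 1≤M (s≤s z≤n) (s≤s z≤n))

      0<y₂ : 0ℚ < y (κ ℕ.+ κ)
      0<y₂ = subst (0ℚ <_) (trans (ℚ.*-identityˡ (y (2 ℕ.* (1 ℕ.* κ)))) (cong y (trans (cong (λ k → 2 ℕ.* k) κ≡) (cong (κ ℕ.+_) (ℕ.+-identityʳ κ)))))
        (sign′ M refl 1≤M)
        where
        sign′ : ∀ P → P ≡ M → 0 ℕ.< P → 0ℚ < sgn 0 * y (2 ℕ.* (1 ℕ.* κ))
        sign′ P@(suc _) e _ = subst (λ ℓ → 0ℚ < sgn ℓ * y (2 ℕ.* (1 ℕ.* κ))) (0/n≡0 P) (sine-sign 2 P (trans (cong (λ k → 2 ℕ.* k) e) (cong (M ℕ.+_) (ℕ.+-identityʳ M))) 0 1 1≤M (s≤s z≤n) (s≤s z≤n))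

      0<v : 0ℚ < v κ
      0<v = ℚ.≰⇒> λ v≤0 → ℚ.<-irrefl refl (ℚ.<-≤-trans (subst (0ℚ <_) (y-double κ) 0<y₂)
        (subst (v κ * y κ ≤_) (ℚ.*-zeroˡ (y κ)) (ℚ.*-monoʳ-≤-nonNeg (y κ) {{ℚ.nonNegative (ℚ.<⇒≤ 0<y)}} v≤0)))

      -- The tangent of half the angle of `S 1`: y is the sine and v twice the cosine of κ steps.
      s₁ : ℚ
      s₁ = (y κ + y κ) * inv (v κ)

      half-angle : (1ℚ + s₁ * s₁) * (S 1 + two) ≡ two + two
      half-angle = trans (cong (λ i → (1ℚ + s₁ * s₁) * (X i + two)) κ≡)
        (cancel (D ^ κ) (v κ) (y κ) (X κ) (inv (v κ)) (inv (D ^ κ)) (inv-inverse 0<v) (inv-inverse (D^-positive κ))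
          (trans (X-v κ) (Chebyshev.v₂ ℤ→ℚ κ (X κ) (X-v κ))) norm)
        where
        D^-positive : ∀ j → 0ℚ < D ^ j
        D^-positive zero    = 0<1
        D^-positive (suc j) = 0<-* 0<D (D^-positive j)
        norm : v κ * v κ + (y κ + y κ) * (y κ + y κ) ≡ (two + two) * D ^ κ
        norm = trans (solve 3 (λ N a b → let s = N :+ N ; D = N :* N :+ :1 in
              ((a :+ a) :- s :* b) :* ((a :+ a) :- s :* b) :+ (b :+ b) :* (b :+ b)
              := ((:1 :+ :1) :+ (:1 :+ :1)) :* (a :* a :- b :* (s :* a :- D :* b))) refl N (y (suc κ)) (y κ))
          (cong ((two + two) *_) (cassini κ))
        cancel : ∀ d v y x i j → v * i ≡ 1ℚ → d * j ≡ 1ℚ → x * d ≡ v * v - (d + d) → v * v + (y + y) * (y + y) ≡ (two + two) * d →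
          (1ℚ + (y + y) * i * ((y + y) * i)) * (x + two) ≡ two + two
        cancel d v y x i j vi dj xd n = trans
          (solve 6 (λ d v y x i j → (:1 :+ (y :+ y) :* i :* ((y :+ y) :* i)) :* (x :+ (:1 :+ :1))
             := (:1 :+ (y :+ y) :* i :* ((y :+ y) :* i)) :* ((x :+ (:1 :+ :1)) :* :1)) refl d v y x i j)
          (trans (cong (λ c → (1ℚ + (y + y) * i * ((y + y) * i)) * ((x + two) * c)) (sym dj))
          (trans (solve 6 (λ d v y x i j → (:1 :+ (y :+ y) :* i :* ((y :+ y) :* i)) :* ((x :+ (:1 :+ :1)) :* (d :* j))
             := (:1 :+ (y :+ y) :* i :* ((y :+ y) :* i)) :* ((x :* d :+ (d :+ d)) :* j)) refl d v y x i j)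
          (trans (cong (λ c → (1ℚ + (y + y) * i * ((y + y) * i)) * ((c + (d + d)) * j)) xd)
          (trans (solve 6 (λ d v y x i j → (:1 :+ (y :+ y) :* i :* ((y :+ y) :* i)) :* ((v :* v :- (d :+ d) :+ (d :+ d)) :* j)
             := (v :* v :+ (y :+ y) :* (y :+ y) :* ((v :* i) :* (v :* i))) :* j) refl d v y x i j)
          (trans (cong (λ c → (v * v + (y + y) * (y + y) * (c * c)) * j) vi)
          (trans (solve 3 (λ v y j → (v :* v :+ (y :+ y) :* (y :+ y) :* (:1 :* :1)) :* j := (v :* v :+ (y :+ y) :* (y :+ y)) :* j) refl v y j)
          (trans (cong (_* j) n)
          (trans (ℚ.*-assoc (two + two) d j) (trans (cong ((two + two) *_) dj) (ℚ.*-identityʳ (two + two)))))))))))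

    first-root : CircleRoot R (S 1)
    first-root = circle-root R {s₁} {S 1} (0≤-* (0≤-+ (ℚ.<⇒≤ 0<y) (ℚ.<⇒≤ 0<y)) (ℚ.<⇒≤ (inv-positive 0<v))) half-angle (ℚ.<⇒≤ R2<0)
      (ℚ.<⇒≤ (subst (0ℚ <_) (trans (cong (λ ℓ → sgn ℓ * ℤℚE.evalM R (S 1)) T0) (ℚ.*-identityˡ _)) (R-sign 0 1 1≤M (s≤s z≤n) (s≤s z≤n))))

    private
      module r₁ = CircleRoot first-root

      start : Located R (S 1) 1
      start = record
        { list = (r₁.u +ℝ r₁.u) ∷ [] ; count = refl ; distinct = [] ∷ [] ; roots = r₁.root ∷ [] ; bounds = r₁.within ∷ [] }

      sample<2 : ∀ c → c ℕ.< M → S (3 ℕ.* c ℕ.+ 2) ≤ two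
      sample<2 c c< = ℚ.<⇒≤ (S<2 (ℕ.≤-trans (s≤s z≤n) (ℕ.m≤n+m 2 (3 ℕ.* c))) (sample-bound c< ℕ.≤-refl))

      within-cell : ∀ c → c ℕ.< M → S (3 ℕ.* c ℕ.+ 2) < S (3 ℕ.* c ℕ.+ 1)
      within-cell c c< = S-strict (ℕ.+-monoʳ-< (3 ℕ.* c) (s≤s (s≤s z≤n))) (sample-bound c< ℕ.≤-refl)

      next-cell : ∀ c → suc c ℕ.< M → S (3 ℕ.* suc c ℕ.+ 1) < S (3 ℕ.* c ℕ.+ 2)
      next-cell c c< = S-strict (subst (3 ℕ.* c ℕ.+ 2 ℕ.<_) (NS.solve 1 (λ c → NS.con 3 NS.:* c NS.:+ NS.con 4 NS.:= NS.con 3 NS.:* (NS.con 1 NS.:+ c) NS.:+ NS.con 1) refl c)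
        (ℕ.+-monoʳ-< (3 ℕ.* c) (s≤s (s≤s (s≤s z≤n))))) (sample-bound c< (s≤s z≤n))

      -- Between the last sample of a cell and the first of the next there is a root whenever the
      -- level rises; the gap inside a cell separates successive roots. The additional root is
      -- `first-root`, between `S 1` and 2.
      sweep : ∀ c → c ℕ.< M → Located R (S (3 ℕ.* c ℕ.+ 1)) (suc (T c))
      sweep zero    _  = subst (λ ℓ → Located R (S 1) (suc ℓ)) (sym T0) start
      sweep (suc c) c< = go (step c c<) (sweep c c<M)
        where
        c<M = ℕ.<-trans (ℕ.n<1+n c) c<
        go : T (suc c) ≡ T c ⊎ (T (suc c) ≡ suc (T c) × Jump (suc c)) → Located R (S (3 ℕ.* c ℕ.+ 1)) (suc (T c)) → Located R (S (3 ℕ.* suc c ℕ.+ 1)) (suc (T (suc c)))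
        go (inj₁ e) ℓ = weaken (ℚ.<⇒≤ (ℚ.<-trans (next-cell c c<) (within-cell c c<M))) (subst (λ ℓ → Located R (S (3 ℕ.* c ℕ.+ 1)) (suc ℓ)) (sym e) ℓ)
        go (inj₂ (e , _)) ℓ = subst (λ ℓ → Located R (S (3 ℕ.* suc c ℕ.+ 1)) (suc ℓ)) (sym e)
          (add-root-below ℓ (ℚ.<⇒≤ (next-cell c c<)) (within-cell c c<M) (sample<2 c c<M)
            (opposite-signs (T c) (subst (λ ℓ → 0ℚ < sgn ℓ * ℤℚE.evalM R (S (3 ℕ.* suc c ℕ.+ 1))) e (R-sign (suc c) 1 c< (s≤s z≤n) (s≤s z≤n)))
              (R-sign c 2 c<M (s≤s z≤n) ℕ.≤-refl)))

      M′ : ℕ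
      M′ = M ℕ.∸ 1
      M′<M : M′ ℕ.< M
      M′<M = ℕ.≤-reflexive (ℕ.m+[n∸m]≡n {1} 1≤M)

    interior-odd : Located R (- two) (suc (T (M ℕ.∸ 1)))
    interior-odd = weaken (ℚ.<⇒≤ (-2<S (sample-bound M′<M (s≤s z≤n)))) (sweep M′ M′<M)

    -- With an even level R is positive at the last sample but negative at -2, which gives one more
    -- root.
    interior-even : ℤℚE.evalM R (- two) < 0ℚ → sgn (T (M ℕ.∸ 1)) ≡ 1ℚ → Located R (- two) (suc (suc (T (M ℕ.∸ 1))))
    interior-even R-2<0 even = add-root-below (sweep M′ M′<M) (ℚ.<⇒≤ (-2<S (sample-bound M′<M ℕ.≤-refl))) (within-cell M′ M′<M) (sample<2 M′ M′<M)
      (inj₁ (ℚ.<⇒≤ R-2<0 , ℚ.<⇒≤ (subst (0ℚ <_) (trans (cong (_* ℤℚE.evalM R (S (3 ℕ.* M′ ℕ.+ 2))) even) (ℚ.*-identityˡ _)) (R-sign M′ 2 M′<M (s≤s z≤n) ℕ.≤-refl))))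

-- From the trace polynomial to the Salem number.

module Salem where

  open Kit
  open Poly
  open Roots
  open Reals
  open Complex
  open Gauss using (module ℤE; module ℤℚE)
  open Irreducible
  open Integral
  open Signs using (ν; ν≡fromℤ; ν-1; ν-+; ν-suc; ν-mono-≤)
  open Analysis
  open Interior
  open import Algebra.Bundles using (CommutativeRing)
  import Algebra.Properties.Semiring.Exp as Exp
  open import Data.Empty using (⊥; ⊥-elim)
  open import Data.Integer as ℤ using (ℤ; 1ℤ; -1ℤ) renaming (+_ to pos)
  import Data.Integer.Properties as ℤ
  open import Data.List as List using (List; []; _∷_; length)
  import Data.List.Properties as List
  open import Data.List.Relation.Unary.All as All using (All; []; _∷_)
  import Data.List.Relation.Unary.All.Properties as All
  open import Data.List.Relation.Unary.AllPairs as AllPairs using (AllPairs; []; _∷_)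
  import Data.List.Relation.Unary.AllPairs.Properties as AllPairs
  open import Data.Nat as ℕ using (ℕ; zero; suc)
  import Data.Nat.Properties as ℕ
  open import Data.Product using (Σ-syntax; ∃-syntax; _×_; _,_; proj₁; proj₂)
  open import Data.Rational as ℚ using (ℚ; 0ℚ; 1ℚ)
  import Data.Rational.Properties as ℚ
  open import Data.Sum using (_⊎_; inj₁; inj₂)
  open import Data.Vec as Vec using (Vec; []; _∷_)
  open import Relation.Binary.PropositionalEquality as ≡ using (_≡_)
  open import Relation.Nullary using (¬_)

  open Coefficients ℤ-ring using (mulM; addConst)

  four : ℚ
  four = two ℚ.+ two

  one≤two : 1ℚ ℚ.≤ two
  one≤two = ≡.subst (ℚ._≤ two) (ℚ.+-identityʳ 1ℚ) (ℚ.+-monoʳ-≤ 1ℚ (ℚ.<⇒≤ 0<1))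

  trace : ∀ {t} → Vec ℤ t → ℕ → Vec ℤ (suc t)
  trace C a = addConst (mulM (ℤ.- pos a ∷ []) C) -1ℤ

  module TraceEval {A : Ring₀} (h : Hom ℤ-ring A) where
    open CommutativeRing A
    open IntegerSolver A
    open Evaluation h using (evalM; evalM-mul; evalM-addConst)
    open Hom h

    trace-eval : ∀ {t} (C : Vec ℤ t) a x → evalM (trace C a) x ≈ (x - ⟦ pos a ⟧) * evalM C x - 1#
    trace-eval C a x = trans (evalM-addConst (mulM (ℤ.- pos a ∷ []) C) -1ℤ x)
      (+-cong (trans (evalM-mul (ℤ.- pos a ∷ []) C x)
                (*-congʳ (trans (+-congʳ (-‿homo (pos a))) (solve 2 (λ a x → :- a :+ x :* :1 := x :- a) refl ⟦ pos a ⟧ x))))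
              (trans (-‿homo 1ℤ) (-‿cong 1-homo)))

  -- The cofactor of zⁿ - 1 in C(z + w) is displayed through w, z and a polynomial in z + w, so at z
  -- = α it visibly lies in the ring `Order`.
  PowerDivides : ∀ {A : Ring₀} → Hom ℤ-ring A → ℕ → ∀ {t} → Vec ℤ t → ℕ → ℕ → ∀ {e} → Vec ℤ e → Set
  PowerDivides {A} h n C i l E =
    ∀ z w → z * w ≈ 1# → evalM C (z + w) ≈ (z ^ n - 1#) * (w ^ i * (z ^ l - 1#) * evalM E (z + w))
    where
    open CommutativeRing A
    open Exp semiring
    open Evaluation h using (evalM)

  -- All that the construction takes from the choice of C. The two bounds beyond 2 make R change
  -- sign near a; C(2) = 0 and the bound on `lo` keep the root on the circle away from 2 and -2.
  record Datum (n t : ℕ) : Set₁ where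
    field
      C        : Vec ℤ t
      C-nonNeg : ∀ x → two ℚ.≤ x → 0ℚ ℚ.≤ ℤℚE.evalM C x
      C-large  : ∀ x → four ℚ.≤ x → 1ℚ ℚ.< ℤℚE.evalM C x
      C[2]≡0   : ℤℚE.evalM C two ≡ 0ℚ
      {e} i l  : ℕ
      E        : Vec ℤ e
      unit     : ∀ {A : Ring₀} (h : Hom ℤ-ring A) → PowerDivides h n C i l E
      a₀       : ℕ
      lo       : ℚ
      -2<lo    : ℚ.- two ℚ.< lo
      interior : ∀ a → a₀ ℕ.≤ a → CircleRoot (trace C a) lo × Located (trace C a) (ℚ.- two) t

  module Quadratic {A : Ring₀} (dom : IsDomain A) where
    open CommutativeRing A
    open IsDomain dom
    open IntegerSolver A
    open LinearFactors A dom using (zero-product)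
    open import Algebra.Properties.Group +-group using (x∙y⁻¹≈ε⇒x≈y)
    open import Relation.Binary.Reasoning.Setoid setoid
    private
      module A = CommutativeRing A

    inverse-square : ∀ z w → z * w ≈ 1# → z * z ≈ (z + w) * z - 1#
    inverse-square z w e = begin
      z * z                       ≈⟨ solve 2 (λ z w → z :* z := (z :+ w) :* z :- z :* w) refl z w ⟩
      (z + w) * z - z * w         ≈⟨ +-congˡ (-‿cong e) ⟩
      (z + w) * z - 1#            ∎

    same-trace : ∀ z w α γ → z * w ≈ 1# → α * γ ≈ 1# → z + w ≈ α + γ → (z - α) * (z - γ) ≈ 0#
    same-trace z w α γ zw αγ e = begin
      (z - α) * (z - γ)                             ≈⟨ solve 4 (λ z w a g → (z :- a) :* (z :- g)
                                                         := ((z :+ w) :- (a :+ g)) :* z :- (z :* w :- a :* g)) refl z w α γ ⟩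
      ((z + w) - (α + γ)) * z - (z * w - α * γ)     ≈⟨ +-cong (*-congʳ (+-congʳ e)) (-‿cong (+-cong zw (-‿cong αγ))) ⟩
      ((α + γ) - (α + γ)) * z - (1# - 1#)           ≈⟨ solve 2 (λ s z → (s :- s) :* z :- (:1 :- :1) := :0) refl (α + γ) z ⟩
      0#                                            ∎

    -- (u + iv)² + 1 = r (u + iv) forces u² + v² = 1, if 4 − r² is not negative.
    unit-modulus : ∀ u v r → u * u - v * v + 1# ≈ r * u → u * v + v * u ≈ r * v →
      (∀ x → x * x + ((1# + 1#) * (1# + 1#) - r * r) ≈ 0# → x ≈ 0#) → ¬ ¬ (u * u + v * v ≈ 1#)
    unit-modulus u v r e₁ e₂ definite k = zero-product v ((u + u) - r) product λ where
        (inj₂ e) → k (from-double e)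
        (inj₁ e) → k (from-double (definite ((u + u) - r) (begin
          ((u + u) - r) * ((u + u) - r) + ((1# + 1#) * (1# + 1#) - r * r)
            ≈⟨ solve 3 (λ u v r → ((u :+ u) :- r) :* ((u :+ u) :- r) :+ ((:1 :+ :1) :* (:1 :+ :1) :- r :* r)
                 := ((:1 :+ :1) :* (:1 :+ :1)) :* ((u :* u :- v :* v :+ :1) :- r :* u :+ v :* v)) refl u v r ⟩
          ((1# + 1#) * (1# + 1#)) * ((u * u - v * v + 1#) - r * u + v * v)
            ≈⟨ *-congˡ (+-cong (+-congʳ e₁) (*-congˡ e)) ⟩
          ((1# + 1#) * (1# + 1#)) * (r * u - r * u + v * 0#)
            ≈⟨ solve 3 (λ u v r → ((:1 :+ :1) :* (:1 :+ :1)) :* (r :* u :- r :* u :+ v :* :0) := :0) refl u v r ⟩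
          0# ∎)))
      where
      product : v * ((u + u) - r) ≈ 0#
      product = begin
        v * ((u + u) - r)           ≈⟨ solve 3 (λ u v r → v :* ((u :+ u) :- r) := (u :* v :+ v :* u) :- r :* v) refl u v r ⟩
        (u * v + v * u) - r * v     ≈⟨ +-congʳ e₂ ⟩
        r * v - r * v               ≈⟨ -‿inverseʳ (r * v) ⟩
        0#                          ∎
      from-double : (u + u) - r ≈ 0# → u * u + v * v ≈ 1#
      from-double e = begin
        u * u + v * v               ≈⟨ solve 3 (λ u v r → u :* u :+ v :* v := ((u :+ u) :- r) :* u :- ((u :* u :- v :* v :+ :1) :- r :* u) :+ :1) refl u v r ⟩
        ((u + u) - r) * u - ((u * u - v * v + 1#) - r * u) + 1#
                                    ≈⟨ +-congʳ (+-cong (*-congʳ e) (-‿cong (+-congʳ e₁))) ⟩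
        0# * u - (r * u - r * u) + 1#
                                    ≈⟨ solve 2 (λ u r → :0 :* u :- (r :* u :- r :* u) :+ :1 := :1) refl u r ⟩
        1#                          ∎

    -- Completing the square turns x² + 2uxy + y² into (x + uy)² + (vy)², because 1 - u² = v².
    definite-form : ∀ u v → u * u + v * v ≈ 1# → ¬ (v ≈ 0#) → (∀ x y → x * x + y * y ≈ 0# → x ≈ 0# × y ≈ 0#) →
      ∀ x y → x * x + (u + u) * (x * y) + y * y ≈ 0# → x ≈ 0# × y ≈ 0#
    definite-form u v e v≉0 squares x y f = x≈0 , y≈0
      where
      split : (x + u * y) * (x + u * y) + (v * y) * (v * y) ≈ 0#
      split = begin
        (x + u * y) * (x + u * y) + (v * y) * (v * y)
          ≈⟨ solve 4 (λ x y u v → (x :+ u :* y) :* (x :+ u :* y) :+ (v :* y) :* (v :* y)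
               := (x :* x :+ (u :+ u) :* (x :* y) :+ y :* y) :+ ((u :* u :+ v :* v) :- :1) :* (y :* y)) refl x y u v ⟩
        (x * x + (u + u) * (x * y) + y * y) + ((u * u + v * v) - 1#) * (y * y)
          ≈⟨ +-cong f (*-congʳ (+-congʳ e)) ⟩
        0# + (1# - 1#) * (y * y)
          ≈⟨ solve 1 (λ y → :0 :+ (:1 :- :1) :* (y :* y) := :0) refl y ⟩
        0# ∎
      y≈0 : y ≈ 0#
      y≈0 = integral v y (proj₂ (squares (x + u * y) (v * y) split)) v≉0
      x≈0 : x ≈ 0#
      x≈0 = begin
        x                     ≈⟨ solve 3 (λ x y u → x := (x :+ u :* y) :- u :* y) refl x y u ⟩
        (x + u * y) - u * y   ≈⟨ +-cong (proj₁ (squares (x + u * y) (v * y) split)) (-‿cong (*-congˡ y≈0)) ⟩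
        0# - u * 0#           ≈⟨ solve 1 (λ u → :0 :- u :* :0 := :0) refl u ⟩
        0#                    ∎

  module Minimality {A : Ring₀} (dom : IsDomain A) (h : Hom ℚ-ring A) (mono : IsMono h) where
    open CommutativeRing A
    open Evaluation h
    open Normalisation dom h mono
    private
      module A = CommutativeRing A

    -- A conjugate is given by an arbitrary minimal polynomial `p`. It divides every polynomial
    -- vanishing at `z`, since a nonzero remainder would vanish at `z` in smaller degree.
    conjugate-root : ∀ {d e} (p : Vec ℚ d) (s : Vec ℚ e) {z w} → evalM p z ≈ 0# → (∀ {k} (q : Vec ℚ k) → evalM q z ≈ 0# → d ℕ.≤ k) →
      evalM s z ≈ 0# → evalM p w ≈ 0# → evalM s w ≈ 0#
    conjugate-root {d} {e} p s {z} {w} pz minimal sz pw with ℕ.m≤n⇒∃[o]m+o≡n (minimal s sz)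
    ... | k , d+k≡e with ≡.trans (ℕ.+-comm k d) d+k≡e
    ...   | ≡.refl with divideM k p s
    ...     | q , r , eq with normalise r
    ...       | inj₁ r≈0 = A.trans (eq w) (A.trans (+-cong (A.trans (*-congʳ pw) (zeroˡ _)) (r≈0 w)) (+-identityˡ 0#))
    ...       | inj₂ (k′ , k′<d , v , c , c≢0 , v≈) = ⊥-elim (ℕ.<⇒≱ k′<d (minimal v (normalised-root {u = r} {v = v} c≢0 v≈
                (A.trans (A.trans (A.sym (+-identityˡ _)) (+-congʳ (A.sym (A.trans (*-congʳ pz) (zeroˡ _))))) (A.trans (A.sym (eq z)) sz)))))

  ℚ→ℝ-mono : IsMono ℚ→ℝ
  ℚ→ℝ-mono = record { injective = fromℚ-injective }

  ℚ→ℂ-mono : IsMono ℚ→ℂ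
  ℚ→ℂ-mono = record { injective = ℚ→ℂ-injective }

  module ℚℂ = Evaluation ℚ→ℂ
  module ℚℝ = Evaluation ℚ→ℝ
  module ℝL = LinearFactors ℝ-ring ℝ-domain
  module ℂL = LinearFactors ℂ-ring ℂ-domain
  module ℂR = CommutativeRing ℂ-ring

  ℤ→ℂ′ : Hom ℤ-ring ℂ-ring
  ℤ→ℂ′ = ℝ→ℂ ∘ₕ ℤ→ℝ

  module ℤℂE = Evaluation ℤ→ℂ′

  evalMonic≡ : ∀ {d} (p : Vec ℚ d) z → evalMonic p z ≡ ℚℂ.evalM p z
  evalMonic≡ []      z = ≡.refl
  evalMonic≡ (a ∷ p) z = ≡.cong (λ w → fromℝ (fromℚ a) +ℂ z *ℂ w) (evalMonic≡ p z)

  isRoot : ∀ {d} (p : Vec ℚ d) {z} → ℚℂ.evalM p z ≋ℂ 0ℂ → IsRoot p z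
  isRoot p {z} e = ≡.subst (_≈ℂ 0ℂ) (≡.sym (evalMonic≡ p z)) (≋ℂ⇒≈ℂ e)

  isRoot⁻¹ : ∀ {d} (p : Vec ℚ d) {z} → IsRoot p z → ℚℂ.evalM p z ≋ℂ 0ℂ
  isRoot⁻¹ p {z} e = ≈ℂ⇒≋ℂ (≡.subst (_≈ℂ 0ℂ) (evalMonic≡ p z) e)

  real-root : ∀ {d} (p : Vec ℚ d) {x} → ℚℝ.evalM p x ≋ 0ℝ → ℚℂ.evalM p (fromℝ x) ≋ℂ 0ℂ
  real-root p {x} e = ℂR.trans (evalM-hom ℝ→ℂ ℚ→ℝ p x) (Hom.⟦⟧-cong ℝ→ℂ e)

  real-root⁻¹ : ∀ {d} (p : Vec ℚ d) {x} → ℚℂ.evalM p (fromℝ x) ≋ℂ 0ℂ → ℚℝ.evalM p x ≋ 0ℝ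
  real-root⁻¹ p {x} e = re≋ (ℂR.trans (ℂR.sym (evalM-hom ℝ→ℂ ℚ→ℝ p x)) e)

  integral⇒algebraic : ∀ {x} → Integrality.IsIntegral ℤ→ℝ x → IsAlgebraicInteger (fromℝ x)
  integral⇒algebraic {x} (d , p , e) = d , p , isRoot (Vec.map fromℤ p) (real-root (Vec.map fromℤ p) (ℝR.trans (evalM-map ℚ→ℝ ℤ→ℚ p x) e))

  double≡2* : ∀ t → double t ≡ 2 ℕ.* t
  double≡2* zero    = ≡.refl
  double≡2* (suc t) = ≡.cong suc (≡.trans (≡.cong suc (double≡2* t)) (≡.sym (ℕ.+-suc t (t ℕ.+ 0))))

  ν-2 : ν 2 ≡ two
  ν-2 = ≡.trans (ν-suc 1) (≡.cong (1ℚ ℚ.+_) ν-1)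

  ν-4 : ν 4 ≡ four
  ν-4 = ≡.trans (ν-+ 2 2) (≡.cong₂ ℚ._+_ ν-2 ν-2)

  module RootOfUnitModulus {A : Ring₀} (h : Hom ℚ-ring A) where
    open CommutativeRing A
    open Evaluation h
    open Coefficients ℚ-ring using (reciprocal)

    reciprocal-root : ∀ {d} (p : Vec ℚ d) z w {x} → z * w ≈ 1# → z + w ≈ x → evalM p x ≈ 0# → evalM (reciprocal p) z ≈ 0#
    reciprocal-root p z w zw e px = trans (evalM-reciprocal p z w zw)
      (trans (*-congˡ (trans (evalM-cong p e) px)) (zeroʳ _))

    power-inverse : ∀ z w → z * w ≈ 1# → ∀ d → w ^ d * z ^ d ≈ 1#
    power-inverse z w zw zero    = *-identityˡ 1#
    power-inverse z w zw (suc d) = trans (solve 4 (λ z w a b → (w :* a) :* (z :* b) := (z :* w) :* (a :* b)) refl z w (w ^ d) (z ^ d))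
      (trans (*-cong zw (power-inverse z w zw d)) (*-identityˡ 1#))
      where open IntegerSolver A

    trace-root : ∀ {d} (p : Vec ℚ d) z w → z * w ≈ 1# → evalM (reciprocal p) z ≈ 0# → evalM p (z + w) ≈ 0#
    trace-root {d} p z w zw e = trans (sym (trans (*-congʳ (power-inverse z w zw d)) (*-identityˡ _)))
      (trans (*-assoc _ _ _) (trans (*-congˡ (trans (sym (evalM-reciprocal p z w zw)) e)) (zeroʳ _)))

  module Construction {n t′} (Dat : Datum n t′) (a : ℕ) (a₀≤a : Datum.a₀ Dat ℕ.≤ a) (4≤a : 4 ℕ.≤ a) where
    open Datum Dat
    open ℚS using (solve; _:=_; _:+_; _:*_; _:-_; :-_; :0; :1)
    open Coefficients ℚ-ring using (reciprocal)

    t : ℕ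
    t = suc t′

    R : Vec ℤ t
    R = trace C a

    -- Bisection runs over τ in [a - 1, a + 1] for the function R(τ + 1/τ): this yields α and 1/α
    -- directly, with no quadratic equation to solve afterwards. At the left end τ + 1/τ ≤ a, so (x
    -- - a) C ≤ 0; at the right end τ + 1/τ ≥ a + 1 and C > 1.
    A p₀ q₀ : ℚ
    A = ν a
    p₀ = A ℚ.- 1ℚ
    q₀ = A ℚ.+ 1ℚ

    private
      four≤A : four ℚ.≤ A
      four≤A = ≡.subst (ℚ._≤ A) ν-4 (ν-mono-≤ 4≤a)

      0<two : 0ℚ ℚ.< two
      0<two = 0<-+ 0<1 0<1

    three≤p₀ : two ℚ.+ 1ℚ ℚ.≤ p₀
    three≤p₀ = 0≤-⇒≤ (≡.subst (0ℚ ℚ.≤_) (solve 1 (λ A → A :- ((:1 :+ :1) :+ (:1 :+ :1)) := (A :- :1) :- ((:1 :+ :1) :+ :1)) ≡.refl A) (≤⇒0≤- four≤A))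

    private
      two≤p₀ : two ℚ.≤ p₀
      two≤p₀ = ℚ.≤-trans (≡.subst (ℚ._≤ two ℚ.+ 1ℚ) (ℚ.+-identityʳ two) (ℚ.+-monoʳ-≤ two (ℚ.<⇒≤ 0<1))) three≤p₀

      one≤p₀ : 1ℚ ℚ.≤ p₀
      one≤p₀ = ℚ.≤-trans (≡.subst (ℚ._≤ two) (ℚ.+-identityʳ 1ℚ) (ℚ.+-monoʳ-≤ 1ℚ (ℚ.<⇒≤ 0<1))) two≤p₀

      p₀≤q₀ : p₀ ℚ.≤ q₀
      p₀≤q₀ = 0≤-⇒≤ (≡.subst (0ℚ ℚ.≤_) (solve 1 (λ A → :1 :+ :1 := (A :+ :1) :- (A :- :1)) ≡.refl A) (ℚ.<⇒≤ 0<two))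

      R-value : ∀ x → ℤℚE.evalM R x ≡ (x ℚ.- A) ℚ.* ℤℚE.evalM C x ℚ.- 1ℚ
      R-value x = ≡.trans (TraceEval.trace-eval ℤ→ℚ C a x) (≡.cong (λ A → (x ℚ.- A) ℚ.* ℤℚE.evalM C x ℚ.- 1ℚ) (≡.sym (ν≡fromℤ a)))

    module I = Interval p₀ q₀

    one≤ : ∀ {x} → I.In x → 1ℚ ℚ.≤ x
    one≤ (p≤x , _) = ℚ.≤-trans one≤p₀ p≤x

    Inv : I.Lipschitz inv
    Inv = I.lip-inv I.lip-id one≤

    private
      0<p₀ : 0ℚ ℚ.< p₀
      0<p₀ = ℚ.<-≤-trans 0<1 one≤p₀

      left : ℤℚE.evalM R (p₀ ℚ.+ inv p₀) ℚ.≤ 0ℚ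
      left = 0≤-⇒≤ (≡.subst (0ℚ ℚ.≤_)
        (≡.trans (solve 3 (λ g A c → (A :- g) :* c :+ :1 := :0 :- ((g :- A) :* c :- :1)) ≡.refl g A (ℤℚE.evalM C g)) (≡.cong (λ v → 0ℚ ℚ.- v) (≡.sym (R-value g))))
        (0≤-+ (0≤-* (≤⇒0≤- g≤A) (C-nonNeg g two≤g)) (ℚ.<⇒≤ 0<1)))
        where
        g = p₀ ℚ.+ inv p₀
        g≤A : g ℚ.≤ A
        g≤A = ≡.subst (g ℚ.≤_) (solve 1 (λ A → (A :- :1) :+ :1 := A) ≡.refl A) (ℚ.+-monoʳ-≤ p₀ (inv≤1 one≤p₀))
        two≤g : two ℚ.≤ g
        two≤g = ℚ.≤-trans two≤p₀ (≡.subst (ℚ._≤ g) (ℚ.+-identityʳ p₀) (ℚ.+-monoʳ-≤ p₀ (ℚ.<⇒≤ (inv-positive 0<p₀))))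

      right : 0ℚ ℚ.≤ ℤℚE.evalM R (q₀ ℚ.+ inv q₀)
      right = ≡.subst (0ℚ ℚ.≤_) (≡.sym (R-value g)) (≤⇒0≤- (≡.subst (ℚ._≤ (g ℚ.- A) ℚ.* ℤℚE.evalM C g) (ℚ.*-identityˡ 1ℚ)
        (*-mono-≤-nonNeg (ℚ.<⇒≤ 0<1) (ℚ.≤-trans (ℚ.<⇒≤ 0<1) 1≤C) 1≤g-A 1≤C)))
        where
        g = q₀ ℚ.+ inv q₀
        0≤inv : 0ℚ ℚ.≤ inv q₀
        0≤inv = ℚ.<⇒≤ (inv-positive (ℚ.<-≤-trans 0<p₀ p₀≤q₀))
        1≤g-A : 1ℚ ℚ.≤ g ℚ.- A
        1≤g-A = 0≤-⇒≤ (≡.subst (0ℚ ℚ.≤_) (solve 2 (λ A i → i := ((A :+ :1) :+ i :- A) :- :1) ≡.refl A (inv q₀)) 0≤inv)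
        four≤g : four ℚ.≤ g
        four≤g = ℚ.≤-trans four≤A (0≤-⇒≤ (≡.subst (0ℚ ℚ.≤_) (solve 2 (λ A i → :1 :+ i := ((A :+ :1) :+ i) :- A) ≡.refl A (inv q₀)) (0≤-+ (ℚ.<⇒≤ 0<1) 0≤inv)))
        1≤C : 1ℚ ℚ.≤ ℤℚE.evalM C g
        1≤C = ℚ.<⇒≤ (C-large g four≤g)

    result : Σ[ P ∈ I.Path ] Null (λ n → ℤℚE.evalM R (I.Path.τ P n ℚ.+ inv (I.Path.τ P n)))
    result = I.intermediate-value p₀≤q₀ (I.lip-evalM R (I.lip-+ I.lip-id Inv)) (inj₁ (left , right))

    P : I.Path
    P = proj₁ result

    α γ ρ : ℝ
    α = I.limit P I.lip-id
    γ = I.limit P Inv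
    ρ = α +ℝ γ

    α-bounds : ∀ n → p₀ ℚ.≤ seq α n × seq α n ℚ.≤ q₀
    α-bounds = I.Path.inside P

    Rρ : ℤℝE.evalM R ρ ≋ 0ℝ
    Rρ = null-root R ρ (proj₂ result)

    αγ : α *ℝ γ ≋ 1ℝ
    αγ = pointwise (λ n → inv-inverse (ℚ.<-≤-trans 0<p₀ (proj₁ (α-bounds n))))

    loc : Located R (ℚ.- two) t′
    loc = proj₂ (interior a a₀≤a)
    module Loc = Located loc
    module r₁ = CircleRoot (proj₁ (interior a a₀≤a))

    r₁ : ℝ
    r₁ = r₁.u +ℝ r₁.u

    ρ-large : ∀ n → two ℚ.+ 1ℚ ℚ.≤ seq ρ n
    ρ-large n = ℚ.≤-trans three≤p₀ (ℚ.≤-trans (proj₁ (α-bounds n))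
      (≡.subst (ℚ._≤ seq α n ℚ.+ seq γ n) (ℚ.+-identityʳ (seq α n)) (ℚ.+-monoʳ-≤ (seq α n) (ℚ.<⇒≤ (inv-positive (ℚ.<-≤-trans 0<p₀ (proj₁ (α-bounds n))))))))

    distinct : AllPairs (λ x y → ¬ (x ≋ y)) (ρ ∷ Loc.list)
    distinct = All.map (λ {r} b e → pointwise-gap⇒≉ {r} {ρ} 1ℚ 0<1 (λ n → ℚ.≤-trans (ℚ.+-monoˡ-≤ 1ℚ (proj₂ (b n))) (ρ-large n)) (ℝR.sym e)) Loc.bounds ∷ Loc.distinct

    Small : ℝ → Set
    Small r = ∀ n → seq r n ℚ.≤ two

    private
      a-r : ∀ {r} → Small r → ∀ n → two ℚ.≤ fromℤ (pos a) ℚ.- seq r n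
      a-r {r} s n = ≡.subst (λ A → two ℚ.≤ A ℚ.- seq r n) (ν≡fromℤ a) (0≤-⇒≤ (≡.subst (0ℚ ℚ.≤_)
        (solve 2 (λ A r → (A :- ((:1 :+ :1) :+ (:1 :+ :1))) :+ ((:1 :+ :1) :- r) := (A :- r) :- (:1 :+ :1)) ≡.refl A (seq r n))
        (0≤-+ (≤⇒0≤- four≤A) (≤⇒0≤- (s n)))))

      prod-one : ∀ {rs} → All Small rs → ∀ n → 1ℚ ℚ.≤ seq (ℝL.prod rs (fromℚ (fromℤ (pos a)))) n
      prod-one [] n = ℚ.≤-refl
      prod-one {r ∷ rs} (s ∷ ss) n = ≡.subst (ℚ._≤ (fromℤ (pos a) ℚ.- seq r n) ℚ.* seq (ℝL.prod rs (fromℚ (fromℤ (pos a)))) n) (ℚ.*-identityˡ 1ℚ)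
        (*-mono-≤-nonNeg (ℚ.<⇒≤ 0<1) (ℚ.≤-trans (ℚ.<⇒≤ 0<1) (prod-one ss n)) (ℚ.≤-trans one≤two (a-r {r} s n)) (prod-one ss n))

      prod-two : ∀ {rs} → All Small rs → 1 ℕ.≤ length rs → ∀ n → two ℚ.≤ seq (ℝL.prod rs (fromℚ (fromℤ (pos a)))) n
      prod-two {r ∷ rs} (s ∷ ss) _ n = ≡.subst (ℚ._≤ (fromℤ (pos a) ℚ.- seq r n) ℚ.* seq (ℝL.prod rs (fromℚ (fromℤ (pos a)))) n) (ℚ.*-identityʳ two)
        (*-mono-≤-nonNeg (ℚ.<⇒≤ 0<two) (ℚ.≤-trans (ℚ.<⇒≤ 0<1) (prod-one ss n)) (a-r {r} s n) (prod-one ss n))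

      large : ∀ {rs} → All Small rs → 1 ℕ.≤ length rs → ∀ q → fromℚ q ≋ ℝL.prod rs (fromℚ (fromℤ (pos a))) → fromℤ (pos 2) ℚ.≤ q
      large {rs} ss len q e = ≡.subst (ℚ._≤ q) (≡.sym (Hom.+-homo ℤ→ℚ 1ℤ 1ℤ)) (ℚ.≮⇒≥ λ q<2 →
        pointwise-gap⇒≉ {fromℚ q} {ℝL.prod rs (fromℚ (fromℤ (pos a)))} (two ℚ.- q) (<⇒0<- q<2)
          (λ n → ≡.subst (ℚ._≤ seq (ℝL.prod rs (fromℚ (fromℤ (pos a)))) n) (solve 2 (λ w q → w := q :+ (w :- q)) ≡.refl two q) (prod-two ss len n)) e)

      centre-value : ℤE.evalM R (pos a) ≡ -1ℤ
      centre-value = ≡.trans (TraceEval.trace-eval (idHom ℤ-ring) C a (pos a))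
        (≡.trans (≡.cong (λ z → z ℤ.* ℤE.evalM C (pos a) ℤ.- 1ℤ) (ℤ.+-inverseʳ (pos a))) (≡.cong (λ v → v ℤ.- 1ℤ) (ℤ.*-zeroˡ (ℤE.evalM C (pos a)))))

    traceRoots : TraceRoots ℚ→ℝ ℝ-domain R
    traceRoots = record
      { centre = pos a ; R[a] = centre-value ; ρ = ρ ; others = Loc.list ; count = ≡.cong suc (≡.sym Loc.count)
      ; distinct = distinct ; roots = Rρ ∷ Loc.roots ; Small = Small ; small = All.map (λ b n → proj₂ (b n)) Loc.bounds ; large = large }

    module Irr = Irreducibility ℝ-domain ℚ→ℝ ℚ→ℝ-mono traceRoots
    module ℝQ = Quadratic ℝ-domain

    private
      R[2]≡-1 : ℤℚE.evalM R two ≡ ℚ.- 1ℚ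
      R[2]≡-1 = ≡.trans (R-value two) (≡.trans (≡.cong (λ c → (two ℚ.- A) ℚ.* c ℚ.- 1ℚ) C[2]≡0)
        (solve 1 (λ A → ((:1 :+ :1) :- A) :* :0 :- :1 := :- :1) ≡.refl A))

      circle : r₁.u *ℝ r₁.u +ℝ r₁.v *ℝ r₁.v ≋ 1ℝ
      circle = pointwise r₁.circle

      -- If v vanished, then r₁ = 2u would satisfy r₁² = 4. It is not -2 because it is bounded below
      -- by `lo`, and it is not 2 because R(2) = -1.
      v≉0 : ¬ (r₁.v ≋ 0ℝ)
      v≉0 v≈0 = Apart₀⇒≉0 {fromℚ (ℤℚE.evalM R two)} (1ℚ , 0<1 , 0 , λ n _ → ℚ.≤-reflexive (≡.sym (≡.trans (≡.cong ℚ.∣_∣ R[2]≡-1) ≡.refl)))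
        (ℝR.trans (ℝR.sym (pointwise (seq-evalM R (fromℚ two)))) (ℝR.trans (ℤℝE.evalM-cong R (ℝR.sym r₁≈2)) r₁.root))
        where
        open CommutativeRing ℝ-ring using (_-_)
        module S = IntegerSolver ℝ-ring
        u = r₁.u
        factored : (r₁ +ℝ fromℚ two) *ℝ (r₁ - fromℚ two) ≋ 0ℝ
        factored = ℝR.trans (identity u (fromℚ two)) (ℝR.trans (ℝR.*-congˡ {four′} (ℝR.trans (ℝR.+-congʳ (ℝR.trans (add-square u r₁.v v≈0) circle)) (pointwise (λ _ → ≡.refl)))) (ℝR.zeroʳ four′))
          where
          four′ = (1ℝ +ℝ 1ℝ) *ℝ (1ℝ +ℝ 1ℝ)
          add-square : ∀ x y → y ≋ 0ℝ → x *ℝ x ≋ x *ℝ x +ℝ y *ℝ y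
          add-square x y e = ℝR.sym (ℝR.trans (ℝR.+-congˡ {x *ℝ x} (ℝR.trans (ℝR.*-congʳ {y} e) (ℝR.zeroˡ y))) (ℝR.+-identityʳ (x *ℝ x)))
          identity : ∀ u w → (u +ℝ u +ℝ fromℚ two) *ℝ ((u +ℝ u) - fromℚ two) ≋ four′ *ℝ (u *ℝ u - 1ℝ)
          identity u w = pointwise (λ n → solve 1 (λ u → ((u :+ u) :+ (:1 :+ :1)) :* ((u :+ u) :- (:1 :+ :1)) := ((:1 :+ :1) :* (:1 :+ :1)) :* (u :* u :- :1)) ≡.refl (seq u n))
        r₁+2≉0 : ¬ (r₁ +ℝ fromℚ two ≋ 0ℝ)
        r₁+2≉0 e = pointwise-gap⇒≉ {0ℝ} {r₁ +ℝ fromℚ two} (lo ℚ.+ two) (≡.subst (0ℚ ℚ.<_) (solve 2 (λ l t → l :- (:- t) := l :+ t) ≡.refl lo two) (<⇒0<- -2<lo))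
          (λ n → ≡.subst (ℚ._≤ seq r₁ n ℚ.+ two) (≡.sym (ℚ.+-identityˡ (lo ℚ.+ two))) (ℚ.+-monoˡ-≤ two (proj₁ (r₁.within n)))) (ℝR.sym e)
        r₁≈2 : r₁ ≋ fromℚ two
        r₁≈2 = x∙y⁻¹≈ε⇒x≈y r₁ (fromℚ two) (IsDomain.integral ℝ-domain (r₁ +ℝ fromℚ two) (r₁ - fromℚ two) factored r₁+2≉0)
          where open import Algebra.Properties.Group (CommutativeRing.+-group ℝ-ring) using (x∙y⁻¹≈ε⇒x≈y)

    minimal-degree : ∀ {e} (q : Vec ℚ e) → ℚℝ.evalM q α ≋ 0ℝ → double t ℕ.≤ e
    minimal-degree = Irr.minimal-degree α (ℝQ.inverse-square α γ αγ) r₁ r₁.root (ℝQ.definite-form r₁.u r₁.v circle v≉0 sum-of-squares)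

    S : Vec ℚ (double t)
    S = reciprocal (Vec.map fromℤ R)

    S-α : ℚℂ.evalM S (fromℝ α) ≋ℂ 0ℂ
    S-α = real-root S (RootOfUnitModulus.reciprocal-root ℚ→ℝ (Vec.map fromℤ R) α γ αγ ℝR.refl (ℝR.trans (evalM-map ℚ→ℝ ℤ→ℚ R ρ) Rρ))

    S-minimal : IsMinimalPolynomial S (fromℝ α)
    S-minimal = record { root = isRoot S S-α ; minimal = λ q e → minimal-degree q (real-root⁻¹ q (isRoot⁻¹ q e)) }

    hasDegree : HasDegree (fromℝ α) (2 ℕ.* t)
    hasDegree = ≡.subst (HasDegree (fromℝ α)) (double≡2* t) (S , S-minimal)

  exceeds-one : ∀ {x y} → 1ℝ <ℝ x → x ≋ y → (∀ n → seq y n ℚ.≤ 1ℚ) → ⊥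
  exceeds-one {x} {y} (ε , 0<ε , M , f) x≋y y≤1 = absurd (unwrap x≋y ε 0<ε)
    where
    open ℚS
    absurd : ∃[ N ] (∀ n → N ℕ.≤ n → ℚ.∣ seq x n ℚ.- seq y n ∣ ℚ.< ε) → ⊥
    absurd (N , g) = ℚ.<-irrefl ≡.refl (ℚ.<-≤-trans (0<-+ (<⇒0<- (f k (ℕ.m≤m⊔n M N))) (<⇒0<- (ℚ.≤-<-trans (p≤∣p∣ (seq x k ℚ.- seq y k)) (g k (ℕ.m≤n⊔m M N)))))
      (≡.subst (ℚ._≤ 0ℚ) (solve 3 (λ x y e → y :- :1 := (x :- (:1 :+ e)) :+ (e :- (x :- y))) ≡.refl (seq x k) (seq y k) ε)
        (≡.subst (seq y k ℚ.- 1ℚ ℚ.≤_) (ℚ.+-inverseʳ 1ℚ) (ℚ.+-monoˡ-≤ (ℚ.- 1ℚ) (y≤1 k)))))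
      where k = M ℕ.⊔ N

  real-inverse : ∀ x → 1ℝ <ℝ x → Σ[ y ∈ ℝ ] x *ℝ y ≋ 1ℝ
  real-inverse x (ε , 0<ε , M , f) = y , ⟨ (λ δ 0<δ → M , λ n M≤n → ≡.subst (ℚ._< δ) (≡.sym (≡.cong ℚ.∣_∣ (≡.trans (≡.cong (ℚ._- 1ℚ) (inv-inverse (0<x n M≤n))) (ℚ.+-inverseʳ 1ℚ)))) 0<δ) ⟩
    where
    1≤x : ∀ n → M ℕ.≤ n → 1ℚ ℚ.≤ seq x n
    1≤x n M≤n = ℚ.<⇒≤ (ℚ.≤-<-trans (≡.subst (ℚ._≤ 1ℚ ℚ.+ ε) (ℚ.+-identityʳ 1ℚ) (ℚ.+-monoʳ-≤ 1ℚ (ℚ.<⇒≤ 0<ε))) (f n M≤n))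
    0<x : ∀ n → M ℕ.≤ n → 0ℚ ℚ.< seq x n
    0<x n M≤n = ℚ.<-≤-trans 0<1 (1≤x n M≤n)
    y : ℝ
    y = mkℝ (λ n → inv (seq x n)) λ δ 0<δ → let (N , g) = cauchy x δ 0<δ in
      M ℕ.⊔ N , λ m n le le′ → ℚ.≤-<-trans
        (inv-difference (1≤x m (ℕ.≤-trans (ℕ.m≤m⊔n M N) le)) (1≤x n (ℕ.≤-trans (ℕ.m≤m⊔n M N) le′)))
        (g m n (ℕ.≤-trans (ℕ.m≤n⊔m M N) le) (ℕ.≤-trans (ℕ.m≤n⊔m M N) le′))

  module Conjugation (A : Ring₀) where
    open CommutativeRing A
    open IntegerSolver A

    norm-re : ∀ u v y → (u * u + v * v) * y ≈ 1# → u * (u * y) - v * - (v * y) ≈ 1#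
    norm-re u v y e = trans (solve 3 (λ u v y → u :* (u :* y) :- v :* :- (v :* y) := (u :* u :+ v :* v) :* y) refl u v y) e

    norm-im : ∀ u v y → u * - (v * y) + v * (u * y) ≈ 0#
    norm-im = solve 3 (λ u v y → u :* :- (v :* y) :+ v :* (u :* y) := :0) refl

    quadratic-re : ∀ u v s → u * u - v * v ≈ (s * u - 0# * v) - 1# → u * u - v * v + 1# ≈ s * u
    quadratic-re u v s e = trans (+-congʳ e) (solve 3 (λ u v s → (s :* u :- :0 :* v) :- :1 :+ :1 := s :* u) refl u v s)

    quadratic-im : ∀ u v s → u * v + v * u ≈ (s * v + 0# * u) - 0# → u * v + v * u ≈ s * v
    quadratic-im u v s e = trans e (solve 3 (λ u v s → (s :* v :+ :0 :* u) :- :0 := s :* v) refl u v s)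

    norm-real : ∀ u v g → u ≈ g → v ≈ 0# → u * u + v * v ≈ g * g
    norm-real u v g e f = trans (+-cong (*-cong e e) (*-cong f f)) (solve 1 (λ g → g :* g :+ :0 :* :0 := g :* g) refl g)

    inverse-from-trace : ∀ x a c e w → (x - a) * c - 1# ≈ 0# → c ≈ e * w → e * (w * (x - a)) ≈ 1#
    inverse-from-trace x a c e w f g = trans (solve 4 (λ e w x a → e :* (w :* (x :- a)) := (x :- a) :* (e :* w)) refl e w x a)
      (trans (*-congˡ (sym g)) (trans (solve 1 (λ m → m := m :- :1 :+ :1) refl ((x - a) * c)) (trans (+-congʳ f) (+-identityˡ 1#))))

  module SalemNumber {n t′} (Dat : Datum n t′) (a : ℕ) (a₀≤a : Datum.a₀ Dat ℕ.≤ a) (4≤a : 4 ℕ.≤ a) where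
    open Construction Dat a a₀≤a 4≤a
    open Datum Dat
    module Cj = Conjugation ℝ-ring
    module ℂQ = Quadratic ℂ-domain
    open import Algebra.Properties.Group (CommutativeRing.+-group ℂ-ring) using (x∙y⁻¹≈ε⇒x≈y)

    Rℚ : Vec ℚ t
    Rℚ = Vec.map fromℤ R

    β₀ : ℂ
    β₀ = r₁.u +i r₁.v

    β₀-root : ℚℂ.evalM S β₀ ≋ℂ 0ℂ
    β₀-root = RootOfUnitModulus.reciprocal-root ℚ→ℂ Rℚ β₀ (r₁.u +i (-ℝ r₁.v)) {fromℝ r₁}
      (pointwise (λ n → ≡.trans (solve 2 (λ u v → u :* u :- v :* (:- v) := u :* u :+ v :* v) ≡.refl (seq r₁.u n) (seq r₁.v n)) (r₁.circle n))
        ,ℂ pointwise (λ n → solve 2 (λ u v → u :* (:- v) :+ v :* u := :0) ≡.refl (seq r₁.u n) (seq r₁.v n)))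
      (ℝR.refl ,ℂ pointwise (λ n → ℚ.+-inverseʳ (seq r₁.v n)))
      (real-root Rℚ (ℝR.trans (evalM-map ℚ→ℝ ℤ→ℚ R r₁) r₁.root))
      where open ℚS

    someOnCircle : Σ[ β ∈ ℂ ] IsConjugate (fromℝ α) β × OnUnitCircle β
    someOnCircle = β₀ , (double t , S , S-minimal , isRoot S β₀-root) , unwrap (pointwise {∣ β₀ ∣²} {1ℝ} r₁.circle)

    greaterThanOne : 1ℝ <ℝ α
    greaterThanOne = 1ℚ , 0<1 , 0 , λ n _ → ℚ.<-≤-trans (≡.subst (ℚ._< two ℚ.+ 1ℚ) (ℚ.+-identityʳ two) (ℚ.+-monoʳ-< two 0<1))
      (ℚ.≤-trans three≤p₀ (proj₁ (α-bounds n)))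

    Root : ℂ → Set
    Root z = Σ[ s ∈ ℝ ] z ≡ fromℝ s × (s ≡ ρ ⊎ (∀ n → ℚ.- two ℚ.≤ seq s n × seq s n ℚ.≤ two))

    roots : List ℂ
    roots = List.map fromℝ (ρ ∷ Loc.list)

    classified : All Root roots
    classified = (ρ , ≡.refl , inj₁ ≡.refl) ∷ All.map⁺ (All.map (λ {s} b → s , ≡.refl , inj₂ b) Loc.bounds)

    factorisation : ∀ z → ℤℂE.evalM R z ≋ℂ ℂL.prod roots z
    factorisation z = ℂR.trans (ℂR.sym (evalM-map-id ℤ→ℂ′ R z))
      (ℂL.factor-roots roots (Vec.map (Hom.⟦_⟧ ℤ→ℂ′) R) (≡.sym (≡.trans (List.length-map fromℝ (ρ ∷ Loc.list)) (≡.cong suc Loc.count)))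
        (AllPairs.map⁺ (AllPairs.map (λ x≉y e → x≉y (re≋ e)) distinct))
        (All.map⁺ (All.map (λ {r} Rr → ℂR.trans (evalM-map-id ℤ→ℂ′ R (fromℝ r)) (ℂR.trans (evalM-hom ℝ→ℂ ℤ→ℝ R r) (Hom.⟦⟧-cong ℝ→ℂ Rr))) (Rρ ∷ Loc.roots))) z)

    trace-vanishes : ∀ z w → z *ℂ w ≋ℂ 1ℂ → ℚℂ.evalM S z ≋ℂ 0ℂ → ℂL.prod roots (z +ℂ w) ≋ℂ 0ℂ
    trace-vanishes z w zw Sz = ℂR.trans (ℂR.sym (factorisation (z +ℂ w)))
      (ℂR.trans (evalM-ext ℤ→ℂ′ (ℚ→ℂ ∘ₕ ℤ→ℚ) (λ _ → ℂR.refl) R (z +ℂ w))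
        (ℂR.trans (ℂR.sym (evalM-map ℚ→ℂ ℤ→ℚ R (z +ℂ w))) (RootOfUnitModulus.trace-root ℚ→ℂ Rℚ z w zw Sz)))

    γ-bounds : ∀ n → 0ℚ ℚ.≤ seq γ n × seq γ n ℚ.≤ 1ℚ
    γ-bounds n = ℚ.<⇒≤ (inv-positive (ℚ.<-≤-trans 0<1 (one≤ (α-bounds n)))) , inv≤1 (one≤ (α-bounds n))

    -- The assumption ∣β∣² > 1 makes β invertible, so β + 1/β is a root of R. If it is ρ, then β is
    -- α or 1/α, the latter not exceeding 1; if it lies in [-2, 2], then ∣β∣ = 1.
    not-outside : ∀ β → ℚℂ.evalM S β ≋ℂ 0ℂ → ¬ (β ≋ℂ fromℝ α) → ¬ (1ℝ <ℝ ∣ β ∣²)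
    not-outside β Sβ β≉α 1<N = ℂL.prod-zero roots (β +ℂ β′) (trace-vanishes β β′ ββ′ Sβ) classified λ where
        (_ , (s , ≡.refl , inj₁ ≡.refl) , e) → outer e
        (_ , (s , ≡.refl , inj₂ b) , e)      → inner s b e
      where
      u v y : ℝ
      u = re β
      v = im β
      y = proj₁ (real-inverse (∣ β ∣²) 1<N)
      β′ : ℂ
      β′ = (u *ℝ y) +i (-ℝ (v *ℝ y))
      ββ′ : β *ℂ β′ ≋ℂ 1ℂ
      ββ′ = Cj.norm-re u v y (proj₂ (real-inverse (∣ β ∣²) 1<N)) ,ℂ Cj.norm-im u v y
      outer : β +ℂ β′ ≋ℂ fromℝ ρ → ⊥
      outer e = ℂL.zero-product (β +ℂ (-ℂ fromℝ α)) (β +ℂ (-ℂ fromℝ γ))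
        (ℂQ.same-trace β β′ (fromℝ α) (fromℝ γ) ββ′ (ℂR.trans (ℂR.sym (Hom.*-homo ℝ→ℂ α γ)) (Hom.⟦⟧-cong ℝ→ℂ αγ))
          (ℂR.trans e (Hom.+-homo ℝ→ℂ α γ))) λ where
        (inj₁ z) → β≉α (x∙y⁻¹≈ε⇒x≈y β (fromℝ α) z)
        (inj₂ z) → let β≈γ = x∙y⁻¹≈ε⇒x≈y β (fromℝ γ) z in
          exceeds-one 1<N (Cj.norm-real u v γ (re≋ β≈γ) (im≋ β≈γ)) (λ n → ≡.subst (seq γ n ℚ.* seq γ n ℚ.≤_) (ℚ.*-identityˡ 1ℚ)
            (*-mono-≤-nonNeg (proj₁ (γ-bounds n)) (ℚ.<⇒≤ 0<1) (proj₂ (γ-bounds n)) (proj₂ (γ-bounds n))))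
      inner : ∀ s → (∀ n → ℚ.- two ℚ.≤ seq s n × seq s n ℚ.≤ two) → β +ℂ β′ ≋ℂ fromℝ s → ⊥
      inner s b e = ℝQ.unit-modulus u v s (Cj.quadratic-re u v s (re≋ equation)) (Cj.quadratic-im u v s (im≋ equation)) definite
        (λ N≈1 → exceeds-one 1<N N≈1 (λ n → ℚ.≤-refl))
        where
        equation : β *ℂ β ≋ℂ (fromℝ s *ℂ β) +ℂ (-ℂ 1ℂ)
        equation = ℂR.trans (ℂQ.inverse-square β β′ ββ′) (ℂR.+-congʳ (ℂR.*-congʳ e))
        definite : ∀ x → x *ℝ x +ℝ ((1ℝ +ℝ 1ℝ) *ℝ (1ℝ +ℝ 1ℝ) -ℝ s *ℝ s) ≋ 0ℝ → x ≋ 0ℝ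
        definite x f = square≈0 x (proj₁ (sum-of-nonNeg {x *ℝ x} {(1ℝ +ℝ 1ℝ) *ℝ (1ℝ +ℝ 1ℝ) -ℝ s *ℝ s} (λ n → 0≤-square (seq x n))
          (λ n → ≡.subst (0ℚ ℚ.≤_) (solve 1 (λ s → ((:1 :+ :1) :- s) :* (s :- :- (:1 :+ :1)) := (:1 :+ :1) :* (:1 :+ :1) :- s :* s) ≡.refl (seq s n))
            (0≤-* (≤⇒0≤- (proj₂ (b n))) (≤⇒0≤- (proj₁ (b n))))) f))
          where open ℚS

    othersInDisc : ∀ β → IsConjugate (fromℝ α) β → ¬ (β ≈ℂ fromℝ α) → InClosedUnitDisc β
    othersInDisc β (d , p , min , pβ) β≉α = ≮⇒≥ℝ (∣ β ∣²) 1ℝ (not-outside β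
      (Minimality.conjugate-root ℂ-domain ℚ→ℂ ℚ→ℂ-mono p S {fromℝ α} {β} (isRoot⁻¹ p (IsMinimalPolynomial.root min))
        (λ q e → IsMinimalPolynomial.minimal min q (isRoot q e)) S-α (isRoot⁻¹ p pβ))
      (λ e → β≉α (≋ℂ⇒≈ℂ e)))

    module _ where
      open Integrality ℤ→ℝ using (module Order)
      open Order R ρ α Rρ (ℝQ.inverse-square α γ αγ)
      open CommutativeRing ℝ-ring using (_-_; semiring)
      open Exp semiring

      member-γ : Member γ
      member-γ = member-cong (pointwise (λ n → ℚS.solve 2 (λ a g → (a ℚS.:+ g) ℚS.:+ (ℚS.:- a) ℚS.:= g) ≡.refl (seq α n) (seq γ n)))
        (member-+ (member-poly poly-r) (member-neg member-α))

      member-power-1 : ∀ k → Member (α ^ k - 1ℝ)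
      member-power-1 k = member-+ (member-^ k member-α) (member-neg member-1)

      member-evalM : ∀ {d} (p : Vec ℤ d) → Member (ℤℝE.evalM p ρ)
      member-evalM []      = member-1
      member-evalM (c ∷ p) = member-+ (member-poly (poly-const c)) (member-* (member-poly poly-r) (member-evalM p))

      -- At ρ the equation R = 0 reads (ρ - a) C(ρ) = 1, and C(ρ) is αⁿ - 1 times the cofactor.
      inverse cofactor : ℝ
      cofactor = γ ^ i *ℝ (α ^ l - 1ℝ) *ℝ ℤℝE.evalM E ρ
      inverse = cofactor *ℝ (ρ - Hom.⟦_⟧ ℤ→ℝ (pos a))

      member-inverse : Member inverse
      member-inverse = member-* (member-* (member-* (member-^ i member-γ) (member-power-1 l)) (member-evalM E))
        (member-+ (member-poly poly-r) (member-neg (member-poly (poly-const (pos a)))))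

      inverse-correct : (α ^ n - 1ℝ) *ℝ inverse ≋ 1ℝ
      inverse-correct = Cj.inverse-from-trace ρ (Hom.⟦_⟧ ℤ→ℝ (pos a)) (ℤℝE.evalM C ρ) (α ^ n - 1ℝ) cofactor
        (ℝR.trans (ℝR.sym (TraceEval.trace-eval ℤ→ℝ C a ρ)) Rρ) (unit ℤ→ℝ α γ αγ)

      ^ℝ≡^ : ∀ k → α ^ℝ k ≡ α ^ k
      ^ℝ≡^ zero    = ≡.refl
      ^ℝ≡^ (suc k) = ≡.cong (α *ℝ_) (^ℝ≡^ k)

      isUnit : IsUnit (fromℝ (α ^ℝ n -ℝ 1ℝ))
      isUnit = ≡.subst (λ x → IsUnit (fromℝ (x -ℝ 1ℝ))) (≡.sym (^ℝ≡^ n))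
        (integral⇒algebraic (integral (member-power-1 n)) , fromℝ inverse ,
         ≋ℂ⇒≈ℂ (ℂR.trans (ℂR.sym (Hom.*-homo ℝ→ℂ (α ^ n - 1ℝ) inverse)) (Hom.⟦⟧-cong ℝ→ℂ inverse-correct)) ,
         integral⇒algebraic (integral member-inverse))

      isSalem : IsSalem α
      isSalem = record
        { algebraicInteger = integral⇒algebraic (integral member-α)
        ; greaterThanOne = greaterThanOne ; othersInDisc = othersInDisc ; someOnCircle = someOnCircle }

-- The polynomial C for odd and for even n.

module Cases where

  open Kit
  open Poly
  open Reals
  open Complex
  open Gauss using (module ℤℚE)
  open Lucas
  open Signs using (ν; ν-1; ν-+; ν-mono-≤; ν≡fromℤ; sgn)
  open Analysis
  open Sampling
  open Interior
  open Salem
  open import Algebra.Bundles using (CommutativeRing)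
  import Algebra.Properties.Semiring.Exp as Exp
  open import Data.Empty using (⊥)
  open import Data.Integer as ℤ using (ℤ; 0ℤ; 1ℤ) renaming (+_ to pos)
  open import Data.Nat as ℕ using (ℕ; zero; suc; z≤n; s≤s)
  import Data.Nat.Properties as ℕ
  import Data.Nat.Solver
  open import Data.Product using (∃-syntax; _×_; _,_; proj₁; proj₂)
  open import Data.Rational as ℚ using (ℚ; 0ℚ; 1ℚ; _+_; _*_; _-_; -_; _≤_; _<_)
  import Data.Rational.Properties as ℚ
  open import Data.Sum using (_⊎_; inj₁; inj₂)
  open import Data.Vec using (Vec; []; _∷_)
  open import Relation.Binary.PropositionalEquality

  open Coefficients ℤ-ring using (mulM; chain)

  AboveOne : ∀ {d} → Vec ℤ d → Set
  AboveOne p = ∀ x → two ≤ x → 1ℚ ≤ ℤℚE.evalM p x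

  one≤-* : ∀ {a b} → 1ℚ ≤ a → 1ℚ ≤ b → 1ℚ ≤ a * b
  one≤-* {a} {b} p q = subst (_≤ a * b) (ℚ.*-identityˡ 1ℚ) (*-mono-≤-nonNeg (ℚ.<⇒≤ 0<1) (ℚ.≤-trans (ℚ.<⇒≤ 0<1) q) p q)

  above-one-mul : ∀ {d e} (p : Vec ℤ d) (q : Vec ℤ e) → AboveOne p → AboveOne q → AboveOne (mulM p q)
  above-one-mul p q hp hq x 2≤x = subst (1ℚ ≤_) (sym (ℤℚE.evalM-mul p q x)) (one≤-* (hp x 2≤x) (hq x 2≤x))

  -- For x ≥ 2 the recurrence gives s_{k+2} - s_{k+1} = (x - 2) s_{k+1} + (s_{k+1} - s_k), so the
  -- values increase.
  above-one-chain : ∀ {d} (a : Vec ℤ d) b → AboveOne a → (∀ x → two ≤ x → ℤℚE.evalM a x ≤ ℤℚE.evalM b x) → ∀ k → AboveOne (chain a b k)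
  above-one-chain a b ha hab k x 2≤x = proj₁ (go k)
    where
    open ℚS
    s : ℕ → ℚ
    s k = ℤℚE.evalM (chain a b k) x
    go : ∀ k → 1ℚ ≤ s k × s k ≤ s (suc k)
    go zero    = ha x 2≤x , hab x 2≤x
    go (suc k) = let (1≤s , s≤) = go k ; 1≤s′ = ℚ.≤-trans 1≤s s≤ in 1≤s′ , 0≤-⇒≤ (subst (0ℚ ≤_)
      (trans (solve 3 (λ x b a → (x :- (:1 :+ :1)) :* b :+ (b :- a) := (x :* b :- a) :- b) refl x (s (suc k)) (s k))
        (cong (_- s (suc k)) (sym (ℤℚE.evalM-chain a b k x))))
      (0≤-+ (0≤-* (≤⇒0≤- 2≤x) (ℚ.≤-trans (ℚ.<⇒≤ 0<1) 1≤s′)) (≤⇒0≤- s≤)))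

  private
    linear : ∀ c x → ℤℚE.evalM (c ∷ []) x ≡ x + fromℤ c
    linear c x = solve 2 (λ c x → c :+ x :* :1 := x :+ c) refl (fromℤ c) x
      where open ℚS

    fromℤ-two : fromℤ (pos 2) ≡ two
    fromℤ-two = Hom.+-homo ℤ→ℚ 1ℤ 1ℤ

    fromℤ-neg-two : fromℤ (ℤ.- pos 2) ≡ - two
    fromℤ-neg-two = trans (Hom.-‿homo ℤ→ℚ (pos 2)) (cong -_ fromℤ-two)

  𝕆-above-one : ∀ k → AboveOne (𝕆 k)
  𝕆-above-one = above-one-chain [] (1ℤ ∷ []) (λ _ _ → ℚ.≤-refl)
    (λ x 2≤x → subst (1ℚ ≤_) (sym (linear 1ℤ x)) (ℚ.≤-trans (ℚ.≤-trans one≤two 2≤x) (subst (_≤ x + 1ℚ) (ℚ.+-identityʳ x) (ℚ.+-monoʳ-≤ x (ℚ.<⇒≤ 0<1)))))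

  𝕌-above-one : ∀ k → AboveOne (𝕌 k)
  𝕌-above-one = above-one-chain [] (0ℤ ∷ []) (λ _ _ → ℚ.≤-refl)
    (λ x 2≤x → subst (1ℚ ≤_) (sym (trans (linear 0ℤ x) (ℚ.+-identityʳ x))) (ℚ.≤-trans one≤two 2≤x))

  𝕍-above-one : ∀ k → AboveOne (𝕍 k)
  𝕍-above-one = above-one-chain (0ℤ ∷ []) (ℤ.- pos 2 ∷ 0ℤ ∷ [])
    (λ x 2≤x → subst (1ℚ ≤_) (sym (trans (linear 0ℤ x) (ℚ.+-identityʳ x))) (ℚ.≤-trans one≤two 2≤x))
    (λ x 2≤x → 0≤-⇒≤ (subst (0ℚ ≤_) (eq x) (0≤-* (≤⇒0≤- 2≤x) (ℚ.≤-trans (ℚ.<⇒≤ 0<1) (ℚ.≤-trans (ℚ.≤-trans one≤two 2≤x) (subst (_≤ x + 1ℚ) (ℚ.+-identityʳ x) (ℚ.+-monoʳ-≤ x (ℚ.<⇒≤ 0<1))))))))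
    where
    open ℚS
    eq : ∀ x → (x - two) * (x + 1ℚ) ≡ ℤℚE.evalM (ℤ.- pos 2 ∷ 0ℤ ∷ []) x - ℤℚE.evalM (0ℤ ∷ []) x
    eq x = trans (solve 1 (λ x → (x :- (:1 :+ :1)) :* (x :+ :1) := (:- (:1 :+ :1) :+ x :* (:0 :+ x :* :1)) :- (:0 :+ x :* :1)) refl x)
      (cong (λ c → (c + x * (0ℚ + x * 1ℚ)) - (0ℚ + x * 1ℚ)) (sym fromℤ-neg-two))

  []-above-one : AboveOne []
  []-above-one _ _ = ℚ.≤-refl

  []-level : ∀ M 1≤M → Samples.Levelled M 1≤M []
  []-level M 1≤M = record
    { T = λ _ → 0 ; T0 = refl ; Jump = λ _ → ⊥ ; step = λ _ _ → inj₁ refl ; sample-sign = λ _ _ _ _ _ → subst (0ℚ <_) (sym (ℚ.*-identityˡ 1ℚ)) 0<1 }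

  -- For a large, R = (X − a) C − 1 has the sign of (X − a) C at every sample.
  large-multiplier : ∀ (H : ℕ → ℚ) k → ∃[ N ] (∀ q → q ℕ.< k → 0ℚ < H q → 1ℚ < (ν N + 1ℚ) * H q)
  large-multiplier H zero = 0 , λ _ ()
  large-multiplier H (suc k) = N₀ ℕ.+ n , bound
    where
    open ℚS
    N₀ = proj₁ (large-multiplier H k)
    n = proj₁ (archimedean (inv (H k)))
    grow : ∀ {a b h} → a ≤ b → 0ℚ < h → 1ℚ < (a + 1ℚ) * h → 1ℚ < (b + 1ℚ) * h
    grow {h = h} a≤b 0<h l = ℚ.<-≤-trans l (ℚ.*-monoʳ-≤-nonNeg h {{ℚ.nonNegative (ℚ.<⇒≤ 0<h)}} (ℚ.+-monoˡ-≤ 1ℚ a≤b))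
    bound : ∀ q → q ℕ.< suc k → 0ℚ < H q → 1ℚ < (ν (N₀ ℕ.+ n) + 1ℚ) * H q
    bound q q< 0<H = case (ℕ.m≤n⇒m<n∨m≡n (ℕ.≤-pred q<))
      where
      last : ∀ {h} → 0ℚ < h → inv h ≤ ν n → 1ℚ < (ν (N₀ ℕ.+ n) + 1ℚ) * h
      last {h} 0<h le = grow (ℚ.≤-trans le (ν-mono-≤ (ℕ.m≤n+m n N₀))) 0<h (0<-⇒< (subst (0ℚ <_) (sym
        (trans (solve 2 (λ i h → (i :+ :1) :* h :- :1 := (h :* i :- :1) :+ h) refl (inv h) h)
          (trans (cong (λ c → (c - 1ℚ) + h) (inv-inverse 0<h)) (solve 1 (λ h → (:1 :- :1) :+ h := h) refl h)))) 0<h))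
      case : q ℕ.< k ⊎ q ≡ k → _
      case (inj₁ q<k)  = grow (ν-mono-≤ (ℕ.m≤m+n N₀ n)) 0<H (proj₂ (large-multiplier H k) q q<k 0<H)
      case (inj₂ refl) = last 0<H (proj₂ (archimedean (inv (H k))))

  sgn≤1 : ∀ a → sgn a ≤ 1ℚ
  sgn≤1 a with sgn-cases a
  ... | inj₁ e = ℚ.≤-reflexive e
  ... | inj₂ e = subst (_≤ 1ℚ) (sym e) (ℚ.≤-trans (ℚ.neg-antimono-≤ (ℚ.<⇒≤ 0<1)) (ℚ.<⇒≤ 0<1))

  -- `p` supplies the levels and `F` the values. They coincide for odd n; for even n, F = (X + 2) p
  -- has the same signs on the samples, all of which exceed -2.
  module Build (M : ℕ) (1≤M : 1 ℕ.≤ M) {d} {p : Vec ℤ d} (lev : Samples.Levelled M 1≤M p) {e} (F : Vec ℤ e)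
    (F-sign : ∀ c e → c ℕ.< M → 1 ℕ.≤ e → e ℕ.≤ 2 → 0ℚ < sgn (Samples.Levelled.T lev c) * ℤℚE.evalM F (Samples.S M 1≤M (3 ℕ.* c ℕ.+ e)))
    (F-above : AboveOne F) where
    open Samples M 1≤M using (S; S<2; -2<S; sample-bound)
    open Samples.Levelled lev using (T)
    open ℚS

    C : Vec ℤ (suc e)
    C = mulM (ℤ.- pos 2 ∷ []) F

    C-value : ∀ x → ℤℚE.evalM C x ≡ (x - two) * ℤℚE.evalM F x
    C-value x = trans (ℤℚE.evalM-mul (ℤ.- pos 2 ∷ []) F x) (cong (_* ℤℚE.evalM F x) (trans (linear (ℤ.- pos 2) x) (cong (x +_) fromℤ-neg-two)))

    R-value : ∀ a x → ℤℚE.evalM (trace C a) x ≡ (x - ν a) * ((x - two) * ℤℚE.evalM F x) - 1ℚ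
    R-value a x = trans (TraceEval.trace-eval ℤ→ℚ C a x) (cong₂ (λ A c → (x - A) * c - 1ℚ) (sym (ν≡fromℤ a)) (C-value x))

    C-nonNeg : ∀ x → two ≤ x → 0ℚ ≤ ℤℚE.evalM C x
    C-nonNeg x 2≤x = subst (0ℚ ≤_) (sym (C-value x)) (0≤-* (≤⇒0≤- 2≤x) (ℚ.≤-trans (ℚ.<⇒≤ 0<1) (F-above x 2≤x)))

    C-large : ∀ x → four ≤ x → 1ℚ < ℤℚE.evalM C x
    C-large x 4≤x = ℚ.<-≤-trans (subst (_< two) (ℚ.+-identityʳ 1ℚ) (ℚ.+-monoʳ-< 1ℚ 0<1)) (subst (two ≤_) (sym (C-value x))
      (subst (_≤ (x - two) * ℤℚE.evalM F x) (ℚ.*-identityʳ two) (*-mono-≤-nonNeg 0≤two (ℚ.≤-trans (ℚ.<⇒≤ 0<1) 1≤F) 2≤x-2 1≤F)))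
      where
      0≤two : 0ℚ ≤ two
      0≤two = 0≤-+ (ℚ.<⇒≤ 0<1) (ℚ.<⇒≤ 0<1)
      2≤x-2 : two ≤ x - two
      2≤x-2 = 0≤-⇒≤ (subst (0ℚ ≤_) (solve 2 (λ x t → x :- (t :+ t) := (x :- t) :- t) refl x two) (≤⇒0≤- 4≤x))
      1≤F : 1ℚ ≤ ℤℚE.evalM F x
      1≤F = F-above x (ℚ.≤-trans 2≤x-2 (0≤-⇒≤ (subst (0ℚ ≤_) (solve 2 (λ x t → t := x :- (x :- t)) refl x two) 0≤two)))

    C[2]≡0 : ℤℚE.evalM C two ≡ 0ℚ
    C[2]≡0 = trans (C-value two) (trans (cong (_* ℤℚE.evalM F two) (ℚ.+-inverseʳ two)) (ℚ.*-zeroˡ (ℤℚE.evalM F two)))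

    private
      H : ℕ → ℕ → ℚ
      H e c = (two - S (3 ℕ.* c ℕ.+ e)) * (sgn (T c) * ℤℚE.evalM F (S (3 ℕ.* c ℕ.+ e)))

      N₁ N₂ : ℕ
      N₁ = proj₁ (large-multiplier (H 1) M)
      N₂ = proj₁ (large-multiplier (H 2) M)

      0<two-S : ∀ {c e} → c ℕ.< M → 1 ℕ.≤ e → e ℕ.≤ 2 → 0ℚ < two - S (3 ℕ.* c ℕ.+ e)
      0<two-S {c} {e} c< 1≤e e≤2 = <⇒0<- (S<2 (ℕ.≤-trans 1≤e (ℕ.m≤n+m e (3 ℕ.* c))) (sample-bound c< e≤2))

      multiplied : ∀ c e → c ℕ.< M → 1 ℕ.≤ e → e ℕ.≤ 2 → 1ℚ < (ν (N₁ ℕ.+ N₂) + 1ℚ) * H e c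
      multiplied c 0 _ () _
      multiplied c 1 c< 1≤e e≤2 = ℚ.<-≤-trans (proj₂ (large-multiplier (H 1) M) c c< 0<H)
        (ℚ.*-monoʳ-≤-nonNeg (H 1 c) {{ℚ.nonNegative (ℚ.<⇒≤ 0<H)}} (ℚ.+-monoˡ-≤ 1ℚ (ν-mono-≤ (ℕ.m≤m+n N₁ N₂))))
        where
        0<H : 0ℚ < H 1 c
        0<H = 0<-* (0<two-S c< 1≤e e≤2) (F-sign c 1 c< 1≤e e≤2)
      multiplied c 2 c< 1≤e e≤2 = ℚ.<-≤-trans (proj₂ (large-multiplier (H 2) M) c c< 0<H)
        (ℚ.*-monoʳ-≤-nonNeg (H 2 c) {{ℚ.nonNegative (ℚ.<⇒≤ 0<H)}} (ℚ.+-monoˡ-≤ 1ℚ (ν-mono-≤ (ℕ.m≤n+m N₂ N₁))))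
        where
        0<H : 0ℚ < H 2 c
        0<H = 0<-* (0<two-S c< 1≤e e≤2) (F-sign c 2 c< 1≤e e≤2)
      multiplied c (suc (suc (suc e))) _ _ (s≤s (s≤s ()))

    -- The summand 3 covers x < 2: then a - x exceeds N₁ + N₂ + 1, the multiplier found for the
    -- samples.
    a₀ : ℕ
    a₀ = 3 ℕ.+ (N₁ ℕ.+ N₂)

    R-sign : ∀ a → a₀ ℕ.≤ a → ∀ c e → c ℕ.< M → 1 ℕ.≤ e → e ℕ.≤ 2 → 0ℚ < sgn (T c) * ℤℚE.evalM (trace C a) (S (3 ℕ.* c ℕ.+ e))
    R-sign a a₀≤a c e c< 1≤e e≤2 = subst (0ℚ <_)
        (trans (solve 5 (λ A x t s f → (A :- x) :* ((t :- x) :* (s :* f)) :- s := s :* ((x :- A) :* ((x :- t) :* f) :- :1)) refl (ν a) x two (sgn (T c)) (ℤℚE.evalM F x))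
          (cong (sgn (T c) *_) (sym (R-value a x))))
        (<⇒0<- (ℚ.≤-<-trans (sgn≤1 (T c)) (ℚ.<-≤-trans (multiplied c e c< 1≤e e≤2)
          (ℚ.*-monoʳ-≤-nonNeg (H e c) {{ℚ.nonNegative (ℚ.<⇒≤ (0<-* (0<two-S c< 1≤e e≤2) (F-sign c e c< 1≤e e≤2)))}} N+1≤))))
      where
      x = S (3 ℕ.* c ℕ.+ e)
      N = N₁ ℕ.+ N₂
      ν3 : ν a₀ ≡ (two + 1ℚ) + ν N
      ν3 = trans (ν-+ 3 N) (cong (_+ ν N) (trans (ν-+ 2 1) (cong₂ _+_ ν-2 ν-1)))
      N+1≤ : ν N + 1ℚ ≤ ν a - x
      N+1≤ = 0≤-⇒≤ (subst (0ℚ ≤_) (solve 4 (λ A x t n → (A :- ((t :+ :1) :+ n)) :+ (t :- x) := (A :- x) :- (n :+ :1)) refl (ν a) x two (ν N))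
        (0≤-+ (≤⇒0≤- (subst (_≤ ν a) ν3 (ν-mono-≤ a₀≤a))) (ℚ.<⇒≤ (0<two-S c< 1≤e e≤2))))

    R[2]<0 : ∀ a → ℤℚE.evalM (trace C a) two < 0ℚ
    R[2]<0 a = subst (_< 0ℚ) (sym (trans (R-value a two) (solve 3 (λ A t f → (t :- A) :* ((t :- t) :* f) :- :1 := :- :1) refl (ν a) two (ℤℚE.evalM F two)))) (ℚ.neg-antimono-< 0<1)

    module SampledRoots (a : ℕ) (a₀≤a : a₀ ℕ.≤ a) = InteriorRoots M 1≤M lev (trace C a) (R-sign a a₀≤a) (R[2]<0 a)

    -2<S1 : - two < S 1
    -2<S1 = -2<S (ℕ.≤-trans (s≤s (s≤s z≤n)) (ℕ.*-monoʳ-≤ 3 1≤M))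

  module UnitIdentity {A : Ring₀} (h : Hom ℤ-ring A) where
    open CommutativeRing A using (Carrier; _≈_; 1#; semiring; +-cong; +-congˡ; +-congʳ; *-cong; *-congˡ; *-congʳ; reflexive)
      renaming (_+_ to _⊞_; _*_ to _⊠_; _-_ to _⊟_; refl to ≈-refl; sym to ≈-sym; trans to ≈-trans)
    open IntegerSolver A
    open Exp semiring
    open Evaluation h using (evalM; evalM-mul)
    open Hom h

    module _ (z w : Carrier) (zw : z ⊠ w ≈ 1#) where
      open Sequence A (z ⊞ 1#) z

      y-closed : ∀ m → y m ⊠ (z ⊟ 1#) ≈ z ^ m ⊟ 1#
      y-closed = recurrence-unique {z ⊞ 1#} {z}
        (λ m → solve 5 (λ s z a b u → (s :* a :- z :* b) :* u := s :* (a :* u) :- z :* (b :* u)) ≈-refl (z ⊞ 1#) z (y (suc m)) (y m) (z ⊟ 1#))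
        (λ m → solve 2 (λ z p → z :* (z :* p) :- :1 := (z :+ :1) :* (z :* p :- :1) :- z :* (p :- :1)) ≈-refl z (z ^ m))
        (solve 1 (λ z → :0 :* (z :- :1) := :1 :- :1) ≈-refl z)
        (solve 1 (λ z → :1 :* (z :- :1) := z :* :1 :- :1) ≈-refl z)

      xπ : (z ⊞ w) ⊠ z ^ 1 ≈ v 2
      xπ = ≈-trans (solve 2 (λ z w → (z :+ w) :* (z :* :1) := z :* z :+ z :* w) ≈-refl z w)
        (≈-trans (+-congˡ zw) (solve 1 (λ z → let s = z :+ :1 ; y₂ = s :* :1 :- z :* :0 ; y₃ = s :* y₂ :- z :* :1 in
          z :* z :+ :1 := (y₃ :+ y₃) :- s :* y₂) ≈-refl z))

      open Chebyshev h 1 (z ⊞ w) xπ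

      z^w^ : ∀ k → (z ^ 1) ^ k ⊠ w ^ k ≈ 1#
      z^w^ zero    = solve 0 (:1 :* :1 := :1) ≈-refl
      z^w^ (suc k) = ≈-trans (solve 4 (λ z w a b → (z :* :1 :* a) :* (w :* b) := (z :* w) :* (a :* b)) ≈-refl z w ((z ^ 1) ^ k) (w ^ k))
        (≈-trans (*-cong zw (z^w^ k)) (solve 0 (:1 :* :1 := :1) ≈-refl))

      𝕆-unit : ∀ k → evalM (𝕆 k) (z ⊞ w) ⊠ (z ^ 1) ^ k ⊠ (z ⊟ 1#) ≈ z ^ suc (k ℕ.+ k) ⊟ 1#
      𝕆-unit k = ≈-trans (*-congʳ (≈-trans (solve 1 (λ a → a := a :* :1) ≈-refl _) (𝕆-formula k)))
        (≈-trans (y-closed (1 ℕ.+ k ℕ.* 2)) (reflexive (cong (λ i → z ^ i ⊟ 1#) (cong suc (NS.solve 1 (λ k → k NS.:* NS.con 2 NS.:= k NS.:+ k) refl k)))))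

      𝕌-unit : ∀ k → evalM (𝕌 k) (z ⊞ w) ⊠ (z ^ 1) ^ k ⊠ (z ^ 2 ⊟ 1#) ≈ z ^ (suc k ℕ.+ suc k) ⊟ 1#
      𝕌-unit k = ≈-trans (*-congˡ (≈-sym (y-closed 2)))
        (≈-trans (solve 3 (λ a b c → a :* (b :* c) := (a :* b) :* c) ≈-refl _ (y 2) (z ⊟ 1#))
          (≈-trans (*-congʳ (𝕌-formula k)) (≈-trans (y-closed (2 ℕ.+ k ℕ.* 2))
            (reflexive (cong (λ i → z ^ i ⊟ 1#) (NS.solve 1 (λ k → NS.con 2 NS.:+ k NS.:* NS.con 2 NS.:= (NS.con 1 NS.:+ k) NS.:+ (NS.con 1 NS.:+ k)) refl k))))))

      private
        neg-two : ⟦ ℤ.- pos 2 ⟧ ≈ CommutativeRing.-_ A (1# ⊞ 1#)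
        neg-two = ≈-trans (-‿homo (pos 2)) (CommutativeRing.-‿cong A (≈-trans (+-homo 1ℤ 1ℤ) (+-cong 1-homo 1-homo)))

        pos-two : ⟦ pos 2 ⟧ ≈ 1# ⊞ 1#
        pos-two = ≈-trans (+-homo 1ℤ 1ℤ) (+-cong 1-homo 1-homo)

      -- With zw = 1 one has z + w - 2 = (z - 1)² w. One factor z - 1 completes the value of `𝕆 k`
      -- to zⁿ - 1, and the other is surplus.
      odd-unit : ∀ k {e} (E : Vec ℤ e) → evalM (mulM (ℤ.- pos 2 ∷ []) (mulM (𝕆 k) E)) (z ⊞ w)
        ≈ (z ^ suc (k ℕ.+ k) ⊟ 1#) ⊠ (w ^ suc k ⊠ (z ^ 1 ⊟ 1#) ⊠ evalM E (z ⊞ w))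
      odd-unit k E = ≈-trans (evalM-mul (ℤ.- pos 2 ∷ []) (mulM (𝕆 k) E) (z ⊞ w))
        (≈-trans (*-cong (+-congʳ neg-two) (evalM-mul (𝕆 k) E (z ⊞ w)))
        (≈-trans (solve 4 (λ z w o e → (:- (:1 :+ :1) :+ (z :+ w) :* :1) :* (o :* e) := (z :- (:1 :+ :1) :+ w) :* o :* e) ≈-refl z w o ε)
        (≈-trans (*-congʳ (*-congʳ (≈-trans (solve 2 (λ z w → z :- (:1 :+ :1) :+ w := z :* :1 :- (:1 :+ :1) :+ w) ≈-refl z w)
            (≈-trans (+-congʳ (+-congʳ (*-congˡ (≈-sym zw)))) (≈-trans (solve 2 (λ z w → z :* (z :* w) :- (:1 :+ :1) :+ w := (z :- :1) :* (z :- :1) :* w :+ (z :* w :- :1) :* (:1 :+ :1)) ≈-refl z w)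
              (≈-trans (+-congˡ (*-congʳ (+-congʳ zw))) (solve 2 (λ z w → (z :- :1) :* (z :- :1) :* w :+ (:1 :- :1) :* (:1 :+ :1) := (z :- :1) :* (z :- :1) :* w :* :1) ≈-refl z w)))))))
        (≈-trans (*-congʳ (*-congʳ (*-congˡ (≈-sym (z^w^ k)))))
        (≈-trans (solve 6 (λ z w o e p q → (z :- :1) :* (z :- :1) :* w :* (p :* q) :* o :* e := (o :* p :* (z :- :1)) :* (w :* q :* (z :* :1 :- :1) :* e)) ≈-refl z w o ε ((z ^ 1) ^ k) (w ^ k))
          (*-congʳ (𝕆-unit k)))))))
        where
        o = evalM (𝕆 k) (z ⊞ w)
        ε = evalM E (z ⊞ w)

      -- Here (z + w)² - 4 = (z - w)² = (z² - 1)² w², and one factor z² - 1 completes the value of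
      -- `𝕌 k`.
      even-unit : ∀ k {e} (E : Vec ℤ e) → evalM (mulM (ℤ.- pos 2 ∷ []) (mulM (pos 2 ∷ []) (mulM (𝕌 k) E))) (z ⊞ w)
        ≈ (z ^ (suc k ℕ.+ suc k) ⊟ 1#) ⊠ (w ^ suc (suc k) ⊠ (z ^ 2 ⊟ 1#) ⊠ evalM E (z ⊞ w))
      even-unit k E = ≈-trans (evalM-mul (ℤ.- pos 2 ∷ []) (mulM (pos 2 ∷ []) (mulM (𝕌 k) E)) (z ⊞ w))
        (≈-trans (*-cong (+-congʳ neg-two) (≈-trans (evalM-mul (pos 2 ∷ []) (mulM (𝕌 k) E) (z ⊞ w)) (*-cong (+-congʳ pos-two) (evalM-mul (𝕌 k) E (z ⊞ w)))))
        (≈-trans (solve 4 (λ z w o e → (:- (:1 :+ :1) :+ (z :+ w) :* :1) :* (((:1 :+ :1) :+ (z :+ w) :* :1) :* (o :* e))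
            := ((z :- w) :* (z :- w) :+ (z :* w :- :1) :* ((:1 :+ :1) :* (:1 :+ :1))) :* o :* e) ≈-refl z w o ε)
        (≈-trans (*-congʳ (*-congʳ (≈-trans (+-congˡ (*-congʳ (+-congʳ zw)))
            (solve 2 (λ z w → (z :- w) :* (z :- w) :+ (:1 :- :1) :* ((:1 :+ :1) :* (:1 :+ :1)) := (z :* :1 :- w) :* (z :* :1 :- w)) ≈-refl z w))))
        (≈-trans (*-congʳ (*-congʳ (*-cong (+-congʳ (*-congˡ (≈-sym zw))) (+-congʳ (*-congˡ (≈-sym zw))))))
        (≈-trans (solve 4 (λ z w o e → (z :* (z :* w) :- w) :* (z :* (z :* w) :- w) :* o :* e := (z :* z :- :1) :* (z :* z :- :1) :* w :* w :* :1 :* o :* e) ≈-refl z w o ε)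
        (≈-trans (*-congʳ (*-congʳ (*-congˡ (≈-sym (z^w^ k)))))
        (≈-trans (solve 6 (λ z w o e p q → (z :* z :- :1) :* (z :* z :- :1) :* w :* w :* (p :* q) :* o :* e
            := (o :* p :* (z :* (z :* :1) :- :1)) :* (w :* (w :* q) :* (z :* (z :* :1) :- :1) :* e)) ≈-refl z w o ε ((z ^ 1) ^ k) (w ^ k))
          (*-congʳ (𝕌-unit k)))))))))
        where
        o = evalM (𝕌 k) (z ⊞ w)
        ε = evalM E (z ⊞ w)

  odd-datum : ∀ k {e} (E : Vec ℤ e) → AboveOne E → ∀ M 1≤M (lev : Samples.Levelled M 1≤M (mulM (𝕆 k) E)) →
    Samples.Levelled.T lev (M ℕ.∸ 1) ≡ k ℕ.+ 0 ℕ.+ e → Datum (suc (k ℕ.+ k)) (suc (k ℕ.+ 0 ℕ.+ e))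
  odd-datum k E 1≤E M 1≤M lev final = record
    { C = C ; C-nonNeg = C-nonNeg ; C-large = C-large ; C[2]≡0 = C[2]≡0 ; i = suc k ; l = 1 ; E = E
    ; unit = λ h z w zw → UnitIdentity.odd-unit h z w zw k E
    ; a₀ = a₀ ; lo = Samples.S M 1≤M 1 ; -2<lo = -2<S1
    ; interior = λ a a₀≤a → SampledRoots.first-root a a₀≤a , subst (λ ℓ → Located (trace C a) (- two) (suc ℓ)) final (SampledRoots.interior-odd a a₀≤a) }
    where open Build M 1≤M lev (mulM (𝕆 k) E) (Samples.Levelled.sample-sign lev) (above-one-mul (𝕆 k) E (𝕆-above-one k) 1≤E)

  -- The parity of k + deg E makes R positive at the last sample; since R(-2) = -1, the root beyond
  -- the last zero of F inside (-2, 2) exists.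
  even-datum : ∀ k {e} (E : Vec ℤ e) → AboveOne E → ∀ M 1≤M (lev : Samples.Levelled M 1≤M (mulM (𝕌 k) E)) →
    Samples.Levelled.T lev (M ℕ.∸ 1) ≡ k ℕ.+ 0 ℕ.+ e → sgn (k ℕ.+ 0 ℕ.+ e) ≡ 1ℚ → Datum (suc k ℕ.+ suc k) (suc (suc (k ℕ.+ 0 ℕ.+ e)))
  even-datum k {e} E 1≤E M 1≤M lev final even = record
    { C = C ; C-nonNeg = C-nonNeg ; C-large = C-large ; C[2]≡0 = C[2]≡0 ; i = suc (suc k) ; l = 2 ; E = E
    ; unit = λ h z w zw → UnitIdentity.even-unit h z w zw k E
    ; a₀ = a₀ ; lo = Samples.S M 1≤M 1 ; -2<lo = -2<S1
    ; interior = λ a a₀≤a → SampledRoots.first-root a a₀≤a ,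
        subst (λ ℓ → Located (trace C a) (- two) (suc (suc ℓ))) final (SampledRoots.interior-even a a₀≤a (R[-2]<0 a) (trans (cong sgn final) even)) }
    where
    open Samples M 1≤M using (S; -2<S; sample-bound)
    open ℚS
    G = mulM (𝕌 k) E
    F = mulM (pos 2 ∷ []) G
    F-value : ∀ x → ℤℚE.evalM F x ≡ (x + two) * ℤℚE.evalM G x
    F-value x = trans (ℤℚE.evalM-mul (pos 2 ∷ []) G x) (cong (_* ℤℚE.evalM G x) (trans (linear (pos 2) x) (cong (x +_) fromℤ-two)))
    F-sign : ∀ c e → c ℕ.< M → 1 ℕ.≤ e → e ℕ.≤ 2 → 0ℚ < sgn (Samples.Levelled.T lev c) * ℤℚE.evalM F (S (3 ℕ.* c ℕ.+ e))
    F-sign c e c< 1≤e e≤2 = let x = S (3 ℕ.* c ℕ.+ e) ; s = sgn (Samples.Levelled.T lev c) in subst (0ℚ <_)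
      (trans (solve 4 (λ x t s g → (x :- (:- t)) :* (s :* g) := s :* ((x :+ t) :* g)) refl x two s (ℤℚE.evalM G x)) (cong (s *_) (sym (F-value x))))
      (0<-* (<⇒0<- (-2<S (sample-bound c< e≤2))) (Samples.Levelled.sample-sign lev c e c< 1≤e e≤2))
    F-above : AboveOne F
    F-above x 2≤x = subst (1ℚ ≤_) (sym (F-value x)) (one≤-* (ℚ.≤-trans (ℚ.≤-trans one≤two 2≤x) (subst (_≤ x + two) (ℚ.+-identityʳ x) (ℚ.+-monoʳ-≤ x (ℚ.≤-trans (ℚ.<⇒≤ 0<1) one≤two))))
      (above-one-mul (𝕌 k) E (𝕌-above-one k) 1≤E x 2≤x))
    open Build M 1≤M lev F F-sign F-above
    R[-2]<0 : ∀ a → ℤℚE.evalM (trace C a) (- two) < 0ℚ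
    R[-2]<0 a = subst (_< 0ℚ) (sym (trans (R-value a (- two)) (trans (cong (λ f → (- two - ν a) * ((- two - two) * f) - 1ℚ) (F-value (- two)))
      (solve 3 (λ A t g → ((:- t) :- A) :* (((:- t) :- t) :* (((:- t) :+ t) :* g)) :- :1 := :- :1) refl (ν a) two (ℤℚE.evalM G (- two)))))) (ℚ.neg-antimono-< 0<1)

-- Choice of the extra factor under each condition, and infinitude.

module Main where

  open Poly
  open Reals
  open Complex
  open Lucas
  open Signs using (ν; ν-1; ν-+; ν-mono-≤; sgn)
  open Sampling
  open Interior
  open Salem
  open Cases
  open import Data.Empty using (⊥; ⊥-elim)
  open import Data.Nat
  import Data.Nat.Properties as ℕ
  open import Data.Nat.Coprimality using (Coprime; coprime-divisor)
  open import Data.Nat.Divisibility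
  open import Data.Nat.DivMod
  open import Data.Nat.Primality using (prime?; prime⇒irreducible)
  open import Data.Product using (∃-syntax; _×_; _,_; proj₁; proj₂)
  open import Data.Rational as ℚ using (ℚ; 0ℚ; 1ℚ)
  import Data.Rational.Properties as ℚ
  open import Data.Sum using (_⊎_; inj₁; inj₂)
  open import Data.Vec using ([])
  open import Relation.Binary.PropositionalEquality
  open import Relation.Nullary using (¬_)
  open import Relation.Nullary.Decidable using (from-yes)
  open import Relation.Binary.Definitions using (Tri; tri<; tri≈; tri>)

  open Coefficients ℤ-ring using (mulM)
  open NS using (_:+_; _:*_; _:=_; con) renaming (solve to ℕ-solve)

  separated : (α : ℕ → ℝ) (base : ℕ → ℕ) → (∀ i j → i < j → 3 + base i ≤ base j) →
    (∀ i k → ν (base i) ℚ.- 1ℚ ℚ.≤ seq (α i) k × seq (α i) k ℚ.≤ ν (base i) ℚ.+ 1ℚ) → ∀ i j → i ≢ j → ¬ (α i ≈ℝ α j)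
  separated α base grows bounds i j i≢j e = go (ℕ.<-cmp i j)
    where
    gap : ∀ {i j x y} → i < j → x ℚ.≤ ν (base i) ℚ.+ 1ℚ → ν (base j) ℚ.- 1ℚ ℚ.≤ y → x ℚ.+ 1ℚ ℚ.≤ y
    gap {i} {j} {x} {y} i<j x≤ ≤y = 0≤-⇒≤ (subst (0ℚ ℚ.≤_)
        (IS.solve 4 (λ x y a b → ((a IS.:+ IS.:1) IS.:- x) IS.:+ (y IS.:- (b IS.:- IS.:1)) IS.:+ (b IS.:- (((IS.:1 IS.:+ IS.:1) IS.:+ IS.:1) IS.:+ a)) IS.:= y IS.:- (x IS.:+ IS.:1)) refl x y (ν (base i)) (ν (base j)))
        (0≤-+ (0≤-+ (≤⇒0≤- x≤) (≤⇒0≤- ≤y)) (≤⇒0≤- (subst (ℚ._≤ ν (base j)) 3+ (ν-mono-≤ (grows i j i<j))))))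
      where
      module IS = ℚS
      3+ : ν (3 + base i) ≡ (two ℚ.+ 1ℚ) ℚ.+ ν (base i)
      3+ = trans (ν-+ 3 (base i)) (cong (ℚ._+ ν (base i)) (trans (ν-+ 2 1) (cong₂ ℚ._+_ ν-2 ν-1)))
    apart : ∀ i j → i < j → ¬ (α i ≋ α j)
    apart i j i<j = pointwise-gap⇒≉ {α i} {α j} 1ℚ 0<1 λ k → gap i<j (proj₂ (bounds i k)) (proj₁ (bounds j k))
    go : Tri (i < j) (i ≡ j) (j < i) → ⊥
    go (tri< i<j _ _) = apart i j i<j ⟨ e ⟩
    go (tri≈ _ i≡j _) = i≢j i≡j
    go (tri> _ _ j<i) = apart j i j<i (ℝR.sym {α i} {α j} ⟨ e ⟩)

  infinitely-many : ∀ {n t} → Datum n t → InfinitelyMany (λ α →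
    IsSalem α × HasDegree (fromℝ α) (2 * suc t) × IsUnit (fromℝ (α ^ℝ n -ℝ 1ℝ)))
  infinitely-many {n} {t} D = N.α , (λ i → N.isSalem i , N.hasDegree i , N.isUnit i) , separated N.α base grows N.α-bounds
    where
    open Datum D using (a₀)
    base : ℕ → ℕ
    -- Each α lies within 1 of its parameter, so parameters 3 apart leave a gap of 1.
    base i = (a₀ + 4) + 3 * i
    a₀≤ : ∀ i → a₀ ≤ base i
    a₀≤ i = ℕ.≤-trans (ℕ.m≤m+n a₀ 4) (ℕ.m≤m+n (a₀ + 4) (3 * i))
    4≤ : ∀ i → 4 ≤ base i
    4≤ i = ℕ.≤-trans (ℕ.m≤n+m 4 a₀) (ℕ.m≤m+n (a₀ + 4) (3 * i))
    grows : ∀ i j → i < j → 3 + base i ≤ base j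
    grows i j i<j = subst (_≤ base j) (ℕ-solve 2 (λ a i → a :+ con 3 :* (con 1 :+ i) := con 3 :+ (a :+ con 3 :* i)) refl (a₀ + 4) i)
      (ℕ.+-monoʳ-≤ (a₀ + 4) (ℕ.*-monoʳ-≤ 3 i<j))
    module N (i : ℕ) where
      open Construction D (base i) (a₀≤ i) (4≤ i) using (α; hasDegree; α-bounds) public
      open SalemNumber D (base i) (a₀≤ i) (4≤ i) using (isSalem; isUnit) public

  last-quotient : ∀ {M n} r q .{{_ : NonZero n}} → 1 ≤ M → r < n → M ≡ suc r + q * n → (M ∸ 1) / n ≡ q
  last-quotient r q (s≤s _) r<n e = division-unique r _ r<n (ℕ.suc-injective e)

  last-quotient-+ : ∀ {M n} o r q .{{_ : NonZero n}} → 1 ≤ M → r < n → M + o ≡ suc r + q * n → (M ∸ 1 + o) / n ≡ q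
  last-quotient-+ o r q (s≤s _) r<n e = division-unique r _ r<n (ℕ.suc-injective e)

  -- An odd multiple of an odd number is odd; this keeps the zeros of a 𝕍 factor away from those at
  -- even positions.
  odd-shift : ∀ m {c} → 2 ∣ c → 2 ∣ c + suc (m + m) → ⊥
  odd-shift m 2∣c 2∣c+ = absurd (∣m+n∣m⇒∣n (subst (2 ∣_) (ℕ.+-comm 1 (m + m)) (∣m+n∣m⇒∣n 2∣c+ 2∣c)) (divides m (ℕ-solve 1 (λ m → m :+ m := m :* con 2) refl m)))
    where
    absurd : 2 ∣ 1 → ⊥
    absurd d with ∣⇒≤ d
    ... | s≤s ()

  halves : ∀ x → (∃[ j ] x ≡ j + j) ⊎ (∃[ j ] x ≡ suc (j + j))
  halves zero = inj₁ (0 , refl)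
  halves (suc x) with halves x
  ... | inj₁ (j , e) = inj₂ (j , cong suc e)
  ... | inj₂ (j , e) = inj₁ (suc j , trans (cong suc e) (cong suc (sym (ℕ.+-suc j j))))

  even-remainder : ∀ x → (3 + x) % 2 ≡ 1 → ∃[ j ] x ≡ j + j
  even-remainder x h with halves x
  ... | inj₁ e = e
  ... | inj₂ (j , refl) with trans (sym h) (trans (cong (_% 2) (ℕ-solve 1 (λ j → con 4 :+ (j :+ j) := (con 2 :+ j) :* con 2) refl j)) (m*n%n≡0 (2 + j) 2))
  ...   | ()

  sgn-even : ∀ {x} → ∃[ j ] x ≡ j + j → sgn x ≡ 1ℚ
  sgn-even (j , refl) = sgn-double j

  -- In units of π/M the zeros of `𝕆 k` are multiples of 4(d + 1), and those of `𝕍 d` are odd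
  -- multiples of 2k + 1: even against odd, for every degree of the extra factor.
  odd-case : ∀ k d → Datum (suc (k + k)) (suc (k + d))
  odd-case k zero = subst (Datum (suc (k + k))) (cong suc (trans (ℕ.+-identityʳ (k + 0)) refl))
    (odd-datum k [] []-above-one M 1≤M lev final)
    where
    M = suc (k + k)
    1≤M : 1 ≤ M
    1≤M = s≤s z≤n
    open Samples M 1≤M using (product-level; 𝕆-level)
    lev = product-level {p = 𝕆 k} {q = []} (𝕆-level k 2 (ℕ-solve 1 (λ k → (con 1 :+ (k :+ k)) :* con 2 := (con 1 :+ (k :+ k)) :+ (con 1 :+ (k :+ k))) refl k)) ([]-level M 1≤M) (λ _ _ _ _ ())
    final : (k + k) / 2 + 0 ≡ k + 0 + 0
    final = cong (_+ 0) (trans (division-unique 0 2 (s≤s z≤n) (ℕ-solve 1 (λ k → k :+ k := k :* con 2) refl k)) (sym (ℕ.+-identityʳ k)))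
  odd-case k (suc d) = subst (Datum (suc (k + k))) (cong suc (ℕ-solve 2 (λ k d → k :+ con 0 :+ (d :+ con 1) := k :+ (con 1 :+ d)) refl k d))
    (odd-datum k (𝕍 d) (𝕍-above-one d) M 1≤M lev final)
    where
    M P Q : ℕ
    M = suc (k + k) * (2 * suc d)
    P = 4 * suc d
    Q = suc (k + k)
    1≤M : 1 ≤ M
    1≤M = s≤s z≤n
    open Samples M 1≤M using (product-level; 𝕆-level; 𝕍-level)
    lev = product-level {p = 𝕆 k} {q = 𝕍 d}
      (𝕆-level k P (ℕ-solve 2 (λ k d → let Q = con 1 :+ (k :+ k) ; e = con 1 :+ d in Q :* (con 4 :* e) := Q :* (con 2 :* e) :+ Q :* (con 2 :* e)) refl k d))
      (𝕍-level d Q (ℕ-solve 2 (λ k d → let Q = con 1 :+ (k :+ k) ; e = con 1 :+ d in (e :+ e) :* (Q :+ Q) := Q :* (con 2 :* e) :+ Q :* (con 2 :* e)) refl k d))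
      (λ c _ _ P∣c Q∣ → odd-shift k (∣-trans (divides (2 * suc d) (ℕ-solve 1 (λ d → con 4 :* (con 1 :+ d) := con 2 :* (con 1 :+ d) :* con 2) refl d)) P∣c)
        (∣-trans (divides Q (ℕ-solve 1 (λ Q → Q :+ Q := Q :* con 2) refl Q)) Q∣))
    final : (M ∸ 1) / P + (M ∸ 1 + Q) / (Q + Q) ≡ k + 0 + (d + 1)
    final = cong₂ _+_
      (trans (last-quotient (suc (d + d)) k 1≤M
        (subst (suc (suc (d + d)) ≤_) (ℕ-solve 1 (λ d → con 2 :+ (d :+ d) :+ (con 2 :+ (d :+ d)) := con 4 :* (con 1 :+ d)) refl d) (ℕ.m≤m+n (suc (suc (d + d))) _))
        (ℕ-solve 2 (λ k d → (con 1 :+ (k :+ k)) :* (con 2 :* (con 1 :+ d)) := (con 2 :+ (d :+ d)) :+ k :* (con 4 :* (con 1 :+ d))) refl k d)) (sym (ℕ.+-identityʳ k)))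
      (trans (last-quotient-+ Q (k + k) (suc d) 1≤M (ℕ.m≤m+n Q Q)
        (ℕ-solve 2 (λ k d → let Q = con 1 :+ (k :+ k) in Q :* (con 2 :* (con 1 :+ d)) :+ Q := Q :+ (con 1 :+ d) :* (Q :+ Q)) refl k d)) (ℕ.+-comm 1 d))

  -- As n/2 = 2m + 1 is odd, the zeros of `𝕍 d` are again at odd positions, and those of `𝕌 k` at
  -- multiples of 2(d + 1).
  twice-odd-case : ∀ m d → let k = m + m in ∃[ j ] k + d ≡ j + j → Datum (suc k + suc k) (suc (suc (k + d)))
  twice-odd-case m zero even = subst (λ e → Datum (suc k + suc k) (suc (suc e))) deg
    (even-datum k [] []-above-one M 1≤M lev final (sgn-even (subst (λ e → ∃[ j ] e ≡ j + j) (sym deg) even)))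
    where
    k = m + m
    M = suc k
    1≤M : 1 ≤ M
    1≤M = s≤s z≤n
    deg : k + 0 + 0 ≡ k + 0
    deg = ℕ.+-identityʳ (k + 0)
    open Samples M 1≤M using (product-level; 𝕌-level)
    lev = product-level {p = 𝕌 k} {q = []} (𝕌-level k 1 (ℕ.*-identityʳ (suc k + suc k))) ([]-level M 1≤M) (λ _ _ _ _ ())
    final : k / 1 + 0 ≡ k + 0 + 0
    final = cong (_+ 0) (trans (n/1≡n k) (sym (ℕ.+-identityʳ k)))
  twice-odd-case m (suc d) even = subst (λ e → Datum (suc k + suc k) (suc (suc e))) deg
    (even-datum k (𝕍 d) (𝕍-above-one d) M 1≤M lev final (sgn-even (subst (λ e → ∃[ j ] e ≡ j + j) (sym deg) even)))
    where
    k M P : ℕ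
    k = m + m
    M = suc k * (suc d + suc d)
    P = suc d + suc d
    1≤M : 1 ≤ M
    1≤M = s≤s z≤n
    deg : k + 0 + (d + 1) ≡ k + suc d
    deg = cong₂ _+_ (ℕ.+-identityʳ k) (ℕ.+-comm d 1)
    open Samples M 1≤M using (product-level; 𝕌-level; 𝕍-level)
    lev = product-level {p = 𝕌 k} {q = 𝕍 d}
      (𝕌-level k P (ℕ-solve 2 (λ k d → let Q = con 1 :+ k ; e = con 1 :+ d in (Q :+ Q) :* (e :+ e) := Q :* (e :+ e) :+ Q :* (e :+ e)) refl k d))
      (𝕍-level d (suc k) (ℕ-solve 2 (λ k d → let Q = con 1 :+ k ; e = con 1 :+ d in (e :+ e) :* (Q :+ Q) := Q :* (e :+ e) :+ Q :* (e :+ e)) refl k d))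
      (λ c _ _ P∣c Q∣ → odd-shift m (∣-trans (divides (suc d) (ℕ-solve 1 (λ e → e :+ e := e :* con 2) refl (suc d))) P∣c)
        (∣-trans (divides (suc k) (ℕ-solve 1 (λ Q → Q :+ Q := Q :* con 2) refl (suc k))) Q∣))
    final : (M ∸ 1) / P + (M ∸ 1 + suc k) / (suc k + suc k) ≡ k + 0 + (d + 1)
    final = cong₂ _+_
      (trans (last-quotient (suc (d + d)) k 1≤M (ℕ.≤-reflexive (cong suc (sym (ℕ.+-suc d d))))
        (ℕ-solve 2 (λ k d → (con 1 :+ k) :* ((con 1 :+ d) :+ (con 1 :+ d)) := (con 2 :+ (d :+ d)) :+ k :* ((con 1 :+ d) :+ (con 1 :+ d))) refl k d)) (sym (ℕ.+-identityʳ k)))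
      (trans (last-quotient-+ (suc k) k (suc d) 1≤M (ℕ.m≤m+n (suc k) (suc k))
        (ℕ-solve 2 (λ k d → let Q = con 1 :+ k ; e = con 1 :+ d in Q :* (e :+ e) :+ Q := Q :+ e :* (Q :+ Q)) refl k d)) (ℕ.+-comm 1 d))

  -- The zeros lie at the multiples of P = 2d + 1 and of Q = n. These are coprime with P Q = 2M, so
  -- no position below M is common to both.
  coprime-case : ∀ k d → Coprime (suc (d + d)) (suc k + suc k) → ∃[ j ] k + d ≡ j + j → Datum (suc k + suc k) (suc (suc (k + d)))
  coprime-case k d coprime even = subst (λ e → Datum (suc k + suc k) (suc (suc e))) deg
    (even-datum k (𝕆 d) (𝕆-above-one d) M 1≤M lev final (sgn-even (subst (λ e → ∃[ j ] e ≡ j + j) (sym deg) even)))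
    where
    P Q M : ℕ
    P = suc (d + d)
    Q = suc k + suc k
    M = suc k * P
    1≤M : 1 ≤ M
    1≤M = s≤s z≤n
    deg : k + 0 + (d + 0) ≡ k + d
    deg = cong₂ _+_ (ℕ.+-identityʳ k) (ℕ.+-identityʳ d)
    open Samples M 1≤M using (product-level; 𝕌-level; 𝕆-level)
    disjoint : ∀ c → 1 ≤ c → c < M → P ∣ c → Q ∣ c → ⊥
    disjoint c 1≤c c<M P∣c (divides q c≡) = ℕ.<⇒≱ c<M (ℕ.≤-trans M≤PQ (∣⇒≤ {{>-nonZero 1≤c}} PQ∣c))
      where
      PQ∣c : P * Q ∣ c
      PQ∣c = subst (P * Q ∣_) (sym c≡) (*-monoˡ-∣ Q (coprime-divisor coprime (subst (P ∣_) (trans c≡ (ℕ.*-comm q Q)) P∣c)))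
      M≤PQ : M ≤ P * Q
      M≤PQ = subst (_≤ P * Q) (ℕ.*-comm P (suc k)) (ℕ.*-monoʳ-≤ P (ℕ.m≤m+n (suc k) (suc k)))
    lev = product-level {p = 𝕌 k} {q = 𝕆 d}
      (𝕌-level k P (ℕ.*-distribʳ-+ P (suc k) (suc k)))
      (𝕆-level d Q (ℕ-solve 2 (λ k P → P :* (k :+ k) := k :* P :+ k :* P) refl (suc k) P))
      disjoint
    final : (M ∸ 1) / P + (M ∸ 1) / Q ≡ k + 0 + (d + 0)
    final = cong₂ _+_
      (trans (last-quotient (d + d) k 1≤M ℕ.≤-refl refl) (sym (ℕ.+-identityʳ k)))
      (trans (last-quotient k d 1≤M (ℕ.m≤m+n (suc k) (suc k))
        (ℕ-solve 2 (λ k d → (con 1 :+ k) :* (con 1 :+ (d :+ d)) := (con 1 :+ k) :+ d :* ((con 1 :+ k) :+ (con 1 :+ k))) refl k d)) (sym (ℕ.+-identityʳ d)))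

  coprime-power : ∀ d s → Coprime (suc (d + d)) (2 ^ s)
  coprime-power d zero    (_ , i∣1) = ∣1⇒≡1 i∣1
  coprime-power d (suc s) {i} (i∣a , i∣) = coprime-power d s (i∣a , coprime-divisor coprime-2 i∣)
    where
    coprime-2 : Coprime i 2
    coprime-2 {j} (j∣i , j∣2) with prime⇒irreducible (from-yes (prime? 2)) j∣2
    ... | inj₁ j≡1 = j≡1
    ... | inj₂ refl = ⊥-elim (odd-shift d (divides 0 refl) (∣-trans j∣i i∣a))

  coprime-three : ∀ {n} → n % 3 ≢ 0 → Coprime 3 n
  coprime-three {n} 3∤n {i} (i∣3 , i∣n) with prime⇒irreducible (from-yes (prime? 3)) i∣3
  ... | inj₁ i≡1  = i≡1
  ... | inj₂ refl = ⊥-elim (3∤n (n∣m⇒m%n≡0 n 3 i∣n))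

  -- Now k is odd, so deg E must be odd. A 𝕍 factor avoids the zeros of `𝕌 k` when its degree is
  -- even, here 2(f + 1); then `𝕆 1` = X + 1 corrects the parity. Writing n = 4m, M = 12(f + 1)m is
  -- the least multiple of the step sizes needed here: P, Q and T are those of `𝕌 k`, `𝕍 e` and
  -- `𝕆 1`.
  four-mod-eight-case : ∀ j f → let k = suc (4 * j) in (suc k + suc k) % 3 ≢ 0 →
    Datum (suc k + suc k) (suc (suc (k + suc (suc f + suc f))))
  four-mod-eight-case j f 3∤n = subst (λ e → Datum (suc k + suc k) (suc (suc e))) deg
    (even-datum k (mulM (𝕍 e) (𝕆 1)) (above-one-mul (𝕍 e) (𝕆 1) (𝕍-above-one e) (𝕆-above-one 1)) M 1≤M lev final
      (sgn-even (suc (suc (2 * j + f)) , ℕ-solve 2 (λ j f → con 1 :+ con 4 :* j :+ con 0 :+ ((con 1 :+ (f :+ f)) :+ con 1 :+ con 1)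
         := (con 2 :+ (con 2 :* j :+ f)) :+ (con 2 :+ (con 2 :* j :+ f))) refl j f)))
    where
    k e m P Q T M : ℕ
    k = suc (4 * j)
    e = suc (f + f)
    m = suc (j + j)
    P = 6 * suc f
    Q = 3 * m
    T = 8 * suc f * m
    M = 12 * suc f * m
    1≤M : 1 ≤ M
    1≤M = s≤s z≤n
    deg : k + 0 + (e + 1 + 1) ≡ k + suc (suc f + suc f)
    deg = ℕ-solve 2 (λ k f → k :+ con 0 :+ ((con 1 :+ (f :+ f)) :+ con 1 :+ con 1) := k :+ (con 1 :+ ((con 1 :+ f) :+ (con 1 :+ f)))) refl k f
    open Samples M 1≤M using (product-level; 𝕌-level; 𝕍-level; 𝕆-level)
    Q-odd : Q ≡ suc (suc (3 * j) + suc (3 * j))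
    Q-odd = ℕ-solve 1 (λ j → con 3 :* (con 1 :+ (j :+ j)) := con 1 :+ ((con 1 :+ con 3 :* j) :+ (con 1 :+ con 3 :* j))) refl j
    even-odd : ∀ {c} → 2 ∣ c → Q + Q ∣ c + Q → ⊥
    even-odd {c} 2∣c Q∣ = odd-shift (suc (3 * j)) 2∣c (subst (λ q → 2 ∣ c + q) Q-odd (∣-trans (divides Q (ℕ-solve 1 (λ Q → Q :+ Q := Q :* con 2) refl Q)) Q∣))
    lev′ = product-level {p = 𝕍 e} {q = 𝕆 1}
      (𝕍-level e Q (ℕ-solve 2 (λ f m → let e = con 2 :+ (f :+ f) in (e :+ e) :* (con 3 :* m :+ con 3 :* m) := con 12 :* (con 1 :+ f) :* m :+ con 12 :* (con 1 :+ f) :* m) refl f m))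
      (𝕆-level 1 T (ℕ-solve 2 (λ f m → con 3 :* (con 8 :* f :* m) := con 12 :* f :* m :+ con 12 :* f :* m) refl (suc f) m))
      (λ c _ _ Q∣ T∣c → even-odd (∣-trans (divides (4 * suc f * m) (ℕ-solve 2 (λ f m → con 8 :* f :* m := con 4 :* f :* m :* con 2) refl (suc f) m)) T∣c) Q∣)
    P-T : ∀ c → 1 ≤ c → c < M → P ∣ c → T ∣ c → ⊥
    P-T c 1≤c c<M P∣c (divides zero    c≡) = ℕ.<⇒≱ 1≤c (ℕ.≤-reflexive c≡)
    -- Only T itself, the position of 2 cos(2π/3), is a multiple of T between 0 and M. If P = 6(f +
    -- 1) divided T = 8(f + 1)m, then 3 would divide 4m = n.
    P-T c 1≤c c<M P∣c (divides (suc zero) c≡) = 3∤n (n∣m⇒m%n≡0 (suc k + suc k) 3 (subst (3 ∣_) n≡ (*-cancelˡ-∣ 2 (*-cancelˡ-∣ (suc f) (subst₂ _∣_ P≡ c≡′ P∣c)))))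
      where
      P≡ : P ≡ suc f * (2 * 3)
      P≡ = ℕ-solve 1 (λ f → con 6 :* f := f :* (con 2 :* con 3)) refl (suc f)
      c≡′ : c ≡ suc f * (2 * (4 * m))
      c≡′ = trans c≡ (ℕ-solve 2 (λ f m → con 1 :* (con 8 :* f :* m) := f :* (con 2 :* (con 4 :* m))) refl (suc f) m)
      n≡ : 4 * m ≡ suc k + suc k
      n≡ = ℕ-solve 1 (λ j → con 4 :* (con 1 :+ (j :+ j)) := (con 2 :+ con 4 :* j) :+ (con 2 :+ con 4 :* j)) refl j
    P-T c 1≤c c<M P∣c (divides (suc (suc q)) c≡) = ℕ.<⇒≱ c<M (subst (M ≤_) (sym c≡) (ℕ.≤-trans (subst (M ≤_)
        (ℕ-solve 2 (λ f m → con 12 :* f :* m :+ con 4 :* f :* m := con 2 :* (con 8 :* f :* m)) refl (suc f) m) (ℕ.m≤m+n M (4 * suc f * m)))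
      (ℕ.*-monoˡ-≤ T {2} {suc (suc q)} (s≤s (s≤s z≤n)))))
    lev = product-level {p = 𝕌 k} {q = mulM (𝕍 e) (𝕆 1)}
      (𝕌-level k P (ℕ-solve 2 (λ j f → let k = con 2 :+ con 4 :* j ; m = con 1 :+ (j :+ j) in (k :+ k) :* (con 6 :* f) := con 12 :* f :* m :+ con 12 :* f :* m) refl j (suc f)))
      lev′
      (λ { c 1≤c c<M P∣c (inj₁ Q∣) → even-odd (∣-trans (divides (3 * suc f) (ℕ-solve 1 (λ f → con 6 :* f := con 3 :* f :* con 2) refl (suc f))) P∣c) Q∣
         ; c 1≤c c<M P∣c (inj₂ T∣) → P-T c 1≤c c<M P∣c T∣ })
    final : (M ∸ 1) / P + ((M ∸ 1 + Q) / (Q + Q) + (M ∸ 1) / T) ≡ k + 0 + (e + 1 + 1)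
    final = cong₂ _+_
      (trans (last-quotient (5 + 6 * f) k 1≤M (ℕ.≤-reflexive (ℕ-solve 1 (λ f → con 6 :+ con 6 :* f := con 6 :* (con 1 :+ f)) refl f))
        (ℕ-solve 2 (λ j f → con 12 :* (con 1 :+ f) :* (con 1 :+ (j :+ j)) := (con 6 :+ con 6 :* f) :+ (con 1 :+ con 4 :* j) :* (con 6 :* (con 1 :+ f))) refl j f)) (sym (ℕ.+-identityʳ k)))
      (cong₂ _+_
        (trans (last-quotient-+ Q (2 + 6 * j) (suc e) 1≤M (subst (_≤ Q + Q) (ℕ-solve 1 (λ j → con 3 :* (con 1 :+ (j :+ j)) := con 3 :+ con 6 :* j) refl j) (ℕ.m≤m+n Q Q))
          (ℕ-solve 2 (λ j f → let m = con 1 :+ (j :+ j) in con 12 :* (con 1 :+ f) :* m :+ con 3 :* m := (con 3 :+ con 6 :* j) :+ (con 2 :+ (f :+ f)) :* (con 3 :* m :+ con 3 :* m)) refl j f)) (ℕ.+-comm 1 e))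
        (last-quotient (3 + (4 * f + (4 * f + 4) * (j + j))) 1 1≤M
          (subst (suc (3 + (4 * f + (4 * f + 4) * (j + j))) ≤_) (ℕ-solve 2 (λ j f → (con 4 :+ (con 4 :* f :+ (con 4 :* f :+ con 4) :* (j :+ j))) :+ con 4 :* (con 1 :+ f) :* (con 1 :+ (j :+ j)) := con 8 :* (con 1 :+ f) :* (con 1 :+ (j :+ j))) refl j f) (ℕ.m≤m+n _ (4 * suc f * m)))
          (ℕ-solve 2 (λ j f → con 12 :* (con 1 :+ f) :* (con 1 :+ (j :+ j)) := (con 4 :+ (con 4 :* f :+ (con 4 :* f :+ con 4) :* (j :+ j))) :+ con 1 :* (con 8 :* (con 1 :+ f) :* (con 1 :+ (j :+ j)))) refl j f)))

  Conclusion : ℕ → ℕ → Set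
  Conclusion n t = InfinitelyMany (λ α → IsSalem α × HasDegree (fromℝ α) (2 * t) × IsUnit (fromℝ (α ^ℝ n -ℝ 1ℝ)))

  conclude : ∀ {m s n t} → Datum m s → m ≡ n → suc s ≡ t → Conclusion n t
  conclude D refl refl = infinitely-many D

  private
    remaining : ∀ c {n k t} → n ≡ k * 2 → n + 2 * c ≤ 2 * t → ∃[ d ] (k + c) + d ≡ t
    remaining c {n} {k} {t} refl le = ℕ.m≤n⇒∃[o]m+o≡n (ℕ.*-cancelˡ-≤ 2 (subst (_≤ 2 * t) (ℕ-solve 2 (λ k c → k :* con 2 :+ con 2 :* c := con 2 :* (k :+ c)) refl k c) le))

    from-remainder : ∀ {n r} m .{{_ : NonZero m}} → n % m ≡ r → n ≡ r + n / m * m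
    from-remainder {n} m e = trans (m≡m%n+[m/n]*n n m) (cong (_+ n / m * m) e)

    degree-2 : ∀ k d {t} → (k + 2) + d ≡ t → suc (suc (k + d)) ≡ t
    degree-2 k d e = trans (ℕ-solve 2 (λ k d → con 2 :+ (k :+ d) := k :+ con 2 :+ d) refl k d) e

    degree-3 : ∀ k d {t} → (k + 3) + d ≡ t → suc (suc (suc (k + d))) ≡ t
    degree-3 k d e = trans (ℕ-solve 2 (λ k d → con 3 :+ (k :+ d) := k :+ con 3 :+ d) refl k d) e

    even-sum : ∀ k d {t} → (k + 3) + d ≡ t → t % 2 ≡ 1 → ∃[ j ] k + d ≡ j + j
    even-sum k d e h = even-remainder (k + d) (trans (cong (_% 2) (degree-3 k d e)) h)

  condition-i : ∀ n t → n % 2 ≡ 1 → n + 3 ≤ 2 * t → Conclusion n t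
  condition-i n t n%2 le = conclude (odd-case k (proj₁ rem)) (sym n≡) (degree-2 k (proj₁ rem) (proj₂ rem))
    where
    k = n / 2
    n≡ : n ≡ suc (k + k)
    n≡ = trans (from-remainder 2 n%2) (cong suc (ℕ-solve 1 (λ k → k :* con 2 := k :+ k) refl k))
    rem : ∃[ d ] (k + 2) + d ≡ t
    rem = remaining 2 {k * 2} {k} refl (ℕ.≤-trans (ℕ.≤-reflexive (trans (ℕ-solve 1 (λ k → k :* con 2 :+ con 4 := con 1 :+ (k :+ k) :+ con 3) refl k) (cong (_+ 3) (sym n≡)))) le)

  condition-ii : ∀ n t → n % 4 ≡ 2 → t % 2 ≡ 1 → n + 4 ≤ 2 * t → Conclusion n t
  condition-ii n t n%4 t%2 le = conclude (twice-odd-case m d (even-sum k d (proj₂ rem) t%2)) (sym n≡) (degree-3 k d (proj₂ rem))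
    where
    m = n / 4
    k = m + m
    n≡ : n ≡ suc k + suc k
    n≡ = trans (from-remainder 4 n%4) (ℕ-solve 1 (λ m → con 2 :+ m :* con 4 := (con 1 :+ (m :+ m)) :+ (con 1 :+ (m :+ m))) refl m)
    rem : ∃[ d ] (k + 3) + d ≡ t
    rem = remaining 3 {k * 2} {k} refl (ℕ.≤-trans (ℕ.≤-reflexive (trans (ℕ-solve 1 (λ k → k :* con 2 :+ con 6 := (con 1 :+ k) :+ (con 1 :+ k) :+ con 4) refl k) (cong (_+ 4) (sym n≡)))) le)
    d = proj₁ rem

  condition-iii : ∀ n t s → 2 ≤ s → n ≡ 2 ^ s → t % 2 ≡ 1 → n + 6 ≤ 2 * t → Conclusion n t
  condition-iii n t (suc s) _ n≡2^s t%2 le = conclude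
      (coprime-case k d (subst (Coprime (suc (d + d))) (trans (sym n≡2^s) n≡) (coprime-power d (suc s))) (even-sum k d (proj₂ rem) t%2))
      (sym n≡) (degree-3 k d (proj₂ rem))
    where
    k = pred (2 ^ s)
    suc-k : suc k ≡ 2 ^ s
    suc-k = ℕ.suc-pred (2 ^ s) {{ℕ.m^n≢0 2 s}}
    n≡ : n ≡ suc k + suc k
    n≡ = trans n≡2^s (trans (cong (2 *_) (sym suc-k)) (cong (suc k +_) (ℕ.+-identityʳ (suc k))))
    rem : ∃[ d ] (k + 3) + d ≡ t
    rem = remaining 3 {k * 2} {k} refl (ℕ.≤-trans (ℕ.m≤n⇒m≤n+o 2 ℕ.≤-refl) (ℕ.≤-trans (ℕ.≤-reflexive (trans (ℕ-solve 1 (λ k → k :* con 2 :+ con 6 :+ con 2 := (con 1 :+ k) :+ (con 1 :+ k) :+ con 6) refl k) (cong (_+ 6) (sym n≡)))) le))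
    d = proj₁ rem

  condition-iv : ∀ n t → n % 8 ≡ 4 → n % 3 ≢ 0 → t % 2 ≡ 1 → n + 6 ≤ 2 * t → Conclusion n t
  condition-iv n t n%8 n%3 t%2 le = go (halves (proj₁ rem)) (proj₂ rem)
    where
    q = n / 8
    k = suc (4 * q)
    n≡ : n ≡ suc k + suc k
    n≡ = trans (from-remainder 8 n%8) (ℕ-solve 1 (λ q → con 4 :+ q :* con 8 := (con 2 :+ con 4 :* q) :+ (con 2 :+ con 4 :* q)) refl q)
    3∤n : (suc k + suc k) % 3 ≢ 0
    3∤n e = n%3 (trans (cong (_% 3) n≡) e)
    rem : ∃[ d ] (k + 4) + d ≡ t
    rem = remaining 4 {k * 2} {k} refl (ℕ.≤-trans (ℕ.≤-reflexive (trans (ℕ-solve 1 (λ k → k :* con 2 :+ con 8 := (con 1 :+ k) :+ (con 1 :+ k) :+ con 6) refl k) (cong (_+ 6) (sym n≡)))) le)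
    -- Since k and t are odd, d is even. For d = 0 the factor X + 1 alone is E; otherwise it is
    -- accompanied by a 𝕍 factor of degree d.
    go : ∀ {d} → (∃[ j ] d ≡ j + j) ⊎ (∃[ j ] d ≡ suc (j + j)) → (k + 4) + d ≡ t → Conclusion n t
    go (inj₁ (zero , refl)) e = conclude
      (coprime-case k 1 (coprime-three 3∤n) (suc (2 * q) , ℕ-solve 1 (λ q → con 1 :+ con 4 :* q :+ con 1 := (con 1 :+ con 2 :* q) :+ (con 1 :+ con 2 :* q)) refl q))
      (sym n≡) (trans (ℕ-solve 1 (λ k → con 3 :+ (k :+ con 1) := k :+ con 4 :+ con 0) refl k) e)
    go (inj₁ (suc f , refl)) e = conclude (four-mod-eight-case q f 3∤n) (sym n≡)
      (trans (ℕ-solve 2 (λ k f → con 3 :+ (k :+ (con 1 :+ (f :+ f))) := k :+ con 4 :+ (f :+ f)) refl k (suc f)) e)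
    go (inj₂ (j , refl)) e with trans (sym t%2) (trans (cong (_% 2) (trans (sym e) (ℕ-solve 2 (λ q j → con 1 :+ con 4 :* q :+ con 4 :+ (con 1 :+ (j :+ j)) := (con 3 :+ con 2 :* q :+ j) :* con 2) refl q j))) (m*n%n≡0 (3 + 2 * q + j) 2))
    ... | ()

-- The theorem.

open import Data.Nat using (ℕ; _+_; _*_; _^_; _≤_; _%_)
open import Data.Product using (_×_; _,_; ∃-syntax)
open import Data.Sum using (_⊎_; inj₁; inj₂)
open import Relation.Binary.PropositionalEquality using (_≡_; _≢_)
open Main using (condition-i; condition-ii; condition-iii; condition-iv)

theorem1 : (n t : ℕ) → 1 ≤ n → 2 ≤ t →
    (n % 2 ≡ 1 × n + 3 ≤ 2 * t)
    ⊎ (n % 4 ≡ 2 × t % 2 ≡ 1 × n + 4 ≤ 2 * t)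
    ⊎ ((∃[ s ] (2 ≤ s × n ≡ 2 ^ s)) × t % 2 ≡ 1 × n + 6 ≤ 2 * t)
    ⊎ (n % 8 ≡ 4 × n % 3 ≢ 0 × t % 2 ≡ 1 × n + 6 ≤ 2 * t) →
    InfinitelyMany (λ α →
    IsSalem α × HasDegree (fromℝ α) (2 * t) × IsUnit (fromℝ (α ^ℝ n -ℝ 1ℝ)))
theorem1 n t _ _ (inj₁ (n%2 , le))                                    = condition-i n t n%2 le
theorem1 n t _ _ (inj₂ (inj₁ (n%4 , t%2 , le)))                       = condition-ii n t n%4 t%2 le
theorem1 n t _ _ (inj₂ (inj₂ (inj₁ ((s , 2≤s , n≡2^s) , t%2 , le)))) = condition-iii n t s 2≤s n≡2^s t%2 le
theorem1 n t _ _ (inj₂ (inj₂ (inj₂ (n%8 , n%3 , t%2 , le))))          = condition-iv n t n%8 n%3 t%2 le
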